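{- Let $0\le k\le n$ be integers and let $\Gamma$ be a proper circular arc graph on $n$ vertices that is obtained from a natural unit interval graph $G$ on $[n+k]$, whose first $k$ vertices form a clique and whose last $k$ vertices form a clique, by identifying $n+r$ with $r$ for each $1\le r\le k$. Let $\mathbf{G}=(G,(n+1,\dots,n+k),(1,\dots,k))$. For any $N\in\mathbb{N}$, \[ X_\Gamma(x_1,\dots,x_N)=\operatorname{tr}M_{\mathbf{G}}^{(N)}, \] which is $e$-positive, i.e. a polynomial in $e_1(x_1,\dots,x_N),\dots,e_N(x_1,\dots,x_N)$ with nonnegative coefficients. In particular, $\Gamma$ is $e$-positive: $X_\Gamma(\bm x)$, in infinitely many variables, has nonnegative coefficients in the elementary symmetric function basis.
   Context: Graphs are finite; when vertices are identified, parallel edges are suppressed, and $\Gamma$ has no loops. $X_\Gamma(\bm x)=\sum_\kappa\prod_{v\in V(\Gamma)}x_{\kappa(v)}$ is the chromatic symmetric function, summed over proper colorings $\kappa:V(\Gamma)\to\{1,2,\dots\}$; $X_\Gamma(x_1,\dots,x_N)$ is obtained by setting $x_c=0$ for $c>N$. A graph on $[m]=\{1,\dots,m\}$ is a natural unit interval graph if whenever $\{p,q\}$ is an edge with $p<q$, then $\{p,r\},\{r,q\}$ are edges for all $p<r<q$. A proper circular arc graph is the intersection graph of finitely many arcs of a circle, none of which contains another. Fix $N\in\mathbb{N}$, let $e_i=e_i(x_1,\dots,x_N)$ ($e_0=1$), let $I_j$ be the set of $j$-tuples of distinct elements of $[N]$, and let $V_j$ be the $\mathbb{Q}(x_1,\dots,x_N)$-vector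 space with basis $\{b_\sigma:\sigma\in I_j\}$ (so $V_j=0$ for $j>N$). For a tuple $\sigma$ of distinct positive integers set \[ A(1\mid\sigma)=\prod_r\frac{\sigma_r-1}{\sigma_r},\qquad A(\sigma_r+1\mid\sigma)=\frac{\sigma_r+1}{\sigma_r}\prod_{r'\ne r}\frac{\sigma_r-\sigma_{r'}+1}{\sigma_r-\sigma_{r'}}, \] and $A(y\mid\sigma)=0$ for all other $y$. Define $M_j^{(N)}\colon V_j\to V_{j+1}$ and $D_j\colon V_j\to V_{j-1}$ by \[ M_j^{(N)}b_\sigma=\sum_{y\in[N]\setminus\sigma}A(y\mid\sigma)\,b_{\sigma,y},\qquad D_jb_\sigma=\frac{e_{\sigma_1}}{e_{\sigma_1-1}}\,b_{\sigma_2,\dots,\sigma_j}, \] where $b_{\sigma,y}$ is indexed by $\sigma$ with $y$ appended. Definition of $M_{\mathbf{G}}^{(N)}\colon V_k\to V_k$. Build $G$ one vertex at a time, starting with the vertices $1,\dots,k$ marked. For $v=k+1,\dots,n+k$ in order, let $r$ be the number of neighbors of $v$ smaller than $v$; these are the $r$ most recently marked vertices. If currently $s$ vertices are marked, apply $D_s$, then $D_{s-1}$, ..., then $D_{r+1}$ (forgetting the oldest marked vertices), and then apply $M_r^{(N)}$ (so that $v$ and its smaller neighbors are marked). After the last vertex, apply operators $D$ in the same way until only the last $k$ vertices $n+1,\dots,n+k$ remain marked. $M_{\mathbf{G}}^{(N)}$ is the composition of all these operators, later steps on the left. -}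

module Defs where

open import Data.Bool using (Bool; true; false; if_then_else_)
open import Data.Fin as Fin using (Fin; toℕ; inject≤; splitAt)
import Data.Fin.Properties as Finₚ
open import Data.Fin.Subset using (Subset; inside; outside; ∣_∣)
open import Data.Integer as ℤ using (ℤ; +_; -[1+_])
open import Data.List
  using (List; []; _∷_; map; foldr; filter; allFin; _++_; cartesianProductWith; concatMap; length)
import Data.List.Properties as Listₚ
open import Data.List.Membership.Propositional using (_∈_)
open import Data.List.Membership.Propositional.Properties
  using (∈-filter⁺; ∈-filter⁻; ∈-map⁺; ∈-cartesianProductWith⁺)
open import Data.List.Relation.Unary.All as All using (All; []; _∷_; all?)
import Data.List.Relation.Unary.All.Properties as Allₚ
open import Data.List.Relation.Unary.Any using (here; there)
open import Data.List.Relation.Unary.Linked using (Linked)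
open import Data.Nat.ListAction using (sum)
open import Data.Nat as ℕ using (ℕ; zero; suc; _≤_; _<_; _≥_; z≤n; s≤s; _≟_; _≤?_; _<?_)
import Data.Nat.Properties as ℕₚ
open import Data.Product using (Σ-syntax; ∃; _×_; _,_; proj₁; proj₂)
open import Data.Rational as ℚ using (ℚ; 0ℚ; 1ℚ)
import Data.Rational.Properties as ℚₚ
open import Data.Sum using (_⊎_; inj₁; inj₂; [_,_]′)
open import Data.Vec as Vec using (Vec; []; _∷_; lookup; _∷ʳ_; zipWith; replicate; tabulate; count)
import Data.Vec.Properties as Vecₚ
open import Data.Vec.Membership.Propositional using () renaming (_∉_ to _∉ᵛ_)
import Data.Vec.Membership.DecPropositional as DecMembership
import Data.Vec.Relation.Unary.All as Vᴬ
import Data.Vec.Relation.Unary.AllPairs as Vᴾ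
import Data.Vec.Relation.Unary.Any as Vᴱ
open import Data.Vec.Relation.Unary.Unique.Propositional using (Unique)
open import Function using (id; _∘_)
open import Function.Bundles using (_⇔_)
open import Level using (0ℓ)
open import Relation.Binary using (Rel; Symmetric; Decidable; DecidableEquality)
open import Relation.Binary.Definitions using (tri<; tri≈; tri>)
open import Relation.Binary.PropositionalEquality
open import Relation.Nullary using (¬_; Dec; yes; no; does; ¬?; contradiction)
open import Relation.Nullary.Decidable using (_×-dec_; _→-dec_)

words : {A : Set} → List A → ∀ n → List (Vec A n)
words as zero    = [] ∷ []
words as (suc n) = cartesianProductWith _∷_ as (words as n)

-- A list of terms; a basis element may occur several times, and only the
-- total coefficient `coeff` is meaningful.
Lin : Set → Set
Lin B = List (ℚ × B)

sumℚ : List ℚ → ℚ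
sumℚ = foldr ℚ._+_ 0ℚ

coeff : {B : Set} → DecidableEquality B → Lin B → B → ℚ
coeff _≟ᴮ_ p b = sumℚ (map (λ (c , b′) → if does (b′ ≟ᴮ b) then c else 0ℚ) p)

Monomial : ℕ → Set
Monomial = Vec ℕ

_≟ᴹ_ : ∀ {m} → DecidableEquality (Monomial m)
_≟ᴹ_ = Vecₚ.≡-dec _≟_

_⊕_ : ∀ {m} → Monomial m → Monomial m → Monomial m
_⊕_ = zipWith ℕ._+_

-- ℚ[x₁,…,x_m], with equality _≈ᴾ_.
Poly : ℕ → Set
Poly m = Lin (Monomial m)

[x^_]_ : ∀ {m} → Monomial m → Poly m → ℚ
[x^ α ] p = coeff _≟ᴹ_ p α

infix 4 _≈ᴾ_ _≉ᴾ_
infixl 6 _+ᴾ_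
infixl 7 _*ᴾ_

_≈ᴾ_ _≉ᴾ_ : ∀ {m} → Poly m → Poly m → Set
p ≈ᴾ q = ∀ α → [x^ α ] p ≡ [x^ α ] q
p ≉ᴾ q = ¬ (p ≈ᴾ q)

constᴾ : ∀ {m} → ℚ → Poly m
constᴾ c = (c , replicate _ 0) ∷ []

0ᴾ 1ᴾ : ∀ {m} → Poly m
0ᴾ = []
1ᴾ = constᴾ 1ℚ

_+ᴾ_ _*ᴾ_ : ∀ {m} → Poly m → Poly m → Poly m
_+ᴾ_ = _++_
_*ᴾ_ = cartesianProductWith (λ (c , α) (d , β) → c ℚ.* d , α ⊕ β)

_^ᴾ_ : ∀ {m} → Poly m → ℕ → Poly m
p ^ᴾ zero  = 1ᴾ
p ^ᴾ suc i = p *ᴾ (p ^ᴾ i)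

-- P ⟦ f ⟧ is P(f₁,…,f_m).
_⟦_⟧ : ∀ {m n} → Poly m → (Fin m → Poly n) → Poly n
P ⟦ f ⟧ = concatMap term P
  where
  term : ℚ × Monomial _ → Poly _
  term (c , α) =
    constᴾ c *ᴾ foldr _*ᴾ_ 1ᴾ (map (λ i → f i ^ᴾ lookup α i) (allFin _))

-- ℚ[x₁,…,x_m] is an integral domain, by comparing lexicographically least monomials.
module Domain where
  pair : ∀ {m} → Poly m → (Monomial m → ℚ) → ℚ
  pair p g = sumℚ (map (λ (c , μ) → c ℚ.* g μ) p)

  δ : ∀ {m} → Monomial m → Monomial m → ℚ
  δ α μ = if does (μ ≟ᴹ α) then 1ℚ else 0ℚ

  δ-refl : ∀ {m} {α μ : Monomial m} → μ ≡ α → δ α μ ≡ 1ℚ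
  δ-refl {α = α} {μ} e with μ ≟ᴹ α
  ... | yes _ = refl
  ... | no ¬e = contradiction e ¬e

  δ-≢ : ∀ {m} {α μ : Monomial m} → μ ≢ α → δ α μ ≡ 0ℚ
  δ-≢ {α = α} {μ} ¬e with μ ≟ᴹ α
  ... | yes e = contradiction e ¬e
  ... | no _  = refl

  coeff-pair : ∀ {m} (p : Poly m) α → [x^ α ] p ≡ pair p (δ α)
  coeff-pair []            α = refl
  coeff-pair ((c , μ) ∷ p) α = cong₂ ℚ._+_ (lem (does (μ ≟ᴹ α))) (coeff-pair p α)
    where
    lem : ∀ b → (if b then c else 0ℚ) ≡ c ℚ.* (if b then 1ℚ else 0ℚ)
    lem true  = sym (ℚₚ.*-identityʳ c)
    lem false = sym (ℚₚ.*-zeroʳ c)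

  erase : ∀ {m} → Monomial m → Poly m → Poly m
  erase μ = filter (λ t → ¬? (proj₂ t ≟ᴹ μ))

  pair-erase : ∀ {m} (p : Poly m) μ g →
    pair p g ≡ [x^ μ ] p ℚ.* g μ ℚ.+ pair (erase μ p) g
  pair-erase [] μ g = sym (trans (ℚₚ.+-identityʳ _) (ℚₚ.*-zeroˡ (g μ)))
  pair-erase ((c , ν) ∷ p) μ g with ν ≟ᴹ μ
  ... | yes refl = begin
    c ℚ.* g μ ℚ.+ pair p g
      ≡⟨ cong (c ℚ.* g μ ℚ.+_) (pair-erase p μ g) ⟩
    c ℚ.* g μ ℚ.+ ([x^ μ ] p ℚ.* g μ ℚ.+ pair (erase μ p) g)
      ≡⟨ ℚₚ.+-assoc (c ℚ.* g μ) _ _ ⟨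
    (c ℚ.* g μ ℚ.+ [x^ μ ] p ℚ.* g μ) ℚ.+ pair (erase μ p) g
      ≡⟨ cong (ℚ._+ _) (ℚₚ.*-distribʳ-+ (g μ) c ([x^ μ ] p)) ⟨
    (c ℚ.+ [x^ μ ] p) ℚ.* g μ ℚ.+ pair (erase μ p) g ∎
    where open ≡-Reasoning
  ... | no _ = begin
    c ℚ.* g ν ℚ.+ pair p g
      ≡⟨ cong (c ℚ.* g ν ℚ.+_) (pair-erase p μ g) ⟩
    c ℚ.* g ν ℚ.+ ([x^ μ ] p ℚ.* g μ ℚ.+ pair (erase μ p) g)
      ≡⟨ ℚₚ.+-assoc (c ℚ.* g ν) _ _ ⟨
    (c ℚ.* g ν ℚ.+ [x^ μ ] p ℚ.* g μ) ℚ.+ pair (erase μ p) g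
      ≡⟨ cong (ℚ._+ _) (ℚₚ.+-comm (c ℚ.* g ν) _) ⟩
    ([x^ μ ] p ℚ.* g μ ℚ.+ c ℚ.* g ν) ℚ.+ pair (erase μ p) g
      ≡⟨ ℚₚ.+-assoc ([x^ μ ] p ℚ.* g μ) _ _ ⟩
    [x^ μ ] p ℚ.* g μ ℚ.+ (c ℚ.* g ν ℚ.+ pair (erase μ p) g)
      ≡⟨ cong (λ z → z ℚ.* g μ ℚ.+ (c ℚ.* g ν ℚ.+ pair (erase μ p) g))
              (ℚₚ.+-identityˡ ([x^ μ ] p)) ⟨
    (0ℚ ℚ.+ [x^ μ ] p) ℚ.* g μ ℚ.+ (c ℚ.* g ν ℚ.+ pair (erase μ p) g) ∎
    where open ≡-Reasoning

  coeff-erase-≡ : ∀ {m} (p : Poly m) μ → [x^ μ ] (erase μ p) ≡ 0ℚ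
  coeff-erase-≡ [] μ = refl
  coeff-erase-≡ ((c , ν) ∷ p) μ with ν ≟ᴹ μ in eq
  ... | yes _ = coeff-erase-≡ p μ
  ... | no _ rewrite eq = trans (ℚₚ.+-identityˡ _) (coeff-erase-≡ p μ)

  coeff-erase-≢ : ∀ {m} (p : Poly m) {μ ν} → ν ≢ μ → [x^ ν ] (erase μ p) ≡ [x^ ν ] p
  coeff-erase-≢ p {μ} {ν} ν≢μ = sym (begin
    [x^ ν ] p                                              ≡⟨ coeff-pair p ν ⟩
    pair p (δ ν)                                           ≡⟨ pair-erase p μ (δ ν) ⟩
    [x^ μ ] p ℚ.* δ ν μ ℚ.+ pair (erase μ p) (δ ν)
      ≡⟨ cong (λ z → [x^ μ ] p ℚ.* z ℚ.+ pair (erase μ p) (δ ν)) (δ-≢ (ν≢μ ∘ sym)) ⟩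
    [x^ μ ] p ℚ.* 0ℚ ℚ.+ pair (erase μ p) (δ ν)
      ≡⟨ cong₂ ℚ._+_ (ℚₚ.*-zeroʳ ([x^ μ ] p)) (sym (coeff-pair (erase μ p) ν)) ⟩
    0ℚ ℚ.+ [x^ ν ] (erase μ p)                             ≡⟨ ℚₚ.+-identityˡ _ ⟩
    [x^ ν ] (erase μ p)                                    ∎)
    where open ≡-Reasoning

  pair-zero : ∀ {m} n (p : Poly m) g → length p ≤ n →
    (∀ μ → [x^ μ ] p ≢ 0ℚ → g μ ≡ 0ℚ) → pair p g ≡ 0ℚ
  pair-zero n       []            g _         _ = refl
  pair-zero (suc n) p@((c , μ) ∷ p′) g (s≤s le) h = begin
    pair p g                                     ≡⟨ pair-erase p μ g ⟩
    [x^ μ ] p ℚ.* g μ ℚ.+ pair (erase μ p) g     ≡⟨ cong₂ ℚ._+_ first rest ⟩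
    0ℚ                                           ∎
    where
    open ≡-Reasoning
    first : [x^ μ ] p ℚ.* g μ ≡ 0ℚ
    first with [x^ μ ] p ℚₚ.≟ 0ℚ
    ... | yes e = trans (cong (ℚ._* g μ) e) (ℚₚ.*-zeroˡ (g μ))
    ... | no ¬e = trans (cong ([x^ μ ] p ℚ.*_) (h μ ¬e)) (ℚₚ.*-zeroʳ ([x^ μ ] p))
    shorter : length (erase μ p) ≤ n
    shorter with μ ≟ᴹ μ
    ... | yes _ = ℕₚ.≤-trans (Listₚ.length-filter _ p′) le
    ... | no ¬e = contradiction refl ¬e
    h′ : ∀ ν → [x^ ν ] (erase μ p) ≢ 0ℚ → g ν ≡ 0ℚ
    h′ ν nz with ν ≟ᴹ μ
    ... | yes refl = contradiction (coeff-erase-≡ p μ) nz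
    ... | no ν≢μ   = h ν (nz ∘ trans (coeff-erase-≢ p ν≢μ))
    rest : pair (erase μ p) g ≡ 0ℚ
    rest = pair-zero n (erase μ p) g shorter h′

  pair-single : ∀ {m} (p : Poly m) α g →
    (∀ μ → μ ≢ α → [x^ μ ] p ≢ 0ℚ → g μ ≡ 0ℚ) → pair p g ≡ [x^ α ] p ℚ.* g α
  pair-single p α g h = begin
    pair p g                                   ≡⟨ pair-erase p α g ⟩
    [x^ α ] p ℚ.* g α ℚ.+ pair (erase α p) g
      ≡⟨ cong ([x^ α ] p ℚ.* g α ℚ.+_) (pair-zero _ (erase α p) g ℕₚ.≤-refl h′) ⟩
    [x^ α ] p ℚ.* g α ℚ.+ 0ℚ                   ≡⟨ ℚₚ.+-identityʳ _ ⟩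
    [x^ α ] p ℚ.* g α                          ∎
    where
    open ≡-Reasoning
    h′ : ∀ ν → [x^ ν ] (erase α p) ≢ 0ℚ → g ν ≡ 0ℚ
    h′ ν nz with ν ≟ᴹ α
    ... | yes refl = contradiction (coeff-erase-≡ p α) nz
    ... | no ν≢α   = h ν ν≢α (nz ∘ trans (coeff-erase-≢ p ν≢α))

  sumℚ-++ : ∀ xs ys → sumℚ (xs ++ ys) ≡ sumℚ xs ℚ.+ sumℚ ys
  sumℚ-++ []       ys = sym (ℚₚ.+-identityˡ _)
  sumℚ-++ (x ∷ xs) ys =
    trans (cong (x ℚ.+_) (sumℚ-++ xs ys)) (sym (ℚₚ.+-assoc x (sumℚ xs) (sumℚ ys)))

  coeff-++ : ∀ {m} (p q : Poly m) γ → [x^ γ ] (p +ᴾ q) ≡ [x^ γ ] p ℚ.+ [x^ γ ] q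
  coeff-++ p q γ = trans (cong sumℚ (Listₚ.map-++ _ p q)) (sumℚ-++ (map _ p) (map _ q))

  coeff-shift : ∀ {m} c (μ : Monomial m) (q : Poly m) γ →
    [x^ γ ] (map (λ (d , ν) → c ℚ.* d , μ ⊕ ν) q) ≡ c ℚ.* pair q (λ ν → δ γ (μ ⊕ ν))
  coeff-shift c μ []            γ = sym (ℚₚ.*-zeroʳ c)
  coeff-shift c μ ((d , ν) ∷ q) γ =
    trans (cong₂ ℚ._+_ (lem (does ((μ ⊕ ν) ≟ᴹ γ))) (coeff-shift c μ q γ))
          (sym (ℚₚ.*-distribˡ-+ c _ _))
    where
    lem : ∀ b → (if b then c ℚ.* d else 0ℚ) ≡ c ℚ.* (d ℚ.* (if b then 1ℚ else 0ℚ))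
    lem true  = cong (c ℚ.*_) (sym (ℚₚ.*-identityʳ d))
    lem false = sym (trans (cong (c ℚ.*_) (ℚₚ.*-zeroʳ d)) (ℚₚ.*-zeroʳ c))

  coeff-* : ∀ {m} (p q : Poly m) γ →
    [x^ γ ] (p *ᴾ q) ≡ pair p (λ μ → pair q (λ ν → δ γ (μ ⊕ ν)))
  coeff-* []            q γ = refl
  coeff-* ((c , μ) ∷ p) q γ =
    trans (coeff-++ (map _ q) (p *ᴾ q) γ) (cong₂ ℚ._+_ (coeff-shift c μ q γ) (coeff-* p q γ))

  infix 4 _≺_
  data _≺_ : ∀ {m} → Monomial m → Monomial m → Set where
    head≺ : ∀ {m a b} {α β : Monomial m} → a < b → (a ∷ α) ≺ (b ∷ β)
    tail≺ : ∀ {m a} {α β : Monomial m} → α ≺ β → (a ∷ α) ≺ (a ∷ β)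

  ≺-irrefl : ∀ {m} {α : Monomial m} → ¬ (α ≺ α)
  ≺-irrefl (head≺ lt) = ℕₚ.<-irrefl refl lt
  ≺-irrefl (tail≺ lt) = ≺-irrefl lt

  ≺-trans : ∀ {m} {α β γ : Monomial m} → α ≺ β → β ≺ γ → α ≺ γ
  ≺-trans (head≺ p) (head≺ q) = head≺ (ℕₚ.<-trans p q)
  ≺-trans (head≺ p) (tail≺ q) = head≺ p
  ≺-trans (tail≺ p) (head≺ q) = head≺ q
  ≺-trans (tail≺ p) (tail≺ q) = tail≺ (≺-trans p q)

  ≺-cmp : ∀ {m} (α β : Monomial m) → α ≺ β ⊎ α ≡ β ⊎ β ≺ α
  ≺-cmp []      []      = inj₂ (inj₁ refl)
  ≺-cmp (a ∷ α) (b ∷ β) with ℕₚ.<-cmp a b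
  ... | tri< lt _ _ = inj₁ (head≺ lt)
  ... | tri> _ _ gt = inj₂ (inj₂ (head≺ gt))
  ... | tri≈ _ refl _ with ≺-cmp α β
  ...   | inj₁ lt          = inj₁ (tail≺ lt)
  ...   | inj₂ (inj₁ refl) = inj₂ (inj₁ refl)
  ...   | inj₂ (inj₂ gt)   = inj₂ (inj₂ (tail≺ gt))

  ⊕-monoˡ : ∀ {m} {α μ : Monomial m} β → α ≺ μ → (α ⊕ β) ≺ (μ ⊕ β)
  ⊕-monoˡ (b ∷ β) (head≺ lt) = head≺ (ℕₚ.+-monoˡ-< b lt)
  ⊕-monoˡ (b ∷ β) (tail≺ lt) = tail≺ (⊕-monoˡ β lt)

  ⊕-monoʳ : ∀ {m} {β ν : Monomial m} α → β ≺ ν → (α ⊕ β) ≺ (α ⊕ ν)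
  ⊕-monoʳ (a ∷ α) (head≺ lt) = head≺ (ℕₚ.+-monoʳ-< a lt)
  ⊕-monoʳ (a ∷ α) (tail≺ lt) = tail≺ (⊕-monoʳ α lt)

  least : ∀ {m} (μ : Monomial m) (μs : List (Monomial m)) →
    Σ[ α ∈ Monomial m ] α ∈ (μ ∷ μs) × (∀ {ν} → ν ∈ (μ ∷ μs) → α ≡ ν ⊎ α ≺ ν)
  least μ []        = μ , here refl , λ { (here refl) → inj₁ refl }
  least μ (μ′ ∷ μs) with least μ′ μs
  ... | α , α∈ , min with ≺-cmp μ α
  ...   | inj₁ μ≺α = μ , here refl , λ
    { (here refl) → inj₁ refl
    ; (there ν∈)  → inj₂ ([ (λ { refl → μ≺α }) , ≺-trans μ≺α ]′ (min ν∈)) }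
  ...   | inj₂ (inj₁ refl) = α , there α∈ , λ { (here refl) → inj₁ refl ; (there ν∈) → min ν∈ }
  ...   | inj₂ (inj₂ α≺μ)  = α , there α∈ , λ { (here refl) → inj₂ α≺μ ; (there ν∈) → min ν∈ }

  coeff-support : ∀ {m} (p : Poly m) {μ} → [x^ μ ] p ≢ 0ℚ → μ ∈ map proj₂ p
  coeff-support []            nz = contradiction refl nz
  coeff-support ((c , ν) ∷ p) {μ} nz with ν ≟ᴹ μ
  ... | yes refl = here refl
  ... | no _     = there (coeff-support p (nz ∘ trans (ℚₚ.+-identityˡ _)))

  leading : ∀ {m} (p : Poly m) → p ≉ᴾ 0ᴾ →
    Σ[ α ∈ Monomial m ] [x^ α ] p ≢ 0ℚ × (∀ {μ} → [x^ μ ] p ≢ 0ℚ → α ≡ μ ⊎ α ≺ μ)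
  leading {m} p p≉0 = go (filter nz? (map proj₂ p)) refl
    where
    nz? : ∀ μ → Dec ([x^ μ ] p ≢ 0ℚ)
    nz? μ = ¬? ([x^ μ ] p ℚₚ.≟ 0ℚ)
    complete : ∀ {μ} → [x^ μ ] p ≢ 0ℚ → μ ∈ filter nz? (map proj₂ p)
    complete nz = ∈-filter⁺ nz? (coeff-support p nz) nz
    go : ∀ L → filter nz? (map proj₂ p) ≡ L →
      Σ[ α ∈ Monomial m ] [x^ α ] p ≢ 0ℚ × (∀ {μ} → [x^ μ ] p ≢ 0ℚ → α ≡ μ ⊎ α ≺ μ)
    go [] eq = contradiction zero! p≉0
      where
      zero! : p ≈ᴾ 0ᴾ
      zero! μ with [x^ μ ] p ℚₚ.≟ 0ℚ
      ... | yes e = e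
      ... | no ¬e with () ← subst (μ ∈_) eq (complete ¬e)
    go (μ ∷ μs) eq with least μ μs
    ... | α , α∈ , min =
      α , proj₂ (∈-filter⁻ nz? {xs = map proj₂ p} (subst (α ∈_) (sym eq) α∈))
        , λ nz → min (subst (_ ∈_) eq (complete nz))

  ℚ-domain : ∀ {a b : ℚ} → a ≢ 0ℚ → b ≢ 0ℚ → a ℚ.* b ≢ 0ℚ
  ℚ-domain {a} {b} a≢0 b≢0 ab≡0 = b≢0 (begin
    b                            ≡⟨ ℚₚ.*-identityˡ b ⟨
    1ℚ ℚ.* b                     ≡⟨ cong (ℚ._* b) (ℚₚ.*-inverseˡ a) ⟨
    ((ℚ.1/ a) ℚ.* a) ℚ.* b       ≡⟨ ℚₚ.*-assoc (ℚ.1/ a) a b ⟩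
    (ℚ.1/ a) ℚ.* (a ℚ.* b)       ≡⟨ cong ((ℚ.1/ a) ℚ.*_) ab≡0 ⟩
    (ℚ.1/ a) ℚ.* 0ℚ              ≡⟨ ℚₚ.*-zeroʳ (ℚ.1/ a) ⟩
    0ℚ                           ∎)
    where
    open ≡-Reasoning
    instance _ = ℚ.≢-nonZero a≢0

  *ᴾ-≉0 : ∀ {m} (p q : Poly m) → p ≉ᴾ 0ᴾ → q ≉ᴾ 0ᴾ → p *ᴾ q ≉ᴾ 0ᴾ
  *ᴾ-≉0 {m} p q p≉0 q≉0 pq≈0 with leading p p≉0 | leading q q≉0
  ... | α , pα≢0 , α-min | β , qβ≢0 , β-min =
    ℚ-domain pα≢0 qβ≢0 (trans (sym product) (pq≈0 (α ⊕ β)))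
    where
    open ≡-Reasoning

    g : Monomial m → ℚ
    g μ = pair q (λ ν → δ (α ⊕ β) (μ ⊕ ν))

    gα : g α ≡ [x^ β ] q
    gα = begin
      g α                                      ≡⟨ pair-single q β _ off ⟩
      [x^ β ] q ℚ.* δ (α ⊕ β) (α ⊕ β)          ≡⟨ cong ([x^ β ] q ℚ.*_) (δ-refl {μ = α ⊕ β} refl) ⟩
      [x^ β ] q ℚ.* 1ℚ                         ≡⟨ ℚₚ.*-identityʳ _ ⟩
      [x^ β ] q                                ∎
      where
      off : ∀ ν → ν ≢ β → [x^ ν ] q ≢ 0ℚ → δ (α ⊕ β) (α ⊕ ν) ≡ 0ℚ
      off ν ν≢β nz with β-min nz
      ... | inj₁ e   = contradiction (sym e) ν≢β
      ... | inj₂ β≺ν =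
        δ-≢ (λ e → ≺-irrefl (subst (α ⊕ β ≺_) e (⊕-monoʳ α β≺ν)))

    g-off : ∀ μ → μ ≢ α → [x^ μ ] p ≢ 0ℚ → g μ ≡ 0ℚ
    g-off μ μ≢α nz with α-min nz
    ... | inj₁ e   = contradiction (sym e) μ≢α
    ... | inj₂ α≺μ = pair-zero _ q _ ℕₚ.≤-refl off
      where
      lt : ∀ {ν} → [x^ ν ] q ≢ 0ℚ → α ⊕ β ≺ μ ⊕ ν
      lt nz′ with β-min nz′
      ... | inj₁ refl = ⊕-monoˡ β α≺μ
      ... | inj₂ β≺ν  = ≺-trans (⊕-monoˡ β α≺μ) (⊕-monoʳ μ β≺ν)
      off : ∀ ν → [x^ ν ] q ≢ 0ℚ → δ (α ⊕ β) (μ ⊕ ν) ≡ 0ℚ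
      off ν nz′ = δ-≢ (λ e → ≺-irrefl (subst (α ⊕ β ≺_) e (lt nz′)))

    product : [x^ α ⊕ β ] (p *ᴾ q) ≡ [x^ α ] p ℚ.* [x^ β ] q
    product = begin
      [x^ α ⊕ β ] (p *ᴾ q)      ≡⟨ coeff-* p q (α ⊕ β) ⟩
      pair p g                  ≡⟨ pair-single p α g g-off ⟩
      [x^ α ] p ℚ.* g α         ≡⟨ cong ([x^ α ] p ℚ.*_) gα ⟩
      [x^ α ] p ℚ.* [x^ β ] q   ∎

  coeff-nonneg : ∀ {m} (p : Poly m) → All (λ t → proj₁ t ≡ 1ℚ) p → ∀ α → 0ℚ ℚ.≤ [x^ α ] p
  coeff-nonneg []            _            α = ℚₚ.≤-refl
  coeff-nonneg ((c , μ) ∷ p) (refl ∷ ones) α with does (μ ≟ᴹ α)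
  ... | true  = ℚₚ.+-mono-≤ {0ℚ} {1ℚ} (ℚₚ.nonNegative⁻¹ 1ℚ) (coeff-nonneg p ones α)
  ... | false = ℚₚ.+-mono-≤ {0ℚ} {0ℚ} ℚₚ.≤-refl (coeff-nonneg p ones α)

  ones-≉0 : ∀ {m} (p : Poly m) → All (λ t → proj₁ t ≡ 1ℚ) p → p ≢ [] → p ≉ᴾ 0ᴾ
  ones-≉0 []            _             p≢[] _   = p≢[] refl
  ones-≉0 ((c , μ) ∷ p) (refl ∷ ones) _    p≈0 with μ ≟ᴹ μ | p≈0 μ
  ... | no ¬e | _ = ¬e refl
  ... | yes _ | e = ℚₚ.<-irrefl (sym e)
    (ℚₚ.+-mono-<-≤ {0ℚ} {1ℚ} (ℚₚ.positive⁻¹ 1ℚ) (coeff-nonneg p ones μ))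

open Domain using (*ᴾ-≉0; ones-≉0)

1ᴾ≉0 : ∀ {m} → 1ᴾ {m} ≉ᴾ 0ᴾ
1ᴾ≉0 = ones-≉0 1ᴾ (refl ∷ []) (λ ())

-- ℚ(x₁,…,x_m), with equality _≈ᶠ_.
record Frac (m : ℕ) : Set where
  constructor frac
  field
    num   : Poly m
    den   : Poly m
    den≉0 : den ≉ᴾ 0ᴾ

infix 4 _≈ᶠ_
infixl 6 _+ᶠ_
infixl 7 _*ᶠ_

_≈ᶠ_ : ∀ {m} → Frac m → Frac m → Set
frac a b _ ≈ᶠ frac c d _ = a *ᴾ d ≈ᴾ c *ᴾ b

fromPoly : ∀ {m} → Poly m → Frac m
fromPoly p = frac p 1ᴾ 1ᴾ≉0

fromℚ : ∀ {m} → ℚ → Frac m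
fromℚ c = fromPoly (constᴾ c)

0ᶠ : ∀ {m} → Frac m
0ᶠ = fromPoly 0ᴾ

_+ᶠ_ _*ᶠ_ : ∀ {m} → Frac m → Frac m → Frac m
frac a b b≉0 +ᶠ frac c d d≉0 = frac (a *ᴾ d +ᴾ c *ᴾ b) (b *ᴾ d) (*ᴾ-≉0 b d b≉0 d≉0)
frac a b b≉0 *ᶠ frac c d d≉0 = frac (a *ᴾ c) (b *ᴾ d) (*ᴾ-≉0 b d b≉0 d≉0)

sumᶠ : ∀ {m} → List (Frac m) → Frac m
sumᶠ = foldr _+ᶠ_ 0ᶠ

sides : List Bool
sides = inside ∷ outside ∷ []

subsets : ∀ N i → List (Subset N)
subsets N i = filter (λ S → ∣ S ∣ ≟ i) (words sides N)

indicator : ∀ {N} → Subset N → ℚ × Monomial N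
indicator S = 1ℚ , Vec.map (λ b → if b then 1 else 0) S

e : ∀ N i → Poly N
e N i = map indicator (subsets N i)

subset-of-size : ∀ N i → i ≤ N → Σ[ S ∈ Subset N ] ∣ S ∣ ≡ i × S ∈ words sides N
subset-of-size zero    zero    _        = [] , refl , here refl
subset-of-size (suc N) zero    _        with subset-of-size N zero z≤n
... | S , eq , S∈ = outside ∷ S , eq , ∈-cartesianProductWith⁺ _∷_ {xs = sides} (there (here refl)) S∈
subset-of-size (suc N) (suc i) (s≤s le) with subset-of-size N i le
... | S , eq , S∈ = inside ∷ S , cong suc eq , ∈-cartesianProductWith⁺ _∷_ {xs = sides} (here refl) S∈

e≉0 : ∀ {N i} → i ≤ N → e N i ≉ᴾ 0ᴾ
e≉0 {N} {i} le = ones-≉0 (e N i) ones nonempty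
  where
  ones : All (λ t → proj₁ t ≡ 1ℚ) (e N i)
  ones = Allₚ.map⁺ (All.universal (λ _ → refl) (subsets N i))
  some : ∀ {S : Subset N} {Ss} → S ∈ Ss → map indicator Ss ≢ []
  some (here _)  ()
  some (there _) ()
  nonempty : e N i ≢ []
  nonempty with subset-of-size N i le
  ... | S , ∣S∣ , S∈ = some (∈-filter⁺ (λ S → ∣ S ∣ ≟ i) S∈ ∣S∣)

EPositive : ∀ {N} → Poly N → Set
EPositive {N} f =
  Σ[ P ∈ Poly N ] (∀ α → 0ℚ ℚ.≤ [x^ α ] P) × f ≈ᴾ P ⟦ (λ i → e N (suc (toℕ i))) ⟧

-- The monomial ∏ x_c^{α_c} is given by any list of exponents α₁, α₂, …
-- containing all the nonzero ones, and a series by its coefficients.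
Series : Set
Series = List ℕ → ℚ

splits : List ℕ → List (List ℕ × List ℕ)
splits []      = ([] , []) ∷ []
splits (a ∷ α) = cartesianProductWith
  (λ i (β , γ) → toℕ i ∷ β , (a ℕ.∸ toℕ i) ∷ γ) (allFin (suc a)) (splits α)

_⊛_ : Series → Series → Series
(f ⊛ g) α = sumℚ (map (λ (β , γ) → f β ℚ.* g γ) (splits α))

e∞ : ℕ → Series
e∞ i α = if does (all? (_≤? 1) α ×-dec (sum α ≟ i)) then 1ℚ else 0ℚ

IsPartition : List ℕ → Set
IsPartition λs = Linked _≥_ λs × All (1 ≤_) λs

e-basis : List ℕ → Series
e-basis λs = foldr _⊛_ (e∞ 0) (map e∞ λs)

EPositive∞ : Series → Set
EPositive∞ f =
  Σ[ c ∈ Lin (List ℕ) ]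
    All (IsPartition ∘ proj₂) c
  × (∀ λs → 0ℚ ℚ.≤ coeff (Listₚ.≡-dec _≟_) c λs)
  × (∀ α → f α ≡ sumℚ (map (λ (a , λs) → a ℚ.* e-basis λs α) c))

record Graph (n : ℕ) : Set₁ where
  infix 4 _∼_ _∼?_
  field
    _∼_    : Rel (Fin n) 0ℓ
    ∼-sym  : Symmetric _∼_
    irrefl : ∀ {v} → ¬ (v ∼ v)
    _∼?_   : Decidable _∼_

NaturalUnitInterval : ∀ {m} → Graph m → Set
NaturalUnitInterval G =
  ∀ {p q} → p Fin.< q → p ∼ q → ∀ r → p Fin.< r → r Fin.< q → (p ∼ r) × (r ∼ q)
  where open Graph G

IsClique : ∀ {m} → Graph m → (Fin m → Set) → Set
IsClique G S = ∀ {p q} → S p → S q → p ≢ q → Graph._∼_ G p q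

-- Vertices are numbered from 0, so these are the vertices 1,…,k and n+1,…,n+k.
First Last : ∀ {n} k → Fin (n ℕ.+ k) → Set
First     k v = toℕ v < k
Last  {n} k v = n ≤ toℕ v

glue : ∀ {n k} → k ≤ n → Fin (n ℕ.+ k) → Fin n
glue {n} k≤n v = [ id , (λ r → inject≤ r k≤n) ]′ (splitAt n v)

-- As Γ is irreflexive, this includes that identifying vertices creates no loop.
ObtainedByGluing : ∀ {n k} → k ≤ n → Graph (n ℕ.+ k) → Graph n → Set
ObtainedByGluing k≤n G Γ = ∀ u v →
  (Graph._∼_ Γ u v) ⇔ (∃ λ p → ∃ λ q → glue k≤n p ≡ u × glue k≤n q ≡ v × Graph._∼_ G p q)

-- The circle is [0,1) with its ends joined. Rational points suffice: which
-- closed arcs meet or contain one another depends only on the cyclic order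
-- of finitely many endpoints.
record Point : Set where
  constructor point
  field
    pos : ℚ
    0≤  : 0ℚ ℚ.≤ pos
    <1  : pos ℚ.< 1ℚ
open Point

-- The closed arc running from start to end in the positive direction.
record Arc : Set where
  constructor arc
  field
    start end : Point

_∈ᴬ_ : Point → Arc → Set
t ∈ᴬ arc a b =
    (pos a ℚ.≤ pos b × pos a ℚ.≤ pos t × pos t ℚ.≤ pos b)
  ⊎ (pos b ℚ.< pos a × (pos a ℚ.≤ pos t ⊎ pos t ℚ.≤ pos b))

ProperCircularArc : ∀ {n} → Graph n → Set
ProperCircularArc {n} Γ =
  Σ[ A ∈ (Fin n → Arc) ]
    (∀ u v → (Graph._∼_ Γ u v) ⇔ (u ≢ v × ∃ λ t → t ∈ᴬ A u × t ∈ᴬ A v))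
  × (∀ u v → u ≢ v → ¬ (∀ t → t ∈ᴬ A u → t ∈ᴬ A v))

Proper : ∀ {n N} → Graph n → Vec (Fin N) n → Set
Proper Γ κ = ∀ u v → Graph._∼_ Γ u v → lookup κ u ≢ lookup κ v

proper? : ∀ {n N} (Γ : Graph n) (κ : Vec (Fin N) n) → Dec (Proper Γ κ)
proper? Γ κ = Finₚ.all? λ u → Finₚ.all? λ v →
  Graph._∼?_ Γ u v →-dec ¬? (lookup κ u Finₚ.≟ lookup κ v)

-- The exponents of ∏_v x_{κ(v)}.
content : ∀ {n N} → Vec (Fin N) n → Monomial N
content κ = tabulate λ c → count (Finₚ._≟ c) κ

-- X_Γ(x₁,…,x_N): setting x_c = 0 for c > N leaves the colorings with values in [N].
X : ∀ {n} → Graph n → ∀ N → Poly N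
X {n} Γ N = map (λ κ → 1ℚ , content κ) (filter (proper? Γ) (words (allFin N) n))

-- The coefficient of x^α only involves colorings by the colors c with α_c ≠ 0.
X∞ : ∀ {n} → Graph n → Series
X∞ Γ α = [x^ Vec.fromList α ] (X Γ (length α))

record Tuple (N j : ℕ) : Set where
  constructor tuple
  field
    entries   : Vec (Fin N) j
    .distinct : Unique entries

All-∷ʳ : ∀ {A : Set} {P : A → Set} {n} {xs : Vec A n} {y} →
  Vᴬ.All P xs → P y → Vᴬ.All P (xs ∷ʳ y)
All-∷ʳ Vᴬ.[]         py = py Vᴬ.∷ Vᴬ.[]
All-∷ʳ (px Vᴬ.∷ pxs) py = px Vᴬ.∷ All-∷ʳ pxs py

Unique-∷ʳ : ∀ {A : Set} {n} {xs : Vec A n} {y} → Unique xs → y ∉ᵛ xs → Unique (xs ∷ʳ y)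
Unique-∷ʳ Vᴾ.[]                 y∉ = Vᴬ.[] Vᴾ.∷ Vᴾ.[]
Unique-∷ʳ (x∉ Vᴾ.∷ xs!) y∉ =
  All-∷ʳ x∉ (y∉ ∘ Vᴱ.here ∘ sym) Vᴾ.∷ Unique-∷ʳ xs! (y∉ ∘ Vᴱ.there)

-- All (y , (σ , y)) with y ∈ [N] ∖ σ.
extensions : ∀ {N j} → Tuple N j → List (Fin N × Tuple N (suc j))
extensions {N} {j} (tuple σ σ!) = concatMap extend (allFin N)
  where
  extend : Fin N → List (Fin N × Tuple N (suc j))
  extend y with DecMembership._∈?_ Finₚ._≟_ y σ
  ... | yes _ = []
  ... | no y∉ = (y , tuple (σ ∷ʳ y) (Unique-∷ʳ σ! y∉)) ∷ []

tuples : ∀ N j → List (Tuple N j)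
tuples N zero    = tuple [] Vᴾ.[] ∷ []
tuples N (suc j) = concatMap (map proj₂ ∘ extensions) (tuples N j)

V : ℕ → ℕ → Set
V N j = List (Frac N × Tuple N j)

basis : ∀ {N j} → Tuple N j → V N j
basis σ = (fromℚ 1ℚ , σ) ∷ []

coeffⱽ : ∀ {N j} → V N j → Tuple N j → Frac N
coeffⱽ x (tuple σ _) =
  sumᶠ (map (λ (a , tuple τ _) → if does (Vecₚ.≡-dec Finₚ._≟_ τ σ) then a else 0ᶠ) x)

extendLinearly : ∀ {N i j} → (Tuple N i → V N j) → V N i → V N j
extendLinearly f = concatMap λ (a , σ) → map (λ (a′ , τ) → a *ᶠ a′ , τ) (f σ)

trace : ∀ {N j} → (V N j → V N j) → Frac N
trace {N} {j} f = sumᶠ (map (λ σ → coeffⱽ (f (basis σ)) σ) (tuples N j))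

-- Total division. Below, every divisor is nonzero, being an entry or a
-- difference of two entries of a tuple of distinct positive integers.
infixl 7 _//_
_//_ : ℤ → ℤ → ℚ
a // (+ zero)    = 0ℚ
a // (+ (suc d)) = a ℚ./ suc d
a // (-[1+ d ])  = (ℤ.- a) ℚ./ suc d

∏ : ∀ {j} → List (Fin j) → (Fin j → ℚ) → ℚ
∏ rs f = foldr ℚ._*_ 1ℚ (map f rs)

-- A y σ is A(y ∣ σ). The cases are disjoint as the entries of σ are distinct and positive.
A : ∀ {j} → ℕ → Vec ℕ j → ℚ
A {j} y σ with y ≟ 1 | Finₚ.any? (λ r → y ≟ suc (lookup σ r))
... | yes _ | _           = ∏ (allFin j) λ r → (+ lookup σ r ℤ.- + 1) // (+ lookup σ r)
... | no _  | no _        = 0ℚ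
... | no _  | yes (r , _) =
  ((s ℤ.+ + 1) // s) ℚ.*
  ∏ (filter (λ r′ → ¬? (r′ Finₚ.≟ r)) (allFin j))
    (λ r′ → (s ℤ.- + lookup σ r′ ℤ.+ + 1) // (s ℤ.- + lookup σ r′))
  where s = + lookup σ r

-- Fin N is numbered from 0, [N] from 1.
value : ∀ {N} → Fin N → ℕ
value i = suc (toℕ i)

M : ∀ {N} j → V N j → V N (suc j)
M j = extendLinearly λ σ →
  map (λ (y , σy) → fromℚ (A (value y) (Vec.map value (Tuple.entries σ))) , σy) (extensions σ)

D : ∀ {N} j → V N (suc j) → V N j
D {N} j = extendLinearly D-basis
  where
  D-basis : Tuple N (suc j) → V N j
  D-basis (tuple (s ∷ σ) s∷σ!) =
    (frac (e N (value s)) (e N (toℕ s)) (e≉0 (Finₚ.toℕ≤n s)) , tuple σ (Vᴾ.tail s∷σ!)) ∷ []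

-- D_{r+1} ∘ ⋯ ∘ D_s. The case s < r, where this is 0, does not occur in M𝐆
-- when G is a natural unit interval graph whose first and last k vertices
-- form cliques.
forgetTo : ∀ {N} r {s} → V N s → V N r
forgetTo r {s} x with s ≟ r
forgetTo r {s}     x | yes refl = x
forgetTo r {zero}  x | no _     = []
forgetTo r {suc s} x | no _     = forgetTo r (D s x)

backDegree : ∀ {m} → Graph m → Fin m → ℕ
backDegree {m} G v =
  length (filter (λ q → (q Finₚ.<? v) ×-dec Graph._∼?_ G q v) (allFin m))

build : ∀ {N} k → List ℕ → ∀ {s} → V N s → V N k
build k []       x = forgetTo k x
build k (r ∷ rs) x = build k rs (M r (forgetTo r x))

M𝐆 : ∀ {n} k → Graph (n ℕ.+ k) → ∀ N → V N k → V N k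
M𝐆 {n} k G N =
  build k (map (backDegree G) (filter (λ v → k ≤? toℕ v) (allFin (n ℕ.+ k))))

{-# OPTIONS --safe #-}
-- X_Γ is the trace of a second composition of the same shape, in which the marked vertices carry
-- their actual colors: a new vertex receives any color not used by the marked vertices, and
-- forgetting a vertex of color c multiplies by x_c. So it suffices to intertwine the two
-- compositions by invertible matrices g_σ(c) on j-tuples.
--
-- For j = N they come from the Sym-linear Cherednik operators of nonsymmetric Jack polynomials in
-- the limit α = 0, acting on functions of arrangements c of all N colors. Their joint spectrum is
-- simple, with eigenfunctions b_σ indexed by the arrangements σ of the labels and normalized to
-- have sum 1. Moving the head color a of c to the end and multiplying by x_a takes b_σ to a
-- multiple of b of the rotated σ, the multiple being found by summing over all arrangements with a
-- given head, and exchanging neighbouring entries of c acts on the b_σ by Young's seminormal form.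
-- For j < N, g_σ(c) is the sum of b over the extensions of σ to arrangements of all labels,
-- weighted by products of A. That g intertwines M and D then reduces to two relations between
-- consecutive values of A, and g is invertible because the b_σ are independent.
--
-- The trace of M_𝐆 is a sum over closed walks of labels. Its coefficients are products of values A
-- ≥ 0, and y + 1 can only be appended while y is marked and y + 1 is not; hence a closed walk uses
-- y + 1 at most as often as y, and the weights e_s / e_{s−1} multiply to a product of e_i.
module Submission where

open import Defs
open import Algebra.Bundles using (CommutativeRing)
import Algebra.Properties.CommutativeSemiring.Exp
import Algebra.Properties.Ring
import Algebra.Solver.Ring
open import Algebra.Solver.Ring.AlmostCommutativeRing
  using (fromCommutativeRing; _-Raw-AlmostCommutative⟶_)
open import Data.Bool using (Bool; true; false; if_then_else_)
import Data.List
open import Data.Fin as Fin using (Fin; toℕ; inject≤)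
import Data.Fin.Properties as Finₚ
open import Data.Fin.Subset using (Subset; inside; outside; ∣_∣)
open import Data.Integer as ℤ using (ℤ; +_; -[1+_])
import Data.Integer.Properties as ℤₚ
open import Data.List
  using (List; []; _∷_; map; foldr; foldl; filter; allFin; _++_; cartesianProductWith; concatMap; length; take; drop)
import Data.List.Properties as Listₚ
open import Data.List.Membership.Propositional using (_∈_; _∉_; find; lose)
import Data.List.Membership.DecPropositional as DecMem
import Data.List.Membership.Propositional.Properties as ∈ₚ
open import Data.List.Relation.Binary.Permutation.Propositional using (_↭_; prep; swap; ↭-refl; ↭-sym; ↭-trans)
import Data.List.Relation.Binary.Permutation.Propositional as Perm
import Data.List.Relation.Binary.Permutation.Propositional.Properties as ↭ₚ
open import Data.List.Relation.Unary.All as All using (All; []; _∷_; all?)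
import Data.List.Relation.Unary.All.Properties as Allₚ
open import Data.List.Relation.Unary.AllPairs using (AllPairs; []; _∷_)
open import Data.List.Relation.Unary.Any using (Any; here; there; any?)
import Data.List.Relation.Unary.Linked.Properties as Linkedₚ
open import Data.List.Relation.Unary.Unique.Propositional using (Unique)
import Data.List.Relation.Unary.Unique.Propositional.Properties as Uniqueₚ
import Data.List.Relation.Unary.AllPairs.Properties as AllPairsₚ
open import Data.Maybe using (Maybe; just; nothing)
import Data.Maybe.Properties as Maybeₚ
open import Data.Nat.ListAction using (sum)
open import Data.Nat as ℕ using (ℕ; zero; suc; _≤_; _<_; z≤n; s≤s)
import Data.Nat.Properties as ℕₚ
open import Data.Product using (Σ-syntax; ∃; ∃₂; _×_; _,_; proj₁; proj₂)
open import Data.Rational as ℚ using (ℚ; 0ℚ; 1ℚ)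
import Data.Rational.Properties as ℚₚ
import Data.Rational.Unnormalised as ℚᵘ
import Data.Rational.Unnormalised.Properties as ℚᵘₚ
open import Data.Sum using (_⊎_; inj₁; inj₂; [_,_]′)
open import Data.Vec as Vec using (Vec; []; _∷_; lookup)
import Data.Vec.Properties as Vecₚ
import Data.Vec.Membership.DecPropositional as DecMemᵛ
import Data.Vec.Membership.Propositional.Properties as ∈ᵛₚ
import Data.Vec.Relation.Unary.All as Vᴬ
import Data.Vec.Relation.Unary.AllPairs as Vᴾ
import Data.Vec.Relation.Unary.Any as Vᴱ
import Data.Vec.Relation.Unary.Unique.Propositional as Vᵁ
open import Function using (id; _∘_)
open import Function.Bundles using (Equivalence)
open import Level using (0ℓ)
open import Relation.Binary using (DecidableEquality)
open import Relation.Binary.Definitions using (tri<; tri≈; tri>)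
open import Relation.Binary.PropositionalEquality as ≡ using (_≡_; _≢_; cong; cong₂; subst; subst₂)
import Relation.Binary.Reasoning.Setoid
open import Relation.Nullary using (¬_; Dec; yes; no; does; ¬?; contradiction; recompute)
open import Relation.Nullary.Decidable using (_×-dec_; _→-dec_)

-- Scaling an eigenfunction to have sum 1 requires its sum over all arrangements to be nonzero, and
-- this shapes the construction. Exchanging labels s, t at the head multiplies the sum by t - s - 1,
-- which is zero exactly when t = s + 1. Rotating the head label s to the end multiplies it by s e_s
-- / ((N - s + 1) e_{s-1}), which is never zero. So s cannot be carried over s + 1 directly; the
-- combinatorial core is that every arrangement can still be reached from the increasing one, whose
-- eigenfunction is constant, by going round the circle. The same factor explains the operators.
-- When s is the only missing label, A(s | τ) = s / (N - s + 1), so rotation contributes A(s | τ)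
-- e_s / e_{s-1}: this is where the weight of D comes from. For shorter tuples, A makes the sum over
-- extensions blind to the order of the unmarked colors. For infinitely many variables one expansion
-- must serve every N. In the expansion over words of labels the coefficients do not mention N, and
-- words in the labels 1, ..., n suffice.

record RationalAlgebra : Set₁ where
  field commutativeRing : CommutativeRing 0ℓ 0ℓ
  open CommutativeRing commutativeRing public hiding (zero)
  field
    ι   : ℚ → Carrier
    ι-+ : ∀ p q → ι (p ℚ.+ q) ≈ ι p + ι q
    ι-* : ∀ p q → ι (p ℚ.* q) ≈ ι p * ι q
    ι-1 : ι 1ℚ ≈ 1#

  module Rₚ = Algebra.Properties.Ring ring
  module ≈-Reasoning = Relation.Binary.Reasoning.Setoid setoid

  ι-0 : ι 0ℚ ≈ 0#
  ι-0 = Rₚ.x+x≈x⇒x≈0 (ι 0ℚ) (sym (ι-+ 0ℚ 0ℚ))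

  ι-neg : ∀ p → ι (ℚ.- p) ≈ - ι p
  ι-neg p = Rₚ.+-inverseˡ-unique (ι (ℚ.- p)) (ι p) (begin
    ι (ℚ.- p) + ι p   ≈⟨ ι-+ _ _ ⟨
    ι (ℚ.- p ℚ.+ p)   ≡⟨ cong ι (ℚₚ.+-inverseˡ p) ⟩
    ι 0ℚ              ≈⟨ ι-0 ⟩
    0#                ∎)
    where open ≈-Reasoning

  morphism : ℚ.+-*-rawRing -Raw-AlmostCommutative⟶ fromCommutativeRing commutativeRing
  morphism = record
    { ⟦_⟧ = ι ; +-homo = ι-+ ; *-homo = ι-* ; -‿homo = ι-neg ; 0-homo = ι-0 ; 1-homo = ι-1 }

  decide : ∀ p q → Maybe (ι p ≈ ι q)
  decide p q with p ℚₚ.≟ q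
  ... | yes ≡.refl = just refl
  ... | no _       = nothing

  -- Rational numbers are the literals of the solver, so identities may contain constants such as
  -- `con (ℚ.- 1ℚ)`.
  module Solver =
    Algebra.Solver.Ring ℚ.+-*-rawRing (fromCommutativeRing commutativeRing) morphism decide

-- Decidability of zero lets elimination search for a pivot and makes division a total function.
record Field : Set₁ where
  field algebra : RationalAlgebra
  open RationalAlgebra algebra public
  field
    _≟0        : ∀ a → Dec (a ≈ 0#)
    1≉0        : ¬ (1# ≈ 0#)
    invertible : ∀ {a} → ¬ (a ≈ 0#) → ∃ λ b → a * b ≈ 1#

-- Finite sums over lists, with Iverson brackets

module Sums (Alg : RationalAlgebra) where
  open RationalAlgebra Alg
  open ≈-Reasoning
  open Solver using (solve; _:+_; _:*_; _:-_; _:=_; con; :-_)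

  private variable
    S T : Set

  ∑ : List S → (S → Carrier) → Carrier
  ∑ []      f = 0#
  ∑ (s ∷ L) f = f s + ∑ L f

  ∑-cong : ∀ (L : List S) {f g} → (∀ s → s ∈ L → f s ≈ g s) → ∑ L f ≈ ∑ L g
  ∑-cong []      h = refl
  ∑-cong (s ∷ L) h = +-cong (h s (here ≡.refl)) (∑-cong L (λ s s∈ → h s (there s∈)))

  ∑-ext : ∀ (L : List S) {f g} → (∀ s → f s ≈ g s) → ∑ L f ≈ ∑ L g
  ∑-ext L h = ∑-cong L (λ s _ → h s)

  ∑-zero : ∀ (L : List S) {f} → (∀ s → s ∈ L → f s ≈ 0#) → ∑ L f ≈ 0#
  ∑-zero []      h = refl
  ∑-zero (s ∷ L) h = trans (+-cong (h s (here ≡.refl)) (∑-zero L (λ s s∈ → h s (there s∈)))) (+-identityˡ 0#)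

  ∑-+ : ∀ (L : List S) f g → ∑ L (λ s → f s + g s) ≈ ∑ L f + ∑ L g
  ∑-+ []      f g = sym (+-identityˡ 0#)
  ∑-+ (s ∷ L) f g = trans (+-congˡ (∑-+ L f g))
    (solve 4 (λ a b c d → (a :+ b) :+ (c :+ d) := (a :+ c) :+ (b :+ d)) refl (f s) (g s) (∑ L f) (∑ L g))

  ∑-*ˡ : ∀ (L : List S) a f → a * ∑ L f ≈ ∑ L (λ s → a * f s)
  ∑-*ˡ []      a f = zeroʳ a
  ∑-*ˡ (s ∷ L) a f = trans (distribˡ a _ _) (+-congˡ (∑-*ˡ L a f))

  ∑-*ʳ : ∀ (L : List S) a f → ∑ L f * a ≈ ∑ L (λ s → f s * a)
  ∑-*ʳ L a f = trans (*-comm _ a) (trans (∑-*ˡ L a f) (∑-ext L (λ s → *-comm a (f s))))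

  ∑-neg : ∀ (L : List S) f → - ∑ L f ≈ ∑ L (λ s → - f s)
  ∑-neg L f = begin
    - ∑ L f               ≈⟨ solve 1 (λ a → :- a := con (ℚ.- 1ℚ) :* a) refl _ ⟩
    ι (ℚ.- 1ℚ) * ∑ L f    ≈⟨ ∑-*ˡ L _ f ⟩
    ∑ L (λ s → ι (ℚ.- 1ℚ) * f s)
      ≈⟨ ∑-ext L (λ s → solve 1 (λ a → con (ℚ.- 1ℚ) :* a := :- a) refl (f s)) ⟩
    ∑ L (λ s → - f s)     ∎

  ∑-comm : ∀ (L : List S) (M : List T) (f : S → T → Carrier) →
    ∑ L (λ s → ∑ M (f s)) ≈ ∑ M (λ t → ∑ L (λ s → f s t))
  ∑-comm []      M f = sym (∑-zero M (λ _ _ → refl))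
  ∑-comm (s ∷ L) M f = trans (+-congˡ (∑-comm L M f)) (sym (∑-+ M (f s) _))

  ∑-++ : ∀ (L M : List S) f → ∑ (L ++ M) f ≈ ∑ L f + ∑ M f
  ∑-++ []      M f = sym (+-identityˡ _)
  ∑-++ (s ∷ L) M f = trans (+-congˡ (∑-++ L M f)) (sym (+-assoc _ _ _))

  ∑-map : ∀ (g : S → T) L f → ∑ (map g L) f ≈ ∑ L (λ s → f (g s))
  ∑-map g []      f = refl
  ∑-map g (s ∷ L) f = +-congˡ (∑-map g L f)

  ∑-concatMap : ∀ (g : S → List T) L f → ∑ (concatMap g L) f ≈ ∑ L (λ s → ∑ (g s) f)
  ∑-concatMap g []      f = refl
  ∑-concatMap g (s ∷ L) f = trans (∑-++ (g s) _ f) (+-congˡ (∑-concatMap g L f))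

  ∑-↭ : ∀ {L M : List S} f → L ↭ M → ∑ L f ≈ ∑ M f
  ∑-↭ f Perm.refl        = refl
  ∑-↭ f (prep s p)  = +-congˡ (∑-↭ f p)
  ∑-↭ f (swap s t p) = trans (+-congˡ (+-congˡ (∑-↭ f p)))
    (solve 3 (λ a b c → a :+ (b :+ c) := b :+ (a :+ c)) refl (f s) (f t) _)
  ∑-↭ f (Perm.trans p q) = trans (∑-↭ f p) (∑-↭ f q)

  [_] : {P : Set} → Dec P → Carrier
  [ yes _ ] = 1#
  [ no _ ]  = 0#

  [yes] : {P : Set} (d : Dec P) → P → [ d ] ≈ 1#
  [yes] (yes _) p = refl
  [yes] (no ¬p) p = contradiction p ¬p

  [no] : {P : Set} (d : Dec P) → ¬ P → [ d ] ≈ 0#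
  [no] (yes p) ¬p = contradiction p ¬p
  [no] (no _)  ¬p = refl

  [⇔] : {P Q : Set} (d : Dec P) (d′ : Dec Q) → (P → Q) → (Q → P) → [ d ] ≈ [ d′ ]
  [⇔] (yes p) d′ f g = sym ([yes] d′ (f p))
  [⇔] (no ¬p) d′ f g = sym ([no] d′ (λ q → ¬p (g q)))

  [×] : {P Q R : Set} (d : Dec P) (d′ : Dec Q) (d″ : Dec R) →
    (P → Q × R) → (Q → R → P) → [ d ] ≈ [ d′ ] * [ d″ ]
  [×] d (yes q) (yes r) f g = trans ([yes] d (g q r)) (sym (*-identityˡ 1#))
  [×] d (no ¬q) d″      f g = trans ([no] d (λ p → ¬q (proj₁ (f p)))) (sym (zeroˡ _))
  [×] d (yes q) (no ¬r) f g = trans ([no] d (λ p → ¬r (proj₂ (f p)))) (sym (zeroʳ _))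

  -- Lets a condition be used inside a summand: where the bracket is 0, both sides vanish.
  [assume] : {P : Set} (d : Dec P) {a b : Carrier} → (P → a ≈ b) → [ d ] * a ≈ [ d ] * b
  [assume] (yes p) h = *-congˡ (h p)
  [assume] (no _)  h = trans (zeroˡ _) (sym (zeroˡ _))

  ∑-filter : ∀ {P : S → Set} (P? : ∀ s → Dec (P s)) L f →
    ∑ (filter P? L) f ≈ ∑ L (λ s → [ P? s ] * f s)
  ∑-filter P? []      f = refl
  ∑-filter P? (s ∷ L) f with P? s
  ... | yes _ = +-cong (sym (*-identityˡ _)) (∑-filter P? L f)
  ... | no _  = trans (sym (+-identityˡ _)) (+-cong (sym (zeroˡ _)) (∑-filter P? L f))

  module _ (_≟ˢ_ : DecidableEquality S) where
    ∑-δ : ∀ {L} {s : S} (f : S → Carrier) → Unique L → s ∈ L → ∑ L (λ t → [ t ≟ˢ s ] * f t) ≈ f s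
    ∑-δ {_ ∷ L} {s} f (s∉ ∷ _) (here ≡.refl) = begin
      [ s ≟ˢ s ] * f s + ∑ L (λ t → [ t ≟ˢ s ] * f t)
        ≈⟨ +-cong (trans (*-congʳ ([yes] (s ≟ˢ s) ≡.refl)) (*-identityˡ _))
                  (∑-zero L (λ t t∈ → trans (*-congʳ ([no] (t ≟ˢ s) (λ t≡s → All.lookup s∉ t∈ (≡.sym t≡s)))) (zeroˡ _))) ⟩
      f s + 0#  ≈⟨ +-identityʳ _ ⟩
      f s       ∎
    ∑-δ {L = t ∷ L} {s} f (t∉ ∷ L!) (there s∈) = begin
      [ t ≟ˢ s ] * f t + ∑ L (λ t → [ t ≟ˢ s ] * f t)
        ≈⟨ +-cong (trans (*-congʳ ([no] (t ≟ˢ s) (All.lookup t∉ s∈))) (zeroˡ _)) (∑-δ f L! s∈) ⟩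
      0# + f s  ≈⟨ +-identityˡ _ ⟩
      f s       ∎

-- Lists without repetition, strings and arrangements

module _ {S : Set} where
  Unique-resp-↭ : {L M : List S} → L ↭ M → Unique L → Unique M
  Unique-resp-↭ Perm.refl        u = u
  Unique-resp-↭ (prep s p)       (s∉ ∷ u) = ↭ₚ.All-resp-↭ p s∉ ∷ Unique-resp-↭ p u
  Unique-resp-↭ (swap s t p)     ((s≢t ∷ s∉) ∷ t∉ ∷ u) =
    ((s≢t ∘ ≡.sym) ∷ ↭ₚ.All-resp-↭ p t∉) ∷ ↭ₚ.All-resp-↭ p s∉ ∷ Unique-resp-↭ p u
  Unique-resp-↭ (Perm.trans p q) u = Unique-resp-↭ q (Unique-resp-↭ p u)

  ∉-head : {s : S} {L : List S} → Unique (s ∷ L) → s ∉ L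
  ∉-head (s∉ ∷ _) s∈ = All.lookup s∉ s∈ ≡.refl

  Unique-∷ : {s : S} {L : List S} → s ∉ L → Unique L → Unique (s ∷ L)
  Unique-∷ s∉ u = All.tabulate (λ t∈ s≡t → s∉ (subst (_∈ _) (≡.sym s≡t) t∈)) ∷ u

  extract : {s : S} {L : List S} → s ∈ L → ∃ λ M → L ↭ s ∷ M
  extract s∈ with ∈ₚ.∈-∃++ s∈
  ... | ys , zs , ≡.refl = ys ++ zs , ↭ₚ.shift _ ys zs

  snoc-↭ : (L : List S) (s : S) → L ++ s ∷ [] ↭ s ∷ L
  snoc-↭ L s = ↭-sym (↭ₚ.∷↭∷ʳ s L)

  length-snoc : (L : List S) (s : S) → length (L ++ s ∷ []) ≡ suc (length L)
  length-snoc L s = ↭ₚ.↭-length (snoc-↭ L s)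

  swap-↭ : (p : List S) (s t : S) (q : List S) → p ++ s ∷ t ∷ q ↭ p ++ t ∷ s ∷ q
  swap-↭ p s t q = ↭ₚ.++⁺ˡ p (swap s t ↭-refl)

  exchange-↭ : (s t : S) (p q : List S) → s ∷ p ++ t ∷ q ↭ t ∷ p ++ s ∷ q
  exchange-↭ s t p q = ↭-trans (prep s (↭ₚ.shift t p q))
    (↭-trans (swap s t ↭-refl) (prep t (↭-sym (↭ₚ.shift s p q))))

  -- Pigeonhole: the head of L is extracted from M and the remainders are compared; the length bound
  -- empties M when L is exhausted.
  unique-cover : {L M : List S} → Unique L → Unique M → length M ≤ length L →
    (∀ {s} → s ∈ L → s ∈ M) → L ↭ M
  unique-cover {[]} {[]}    _ _ _ _ = ↭-refl
  unique-cover {s ∷ L} {M} L!@(_ ∷ L!′) M! le L⊆M with extract (L⊆M (here ≡.refl))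
  ... | M′ , M↭ = ↭-trans (prep s (unique-cover L!′ (tail (Unique-resp-↭ M↭ M!)) le′ ⊆′)) (↭-sym M↭)
    where
    tail : ∀ {t T} → Unique (t ∷ T) → Unique {A = S} T
    tail (_ ∷ u) = u
    le′ : length M′ ≤ length L
    le′ = ℕₚ.≤-pred (subst (_≤ suc (length L)) (↭ₚ.↭-length M↭) le)
    ⊆′ : ∀ {t} → t ∈ L → t ∈ M′
    ⊆′ t∈ with ↭ₚ.∈-resp-↭ M↭ (L⊆M (there t∈))
    ... | here ≡.refl = contradiction t∈ (∉-head L!)
    ... | there t∈M′  = t∈M′

  unique-⊆-length : {L M : List S} → Unique L → (∀ {s} → s ∈ L → s ∈ M) → length L ≤ length M
  unique-⊆-length {[]}        _             _ = z≤n
  unique-⊆-length {s ∷ L} {M} L!@(_ ∷ L!′) h with extract (h (here ≡.refl))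
  ... | M′ , M↭ = subst (suc (length L) ≤_) (≡.sym (↭ₚ.↭-length M↭)) (s≤s (unique-⊆-length L!′ h′))
    where
    h′ : ∀ {t} → t ∈ L → t ∈ M′
    h′ t∈ with ↭ₚ.∈-resp-↭ M↭ (h (there t∈))
    ... | here ≡.refl = contradiction t∈ (∉-head L!)
    ... | there t∈M′  = t∈M′

  -- The counterpart of `words` for lists. Words are constantly cut and rejoined below, and for
  -- lists reassociation needs no casts on lengths.
  strings : List S → ℕ → List (List S)
  strings L zero    = [] ∷ []
  strings L (suc j) = cartesianProductWith _∷_ L (strings L j)

  strings-unique : ∀ {L} j → Unique L → Unique (strings L j)
  strings-unique zero    L! = [] ∷ []
  strings-unique (suc j) L! =
    Uniqueₚ.cartesianProductWith⁺ _∷_ (λ { ≡.refl → ≡.refl , ≡.refl }) L! (strings-unique j L!)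

  ∈-strings⁺ : ∀ {L c} → (∀ {s} → s ∈ c → s ∈ L) → c ∈ strings L (length c)
  ∈-strings⁺ {c = []}    h = here ≡.refl
  ∈-strings⁺ {c = s ∷ c} h = ∈ₚ.∈-cartesianProductWith⁺ _∷_ (h (here ≡.refl)) (∈-strings⁺ (λ t∈ → h (there t∈)))

  ∈-strings⁻ : ∀ {L} j {c} → c ∈ strings L j → length c ≡ j
  ∈-strings⁻ zero    (here ≡.refl) = ≡.refl
  ∈-strings⁻ {L} (suc j) c∈ with ∈ₚ.∈-cartesianProductWith⁻ _∷_ L (strings L j) c∈
  ... | s , d , _ , d∈ , ≡.refl = cong suc (∈-strings⁻ j d∈)

  module _ (_≟ˢ_ : DecidableEquality S) where
    unique? : (c : List S) → Dec (Unique c)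
    unique? []      = yes []
    unique? (s ∷ c) with DecMem._∈?_ _≟ˢ_ s c | unique? c
    ... | yes s∈ | _     = no (λ u → ∉-head u s∈)
    ... | no _   | no ¬u = no (λ { (_ ∷ u) → ¬u u })
    ... | no s∉  | yes u = yes (Unique-∷ s∉ u)

strings-map : ∀ {S T : Set} (f : S → T) L j → strings (map f L) j ≡ map (map f) (strings L j)
strings-map f L zero    = ≡.refl
strings-map f L (suc j) rewrite strings-map f L j = go L
  where
  go : ∀ M → cartesianProductWith _∷_ (map f M) (map (map f) (strings L j))
           ≡ map (map f) (cartesianProductWith _∷_ M (strings L j))
  go []      = ≡.refl
  go (s ∷ M) = ≡.trans (cong₂ _++_ (inner (strings L j)) (go M)) (≡.sym (Listₚ.map-++ (map f) (map (s ∷_) (strings L j)) _))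
    where
    inner : ∀ Q → map (f s ∷_) (map (map f) Q) ≡ map (map f) (map (s ∷_) Q)
    inner []      = ≡.refl
    inner (c ∷ Q) = cong (_ ∷_) (inner Q)

module _ {N : ℕ} where
  _∈?_ : (s : Fin N) (c : List (Fin N)) → Dec (s ∈ c)
  _∈?_ = DecMem._∈?_ Finₚ._≟_

  _≟ᶜ_ : DecidableEquality (List (Fin N))
  _≟ᶜ_ = Listₚ.≡-dec Finₚ._≟_

  -- Used both for colors and for labels, which range over the same set. Encoded as a permutation so
  -- that moving entries is composition of permutations.
  Full : List (Fin N) → Set
  Full c = c ↭ allFin N

  full-unique : ∀ {c} → Full c → Unique c
  full-unique p = Unique-resp-↭ (↭-sym p) (Uniqueₚ.allFin⁺ N)

  full-length : ∀ {c} → Full c → length c ≡ N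
  full-length p = ≡.trans (↭ₚ.↭-length p) (Listₚ.length-tabulate id)

  full-∈ : ∀ {c} s → Full c → s ∈ c
  full-∈ s p = ↭ₚ.∈-resp-↭ (↭-sym p) (∈ₚ.∈-allFin s)

  unique-full : ∀ {c} → Unique c → length c ≡ N → Full c
  unique-full u len = unique-cover u (Uniqueₚ.allFin⁺ N)
    (ℕₚ.≤-reflexive (≡.trans (Listₚ.length-tabulate id) (≡.sym len))) (λ {s} _ → ∈ₚ.∈-allFin s)

  unique-length : ∀ {c : List (Fin N)} → Unique c → length c ≤ N
  unique-length {c} u = subst (length c ≤_) (Listₚ.length-tabulate id)
    (unique-⊆-length u (λ {s} _ → ∈ₚ.∈-allFin s))

  missing : ∀ {c : List (Fin N)} → length c < N → ∃ λ s → s ∉ c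
  missing {c} lt with all? (_∈? c) (allFin N)
  ... | no ¬all = let s , s∉ = go (allFin N) ¬all in s , s∉
    where
    go : ∀ L → ¬ All (_∈ c) L → ∃ λ s → s ∉ c
    go []      ¬a = contradiction [] ¬a
    go (s ∷ L) ¬a with s ∈? c
    ... | yes s∈ = go L (λ a → ¬a (s∈ ∷ a))
    ... | no s∉  = s , s∉
  ... | yes cov = contradiction lt (ℕₚ.≤⇒≯ (subst (_≤ length c) (Listₚ.length-tabulate id)
    (unique-⊆-length (Uniqueₚ.allFin⁺ N) (All.lookup cov))))

  arrangements : ℕ → List (List (Fin N))
  arrangements j = filter (unique? Finₚ._≟_) (strings (allFin N) j)

  arrangements-unique : ∀ j → Unique (arrangements j)
  arrangements-unique j = Uniqueₚ.filter⁺ (unique? Finₚ._≟_) (strings-unique j (Uniqueₚ.allFin⁺ N))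

  ∈-arrangements⁺ : ∀ {c} → Unique c → c ∈ arrangements (length c)
  ∈-arrangements⁺ u = ∈ₚ.∈-filter⁺ (unique? Finₚ._≟_) (∈-strings⁺ (λ {s} _ → ∈ₚ.∈-allFin s)) u

  ∈-arrangements⁻ : ∀ j {c} → c ∈ arrangements j → Unique c × length c ≡ j
  ∈-arrangements⁻ j c∈ with ∈ₚ.∈-filter⁻ (unique? Finₚ._≟_) {xs = strings (allFin N) j} c∈
  ... | c∈′ , u = u , ∈-strings⁻ j c∈′

  full⇒∈ : ∀ {c} → Full c → c ∈ arrangements N
  full⇒∈ {c} p = subst (λ j → c ∈ arrangements j) (full-length p) (∈-arrangements⁺ (full-unique p))

  ∈⇒full : ∀ {c} → c ∈ arrangements N → Full c
  ∈⇒full c∈ = let u , len = ∈-arrangements⁻ N c∈ in unique-full u len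

-- Linear algebra over a field, and operators with simple joint spectrum

module LinearAlgebra (F : Field) where
  open Field F
  open Sums algebra
  open ≈-Reasoning
  open Solver using (solve; _:+_; _:*_; _:-_; _:=_; con; :-_)

  -- The default 1/0 = 0 is relied upon: it makes diagonal weights vanish and turns the factor 1 +
  -- 1/(n - n) into 1, so that products need not skip an index.
  recip : Carrier → Carrier
  recip a with a ≟0
  ... | yes _  = 0#
  ... | no a≉0 = proj₁ (invertible a≉0)

  recip-* : ∀ {a} → ¬ (a ≈ 0#) → a * recip a ≈ 1#
  recip-* {a} a≉0 with a ≟0
  ... | yes a≈0 = contradiction a≈0 a≉0
  ... | no a≉0′ = proj₂ (invertible a≉0′)

  cancel : ∀ {a b} → ¬ (a ≈ 0#) → a * b ≈ 0# → b ≈ 0#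
  cancel {a} {b} a≉0 ab≈0 = begin
    b                  ≈⟨ *-identityˡ b ⟨
    1# * b             ≈⟨ *-congʳ (recip-* a≉0) ⟨
    (a * recip a) * b  ≈⟨ solve 3 (λ a r b → (a :* r) :* b := r :* (a :* b)) refl a (recip a) b ⟩
    recip a * (a * b)  ≈⟨ *-congˡ ab≈0 ⟩
    recip a * 0#       ≈⟨ zeroʳ _ ⟩
    0#                 ∎

  -≈0 : ∀ {a b} → a - b ≈ 0# → a ≈ b
  -≈0 {a} {b} = Rₚ.x∙y⁻¹≈ε⇒x≈y a b

  ≈0- : ∀ {a b} → a ≈ b → a - b ≈ 0#
  ≈0- = Rₚ.x≈y⇒x∙y⁻¹≈ε

  cancelˡ : ∀ {a b c} → ¬ (a ≈ 0#) → a * b ≈ a * c → b ≈ c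
  cancelˡ {a} {b} {c} a≉0 h = -≈0 (cancel a≉0 (begin
    a * (b - c)      ≈⟨ solve 3 (λ a b c → a :* (b :- c) := a :* b :- a :* c) refl a b c ⟩
    a * b - a * c    ≈⟨ ≈0- h ⟩
    0#               ∎))

  ≉0-* : ∀ {a b} → ¬ (a ≈ 0#) → ¬ (b ≈ 0#) → ¬ (a * b ≈ 0#)
  ≉0-* a≉0 b≉0 ab≈0 = b≉0 (cancel a≉0 ab≈0)

  module _ {S T : Set} (_≟ˢ_ : DecidableEquality S) where

    -- Gaussian elimination of one coordinate at a time.
    dependent : ∀ (Cs : List T) (Ls : List S) → Unique Ls → length Cs < length Ls →
      (v : S → T → Carrier) →
      Σ[ λ′ ∈ (S → Carrier) ] (∃ λ z → z ∈ Ls × ¬ (λ′ z ≈ 0#)) ×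
        (∀ c → c ∈ Cs → ∑ Ls (λ z → λ′ z * v z c) ≈ 0#)
    dependent []       (z ∷ Ls) _   _  v = (λ _ → 1#) , (z , here ≡.refl , 1≉0) , λ _ ()
    dependent (c ∷ Cs) Ls       Ls! lt v with any? (λ z → ¬? (v z c ≟0)) Ls
    ... | no none with dependent Cs Ls Ls! (ℕₚ.≤-trans (ℕₚ.n≤1+n _) lt) v
    ...   | μ , wit , rel = μ , wit , λ
      { d (here ≡.refl) → ∑-zero Ls (λ z z∈ → trans (*-congˡ (vanish z z∈)) (zeroʳ _))
      ; d (there d∈)    → rel d d∈ }
      where
      vanish : ∀ z → z ∈ Ls → v z c ≈ 0#
      vanish z z∈ with v z c ≟0
      ... | yes e = e
      ... | no ne = contradiction (lose z∈ ne) none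
    dependent (c ∷ Cs) Ls Ls! lt v | yes some with find some
    ... | p , p∈ , ne with extract p∈
    ...   | Ls′ , Ls↭ with Unique-resp-↭ Ls↭ Ls!
    ...     | pLs!@(_ ∷ Ls!′)
      with dependent Cs Ls′ Ls!′ (ℕₚ.≤-pred (subst (suc (suc (length Cs)) ≤_) (↭ₚ.↭-length Ls↭) lt))
             (λ z d → v z d - (v z c * recip (v p c)) * v p d)
    ...       | μ , (z₀ , z₀∈ , μz₀) , rel =
      μ′ , (z₀ , ↭ₚ.∈-resp-↭ (↭-sym Ls↭) (there z₀∈) , λ e → μz₀ (trans (sym (μ′≈μ z₀ z₀∈)) e)) , rel′
      where
      r = recip (v p c)
      a = ∑ Ls′ (λ z → μ z * v z c)
      -- The pivot p receives the coefficient that cancels coordinate c of the combination.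
      μ′ : S → Carrier
      μ′ z with z ≟ˢ p
      ... | yes _ = - (a * r)
      ... | no _  = μ z
      μ′p : μ′ p ≈ - (a * r)
      μ′p with p ≟ˢ p
      ... | yes _ = refl
      ... | no ¬e = contradiction ≡.refl ¬e
      μ′≈μ : ∀ z → z ∈ Ls′ → μ′ z ≈ μ z
      μ′≈μ z z∈ with z ≟ˢ p
      ... | yes ≡.refl = contradiction z∈ (∉-head pLs!)
      ... | no _       = refl
      expand : ∀ d → ∑ Ls (λ z → μ′ z * v z d) ≈ ∑ Ls′ (λ z → μ z * v z d) - (a * r) * v p d
      expand d = begin
        ∑ Ls (λ z → μ′ z * v z d)
          ≈⟨ ∑-↭ _ Ls↭ ⟩
        μ′ p * v p d + ∑ Ls′ (λ z → μ′ z * v z d)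
          ≈⟨ +-cong (*-congʳ μ′p) (∑-cong Ls′ (λ z z∈ → *-congʳ (μ′≈μ z z∈))) ⟩
        - (a * r) * v p d + ∑ Ls′ (λ z → μ z * v z d)
          ≈⟨ solve 3 (λ x y z → :- x :* y :+ z := z :- x :* y) refl (a * r) (v p d) _ ⟩
        ∑ Ls′ (λ z → μ z * v z d) - (a * r) * v p d ∎
      rel′ : ∀ d → d ∈ c ∷ Cs → ∑ Ls (λ z → μ′ z * v z d) ≈ 0#
      rel′ d (here ≡.refl) = trans (expand c) (≈0- (sym (begin
        (a * r) * v p c   ≈⟨ solve 3 (λ a r v → (a :* r) :* v := a :* (v :* r)) refl a r (v p c) ⟩
        a * (v p c * r)   ≈⟨ *-congˡ (recip-* ne) ⟩
        a * 1#            ≈⟨ *-identityʳ a ⟩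
        a                 ∎)))
      rel′ d (there d∈) = begin
        ∑ Ls (λ z → μ′ z * v z d)
          ≈⟨ expand d ⟩
        ∑ Ls′ (λ z → μ z * v z d) - (a * r) * v p d
          ≈⟨ +-congˡ (-‿cong (trans (*-assoc a r _) (∑-*ʳ Ls′ _ _))) ⟩
        ∑ Ls′ (λ z → μ z * v z d) - ∑ Ls′ (λ z → (μ z * v z c) * (r * v p d))
          ≈⟨ +-congˡ (∑-neg Ls′ _) ⟩
        ∑ Ls′ (λ z → μ z * v z d) + ∑ Ls′ (λ z → - ((μ z * v z c) * (r * v p d)))
          ≈⟨ ∑-+ Ls′ _ _ ⟨
        ∑ Ls′ (λ z → μ z * v z d + - ((μ z * v z c) * (r * v p d)))
          ≈⟨ ∑-ext Ls′ (λ z → solve 5 (λ m x y r w → m :* x :+ :- ((m :* y) :* (r :* w)) := m :* (x :- (y :* r) :* w))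
               refl (μ z) (v z d) (v z c) r (v p d)) ⟩
        ∑ Ls′ (λ z → μ z * (v z d - (v z c * r) * v p d))
          ≈⟨ rel d d∈ ⟩
        0# ∎

  Independent : {S T : Set} → List S → List T → (S → T → Carrier) → Set
  Independent {S} Ls Cs v =
    ∀ (λ′ : S → Carrier) → (∀ c → c ∈ Cs → ∑ Ls (λ z → λ′ z * v z c) ≈ 0#) → ∀ z → z ∈ Ls → λ′ z ≈ 0#

  module _ {S T : Set} (_≟ˢ_ : DecidableEquality S) where
    -- With u adjoined as `nothing` there are more vectors than coordinates, hence a nontrivial
    -- relation. Independence of v forces the coefficient of u to be nonzero, and dividing by it
    -- solves for u.
    span : ∀ {Cs : List T} {Ls : List S} v → Unique Ls → length Ls ≡ length Cs →
      Independent Ls Cs v → ∀ u → Σ[ μ ∈ (S → Carrier) ] (∀ c → c ∈ Cs → u c ≈ ∑ Ls (λ z → μ z * v z c))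
    span {Cs} {Ls} v Ls! len ind u = result (dep Ls! (ℕₚ.≤-reflexive (cong suc (≡.sym len))))
      where
      v₊ : Maybe S → T → Carrier
      v₊ nothing  = u
      v₊ (just z) = v z
      result : Σ[ λ′ ∈ (Maybe S → Carrier) ] (∃ λ z → z ∈ nothing ∷ map just Ls × ¬ (λ′ z ≈ 0#)) ×
          (∀ c → c ∈ Cs → ∑ (nothing ∷ map just Ls) (λ z → λ′ z * v₊ z c) ≈ 0#) →
        Σ[ μ ∈ (S → Carrier) ] (∀ c → c ∈ Cs → u c ≈ ∑ Ls (λ z → μ z * v z c))
      result (λ′ , (z₀ , z₀∈ , nz) , rel) = μ , main
        where
        l = λ′ nothing
        rel₁ : ∀ c → c ∈ Cs → l * u c + ∑ Ls (λ z → λ′ (just z) * v z c) ≈ 0#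
        rel₁ c c∈ = trans (+-congˡ (sym (∑-map just Ls _))) (rel c c∈)
        l≉0 : ¬ (l ≈ 0#)
        l≉0 l≈0 = nz (all0 z₀ z₀∈)
          where
          rest0 : ∀ z → z ∈ Ls → λ′ (just z) ≈ 0#
          rest0 = ind (λ z → λ′ (just z)) (λ c c∈ → begin
            ∑ Ls (λ z → λ′ (just z) * v z c)           ≈⟨ +-identityˡ _ ⟨
            0# + ∑ Ls (λ z → λ′ (just z) * v z c)      ≈⟨ +-congʳ (trans (*-congʳ l≈0) (zeroˡ _)) ⟨
            l * u c + ∑ Ls (λ z → λ′ (just z) * v z c) ≈⟨ rel₁ c c∈ ⟩
            0#                                         ∎)
          all0 : ∀ z → z ∈ nothing ∷ map just Ls → λ′ z ≈ 0#
          all0 _ (here ≡.refl) = l≈0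
          all0 z (there z∈) with ∈ₚ.∈-map⁻ just z∈
          ... | y , y∈ , ≡.refl = rest0 y y∈
        r = recip l
        μ : S → Carrier
        μ z = - (r * λ′ (just z))
        main : ∀ c → c ∈ Cs → u c ≈ ∑ Ls (λ z → μ z * v z c)
        main c c∈ = -≈0 (begin
          u c - ∑ Ls (λ z → μ z * v z c)
            ≈⟨ +-cong (sym (trans (*-congʳ (recip-* l≉0)) (*-identityˡ _))) (-‿cong (trans (∑-ext Ls (λ z →
                 solve 3 (λ r a b → :- (r :* a) :* b := (:- r) :* (a :* b)) refl r (λ′ (just z)) (v z c)))
                 (sym (∑-*ˡ Ls (- r) _)))) ⟩
          (l * r) * u c - (- r) * ∑ Ls (λ z → λ′ (just z) * v z c)
            ≈⟨ solve 4 (λ l r u s → (l :* r) :* u :- (:- r) :* s := r :* (l :* u :+ s)) refl l r (u c) _ ⟩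
          r * (l * u c + ∑ Ls (λ z → λ′ (just z) * v z c))
            ≈⟨ *-congˡ (rel₁ c c∈) ⟩
          r * 0# ≈⟨ zeroʳ r ⟩
          0# ∎)
      dep : Unique Ls → length Cs < suc (length Ls) → _
      dep u lt = dependent (Maybeₚ.≡-dec _≟ˢ_) Cs (nothing ∷ map just Ls)
        (Unique-∷ nothing∉ (Uniqueₚ.map⁺ Maybeₚ.just-injective u))
        (subst (length Cs <_) (cong suc (≡.sym (Listₚ.length-map just Ls))) lt) v₊
        where
        nothing∉ : nothing ∉ map just Ls
        nothing∉ n∈ with ∈ₚ.∈-map⁻ just n∈
        ... | _ , _ , ()

  module _ {S : Set} (_≟ˢ_ : DecidableEquality S) {L : List S} (L! : Unique L)
           (g : S → S → Carrier) (ind : Independent L L g) where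
    private
      δ : S → S → Carrier
      δ s t = [ t ≟ˢ s ]

    inverse : S → S → Carrier
    inverse c = proj₁ (span _≟ˢ_ {L} {L} g L! ≡.refl ind (δ c))

    inverseˡ : ∀ c d → d ∈ L → ∑ L (λ z → inverse c z * g z d) ≈ δ c d
    inverseˡ c d d∈ = sym (proj₂ (span _≟ˢ_ {L} {L} g L! ≡.refl ind (δ c)) d d∈)

    -- A left inverse of a square matrix is a right inverse: (g g⁻¹ - 1) g = g - g = 0, and the rows
    -- of g are independent.
    inverseʳ : ∀ y z → y ∈ L → z ∈ L → ∑ L (λ c → g y c * inverse c z) ≈ δ y z
    inverseʳ y z y∈ z∈ = -≈0 (ind (λ z → ∑ L (λ c → g y c * inverse c z) - δ y z) vanish z z∈)
      where
      vanish : ∀ d → d ∈ L → ∑ L (λ z → (∑ L (λ c → g y c * inverse c z) - δ y z) * g z d) ≈ 0#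
      vanish d d∈ = begin
        ∑ L (λ z → (∑ L (λ c → g y c * inverse c z) - δ y z) * g z d)
          ≈⟨ ∑-ext L (λ z → solve 3 (λ a b c → (a :- b) :* c := a :* c :+ :- (b :* c)) refl _ (δ y z) (g z d)) ⟩
        ∑ L (λ z → ∑ L (λ c → g y c * inverse c z) * g z d + - (δ y z * g z d))
          ≈⟨ ∑-+ L _ _ ⟩
        ∑ L (λ z → ∑ L (λ c → g y c * inverse c z) * g z d) + ∑ L (λ z → - (δ y z * g z d))
          ≈⟨ +-cong (∑-ext L (λ z → ∑-*ʳ L _ _)) (sym (∑-neg L _)) ⟩
        ∑ L (λ z → ∑ L (λ c → (g y c * inverse c z) * g z d)) - ∑ L (λ z → δ y z * g z d)
          ≈⟨ +-cong (∑-comm L L _) (-‿cong (∑-δ _≟ˢ_ (λ z → g z d) L! y∈)) ⟩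
        ∑ L (λ c → ∑ L (λ z → (g y c * inverse c z) * g z d)) - g y d
          ≈⟨ +-congʳ (∑-cong L (λ c c∈ → begin
               ∑ L (λ z → (g y c * inverse c z) * g z d) ≈⟨ ∑-ext L (λ z → *-assoc _ _ _) ⟩
               ∑ L (λ z → g y c * (inverse c z * g z d)) ≈⟨ ∑-*ˡ L _ _ ⟨
               g y c * ∑ L (λ z → inverse c z * g z d)   ≈⟨ *-congˡ (inverseˡ c d d∈) ⟩
               g y c * δ c d                             ≈⟨ *-comm _ _ ⟩
               δ c d * g y c                             ≈⟨ *-congʳ ([⇔] (d ≟ˢ c) (c ≟ˢ d) ≡.sym ≡.sym) ⟩
               [ c ≟ˢ d ] * g y c                        ∎)) ⟩
        ∑ L (λ c → [ c ≟ˢ d ] * g y c) - g y d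
          ≈⟨ ≈0- (∑-δ _≟ˢ_ (g y) L! d∈) ⟩
        0# ∎

    -- T and T′ are conjugate under the invertible matrix g.
    trace-conjugate : ∀ (T T′ : S → S → Carrier) →
      (∀ y d → y ∈ L → d ∈ L → ∑ L (λ c → g y c * T′ c d) ≈ ∑ L (λ z → T y z * g z d)) →
      ∑ L (λ z → T z z) ≈ ∑ L (λ c → T′ c c)
    trace-conjugate T T′ comm = begin
      ∑ L (λ y → T y y)
        ≈⟨ ∑-cong L (λ y y∈ → sym (∑-δ _≟ˢ_ (T y) L! y∈)) ⟩
      ∑ L (λ y → ∑ L (λ z → [ z ≟ˢ y ] * T y z))
        ≈⟨ ∑-cong L (λ y y∈ → ∑-cong L (λ z z∈ → trans
             (*-congʳ (trans ([⇔] (z ≟ˢ y) (y ≟ˢ z) ≡.sym ≡.sym) (sym (inverseʳ z y z∈ y∈))))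
             (trans (∑-*ʳ L _ _) (∑-ext L (λ d → solve 3 (λ a b c → (a :* b) :* c := (c :* a) :* b) refl _ _ _))))) ⟩
      ∑ L (λ y → ∑ L (λ z → ∑ L (λ d → (T y z * g z d) * inverse d y)))
        ≈⟨ ∑-ext L (λ y → trans (∑-comm L L _) (∑-ext L (λ d → sym (∑-*ʳ L _ _)))) ⟩
      ∑ L (λ y → ∑ L (λ d → ∑ L (λ z → T y z * g z d) * inverse d y))
        ≈⟨ ∑-cong L (λ y y∈ → ∑-cong L (λ d d∈ → *-congʳ (sym (comm y d y∈ d∈)))) ⟩
      ∑ L (λ y → ∑ L (λ d → ∑ L (λ c → g y c * T′ c d) * inverse d y))
        ≈⟨ ∑-ext L (λ y → ∑-ext L (λ d → trans (∑-*ʳ L _ _)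
             (∑-ext L (λ c → solve 3 (λ a b c → (a :* b) :* c := b :* (c :* a)) refl _ _ _)))) ⟩
      ∑ L (λ y → ∑ L (λ d → ∑ L (λ c → T′ c d * (inverse d y * g y c))))
        ≈⟨ trans (∑-comm L L _) (∑-ext L (λ d → trans (∑-comm L L _) (∑-ext L (λ c → sym (∑-*ˡ L _ _))))) ⟩
      ∑ L (λ d → ∑ L (λ c → T′ c d * ∑ L (λ y → inverse d y * g y c)))
        ≈⟨ ∑-cong L (λ d d∈ → ∑-cong L (λ c c∈ → trans (*-congˡ (inverseˡ d c c∈)) (*-comm _ _))) ⟩
      ∑ L (λ d → ∑ L (λ c → [ c ≟ˢ d ] * T′ c d))
        ≈⟨ ∑-cong L (λ d d∈ → ∑-δ _≟ˢ_ (λ c → T′ c d) L! d∈) ⟩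
      ∑ L (λ c → T′ c c) ∎

-- Functions matter only on L, whose elements index both the coordinates and the eigenvectors.
-- `separated` is simplicity of the joint spectrum. There are two uses: the operators at all
-- positions of an arrangement, and a single operator on functions of the head color.
module Eigenbasis (F : Field) {S R : Set} (_≟ˢ_ : DecidableEquality S)
  {L : List S} (L! : Unique L)
  (Θ : R → (S → Field.Carrier F) → S → Field.Carrier F)
  (Θ-cong : ∀ r f g → (∀ c → c ∈ L → Field._≈_ F (f c) (g c)) →
    ∀ c → c ∈ L → Field._≈_ F (Θ r f c) (Θ r g c))
  (Θ-linear : ∀ r a f g c → c ∈ L →
    Field._≈_ F (Θ r (λ d → Field._+_ F (Field._*_ F a (f d)) (g d)) c)
                (Field._+_ F (Field._*_ F a (Θ r f c)) (Θ r g c)))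
  (ev : S → R → Field.Carrier F)
  (separated : ∀ {y z} → y ∈ L → z ∈ L → y ≢ z → ∃ λ r → ¬ (Field._≈_ F (ev y r) (ev z r)))
  where

  open Field F
  open Sums algebra
  open LinearAlgebra F
  open ≈-Reasoning
  open Solver using (solve; _:+_; _:*_; _:-_; _:=_; con; :-_)

  Eigenvector : S → (S → Carrier) → Set
  Eigenvector z f = ∀ r c → c ∈ L → Θ r f c ≈ ev z r * f c

  -- Linearity is given in the form a f + g, so Θ 0 = Θ (1 · 0 + 0) = Θ 0 + Θ 0.
  Θ-0 : ∀ r c → c ∈ L → Θ r (λ _ → 0#) c ≈ 0#
  Θ-0 r c c∈ = begin
    t                ≈⟨ solve 1 (λ t → t := (con 1ℚ :* t :+ t) :- t) refl t ⟩
    (ι 1ℚ * t + t) - t  ≈⟨ +-congʳ (sym (Θ-linear r (ι 1ℚ) (λ _ → 0#) (λ _ → 0#) c c∈)) ⟩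
    Θ r (λ _ → ι 1ℚ * 0# + 0#) c - t
      ≈⟨ +-congʳ (Θ-cong r _ _ (λ _ _ → trans (+-identityʳ _) (zeroʳ _)) c c∈) ⟩
    t - t            ≈⟨ -‿inverseʳ t ⟩
    0#               ∎
    where t = Θ r (λ _ → 0#) c

  Θ-∑ : ∀ r (Zs : List S) (μ : S → Carrier) (b : S → S → Carrier) c → c ∈ L →
    Θ r (λ d → ∑ Zs (λ z → μ z * b z d)) c ≈ ∑ Zs (λ z → μ z * Θ r (b z) c)
  Θ-∑ r []       μ b c c∈ = Θ-0 r c c∈
  Θ-∑ r (z ∷ Zs) μ b c c∈ =
    trans (Θ-linear r (μ z) (b z) _ c c∈) (+-congˡ (Θ-∑ r Zs μ b c c∈))

  eigenvector-combination : ∀ {z a f g} → Eigenvector z f → Eigenvector z g →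
    Eigenvector z (λ c → a * f c + g c)
  eigenvector-combination {z} {a} {f} {g} ef eg r c c∈ = begin
    Θ r (λ c → a * f c + g c) c              ≈⟨ Θ-linear r a f g c c∈ ⟩
    a * Θ r f c + Θ r g c                    ≈⟨ +-cong (*-congˡ (ef r c c∈)) (eg r c c∈) ⟩
    a * (ev z r * f c) + ev z r * g c
      ≈⟨ solve 4 (λ a e f g → a :* (e :* f) :+ e :* g := e :* (a :* f :+ g)) refl a (ev z r) (f c) (g c) ⟩
    ev z r * (a * f c + g c)                 ∎

  module _ (b : S → S → Carrier) (b-eigen : ∀ z → z ∈ L → Eigenvector z (b z))
           (b-nonzero : ∀ z → z ∈ L → ∃ λ c → c ∈ L × ¬ (b z c ≈ 0#)) where

    -- Applying Θ r - ev z r to the relation removes the term at z and multiplies f by ev t r - ev z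
    -- r, which is nonzero for a separating r. What remains has one term fewer.
    eliminate : ∀ {t} → t ∈ L → ∀ (Zs : List S) (μ : S → Carrier) → (∀ {z} → z ∈ Zs → z ∈ L × z ≢ t) →
      ∀ f → Eigenvector t f → (∀ c → c ∈ L → f c + ∑ Zs (λ z → μ z * b z c) ≈ 0#) →
      ∀ c → c ∈ L → f c ≈ 0#
    eliminate t∈ []       μ _  f ef rel c c∈ = trans (sym (+-identityʳ _)) (rel c c∈)
    eliminate {t} t∈ (z ∷ Zs) μ ok f ef rel c c∈
      with ok (here ≡.refl)
    ... | z∈ , z≢t with separated t∈ z∈ (z≢t ∘ ≡.sym)
    ...   | r , t≉z = cancel (λ e → t≉z (-≈0 e))
        (eliminate t∈ Zs (λ y → (ev y r - ev z r) * μ y) (λ y∈ → ok (there y∈))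
          (λ d → (ev t r - ev z r) * f d) ef′ rel′ c c∈)
      where
      ef′ : Eigenvector t (λ d → (ev t r - ev z r) * f d)
      ef′ s d d∈ = begin
        Θ s (λ d → a * f d) d        ≈⟨ Θ-cong s _ _ (λ d _ → sym (+-identityʳ _)) d d∈ ⟩
        Θ s (λ d → a * f d + 0#) d   ≈⟨ Θ-linear s a f (λ _ → 0#) d d∈ ⟩
        a * Θ s f d + Θ s (λ _ → 0#) d ≈⟨ +-cong (*-congˡ (ef s d d∈)) (Θ-0 s d d∈) ⟩
        a * (ev t s * f d) + 0#
          ≈⟨ trans (+-identityʳ _) (solve 3 (λ a e f → a :* (e :* f) := e :* (a :* f)) refl a (ev t s) (f d)) ⟩
        ev t s * (a * f d)           ∎
        where a = ev t r - ev z r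
      rel′ : ∀ d → d ∈ L → (ev t r - ev z r) * f d + ∑ Zs (λ y → ((ev y r - ev z r) * μ y) * b y d) ≈ 0#
      rel′ d d∈ = begin
        (ev t r - ev z r) * f d + ∑ Zs (λ y → ((ev y r - ev z r) * μ y) * b y d)
          ≈⟨ +-congˡ (trans (∑-cong Zs (λ y y∈ → trans
               (solve 4 (λ e₁ e₂ m b → ((e₁ :- e₂) :* m) :* b := m :* (e₁ :* b) :+ :- e₂ :* (m :* b)) refl (ev y r) (ev z r) (μ y) (b y d))
               (+-congʳ (*-congˡ (sym (b-eigen y (proj₁ (ok (there y∈))) r d d∈)))))) (trans (∑-+ Zs _ _) (+-congˡ (sym (∑-*ˡ Zs _ _))))) ⟩
        (ev t r - ev z r) * f d + (∑ Zs (λ y → μ y * Θ r (b y) d) + - ev z r * ∑ Zs (λ y → μ y * b y d))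
          ≈⟨ solve 7 (λ t z f s u m b → (t :- z) :* f :+ (s :+ :- z :* u)
               := (t :* f :+ (m :* (z :* b) :+ s)) :- z :* (f :+ (m :* b :+ u)))
               refl (ev t r) (ev z r) (f d) (∑ Zs (λ y → μ y * Θ r (b y) d)) (∑ Zs (λ y → μ y * b y d)) (μ z) (b z d) ⟩
        (ev t r * f d + (μ z * (ev z r * b z d) + ∑ Zs (λ y → μ y * Θ r (b y) d)))
          - ev z r * (f d + (μ z * b z d + ∑ Zs (λ y → μ y * b y d)))
          ≈⟨ +-congʳ (+-congʳ (sym (trans (*-congʳ ι-1) (*-identityˡ _)))) ⟩
        (ι 1ℚ * (ev t r * f d) + (μ z * (ev z r * b z d) + ∑ Zs (λ y → μ y * Θ r (b y) d)))
          - ev z r * (f d + (μ z * b z d + ∑ Zs (λ y → μ y * b y d)))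
          ≈⟨ +-cong (+-cong (*-congˡ (sym (ef r d d∈)))
               (trans (+-congʳ (*-congˡ (sym (b-eigen z z∈ r d d∈)))) (sym (Θ-∑ r (z ∷ Zs) μ b d d∈))))
               (-‿cong (trans (*-congˡ (rel d d∈)) (zeroʳ _))) ⟩
        (ι 1ℚ * Θ r f d + Θ r (λ d → ∑ (z ∷ Zs) (λ y → μ y * b y d)) d) - 0#
          ≈⟨ +-congʳ (sym (Θ-linear r (ι 1ℚ) f _ d d∈)) ⟩
        Θ r (λ d → ι 1ℚ * f d + ∑ (z ∷ Zs) (λ y → μ y * b y d)) d - 0#
          ≈⟨ +-congʳ (trans (Θ-cong r _ _ (λ d d∈ → trans (+-congʳ (trans (*-congʳ ι-1) (*-identityˡ _))) (rel d d∈)) d d∈)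
               (Θ-0 r d d∈)) ⟩
        0# - 0#  ≈⟨ -‿inverseʳ 0# ⟩
        0#       ∎

    private
      others : ∀ {t L′} → L ↭ t ∷ L′ → ∀ {z} → z ∈ L′ → z ∈ L × z ≢ t
      others p z∈ = ↭ₚ.∈-resp-↭ (↭-sym p) (there z∈) ,
        λ { ≡.refl → ∉-head (Unique-resp-↭ p L!) z∈ }

    eigenvectors-independent : Independent L L b
    eigenvectors-independent μ rel t t∈ with extract t∈ | b-nonzero t t∈
    ... | L′ , p | c , c∈ , nz = cancel nz (trans (*-comm _ _) (eliminate t∈ L′ μ (others p) _ scaled rel′ c c∈))
      where
      scaled : Eigenvector t (λ c → μ t * b t c)
      scaled r d d∈ = trans (Θ-cong r _ _ (λ d _ → sym (+-identityʳ _)) d d∈)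
        (trans (eigenvector-combination (b-eigen t t∈) (λ s d d∈ → trans (Θ-0 s d d∈) (sym (zeroʳ _))) r d d∈)
          (*-congˡ (+-identityʳ _)))
      rel′ : ∀ d → d ∈ L → μ t * b t d + ∑ L′ (λ z → μ z * b z d) ≈ 0#
      rel′ d d∈ = trans (sym (∑-↭ _ p)) (rel d d∈)

    -- Expanded in the basis, f minus its b t-component is an eigenvector for t and also a
    -- combination of the other basis vectors, hence 0 by `eliminate`.
    eigenvector-unique : ∀ {t f} → t ∈ L → Eigenvector t f →
      ∃ λ a → ∀ c → c ∈ L → f c ≈ a * b t c
    eigenvector-unique {t} {f} t∈ ef =
      compare (span _≟ˢ_ {L} {L} b L! ≡.refl eigenvectors-independent f) (extract t∈)
      where
      compare : Σ[ μ ∈ (S → Carrier) ] (∀ c → c ∈ L → f c ≈ ∑ L (λ z → μ z * b z c)) →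
        (∃ λ L′ → L ↭ t ∷ L′) → ∃ λ a → ∀ c → c ∈ L → f c ≈ a * b t c
      compare (μ , comb) (L′ , p) = μ t , λ c c∈ → -≈0 (begin
        f c - μ t * b t c   ≈⟨ solve 3 (λ f m b → f :- m :* b := :- m :* b :+ f) refl (f c) (μ t) (b t c) ⟩
        g c                 ≈⟨ eliminate t∈ L′ (λ z → - μ z) (others p) g eg rel c c∈ ⟩
        0#                  ∎)
        where
        g : S → Carrier
        g c = - μ t * b t c + f c
        eg : Eigenvector t g
        eg = eigenvector-combination (b-eigen t t∈) ef
        rel : ∀ c → c ∈ L → g c + ∑ L′ (λ z → - μ z * b z c) ≈ 0#
        rel c c∈ = begin
          g c + ∑ L′ (λ z → - μ z * b z c)
            ≈⟨ +-congˡ (trans (∑-ext L′ (λ z → sym (Rₚ.-‿distribˡ-* (μ z) (b z c)))) (sym (∑-neg L′ _))) ⟩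
          (- μ t * b t c + f c) - ∑ L′ (λ z → μ z * b z c)
            ≈⟨ +-congʳ (+-congˡ (trans (comb c c∈) (∑-↭ _ p))) ⟩
          (- μ t * b t c + (μ t * b t c + ∑ L′ (λ z → μ z * b z c))) - ∑ L′ (λ z → μ z * b z c)
            ≈⟨ ≈0- (solve 3 (λ m b s → :- m :* b :+ (m :* b :+ s) := s) refl (μ t) (b t c)
                 (∑ L′ (λ z → μ z * b z c))) ⟩
          0#   ∎

-- Natural numbers in a field over ℚ, and sums over a chosen entry of a list

module ℚRing = Algebra.Properties.Ring ℚₚ.+-*-ring

nat : ℕ → ℚ
nat zero    = 0ℚ
nat (suc n) = 1ℚ ℚ.+ nat n

nat-nonneg : ∀ n → 0ℚ ℚ.≤ nat n
nat-nonneg zero    = ℚₚ.≤-refl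
nat-nonneg (suc n) = ℚₚ.+-mono-≤ {0ℚ} {1ℚ} (ℚₚ.nonNegative⁻¹ 1ℚ) (nat-nonneg n)

nat-suc≢0 : ∀ n → nat (suc n) ≢ 0ℚ
nat-suc≢0 n e = ℚₚ.<-irrefl (≡.sym e) (ℚₚ.+-mono-<-≤ {0ℚ} {1ℚ} (ℚₚ.positive⁻¹ 1ℚ) (nat-nonneg n))

nat-injective : ∀ m n → nat m ≡ nat n → m ≡ n
nat-injective zero    zero    e = ≡.refl
nat-injective zero    (suc n) e = contradiction (≡.sym e) (nat-suc≢0 n)
nat-injective (suc m) zero    e = contradiction e (nat-suc≢0 m)
nat-injective (suc m) (suc n) e = cong suc (nat-injective m n (ℚRing.+-cancelˡ 1ℚ (nat m) (nat n) e))

module FieldNumbers (F : Field) where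
  open Field F
  open LinearAlgebra F
  open ≈-Reasoning

  -- The image of 1/q would be an inverse of 0.
  ι-≉0 : ∀ {q} → q ≢ 0ℚ → ¬ (ι q ≈ 0#)
  ι-≉0 {q} q≢0 ιq≈0 = 1≉0 (begin
    1#                      ≈⟨ ι-1 ⟨
    ι 1ℚ                    ≡⟨ cong ι (ℚₚ.*-inverseʳ q) ⟨
    ι (q ℚ.* (ℚ.1/ q))      ≈⟨ ι-* q _ ⟩
    ι q * ι (ℚ.1/ q)        ≈⟨ *-congʳ ιq≈0 ⟩
    0# * ι (ℚ.1/ q)         ≈⟨ zeroˡ _ ⟩
    0#                      ∎)
    where instance _ = ℚ.≢-nonZero q≢0

  ι-injective : ∀ {p q} → ι p ≈ ι q → p ≡ q
  ι-injective {p} {q} e with (p ℚ.- q) ℚₚ.≟ 0ℚ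
  ... | yes z = ℚRing.x∙y⁻¹≈ε⇒x≈y p q z
  ... | no nz = contradiction (trans (ι-+ p (ℚ.- q)) (trans (+-congˡ (ι-neg q)) (≈0- e))) (ι-≉0 nz)

  ν : ℕ → Carrier
  ν n = ι (nat n)

  ν-suc : ∀ n → ν (suc n) ≈ 1# + ν n
  ν-suc n = trans (ι-+ 1ℚ (nat n)) (+-congʳ ι-1)

  ν-0 : ν 0 ≈ 0#
  ν-0 = ι-0

  ν-1 : ν 1 ≈ 1#
  ν-1 = trans (ν-suc 0) (trans (+-congˡ ν-0) (+-identityʳ 1#))

  ν-injective : ∀ {m n} → ν m ≈ ν n → m ≡ n
  ν-injective {m} {n} e = nat-injective m n (ι-injective e)

  ν-suc≉0 : ∀ n → ¬ (ν (suc n) ≈ 0#)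
  ν-suc≉0 n = ι-≉0 (nat-suc≢0 n)

module PickSums (Alg : RationalAlgebra) where
  open RationalAlgebra Alg
  open Sums Alg
  open ≈-Reasoning
  open Solver using (solve; _:+_; _:*_; _:-_; _:=_; con; :-_)

  private variable
    S T : Set

  -- The sum over all ways to write L as p ++ s ∷ q.
  ∑pick : List S → (S → List S → List S → Carrier) → Carrier
  ∑pick []      G = 0#
  ∑pick (s ∷ L) G = G s [] L + ∑pick L (λ t p q → G t (s ∷ p) q)

  pick-cong : ∀ (L : List S) {G H} → (∀ s p q → L ≡ p ++ s ∷ q → G s p q ≈ H s p q) → ∑pick L G ≈ ∑pick L H
  pick-cong []      h = refl
  pick-cong (s ∷ L) h = +-cong (h s [] L ≡.refl) (pick-cong L (λ t p q e → h t (s ∷ p) q (cong (s ∷_) e)))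

  pick-+ : ∀ (L : List S) G H → ∑pick L (λ s p q → G s p q + H s p q) ≈ ∑pick L G + ∑pick L H
  pick-+ []      G H = sym (+-identityˡ 0#)
  pick-+ (s ∷ L) G H = trans (+-congˡ (pick-+ L _ _))
    (solve 4 (λ a b c d → (a :+ b) :+ (c :+ d) := (a :+ c) :+ (b :+ d)) refl
       (G s [] L) (H s [] L) (∑pick L (λ t p q → G t (s ∷ p) q)) (∑pick L (λ t p q → H t (s ∷ p) q)))

  pick-*ˡ : ∀ (L : List S) a G → a * ∑pick L G ≈ ∑pick L (λ s p q → a * G s p q)
  pick-*ˡ []      a G = zeroʳ a
  pick-*ˡ (s ∷ L) a G = trans (distribˡ a _ _) (+-congˡ (pick-*ˡ L a _))

  pick-snoc : ∀ (L : List S) z G →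
    ∑pick (L ++ z ∷ []) G ≈ ∑pick L (λ s p q → G s p (q ++ z ∷ [])) + G z L []
  pick-snoc []      z G = trans (+-identityʳ _) (sym (+-identityˡ _))
  pick-snoc (s ∷ L) z G = trans (+-congˡ (pick-snoc L z _)) (sym (+-assoc _ _ _))

  pick-∑ : ∀ (L : List S) h → ∑pick L (λ s _ _ → h s) ≈ ∑ L h
  pick-∑ []      h = refl
  pick-∑ (s ∷ L) h = +-congˡ (pick-∑ L h)

  pick-const : ∀ (L : List S) a → ∑pick L (λ _ _ _ → a) ≈ ι (nat (length L)) * a
  pick-const []      a = sym (trans (*-congʳ ι-0) (zeroˡ a))
  pick-const (s ∷ L) a = begin
    a + ∑pick L (λ _ _ _ → a)         ≈⟨ +-congˡ (pick-const L a) ⟩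
    a + ι (nat (length L)) * a        ≈⟨ solve 2 (λ a n → a :+ n :* a := (con 1ℚ :+ n) :* a) refl a (ι (nat (length L))) ⟩
    (ι 1ℚ + ι (nat (length L))) * a   ≈⟨ *-congʳ (sym (ι-+ 1ℚ _)) ⟩
    ι (nat (suc (length L))) * a      ∎

  pick-zero : ∀ (L : List S) {G} → (∀ s p q → L ≡ p ++ s ∷ q → G s p q ≈ 0#) → ∑pick L G ≈ 0#
  pick-zero L h = trans (pick-cong L h) (trans (pick-const L 0#) (zeroʳ _))

  pick-∑-comm : ∀ (L : List S) (Zs : List T) (G : T → S → List S → List S → Carrier) →
    ∑pick L (λ s p q → ∑ Zs (λ z → G z s p q)) ≈ ∑ Zs (λ z → ∑pick L (G z))
  pick-∑-comm []      Zs G = sym (∑-zero Zs (λ _ _ → refl))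
  pick-∑-comm (s ∷ L) Zs G = trans (+-congˡ (pick-∑-comm L Zs (λ z t p q → G z t (s ∷ p) q)))
    (sym (∑-+ Zs (λ z → G z s [] L) _))

-- Cherednik operators on functions of color arrangements, and rotation

assoc₂ : {S : Set} (p : List S) (s : S) (q : List S) (t : S) (r z : List S) →
  p ++ s ∷ q ++ t ∷ r ++ z ≡ (p ++ s ∷ q ++ t ∷ r) ++ z
assoc₂ p s q t r z = ≡.trans (cong (λ l → p ++ s ∷ l) (≡.sym (Listₚ.++-assoc q (t ∷ r) z)))
  (≡.sym (Listₚ.++-assoc p (s ∷ q ++ t ∷ r) z))

snoc-view : {S : Set} (q : List S) → q ≡ [] ⊎ ∃₂ λ q₀ z → q ≡ q₀ ++ z ∷ []
snoc-view []      = inj₁ ≡.refl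
snoc-view (s ∷ q) with snoc-view q
... | inj₁ ≡.refl            = inj₂ ([] , s , ≡.refl)
... | inj₂ (q₀ , z , ≡.refl) = inj₂ (s ∷ q₀ , z , ≡.refl)

swapHead : {S : Set} → List S → List S
swapHead (s ∷ t ∷ c) = t ∷ s ∷ c
swapHead c           = c

-- Functions of an arrangement c of all N colors. The operators Θ are the Sym-linear
-- Cherednik operators of nonsymmetric Jack polynomials in the limit α = 0.
module ColorFunctions (F : Field) (N : ℕ) (x : Fin N → Field.Carrier F)
  (x-distinct : ∀ {a b} → a ≢ b → ¬ (Field._≈_ F (x a) (x b))) where

  open Field F
  open LinearAlgebra F
  open FieldNumbers F
  open PickSums algebra
  open ≈-Reasoning
  open Solver using (solve; _:+_; _:*_; _:-_; _:=_; con; :-_)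

  Fun : Set
  Fun = List (Fin N) → Carrier

  gap : Fin N → Fin N → Carrier
  gap a b = recip (x b - x a)

  -- x_b/(x_b - x_a) = 1 + x_a/(x_b - x_a): the weights for exchanging a with a later and with an
  -- earlier b differ by exactly 1. Every commutation relation of the operators Θ rests on this.
  gap-eq : ∀ {a b} → a ≢ b → x b * gap a b ≈ 1# + x a * gap a b
  gap-eq {a} {b} a≢b = begin
    x b * gap a b
      ≈⟨ solve 3 (λ b a g → b :* g := (b :- a) :* g :+ a :* g) refl (x b) (x a) (gap a b) ⟩
    (x b - x a) * gap a b + x a * gap a b
      ≈⟨ +-congʳ (recip-* (λ e → x-distinct (a≢b ∘ ≡.sym) (-≈0 e))) ⟩
    1# + x a * gap a b ∎

  -- The splitting p ++ a ∷ q of the arrangement selects the operator: it belongs to the position of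
  -- a, counted from 1. Differences with a later b carry x_b/(x_b - x_a), those with an earlier b
  -- carry x_a/(x_b - x_a).
  Θ : Fun → List (Fin N) → Fin N → List (Fin N) → Carrier
  Θ f p a q = ν (suc (length p)) * f (p ++ a ∷ q)
    + ( ∑pick q (λ b q₁ q₂ → (x b * gap a b) * (f (p ++ a ∷ q) - f (p ++ b ∷ q₁ ++ a ∷ q₂)))
      + ∑pick p (λ b p₁ p₂ → (x a * gap a b) * (f (p ++ a ∷ q) - f (p₁ ++ a ∷ p₂ ++ b ∷ q))))

  -- At each position the eigenvalue is the label that σ has there. The label word and the color
  -- word are split separately, and equal lengths of the parts say that the positions agree.
  Eig : List (Fin N) → Fun → Set
  Eig σ f = ∀ p′ s q′ p a q → σ ≡ p′ ++ s ∷ q′ → length p ≡ length p′ → length q ≡ length q′ →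
    Full (p ++ a ∷ q) → Θ f p a q ≈ ν (value s) * f (p ++ a ∷ q)

  Θ-cong : ∀ {f g} p a q → Full (p ++ a ∷ q) → (∀ c → Full c → f c ≈ g c) → Θ f p a q ≈ Θ g p a q
  Θ-cong p a q full h = +-cong (*-congˡ (h _ full)) (+-cong
    (pick-cong q (λ { b q₁ q₂ ≡.refl → *-congˡ (+-cong (h _ full) (-‿cong (h _
      (↭-trans (↭ₚ.++⁺ˡ p (exchange-↭ b a q₁ q₂)) full)))) }))
    (pick-cong p (λ { b p₁ p₂ ≡.refl → *-congˡ (+-cong (h _ full) (-‿cong (h _
      (↭-trans (↭-trans (↭ₚ.++⁺ˡ p₁ (exchange-↭ a b p₂ q))
        (Perm.↭-reflexive (≡.sym (Listₚ.++-assoc p₁ (b ∷ p₂) (a ∷ q))))) full)))) })))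

  Θ-linear : ∀ k f g p a q → Θ (λ c → k * f c + g c) p a q ≈ k * Θ f p a q + Θ g p a q
  Θ-linear k f g p a q = trans
    (+-congˡ (+-cong
      (linear q (λ b → x b * gap a b) (λ b q₁ q₂ → p ++ b ∷ q₁ ++ a ∷ q₂) (p ++ a ∷ q))
      (linear p (λ b → x a * gap a b) (λ b p₁ p₂ → p₁ ++ a ∷ p₂ ++ b ∷ q) (p ++ a ∷ q))))
    (solve 8 (λ n k f g s₁ s₂ s₃ s₄ →
        n :* (k :* f :+ g) :+ ((k :* s₁ :+ s₂) :+ (k :* s₃ :+ s₄))
        := k :* (n :* f :+ (s₁ :+ s₃)) :+ (n :* g :+ (s₂ :+ s₄))) refl
      (ν (suc (length p))) k (f (p ++ a ∷ q)) (g (p ++ a ∷ q))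
      (∑pick q (λ b q₁ q₂ → (x b * gap a b) * (f (p ++ a ∷ q) - f (p ++ b ∷ q₁ ++ a ∷ q₂))))
      (∑pick q (λ b q₁ q₂ → (x b * gap a b) * (g (p ++ a ∷ q) - g (p ++ b ∷ q₁ ++ a ∷ q₂))))
      (∑pick p (λ b p₁ p₂ → (x a * gap a b) * (f (p ++ a ∷ q) - f (p₁ ++ a ∷ p₂ ++ b ∷ q))))
      (∑pick p (λ b p₁ p₂ → (x a * gap a b) * (g (p ++ a ∷ q) - g (p₁ ++ a ∷ p₂ ++ b ∷ q)))))
    where
    linear : ∀ L (w : Fin N → Carrier) (h : Fin N → List (Fin N) → List (Fin N) → List (Fin N)) (c : List (Fin N)) →
      ∑pick L (λ b l r → w b * ((k * f c + g c) - (k * f (h b l r) + g (h b l r))))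
      ≈ k * ∑pick L (λ b l r → w b * (f c - f (h b l r))) + ∑pick L (λ b l r → w b * (g c - g (h b l r)))
    linear L w h c = begin
      ∑pick L (λ b l r → w b * ((k * f c + g c) - (k * f (h b l r) + g (h b l r))))
        ≈⟨ pick-cong L (λ b l r _ → solve 6 (λ w k f g f′ g′ →
             w :* ((k :* f :+ g) :- (k :* f′ :+ g′)) := k :* (w :* (f :- f′)) :+ w :* (g :- g′))
             refl (w b) k (f c) (g c) (f (h b l r)) (g (h b l r))) ⟩
      ∑pick L (λ b l r → k * (w b * (f c - f (h b l r))) + w b * (g c - g (h b l r)))
        ≈⟨ pick-+ L _ _ ⟩
      ∑pick L (λ b l r → k * (w b * (f c - f (h b l r)))) + ∑pick L (λ b l r → w b * (g c - g (h b l r)))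
        ≈⟨ +-congʳ (sym (pick-*ˡ L k _)) ⟩
      k * ∑pick L (λ b l r → w b * (f c - f (h b l r))) + ∑pick L (λ b l r → w b * (g c - g (h b l r))) ∎

  Eig-cong : ∀ {σ f g} → (∀ c → Full c → f c ≈ g c) → Eig σ f → Eig σ g
  Eig-cong {f = f} {g} h ef p′ s q′ p a q e l₁ l₂ full = begin
    Θ g p a q                      ≈⟨ Θ-cong p a q full h ⟨
    Θ f p a q                      ≈⟨ ef p′ s q′ p a q e l₁ l₂ full ⟩
    ν (value s) * f (p ++ a ∷ q)   ≈⟨ *-congˡ (h _ full) ⟩
    ν (value s) * g (p ++ a ∷ q)   ∎

  Eig-combination : ∀ {σ} k {f g} → Eig σ f → Eig σ g → Eig σ (λ c → k * f c + g c)
  Eig-combination k {f} {g} ef eg p′ s q′ p a q e l₁ l₂ full = begin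
    Θ (λ c → k * f c + g c) p a q
      ≈⟨ Θ-linear k f g p a q ⟩
    k * Θ f p a q + Θ g p a q
      ≈⟨ +-cong (*-congˡ (ef p′ s q′ p a q e l₁ l₂ full)) (eg p′ s q′ p a q e l₁ l₂ full) ⟩
    k * (ν (value s) * f (p ++ a ∷ q)) + ν (value s) * g (p ++ a ∷ q)
      ≈⟨ solve 4 (λ k n f g → k :* (n :* f) :+ n :* g := n :* (k :* f :+ g)) refl k (ν (value s)) (f (p ++ a ∷ q)) (g (p ++ a ∷ q)) ⟩
    ν (value s) * (k * f (p ++ a ∷ q) + g (p ++ a ∷ q)) ∎

  Θ-const : ∀ k p a q → Θ (λ _ → k) p a q ≈ ν (suc (length p)) * k
  Θ-const k p a q = trans (+-congˡ (trans (+-cong (pick-zero q (λ b _ _ _ → z (x b * gap a b)))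
      (pick-zero p (λ b _ _ _ → z (x a * gap a b)))) (+-identityˡ 0#))) (+-identityʳ _)
    where
    z : ∀ w → w * (k - k) ≈ 0#
    z w = trans (*-congˡ (-‿inverseʳ k)) (zeroʳ w)

  Eig-zero : ∀ {σ} → Eig σ (λ _ → 0#)
  Eig-zero p′ s q′ p a q _ _ _ _ = trans (Θ-const 0# p a q) (trans (zeroʳ _) (sym (zeroʳ _)))

  Eig-scale : ∀ {σ} k {f} → Eig σ f → Eig σ (λ c → k * f c)
  Eig-scale k {f} ef = Eig-cong {f = λ c → k * f c + 0#} (λ c _ → +-identityʳ _)
    (Eig-combination k {f} {λ _ → 0#} ef Eig-zero)

  private
    tabulate-split : ∀ {n} (g : Fin n → Fin N) p s q → Data.List.tabulate g ≡ p ++ s ∷ q →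
      ∃ λ i → s ≡ g i × toℕ i ≡ length p
    tabulate-split {suc n} g []      s q e = Fin.zero , Listₚ.∷-injectiveˡ (≡.sym e) , ≡.refl
    tabulate-split {suc n} g (_ ∷ p) s q e with tabulate-split (g ∘ Fin.suc) p s q (Listₚ.∷-injectiveʳ e)
    ... | i , eq , len = Fin.suc i , eq , cong suc len

  -- All differences vanish on a constant, which leaves the position number; so the constants belong
  -- to the increasing arrangement.
  Eig-const : ∀ k → Eig (allFin N) (λ _ → k)
  Eig-const k p′ s q′ p a q e l₁ l₂ full with tabulate-split id p′ s q′ e
  ... | i , ≡.refl , len = trans (Θ-const k p a q)
    (*-congʳ (reflexive (cong (ν ∘ suc) (≡.trans l₁ (≡.sym len)))))

  -- Access to the last entry. The value 0 at the empty list is arbitrary; proofs go through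
  -- `lastly-snoc`.
  lastly : List (Fin N) → (List (Fin N) → Fin N → Carrier) → Carrier
  lastly []          G = 0#
  lastly (a ∷ [])    G = G [] a
  lastly (a ∷ b ∷ c) G = lastly (b ∷ c) (λ p → G (a ∷ p))

  lastly-snoc : ∀ c z G → lastly (c ++ z ∷ []) G ≡ G c z
  lastly-snoc []          z G = ≡.refl
  lastly-snoc (a ∷ [])    z G = ≡.refl
  lastly-snoc (a ∷ b ∷ c) z G = lastly-snoc (b ∷ c) z (λ p → G (a ∷ p))

  rotate : Fun → Fun
  rotate f c = lastly c (λ p z → x z * f (z ∷ p))

  rotate-≡ : ∀ f {c} p z → c ≡ p ++ z ∷ [] → rotate f c ≈ x z * f (z ∷ p)
  rotate-≡ f p z ≡.refl = reflexive (lastly-snoc p z _)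

  -- Rotation lowers the position by one. The color z is later than a on one side and earlier on the
  -- other; by `gap-eq` the change of weight leaves one spare copy of x_z B, which raises the scalar
  -- from |p| + 1 to |p| + 2.
  Θ-rotate : ∀ f p a q z → Unique (p ++ a ∷ q ++ z ∷ []) →
    Θ (rotate f) p a (q ++ z ∷ []) ≈ x z * Θ f (z ∷ p) a q
  Θ-rotate f p a q z u = begin
    ν (suc (length p)) * rotate f (p ++ a ∷ q ++ z ∷ []) + (Q + P)
      ≈⟨ +-cong (*-congˡ (rotate-≡ f (p ++ a ∷ q) z (≡.sym (Listₚ.++-assoc p (a ∷ q) _)))) (+-cong Q≈ P≈) ⟩
    ν (suc (length p)) * (x z * B) + ((x z * Q′ + x z * (B + (x a * gap a z) * (B - B′))) + x z * P′)
      ≈⟨ solve 7 (λ n z b q p w b′ → n :* (z :* b) :+ ((z :* q :+ z :* (b :+ w :* (b :- b′))) :+ z :* p)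
           := z :* ((con 1ℚ :+ n) :* b :+ (q :+ (w :* (b :- b′) :+ p)))) refl
           (ν (suc (length p))) (x z) B Q′ P′ (x a * gap a z) B′ ⟩
    x z * ((ι 1ℚ + ν (suc (length p))) * B + (Q′ + ((x a * gap a z) * (B - B′) + P′)))
      ≈⟨ *-congˡ (+-congʳ (*-congʳ (sym (ι-+ 1ℚ _)))) ⟩
    x z * Θ f (z ∷ p) a q ∎
    where
    B  = f (z ∷ p ++ a ∷ q)
    B′ = f (a ∷ p ++ z ∷ q)
    Q  = ∑pick (q ++ z ∷ []) (λ b q₁ q₂ → (x b * gap a b) * (rotate f (p ++ a ∷ q ++ z ∷ []) - rotate f (p ++ b ∷ q₁ ++ a ∷ q₂)))
    P  = ∑pick p (λ b p₁ p₂ → (x a * gap a b) * (rotate f (p ++ a ∷ q ++ z ∷ []) - rotate f (p₁ ++ a ∷ p₂ ++ b ∷ q ++ z ∷ [])))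
    Q′ = ∑pick q (λ b q₁ q₂ → (x b * gap a b) * (B - f (z ∷ p ++ b ∷ q₁ ++ a ∷ q₂)))
    P′ = ∑pick p (λ b p₁ p₂ → (x a * gap a b) * (B - f (z ∷ p₁ ++ a ∷ p₂ ++ b ∷ q)))
    a≢z : a ≢ z
    a≢z ≡.refl = ∉-head (Unique-resp-↭ (↭ₚ.shift a p (q ++ a ∷ [])) u) (∈ₚ.∈-++⁺ʳ p (∈ₚ.∈-++⁺ʳ q (here ≡.refl)))
    B≈ : rotate f (p ++ a ∷ q ++ z ∷ []) ≈ x z * B
    B≈ = rotate-≡ f (p ++ a ∷ q) z (≡.sym (Listₚ.++-assoc p (a ∷ q) _))
    factor : ∀ w c → (w * (x z * B - x z * f c)) ≈ x z * (w * (B - f c))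
    factor w c = solve 4 (λ w z b c → w :* (z :* b :- z :* c) := z :* (w :* (b :- c))) refl w (x z) B (f c)
    Q≈ : Q ≈ x z * Q′ + x z * (B + (x a * gap a z) * (B - B′))
    Q≈ = trans (pick-snoc q z _) (+-cong
      (trans (pick-cong q (λ b q₁ q₂ _ → trans (*-congˡ (+-cong B≈ (-‿cong
          (rotate-≡ f (p ++ b ∷ q₁ ++ a ∷ q₂) z (assoc₂ p b q₁ a q₂ _))))) (factor _ _)))
        (sym (pick-*ˡ q (x z) _)))
      (begin
        (x z * gap a z) * (rotate f (p ++ a ∷ q ++ z ∷ []) - rotate f (p ++ z ∷ q ++ a ∷ []))
          ≈⟨ *-congˡ (+-cong B≈ (-‿cong (rotate-≡ f (p ++ z ∷ q) a (≡.sym (Listₚ.++-assoc p (z ∷ q) _))))) ⟩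
        (x z * gap a z) * (x z * B - x a * B′)
          ≈⟨ solve 5 (λ z g b a b′ → (z :* g) :* (z :* b :- a :* b′) := z :* ((z :* g) :* b :- (a :* g) :* b′)) refl (x z) (gap a z) B (x a) B′ ⟩
        x z * ((x z * gap a z) * B - (x a * gap a z) * B′)
          ≈⟨ *-congˡ (+-congʳ (*-congʳ (gap-eq a≢z))) ⟩
        x z * ((1# + x a * gap a z) * B - (x a * gap a z) * B′)
          ≈⟨ *-congˡ (trans (+-congʳ (trans (distribʳ B 1# _) (+-congʳ (*-identityˡ B)))) (solve 3 (λ w b b′ → (b :+ w :* b) :- w :* b′ := b :+ w :* (b :- b′)) refl (x a * gap a z) B B′)) ⟩
        x z * (B + (x a * gap a z) * (B - B′)) ∎))
    P≈ : P ≈ x z * P′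
    P≈ = trans (pick-cong p (λ b p₁ p₂ _ → trans (*-congˡ (+-cong B≈ (-‿cong
          (rotate-≡ f (p₁ ++ a ∷ p₂ ++ b ∷ q) z (assoc₂ p₁ a p₂ b q _))))) (factor _ _)))
        (sym (pick-*ˡ p (x z) _))

  -- The last position corresponds to the first. Each of the |p| terms for an earlier color turns
  -- into the term for a later one minus a copy of x_a B, which lowers the scalar from |p| + 1 to 1.
  Θ-rotate-last : ∀ f p a → Unique (p ++ a ∷ []) → Θ (rotate f) p a [] ≈ x a * Θ f [] a p
  Θ-rotate-last f p a u = begin
    ν (suc (length p)) * rotate f (p ++ a ∷ []) + (0# + P)
      ≈⟨ +-cong (*-cong (ν-suc (length p)) (rotate-≡ f p a ≡.refl)) (trans (+-identityˡ _) P≈) ⟩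
    (1# + ν (length p)) * (x a * B) + (x a * P′ - ν (length p) * (x a * B))
      ≈⟨ +-congʳ (trans (distribʳ _ 1# _) (+-congʳ (*-identityˡ _))) ⟩
    (x a * B + ν (length p) * (x a * B)) + (x a * P′ - ν (length p) * (x a * B))
      ≈⟨ solve 4 (λ a b n p → (a :* b :+ n :* (a :* b)) :+ (a :* p :- n :* (a :* b)) := a :* (b :+ p)) refl (x a) B (ν (length p)) P′ ⟩
    x a * (B + P′)
      ≈⟨ *-congˡ (+-cong (sym (trans (*-congʳ ν-1) (*-identityˡ B))) (sym (+-identityʳ P′))) ⟩
    x a * Θ f [] a p ∎
    where
    B = f (a ∷ p)
    P = ∑pick p (λ b p₁ p₂ → (x a * gap a b) * (rotate f (p ++ a ∷ []) - rotate f (p₁ ++ a ∷ p₂ ++ b ∷ [])))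
    P′ = ∑pick p (λ b p₁ p₂ → (x b * gap a b) * (B - f (b ∷ p₁ ++ a ∷ p₂)))
    P≈ : P ≈ x a * P′ - ν (length p) * (x a * B)
    P≈ = begin
      P ≈⟨ pick-cong p term ⟩
      ∑pick p (λ b p₁ p₂ → x a * ((x b * gap a b) * (B - f (b ∷ p₁ ++ a ∷ p₂))) + - (x a * B))
        ≈⟨ pick-+ p _ _ ⟩
      ∑pick p (λ b p₁ p₂ → x a * ((x b * gap a b) * (B - f (b ∷ p₁ ++ a ∷ p₂)))) + ∑pick p (λ _ _ _ → - (x a * B))
        ≈⟨ +-cong (sym (pick-*ˡ p (x a) _)) (pick-const p _) ⟩
      x a * P′ + ν (length p) * - (x a * B)
        ≈⟨ +-congˡ (sym (Rₚ.-‿distribʳ-* _ _)) ⟩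
      x a * P′ - ν (length p) * (x a * B) ∎
      where
      term : ∀ b p₁ p₂ → p ≡ p₁ ++ b ∷ p₂ →
        (x a * gap a b) * (rotate f (p ++ a ∷ []) - rotate f (p₁ ++ a ∷ p₂ ++ b ∷ []))
        ≈ x a * ((x b * gap a b) * (B - f (b ∷ p₁ ++ a ∷ p₂))) + - (x a * B)
      term b p₁ p₂ p≡ = begin
        (x a * gap a b) * (rotate f (p ++ a ∷ []) - rotate f (p₁ ++ a ∷ p₂ ++ b ∷ []))
          ≈⟨ *-congˡ (+-cong (rotate-≡ f p a ≡.refl) (-‿cong
               (rotate-≡ f (p₁ ++ a ∷ p₂) b (≡.sym (Listₚ.++-assoc p₁ (a ∷ p₂) _))))) ⟩
        (x a * gap a b) * (x a * B - x b * B′)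
          ≈⟨ solve 5 (λ a g b B B′ → (a :* g) :* (a :* B :- b :* B′) := a :* ((a :* g) :* B :- (b :* g) :* B′)) refl (x a) (gap a b) (x b) B B′ ⟩
        x a * ((x a * gap a b) * B - (x b * gap a b) * B′)
          ≈⟨ *-congˡ (solve 4 (λ s t B B′ → s :* B :- t :* B′ := t :* (B :- B′) :- (t :- s) :* B) refl (x a * gap a b) (x b * gap a b) B B′) ⟩
        x a * ((x b * gap a b) * (B - B′) - (x b * gap a b - x a * gap a b) * B)
          ≈⟨ *-congˡ (+-congˡ (-‿cong (trans (*-congʳ one) (*-identityˡ B)))) ⟩
        x a * ((x b * gap a b) * (B - B′) - B)
          ≈⟨ solve 3 (λ a y B → a :* (y :- B) := a :* y :+ :- (a :* B)) refl (x a) _ B ⟩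
        x a * ((x b * gap a b) * (B - B′)) + - (x a * B) ∎
        where
        B′ = f (b ∷ p₁ ++ a ∷ p₂)
        a≢b : a ≢ b
        a≢b ≡.refl = ∉-head (Unique-resp-↭ (snoc-↭ p a) u) (subst (a ∈_) (≡.sym p≡) (∈ₚ.∈-insert p₁))
        one : x b * gap a b - x a * gap a b ≈ 1#
        one = trans (+-congʳ (gap-eq a≢b)) (trans (+-assoc _ _ _) (trans (+-congˡ (-‿inverseʳ _)) (+-identityʳ 1#)))

  Eig-rotate : ∀ {s τ f} → Eig (s ∷ τ) f → Eig (τ ++ s ∷ []) (rotate f)
  Eig-rotate {s} {τ} {f} ef p′ t q′ p a q e l₁ l₂ full with snoc-view q | snoc-view q′
  Eig-rotate {s} {τ} {f} ef p′ t q′ p a q e l₁ l₂ full | inj₁ ≡.refl | inj₁ ≡.refl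
    with Listₚ.∷ʳ-injective τ p′ e
  ... | ≡.refl , ≡.refl = begin
    Θ (rotate f) p a []              ≈⟨ Θ-rotate-last f p a (full-unique full) ⟩
    x a * Θ f [] a p                 ≈⟨ *-congˡ (ef [] s τ [] a p ≡.refl ≡.refl l₁ (↭-trans (↭-sym (snoc-↭ p a)) full)) ⟩
    x a * (ν (value s) * f (a ∷ p))  ≈⟨ solve 3 (λ a n f → a :* (n :* f) := n :* (a :* f)) refl (x a) (ν (value s)) (f (a ∷ p)) ⟩
    ν (value s) * (x a * f (a ∷ p))  ≈⟨ *-congˡ (sym (rotate-≡ f p a ≡.refl)) ⟩
    ν (value s) * rotate f (p ++ a ∷ []) ∎
  Eig-rotate ef p′ t q′ p a q e l₁ l₂ full | inj₁ ≡.refl | inj₂ (q₀ , z , ≡.refl) =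
    contradiction (≡.trans l₂ (length-snoc q₀ z)) (λ ())
  Eig-rotate ef p′ t q′ p a q e l₁ l₂ full | inj₂ (q₀ , z , ≡.refl) | inj₁ ≡.refl =
    contradiction (≡.trans (≡.sym l₂) (length-snoc q₀ z)) (λ ())
  Eig-rotate {s} {τ} {f} ef p′ t q′ p a q e l₁ l₂ full | inj₂ (q₀ , z , ≡.refl) | inj₂ (q₁ , y , ≡.refl)
    with Listₚ.∷ʳ-injective τ (p′ ++ t ∷ q₁) (≡.trans e (≡.sym (Listₚ.++-assoc p′ (t ∷ q₁) (y ∷ []))))
  ... | τ≡ , ≡.refl = begin
    Θ (rotate f) p a (q₀ ++ z ∷ [])  ≈⟨ Θ-rotate f p a q₀ z (full-unique full) ⟩
    x z * Θ f (z ∷ p) a q₀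
      ≈⟨ *-congˡ (ef (s ∷ p′) t q₁ (z ∷ p) a q₀ (cong (s ∷_) τ≡) (cong suc l₁)
           (ℕₚ.suc-injective (≡.trans (≡.sym (length-snoc q₀ z)) (≡.trans l₂ (length-snoc q₁ y))))
           (↭-trans (↭-sym (snoc-↭ (p ++ a ∷ q₀) z)) (↭-trans (Perm.↭-reflexive eq) full))) ⟩
    x z * (ν (value t) * f (z ∷ p ++ a ∷ q₀))
      ≈⟨ solve 3 (λ a n f → a :* (n :* f) := n :* (a :* f)) refl (x z) (ν (value t)) _ ⟩
    ν (value t) * (x z * f (z ∷ p ++ a ∷ q₀))
      ≈⟨ *-congˡ (sym (rotate-≡ f (p ++ a ∷ q₀) z (≡.sym eq))) ⟩
    ν (value t) * rotate f (p ++ a ∷ q₀ ++ z ∷ []) ∎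
    where eq = Listₚ.++-assoc p (a ∷ q₀) (z ∷ [])

-- Sums over strings and arrangements

module StringSums (Alg : RationalAlgebra) where
  open RationalAlgebra Alg
  open Sums Alg
  open PickSums Alg
  open ≈-Reasoning

  private variable
    S : Set

  strings-front : ∀ (L : List S) j f →
    ∑ (strings L (suc j)) f ≈ ∑ L (λ s → ∑ (strings L j) (λ c → f (s ∷ c)))
  strings-front L j f = go L
    where
    go : ∀ M → ∑ (cartesianProductWith _∷_ M (strings L j)) f ≈ ∑ M (λ s → ∑ (strings L j) (λ c → f (s ∷ c)))
    go []      = refl
    go (s ∷ M) = trans (∑-++ (map (s ∷_) (strings L j)) _ f) (+-cong (∑-map (s ∷_) (strings L j) f) (go M))

  strings-back : ∀ (L : List S) j f →
    ∑ (strings L (suc j)) f ≈ ∑ (strings L j) (λ c → ∑ L (λ s → f (c ++ s ∷ [])))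
  strings-back L zero    f = trans (strings-front L 0 f)
    (trans (∑-ext L (λ s → +-identityʳ _)) (sym (+-identityʳ _)))
  strings-back L (suc j) f = begin
    ∑ (strings L (suc (suc j))) f
      ≈⟨ strings-front L (suc j) f ⟩
    ∑ L (λ s → ∑ (strings L (suc j)) (λ c → f (s ∷ c)))
      ≈⟨ ∑-ext L (λ s → strings-back L j (λ c → f (s ∷ c))) ⟩
    ∑ L (λ s → ∑ (strings L j) (λ c → ∑ L (λ t → f (s ∷ c ++ t ∷ []))))
      ≈⟨ strings-front L j (λ c → ∑ L (λ t → f (c ++ t ∷ []))) ⟨
    ∑ (strings L (suc j)) (λ c → ∑ L (λ s → f (c ++ s ∷ []))) ∎

  strings-swap : ∀ (L : List S) j f →
    ∑ (strings L j) (λ c → f (swapHead c)) ≈ ∑ (strings L j) f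
  strings-swap L zero          f = refl
  strings-swap L (suc zero)    f = trans (strings-front L 0 _) (sym (strings-front L 0 f))
  strings-swap L (suc (suc j)) f = begin
    ∑ (strings L (suc (suc j))) (λ c → f (swapHead c))
      ≈⟨ twice (λ c → f (swapHead c)) ⟩
    ∑ L (λ s → ∑ L (λ t → ∑ (strings L j) (λ c → f (t ∷ s ∷ c))))
      ≈⟨ ∑-comm L L _ ⟩
    ∑ L (λ t → ∑ L (λ s → ∑ (strings L j) (λ c → f (t ∷ s ∷ c))))
      ≈⟨ twice f ⟨
    ∑ (strings L (suc (suc j))) f ∎
    where
    twice : ∀ g → ∑ (strings L (suc (suc j))) g ≈ ∑ L (λ s → ∑ L (λ t → ∑ (strings L j) (λ c → g (s ∷ t ∷ c))))
    twice g = trans (strings-front L (suc j) g) (∑-ext L (λ s → strings-front L j (λ c → g (s ∷ c))))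

  ∑split : List S → (List S → List S → Carrier) → Carrier
  ∑split []      H = H [] []
  ∑split (s ∷ c) H = H [] (s ∷ c) + ∑split c (λ p q → H (s ∷ p) q)

  split-*ˡ : ∀ (c : List S) a H → a * ∑split c H ≈ ∑split c (λ p q → a * H p q)
  split-*ˡ []      a H = refl
  split-*ˡ (s ∷ c) a H = trans (distribˡ a _ _) (+-congˡ (split-*ˡ c a _))

  -- A string with a chosen entry amounts to that entry together with a string one shorter and a
  -- place at which to cut it.
  strings-pick : ∀ (L : List S) j G →
    ∑ (strings L (suc j)) (λ c → ∑pick c G)
    ≈ ∑ L (λ s → ∑ (strings L j) (λ c → ∑split c (G s)))
  strings-pick L zero    G = trans (strings-front L 0 _)
    (∑-ext L (λ s → +-congʳ (+-identityʳ _)))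
  strings-pick L (suc j) G = begin
    ∑ (strings L (suc (suc j))) (λ c → ∑pick c G)
      ≈⟨ strings-front L (suc j) _ ⟩
    ∑ L (λ s → ∑ (strings L (suc j)) (λ c → G s [] c + ∑pick c (λ t p q → G t (s ∷ p) q)))
      ≈⟨ ∑-ext L (λ s → trans (∑-+ (strings L (suc j)) _ _) (+-congˡ (strings-pick L j _))) ⟩
    ∑ L (λ s → ∑ (strings L (suc j)) (G s []) + ∑ L (λ t → ∑ (strings L j) (λ c → ∑split c (λ p q → G t (s ∷ p) q))))
      ≈⟨ ∑-+ L _ _ ⟩
    ∑ L (λ s → ∑ (strings L (suc j)) (G s [])) + ∑ L (λ s → ∑ L (λ t → ∑ (strings L j) (λ c → ∑split c (λ p q → G t (s ∷ p) q))))
      ≈⟨ +-cong (∑-ext L (λ s → strings-front L j _)) (∑-comm L L _) ⟩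
    ∑ L (λ s → ∑ L (λ t → ∑ (strings L j) (λ c → G s [] (t ∷ c)))) + ∑ L (λ t → ∑ L (λ s → ∑ (strings L j) (λ c → ∑split c (λ p q → G t (s ∷ p) q))))
      ≈⟨ ∑-+ L _ _ ⟨
    ∑ L (λ s → ∑ L (λ t → ∑ (strings L j) (λ c → G s [] (t ∷ c))) + ∑ L (λ t → ∑ (strings L j) (λ c → ∑split c (λ p q → G s (t ∷ p) q))))
      ≈⟨ ∑-ext L (λ s → trans (sym (∑-+ L _ _)) (∑-ext L (λ t → sym (∑-+ (strings L j) _ _)))) ⟩
    ∑ L (λ s → ∑ L (λ t → ∑ (strings L j) (λ c → ∑split (t ∷ c) (G s))))
      ≈⟨ ∑-ext L (λ s → sym (strings-front L j _)) ⟩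
    ∑ L (λ s → ∑ (strings L (suc j)) (λ c → ∑split c (G s))) ∎

  module _ {N : ℕ} where
    [unique] : List (Fin N) → Carrier
    [unique] c = [ unique? Finₚ._≟_ c ]

    [unique]-↭ : ∀ {c d} → c ↭ d → [unique] c ≈ [unique] d
    [unique]-↭ p = [⇔] (unique? Finₚ._≟_ _) (unique? Finₚ._≟_ _) (Unique-resp-↭ p) (Unique-resp-↭ (↭-sym p))

    [unique]-∷ : ∀ s c → [unique] (s ∷ c) ≈ [unique] c * [ ¬? (s ∈? c) ]
    [unique]-∷ s c = [×] (unique? Finₚ._≟_ (s ∷ c)) (unique? Finₚ._≟_ c) (¬? (s ∈? c))
      (λ { u@(_ ∷ u′) → u′ , ∉-head u }) (λ u s∉ → Unique-∷ s∉ u)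

    ∑-arrangements : ∀ j f → ∑ (arrangements j) f ≈ ∑ (strings (allFin N) j) (λ c → [unique] c * f c)
    ∑-arrangements j f = ∑-filter (unique? Finₚ._≟_) (strings (allFin N) j) f

    arrangements-swap : ∀ j f → ∑ (arrangements j) (λ c → f (swapHead c)) ≈ ∑ (arrangements j) f
    arrangements-swap j f = begin
      ∑ (arrangements j) (λ c → f (swapHead c))
        ≈⟨ ∑-arrangements j _ ⟩
      ∑ (strings (allFin N) j) (λ c → [unique] c * f (swapHead c))
        ≈⟨ ∑-ext (strings (allFin N) j) (λ c → *-congʳ ([unique]-↭ (head-↭ c))) ⟩
      ∑ (strings (allFin N) j) (λ c → [unique] (swapHead c) * f (swapHead c))
        ≈⟨ strings-swap (allFin N) j (λ c → [unique] c * f c) ⟩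
      ∑ (strings (allFin N) j) (λ c → [unique] c * f c)
        ≈⟨ ∑-arrangements j f ⟨
      ∑ (arrangements j) f ∎
      where
      head-↭ : ∀ c → c ↭ swapHead c
      head-↭ []          = ↭-refl
      head-↭ (_ ∷ [])    = ↭-refl
      head-↭ (s ∷ t ∷ c) = swap s t ↭-refl

-- Elementary symmetric functions of a list of variables

module ElementarySymmetric (Alg : RationalAlgebra) {S : Set} (x : S → RationalAlgebra.Carrier Alg) where
  open RationalAlgebra Alg
  open PickSums Alg
  open ≈-Reasoning
  open Solver using (solve; _:+_; _:*_; _:-_; _:=_; con; :-_)

  esym : ℕ → List S → Carrier
  esym zero    c       = 1#
  esym (suc i) []      = 0#
  esym (suc i) (s ∷ c) = esym (suc i) c + x s * esym i c

  esym-↭ : ∀ i {c d} → c ↭ d → esym i c ≈ esym i d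
  esym-↭ zero          _ = refl
  esym-↭ (suc i)       Perm.refl = refl
  esym-↭ (suc i)       (prep s p) = +-cong (esym-↭ (suc i) p) (*-congˡ (esym-↭ i p))
  esym-↭ (suc i)       (Perm.trans p q) = trans (esym-↭ (suc i) p) (esym-↭ (suc i) q)
  esym-↭ (suc zero)    (swap {c} {d} s t p) = trans
    (+-congʳ (+-congʳ (esym-↭ 1 p)))
    (solve 4 (λ c s t o → (c :+ t :* o) :+ s :* o := (c :+ s :* o) :+ t :* o) refl (esym 1 d) (x s) (x t) 1#)
  esym-↭ (suc (suc i)) (swap {c} {d} s t p) = trans
    (+-cong (+-cong (esym-↭ (suc (suc i)) p) (*-congˡ (esym-↭ (suc i) p)))
      (*-congˡ (+-cong (esym-↭ (suc i) p) (*-congˡ (esym-↭ i p)))))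
    (solve 5 (λ a b c s t → (a :+ t :* b) :+ s :* (b :+ t :* c) := (a :+ s :* b) :+ t :* (b :+ s :* c)) refl
      (esym (suc (suc i)) d) (esym (suc i) d) (esym i d) (x s) (x t))

  -- Each squarefree product of i + 1 variables arises once for each of its factors.
  pick-esym : ∀ i c → ∑pick c (λ s p q → x s * esym i (p ++ q)) ≈ ι (nat (suc i)) * esym (suc i) c
  pick-esym i       []      = sym (zeroʳ _)
  pick-esym zero    (s ∷ c) = trans (+-congˡ (pick-esym zero c)) (trans
    (+-congˡ (trans (*-congʳ ν1) (*-identityˡ _)))
    (trans (+-comm _ _) (sym (trans (*-congʳ ν1) (*-identityˡ _)))))
    where
    ν1 : ι (nat 1) ≈ 1#
    ν1 = trans (reflexive (cong ι (ℚₚ.+-identityʳ 1ℚ))) ι-1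
  pick-esym (suc i) (s ∷ c) = begin
    x s * esym (suc i) c + ∑pick c (λ t p q → x t * (esym (suc i) (p ++ q) + x s * esym i (p ++ q)))
      ≈⟨ +-congˡ (trans (pick-cong c (λ t p q _ → solve 4 (λ t e s f → t :* (e :+ s :* f) := t :* e :+ s :* (t :* f))
           refl (x t) (esym (suc i) (p ++ q)) (x s) (esym i (p ++ q)))) (trans (pick-+ c _ _)
           (+-cong (pick-esym (suc i) c) (trans (sym (pick-*ˡ c (x s) _)) (*-congˡ (pick-esym i c)))))) ⟩
    x s * esym (suc i) c + (ι (nat (suc (suc i))) * esym (suc (suc i)) c + x s * (ι (nat (suc i)) * esym (suc i) c))
      ≈⟨ +-congˡ (+-congʳ (*-congʳ (ι-+ 1ℚ (nat (suc i))))) ⟩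
    x s * esym (suc i) c + ((ι 1ℚ + ι (nat (suc i))) * esym (suc (suc i)) c + x s * (ι (nat (suc i)) * esym (suc i) c))
      ≈⟨ solve 4 (λ s e n f → s :* e :+ ((con 1ℚ :+ n) :* f :+ s :* (n :* e)) := (con 1ℚ :+ n) :* (f :+ s :* e)) refl
           (x s) (esym (suc i) c) (ι (nat (suc i))) (esym (suc (suc i)) c) ⟩
    (ι 1ℚ + ι (nat (suc i))) * (esym (suc (suc i)) c + x s * esym (suc i) c)
      ≈⟨ *-congʳ (ι-+ 1ℚ (nat (suc i))) ⟨
    ι (nat (suc (suc i))) * esym (suc (suc i)) (s ∷ c) ∎

  -- Σ e_i(c − s) = (|c| − i) e_i(c), with the subtracted term moved to the left.
  pick-esym-rest : ∀ i c →
    ∑pick c (λ s p q → esym i (p ++ q)) + ι (nat i) * esym i c ≈ ι (nat (length c)) * esym i c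
  pick-esym-rest zero    c = trans (+-congˡ (trans (*-congʳ ι-0) (zeroˡ _))) (trans (+-identityʳ _) (pick-const c 1#))
  pick-esym-rest (suc i) []      = trans (+-identityˡ _) (trans (zeroʳ _) (sym (zeroʳ _)))
  pick-esym-rest (suc i) (s ∷ c) = begin
    (e₁ + ∑pick c (λ t p q → esym (suc i) (p ++ q) + x s * esym i (p ++ q))) + ι (nat (suc i)) * (e₁ + x s * e₀)
      ≈⟨ +-cong (+-congˡ (trans (pick-+ c _ _) (+-congˡ (sym (pick-*ˡ c (x s) _))))) (*-congʳ (ι-+ 1ℚ (nat i))) ⟩
    (e₁ + (p₁ + x s * p₀)) + (ι 1ℚ + ι (nat i)) * (e₁ + x s * e₀)
      ≈⟨ solve 6 (λ e₁ p₁ s p₀ n e₀ → (e₁ :+ (p₁ :+ s :* p₀)) :+ (con 1ℚ :+ n) :* (e₁ :+ s :* e₀)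
           := e₁ :+ (p₁ :+ (con 1ℚ :+ n) :* e₁) :+ s :* (e₀ :+ (p₀ :+ n :* e₀))) refl e₁ p₁ (x s) p₀ (ι (nat i)) e₀ ⟩
    e₁ + (p₁ + (ι 1ℚ + ι (nat i)) * e₁) + x s * (e₀ + (p₀ + ι (nat i) * e₀))
      ≈⟨ +-cong (+-congˡ (trans (+-congˡ (*-congʳ (sym (ι-+ 1ℚ (nat i))))) (pick-esym-rest (suc i) c)))
           (*-congˡ (+-congˡ (pick-esym-rest i c))) ⟩
    e₁ + n * e₁ + x s * (e₀ + n * e₀)
      ≈⟨ solve 4 (λ e₁ n s e₀ → e₁ :+ n :* e₁ :+ s :* (e₀ :+ n :* e₀) := (con 1ℚ :+ n) :* (e₁ :+ s :* e₀)) refl e₁ n (x s) e₀ ⟩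
    (ι 1ℚ + n) * (e₁ + x s * e₀)
      ≈⟨ *-congʳ (ι-+ 1ℚ (nat (length c))) ⟨
    ι (nat (suc (length c))) * (e₁ + x s * e₀) ∎
    where
    e₁ = esym (suc i) c
    e₀ = esym i c
    p₁ = ∑pick c (λ t p q → esym (suc i) (p ++ q))
    p₀ = ∑pick c (λ t p q → esym i (p ++ q))
    n  = ι (nat (length c))

-- Exchange of the first two positions

module LabelSwaps (F : Field) (N : ℕ) (x : Fin N → Field.Carrier F)
  (x-distinct : ∀ {a b} → a ≢ b → ¬ (Field._≈_ F (x a) (x b))) where

  open Field F
  open FieldNumbers F
  open PickSums algebra
  open ColorFunctions F N x x-distinct
  open ≈-Reasoning
  open Solver using (solve; _:+_; _:*_; _:-_; _:=_; con; :-_)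

  private
    ≢-heads : ∀ {a b} {q : List (Fin N)} → Unique (a ∷ b ∷ q) → a ≢ b
    ≢-heads ((a≢b ∷ _) ∷ _) = a≢b

    ν-2 : ν 2 ≈ 1# + 1#
    ν-2 = trans (ν-suc 1) (+-congˡ ν-1)

  -- With w the exchange of the first two colors, this and the next two lemmas are the relations of
  -- the degenerate affine Hecke algebra: Θ₁ w = w Θ₂ - 1, Θ₂ w = w Θ₁ + 1, and Θ_r w = w Θ_r for r
  -- > 2. The constants ±1 come from the 1 in `gap-eq`.
  Θ-swap₀ : ∀ f a b q → Unique (a ∷ b ∷ q) →
    Θ (f ∘ swapHead) [] a (b ∷ q) ≈ Θ f (b ∷ []) a q - f (a ∷ b ∷ q)
  Θ-swap₀ f a b q u = begin
    ν 1 * u′ + (((x b * gap a b) * (u′ - v) + S) + 0#)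
      ≈⟨ +-cong (*-congʳ ν-1) (+-congʳ (+-congʳ (*-congʳ (gap-eq (≢-heads u))))) ⟩
    1# * u′ + (((1# + x a * gap a b) * (u′ - v) + S) + 0#)
      ≈⟨ solve 6 (λ o z y u v s → o :* u :+ (((o :+ y) :* (u :- v) :+ s) :+ z)
           := ((o :+ o) :* u :+ (s :+ (y :* (u :- v) :+ z))) :- o :* v) refl 1# 0# (x a * gap a b) u′ v S ⟩
    ((1# + 1#) * u′ + (S + ((x a * gap a b) * (u′ - v) + 0#))) - 1# * v
      ≈⟨ +-cong (+-congʳ (*-congʳ (sym ν-2))) (-‿cong (*-identityˡ v)) ⟩
    Θ f (b ∷ []) a q - f (a ∷ b ∷ q) ∎
    where
    u′ = f (b ∷ a ∷ q)
    v  = f (a ∷ b ∷ q)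
    S  = ∑pick q (λ e q₁ q₂ → (x e * gap a e) * (u′ - f (b ∷ e ∷ q₁ ++ a ∷ q₂)))

  Θ-swap₁ : ∀ f a b q → Unique (a ∷ b ∷ q) →
    Θ (f ∘ swapHead) (b ∷ []) a q ≈ Θ f [] a (b ∷ q) + f (b ∷ a ∷ q)
  Θ-swap₁ f a b q u = begin
    ν 2 * u′ + (S + ((x a * gap a b) * (u′ - v) + 0#))
      ≈⟨ +-congʳ (*-congʳ ν-2) ⟩
    (1# + 1#) * u′ + (S + ((x a * gap a b) * (u′ - v) + 0#))
      ≈⟨ solve 6 (λ o z y u v s → (o :+ o) :* u :+ (s :+ (y :* (u :- v) :+ z))
           := (o :* u :+ (((o :+ y) :* (u :- v) :+ s) :+ z)) :+ o :* v) refl 1# 0# (x a * gap a b) u′ v S ⟩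
    (1# * u′ + (((1# + x a * gap a b) * (u′ - v) + S) + 0#)) + 1# * v
      ≈⟨ +-cong (+-cong (*-congʳ (sym ν-1)) (+-congʳ (+-congʳ (*-congʳ (sym (gap-eq (≢-heads u))))))) (*-identityˡ v) ⟩
    Θ f [] a (b ∷ q) + f (b ∷ a ∷ q) ∎
    where
    u′ = f (a ∷ b ∷ q)
    v  = f (b ∷ a ∷ q)
    S  = ∑pick q (λ e q₁ q₂ → (x e * gap a e) * (u′ - f (e ∷ b ∷ q₁ ++ a ∷ q₂)))

  Θ-swap₂ : ∀ f b₁ b₂ p a q →
    Θ (f ∘ swapHead) (b₁ ∷ b₂ ∷ p) a q ≈ Θ f (b₂ ∷ b₁ ∷ p) a q
  Θ-swap₂ f b₁ b₂ p a q = +-congˡ (+-congˡ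
    (solve 3 (λ a b c → a :+ (b :+ c) := b :+ (a :+ c)) refl _ _ _))

  -- With w the exchange of colors and δ = t - s, one has Θ₁ (δ w f - f) = δ (t w f - f) - s f = t
  -- (δ w f - f), and likewise for the second position. The choice of δ is what absorbs the
  -- constants ±1.
  Eig-swap : ∀ {s t τ f} → Eig (s ∷ t ∷ τ) f →
    Eig (t ∷ s ∷ τ) (λ c → (ν (value t) - ν (value s)) * f (swapHead c) + - f c)
  Eig-swap {s} {t} {τ} {f} ef = go
    where
    δ = ν (value t) - ν (value s)
    h : Fun
    h c = δ * f (swapHead c) + - f c
    Θ-h : ∀ p a q → Θ h p a q ≈ δ * Θ (f ∘ swapHead) p a q - Θ f p a q
    Θ-h p a q = trans (Θ-linear δ (f ∘ swapHead) (λ c → - f c) p a q) (+-congˡ (begin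
      Θ (λ c → - f c) p a q              ≈⟨ solve 2 (λ m t → m := :- t :+ (m :+ t)) refl (Θ (λ c → - f c) p a q) (Θ f p a q) ⟩
      - Θ f p a q + (Θ (λ c → - f c) p a q + Θ f p a q)
        ≈⟨ +-congˡ (trans (+-comm _ _) (trans (+-congʳ (sym (*-identityˡ _))) (sym (Θ-linear 1# f (λ c → - f c) p a q)))) ⟩
      - Θ f p a q + Θ (λ c → 1# * f c + - f c) p a q
        ≈⟨ +-congˡ (trans (zero-fun p a q) refl) ⟩
      - Θ f p a q + 0#                   ≈⟨ +-identityʳ _ ⟩
      - Θ f p a q                        ∎))
      where
      z : ∀ c → 1# * f c + - f c ≈ 0#
      z c = trans (+-congʳ (*-identityˡ _)) (-‿inverseʳ _)
      zero-fun : ∀ p a q → Θ (λ c → 1# * f c + - f c) p a q ≈ 0#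
      zero-fun p a q = trans (+-cong (trans (*-congˡ (z _)) (zeroʳ _)) (trans (+-cong
        (pick-zero q (λ b q₁ q₂ _ → trans (*-congˡ (trans (+-cong (z _) (-‿cong (z _))) (-‿inverseʳ 0#))) (zeroʳ _)))
        (pick-zero p (λ b p₁ p₂ _ → trans (*-congˡ (trans (+-cong (z _) (-‿cong (z _))) (-‿inverseʳ 0#))) (zeroʳ _))))
        (+-identityʳ 0#))) (+-identityʳ 0#)
    go : Eig (t ∷ s ∷ τ) h
    go [] .t .(s ∷ τ) [] a (b ∷ q) ≡.refl _ l₂ full = begin
      Θ h [] a (b ∷ q)
        ≈⟨ Θ-h [] a (b ∷ q) ⟩
      δ * Θ (f ∘ swapHead) [] a (b ∷ q) - Θ f [] a (b ∷ q)
        ≈⟨ +-cong (*-congˡ (trans (Θ-swap₀ f a b q (full-unique full))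
             (+-congʳ (ef (s ∷ []) t τ (b ∷ []) a q ≡.refl ≡.refl (ℕₚ.suc-injective l₂) (↭-trans (swap b a ↭-refl) full)))))
             (-‿cong (ef [] s (t ∷ τ) [] a (b ∷ q) ≡.refl ≡.refl l₂ full)) ⟩
      δ * (ν (value t) * u - v) - ν (value s) * v
        ≈⟨ solve 4 (λ s t u v → (t :- s) :* (t :* u :- v) :- s :* v := t :* ((t :- s) :* u :+ :- v)) refl
             (ν (value s)) (ν (value t)) u v ⟩
      ν (value t) * h (a ∷ b ∷ q) ∎
      where
      u = f (b ∷ a ∷ q)
      v = f (a ∷ b ∷ q)
    go (.t ∷ []) .s .τ (b ∷ []) a q ≡.refl _ l₂ full = begin
      Θ h (b ∷ []) a q
        ≈⟨ Θ-h (b ∷ []) a q ⟩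
      δ * Θ (f ∘ swapHead) (b ∷ []) a q - Θ f (b ∷ []) a q
        ≈⟨ +-cong (*-congˡ (trans (Θ-swap₁ f a b q (full-unique full′))
             (+-congʳ (ef [] s (t ∷ τ) [] a (b ∷ q) ≡.refl ≡.refl (cong suc l₂) full′))))
             (-‿cong (ef (s ∷ []) t τ (b ∷ []) a q ≡.refl ≡.refl l₂ full)) ⟩
      δ * (ν (value s) * u + v) - ν (value t) * v
        ≈⟨ solve 4 (λ s t u v → (t :- s) :* (s :* u :+ v) :- t :* v := s :* ((t :- s) :* u :+ :- v)) refl
             (ν (value s)) (ν (value t)) u v ⟩
      ν (value s) * h (b ∷ a ∷ q) ∎
      where
      u = f (a ∷ b ∷ q)
      v = f (b ∷ a ∷ q)
      full′ : Full (a ∷ b ∷ q)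
      full′ = ↭-trans (swap a b ↭-refl) full
    go (.t ∷ .s ∷ p′) r q′ (b₁ ∷ b₂ ∷ p) a q ≡.refl l₁ l₂ full = begin
      Θ h (b₁ ∷ b₂ ∷ p) a q
        ≈⟨ Θ-h (b₁ ∷ b₂ ∷ p) a q ⟩
      δ * Θ (f ∘ swapHead) (b₁ ∷ b₂ ∷ p) a q - Θ f (b₁ ∷ b₂ ∷ p) a q
        ≈⟨ +-cong (*-congˡ (trans (Θ-swap₂ f b₁ b₂ p a q)
             (ef (s ∷ t ∷ p′) r q′ (b₂ ∷ b₁ ∷ p) a q ≡.refl l₁ l₂ (↭-trans (swap b₂ b₁ ↭-refl) full))))
             (-‿cong (ef (s ∷ t ∷ p′) r q′ (b₁ ∷ b₂ ∷ p) a q ≡.refl l₁ l₂ full)) ⟩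
      δ * (ν (value r) * u) - ν (value r) * v
        ≈⟨ solve 4 (λ d n u v → d :* (n :* u) :- n :* v := n :* (d :* u :+ :- v)) refl δ (ν (value r)) u v ⟩
      ν (value r) * h (b₁ ∷ b₂ ∷ p ++ a ∷ q) ∎
      where
      u = f (b₂ ∷ b₁ ∷ p ++ a ∷ q)
      v = f (b₁ ∷ b₂ ∷ p ++ a ∷ q)

-- How rotation changes the sum of an eigenfunction

module RotationMass (F : Field) (N : ℕ) (x : Fin N → Field.Carrier F)
  (x-distinct : ∀ {a b} → a ≢ b → ¬ (Field._≈_ F (x a) (x b)))
  (esym-nonzero : ∀ i → i ≤ N →
    ¬ (Field._≈_ F (ElementarySymmetric.esym (Field.algebra F) x i (allFin N)) (Field.0# F))) where

  open Field F
  open Sums algebra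
  open LinearAlgebra F
  open FieldNumbers F
  open PickSums algebra
  open StringSums algebra
  open ElementarySymmetric algebra x
  open ColorFunctions F N x x-distinct
  open ≈-Reasoning
  open Solver using (solve; _:+_; _:*_; _:-_; _:=_; con; :-_)

  private
    all = allFin N

  weight : Fin N → Fin N → Carrier
  weight a b = x b * gap a b

  -- The default of `recip` gives `gap a a` the value 0. Hence sums over b may include a itself.
  weight-self : ∀ a → weight a a ≈ 0#
  weight-self a with (x a - x a) ≟0
  ... | yes _ = zeroʳ _
  ... | no nz = contradiction (-‿inverseʳ (x a)) nz

  others : Fin N → List (Fin N)
  others a = proj₁ (extract (∈ₚ.∈-allFin a))

  others-↭ : ∀ a → all ↭ a ∷ others a
  others-↭ a = proj₂ (extract (∈ₚ.∈-allFin a))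

  others-unique : ∀ a → Unique (a ∷ others a)
  others-unique a = Unique-resp-↭ (others-↭ a) (Uniqueₚ.allFin⁺ N)

  others-full : ∀ {a t} → Full (a ∷ t) → others a ↭ t
  others-full {a} full = ↭ₚ.drop-∷ (↭-trans (↭-sym (others-↭ a)) (↭-sym full))

  E : ℕ → Fin N → Carrier
  E i a = esym i (others a)

  -- What Θ at the first position induces on the sums of a function over all arrangements with given
  -- head.
  Θ₁ : (Fin N → Carrier) → Fin N → Carrier
  Θ₁ β a = β a + ∑ all (λ b → weight a b * (β a - β b))

  ∑-others : ∀ a (h : Fin N → Carrier) → ∑ all (λ b → weight a b * h b) ≈ ∑ (others a) (λ b → weight a b * h b)
  ∑-others a h = trans (∑-↭ _ (others-↭ a))
    (trans (+-congʳ (trans (*-congʳ (weight-self a)) (zeroˡ _))) (+-identityˡ _))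

  -- Leaving out x_a or x_b from e_i gives values that differ by (x_b - x_a) e_{i-1} of the
  -- remaining variables, and the weight turns this into x_b e_{i-1}. By `pick-esym` the sum over b
  -- is i times `E i a`.
  E-eigen : ∀ i a → Θ₁ (E i) a ≈ ν (suc i) * E i a
  E-eigen i a = begin
    E i a + ∑ all (λ b → weight a b * (E i a - E i b))
      ≈⟨ +-congˡ (trans (∑-others a (λ b → E i a - E i b)) (sym (pick-∑ (others a) _))) ⟩
    E i a + ∑pick (others a) (λ b _ _ → weight a b * (E i a - E i b))
      ≈⟨ +-congˡ (differences i) ⟩
    E i a + ν i * E i a
      ≈⟨ +-congʳ (sym (*-identityˡ _)) ⟩
    1# * E i a + ν i * E i a
      ≈⟨ distribʳ _ _ _ ⟨
    (1# + ν i) * E i a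
      ≈⟨ *-congʳ (ν-suc i) ⟨
    ν (suc i) * E i a ∎
    where
    others-swap : ∀ b p q → others a ≡ p ++ b ∷ q → others b ↭ a ∷ p ++ q
    others-swap b p q e = others-full (↭-trans (swap b a ↭-refl)
      (↭-trans (prep a (↭-trans (↭-sym (↭ₚ.shift b p q)) (Perm.↭-reflexive (≡.sym e)))) (↭-sym (others-↭ a))))
    differences : ∀ i → ∑pick (others a) (λ b _ _ → weight a b * (E i a - E i b)) ≈ ν i * E i a
    differences zero    = trans (pick-zero (others a) (λ _ _ _ _ → trans (*-congˡ (-‿inverseʳ 1#)) (zeroʳ _)))
      (sym (trans (*-congʳ ν-0) (zeroˡ _)))
    differences (suc i) = trans (pick-cong (others a) (λ b p q e → begin
      weight a b * (esym (suc i) (others a) - esym (suc i) (others b))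
        ≈⟨ *-congˡ (+-cong (trans (reflexive (cong (esym (suc i)) e)) (esym-↭ (suc i) (↭ₚ.shift b p q)))
             (-‿cong (esym-↭ (suc i) (others-swap b p q e)))) ⟩
      weight a b * ((esym (suc i) (p ++ q) + x b * esym i (p ++ q)) - (esym (suc i) (p ++ q) + x a * esym i (p ++ q)))
        ≈⟨ solve 5 (λ b g f e a → (b :* g) :* ((f :+ b :* e) :- (f :+ a :* e)) := ((b :* g) :- (a :* g)) :* (b :* e))
             refl (x b) (gap a b) (esym (suc i) (p ++ q)) (esym i (p ++ q)) (x a) ⟩
      (x b * gap a b - x a * gap a b) * (x b * esym i (p ++ q))
        ≈⟨ *-congʳ (trans (+-congʳ (gap-eq (distinct b p q e))) (trans (+-assoc _ _ _)
             (trans (+-congˡ (-‿inverseʳ _)) (+-identityʳ 1#)))) ⟩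
      1# * (x b * esym i (p ++ q))
        ≈⟨ *-identityˡ _ ⟩
      x b * esym i (p ++ q) ∎)) (pick-esym i (others a))
      where
      distinct : ∀ b p q → others a ≡ p ++ b ∷ q → a ≢ b
      distinct b p q e ≡.refl = ∉-head (others-unique a) (subst (a ∈_) (≡.sym e) (∈ₚ.∈-insert p))

  pick-others : ∀ i (h : Fin N → Carrier) → ∑ all (λ a → h a * E i a) ≈ ∑pick all (λ a p q → h a * esym i (p ++ q))
  pick-others i h = trans (sym (pick-∑ all _)) (pick-cong all (λ a p q e → *-congˡ
    (esym-↭ i (others-full (↭-trans (↭-sym (↭ₚ.shift a p q)) (Perm.↭-reflexive (≡.sym e)))))))

  ∑-xE : ∀ i → ∑ all (λ a → x a * E i a) ≈ ν (suc i) * esym (suc i) all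
  ∑-xE i = trans (pick-others i x) (pick-esym i all)

  ∑-E : ∀ i → ∑ all (E i) + ν i * esym i all ≈ ν N * esym i all
  ∑-E i = trans (+-congʳ (trans (∑-ext all (λ a → sym (*-identityˡ _)))
      (trans (pick-others i (λ _ → 1#)) (pick-cong all (λ _ _ _ _ → *-identityˡ _)))))
    (trans (pick-esym-rest i all) (*-congʳ (reflexive (cong ν (Listₚ.length-tabulate {n = N} id)))))

  -- Otherwise (i + 1) e_{i+1} = Σ x_a `E i a` would vanish.
  E-nonzero : ∀ i → i < N → ∃ λ a → a ∈ all × ¬ (E i a ≈ 0#)
  E-nonzero i i<N with any? (λ a → ¬? (E i a ≟0)) all
  ... | yes some = find some
  ... | no none  = contradiction (begin
      ν (suc i) * esym (suc i) all   ≈⟨ ∑-xE i ⟨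
      ∑ all (λ a → x a * E i a)      ≈⟨ ∑-zero all (λ a a∈ → trans (*-congˡ (vanish a a∈)) (zeroʳ _)) ⟩
      0#                             ∎) (≉0-* (ν-suc≉0 i) (esym-nonzero (suc i) i<N))
    where
    vanish : ∀ a → a ∈ all → E i a ≈ 0#
    vanish a a∈ with E i a ≟0
    ... | yes e = e
    ... | no ne = contradiction (lose a∈ ne) none

  private
    open import Data.Unit using (⊤; tt)

    Θ₁-cong : (r : ⊤) → ∀ β γ → (∀ a → a ∈ all → β a ≈ γ a) → ∀ a → a ∈ all → Θ₁ β a ≈ Θ₁ γ a
    Θ₁-cong _ β γ h a a∈ = +-cong (h a a∈)
      (∑-cong all (λ b b∈ → *-congˡ (+-cong (h a a∈) (-‿cong (h b b∈)))))

    Θ₁-linear : (r : ⊤) → ∀ k β γ a → a ∈ all → Θ₁ (λ b → k * β b + γ b) a ≈ k * Θ₁ β a + Θ₁ γ a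
    Θ₁-linear _ k β γ a _ = begin
      (k * β a + γ a) + ∑ all (λ b → weight a b * ((k * β a + γ a) - (k * β b + γ b)))
        ≈⟨ +-congˡ (trans (∑-ext all (λ b → solve 6 (λ w k β γ β′ γ′ →
             w :* ((k :* β :+ γ) :- (k :* β′ :+ γ′)) := k :* (w :* (β :- β′)) :+ w :* (γ :- γ′)) refl
             (weight a b) k (β a) (γ a) (β b) (γ b)))
           (trans (∑-+ all _ _) (+-congʳ (sym (∑-*ˡ all k _))))) ⟩
      (k * β a + γ a) + (k * s₁ + s₂)
        ≈⟨ solve 5 (λ k β γ s t → (k :* β :+ γ) :+ (k :* s :+ t) := k :* (β :+ s) :+ (γ :+ t)) refl k (β a) (γ a) s₁ s₂ ⟩
      k * Θ₁ β a + Θ₁ γ a ∎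
      where
      s₁ = ∑ all (λ b → weight a b * (β a - β b))
      s₂ = ∑ all (λ b → weight a b * (γ a - γ b))

    value-injective : ∀ {s t : Fin N} → value s ≡ value t → s ≡ t
    value-injective e = Finₚ.toℕ-injective (ℕₚ.suc-injective e)

    module B = Eigenbasis F Finₚ._≟_ (Uniqueₚ.allFin⁺ N) (λ _ → Θ₁) Θ₁-cong Θ₁-linear (λ s _ → ν (value s))
      (λ _ _ s≢t → tt , λ e → s≢t (value-injective (ν-injective e)))

  -- The N eigenvalues 1, ..., N on functions of one color are distinct, so every eigenspace is a
  -- line.
  Θ₁-eigen-unique : ∀ s β → (∀ a → Θ₁ β a ≈ ν (value s) * β a) → ∃ λ k → ∀ a → β a ≈ k * E (toℕ s) a
  Θ₁-eigen-unique s β eig = result (B.eigenvector-unique (λ s → E (toℕ s))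
      (λ s _ _ a _ → E-eigen (toℕ s) a) (λ s _ → E-nonzero (toℕ s) (Finₚ.toℕ<n s))
      (∈ₚ.∈-allFin s) (λ _ a _ → eig a))
    where
    result : (∃ λ k → ∀ a → a ∈ all → β a ≈ k * E (toℕ s) a) → ∃ λ k → ∀ a → β a ≈ k * E (toℕ s) a
    result (k , h) = k , λ a → h a (∈ₚ.∈-allFin a)

  mass : Fun → Carrier
  mass f = ∑ (arrangements N) f

  module _ (m : ℕ) (N≡ : suc m ≡ N) (f : Fun) where
    headMass : Fin N → Carrier
    headMass a = ∑ (strings all m) (λ t → [unique] (a ∷ t) * f (a ∷ t))

    mass-heads : mass f ≈ ∑ all headMass
    mass-heads = begin
      mass f
        ≡⟨ cong (λ j → ∑ (arrangements j) f) (≡.sym N≡) ⟩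
      ∑ (arrangements (suc m)) f
        ≈⟨ ∑-arrangements (suc m) f ⟩
      ∑ (strings all (suc m)) (λ c → [unique] c * f c)
        ≈⟨ strings-front all m _ ⟩
      ∑ all headMass ∎

    mass-rotate-heads : mass (rotate f) ≈ ∑ all (λ a → x a * headMass a)
    mass-rotate-heads = begin
      mass (rotate f)
        ≡⟨ cong (λ j → ∑ (arrangements j) (rotate f)) (≡.sym N≡) ⟩
      ∑ (arrangements (suc m)) (rotate f)
        ≈⟨ ∑-arrangements (suc m) (rotate f) ⟩
      ∑ (strings all (suc m)) (λ c → [unique] c * rotate f c)
        ≈⟨ strings-back all m _ ⟩
      ∑ (strings all m) (λ t → ∑ all (λ a → [unique] (t ++ a ∷ []) * rotate f (t ++ a ∷ [])))
        ≈⟨ ∑-comm (strings all m) all _ ⟩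
      ∑ all (λ a → ∑ (strings all m) (λ t → [unique] (t ++ a ∷ []) * rotate f (t ++ a ∷ [])))
        ≈⟨ ∑-ext all (λ a → trans (∑-ext (strings all m) (λ t → trans
             (*-cong ([unique]-↭ (snoc-↭ t a)) (rotate-≡ f t a ≡.refl))
             (solve 3 (λ u x f → u :* (x :* f) := x :* (u :* f)) refl ([unique] (a ∷ t)) (x a) (f (a ∷ t)))))
             (sym (∑-*ˡ (strings all m) (x a) _))) ⟩
      ∑ all (λ a → x a * headMass a) ∎

    private
      full-head : ∀ {a t} → t ∈ strings all m → Unique (a ∷ t) → Full (a ∷ t)
      full-head t∈ u = unique-full u (≡.trans (cong suc (∈-strings⁻ m t∈)) N≡)

    weight-sum : ∀ a t → t ∈ strings all m → Unique (a ∷ t) →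
      ∑pick t (λ b _ _ → weight a b * f (a ∷ t)) ≈ ∑ all (λ b → weight a b * f (a ∷ t))
    weight-sum a t t∈ u = trans (pick-∑ t _) (trans (sym (∑-↭ _ (others-full (full-head t∈ u)))) (sym (∑-others a _)))

    locate : ∀ a b t → t ∈ strings all m → Unique (b ∷ t) → b ≢ a →
      ∑pick t (λ e _ _ → [ e Finₚ.≟ a ]) ≈ 1#
    locate a b t t∈ u b≢a = trans (pick-∑ t _) (trans (∑-ext t (λ e → sym (*-identityʳ _)))
      (∑-δ Finₚ._≟_ (λ _ → 1#) (tail u) (a∈ (full-∈ a (full-head t∈ u)))))
      where
      tail : ∀ {c d} → Unique (c ∷ d) → Unique {A = Fin N} d
      tail (_ ∷ u) = u
      a∈ : a ∈ b ∷ t → a ∈ t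
      a∈ (here e)   = contradiction (≡.sym e) b≢a
      a∈ (there a∈) = a∈

    -- Exchanging the head a with a later b gives an arrangement with head b, and the place of a in
    -- it is then determined; so for each b every arrangement with head b occurs once. The term b =
    -- a is harmless because its weight is 0.
    exchange-sum : ∀ a →
      ∑ (strings all m) (λ t → [unique] (a ∷ t) * ∑pick t (λ b p q → weight a b * f (b ∷ p ++ a ∷ q)))
      ≈ ∑ all (λ b → weight a b * headMass b)
    exchange-sum a = begin
      ∑ (strings all m) (λ t → [unique] (a ∷ t) * ∑pick t (λ b p q → weight a b * f (b ∷ p ++ a ∷ q)))
        ≈⟨ ∑-ext (strings all m) (λ t → trans (pick-*ˡ t _ _) (pick-cong t (λ b p q e → trans
             (*-congʳ ([unique]-↭ (↭-trans (Perm.↭-reflexive (cong (a ∷_) e)) (exchange-↭ a b p q))))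
             (solve 3 (λ u w f → u :* (w :* f) := w :* (u :* f)) refl _ _ _)))) ⟩
      ∑ (strings all m) (λ t → ∑pick t (λ b p q → weight a b * G b p q))
        ≈⟨ regroup m ⟩
      ∑ all (λ b → weight a b * ∑ (strings all m) (λ t → ∑pick t (λ e p q → [ e Finₚ.≟ a ] * G b p q)))
        ≈⟨ ∑-ext all per-head ⟩
      ∑ all (λ b → weight a b * headMass b) ∎
      where
      G : Fin N → List (Fin N) → List (Fin N) → Carrier
      G b p q = [unique] (b ∷ p ++ a ∷ q) * f (b ∷ p ++ a ∷ q)
      -- The string with b chosen becomes b and a string with a cut. Placing a at the cut is
      -- rewritten as choosing an entry e under the bracket e = a, which makes the tail an ordinary
      -- string again.
      regroup : ∀ j → ∑ (strings all j) (λ t → ∑pick t (λ b p q → weight a b * G b p q))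
        ≈ ∑ all (λ b → weight a b * ∑ (strings all j) (λ t → ∑pick t (λ e p q → [ e Finₚ.≟ a ] * G b p q)))
      regroup zero    = trans (+-identityʳ _) (sym (∑-zero all (λ b _ → trans (*-congˡ (+-identityʳ _)) (zeroʳ _))))
      regroup (suc j) = trans (strings-pick all j _) (∑-ext all (λ b → begin
        ∑ (strings all j) (λ c → ∑split c (λ p q → weight a b * G b p q))
          ≈⟨ trans (∑-ext (strings all j) (λ c → sym (split-*ˡ c (weight a b) _))) (sym (∑-*ˡ (strings all j) _ _)) ⟩
        weight a b * ∑ (strings all j) (λ c → ∑split c (G b))
          ≈⟨ *-congˡ (sym (∑-δ Finₚ._≟_ (λ _ → ∑ (strings all j) (λ c → ∑split c (G b))) (Uniqueₚ.allFin⁺ N) (∈ₚ.∈-allFin a))) ⟩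
        weight a b * ∑ all (λ e → [ e Finₚ.≟ a ] * ∑ (strings all j) (λ c → ∑split c (G b)))
          ≈⟨ *-congˡ (∑-ext all (λ e → trans (∑-*ˡ (strings all j) _ _) (∑-ext (strings all j) (λ c → split-*ˡ c _ _)))) ⟩
        weight a b * ∑ all (λ e → ∑ (strings all j) (λ c → ∑split c (λ p q → [ e Finₚ.≟ a ] * G b p q)))
          ≈⟨ *-congˡ (sym (strings-pick all j (λ e p q → [ e Finₚ.≟ a ] * G b p q))) ⟩
        weight a b * ∑ (strings all (suc j)) (λ t → ∑pick t (λ e p q → [ e Finₚ.≟ a ] * G b p q)) ∎))
      per-head : ∀ b → weight a b * ∑ (strings all m) (λ t → ∑pick t (λ e p q → [ e Finₚ.≟ a ] * G b p q))
        ≈ weight a b * headMass b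
      per-head b with b Finₚ.≟ a
      ... | yes ≡.refl = trans (trans (*-congʳ (weight-self a)) (zeroˡ _)) (sym (trans (*-congʳ (weight-self a)) (zeroˡ _)))
      ... | no b≢a = *-congˡ (∑-cong (strings all m) (λ t t∈ → begin
        ∑pick t (λ e p q → [ e Finₚ.≟ a ] * G b p q)
          ≈⟨ pick-cong t (λ { e p q ≡.refl → trans (replace e p q) (*-comm _ _) }) ⟩
        ∑pick t (λ e p q → ([unique] (b ∷ t) * f (b ∷ t)) * [ e Finₚ.≟ a ])
          ≈⟨ pick-*ˡ t _ _ ⟨
        ([unique] (b ∷ t) * f (b ∷ t)) * ∑pick t (λ e _ _ → [ e Finₚ.≟ a ])
          ≈⟨ *-assoc _ _ _ ⟩
        [unique] (b ∷ t) * (f (b ∷ t) * ∑pick t (λ e _ _ → [ e Finₚ.≟ a ]))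
          ≈⟨ [assume] (unique? Finₚ._≟_ (b ∷ t)) (λ u → trans (*-congˡ (locate a b t t∈ u b≢a)) (*-identityʳ _)) ⟩
        [unique] (b ∷ t) * f (b ∷ t) ∎))
        where
        replace : ∀ e p q → [ e Finₚ.≟ a ] * G b p q ≈ [ e Finₚ.≟ a ] * ([unique] (b ∷ p ++ e ∷ q) * f (b ∷ p ++ e ∷ q))
        replace e p q with e Finₚ.≟ a
        ... | yes ≡.refl = refl
        ... | no _       = trans (zeroˡ _) (sym (zeroˡ _))

    -- The eigenvalue equation at the first position, summed over all tails; `exchange-sum`
    -- evaluates the exchanged terms.
    headMass-eigen : ∀ {s τ} → Full (s ∷ τ) → Eig (s ∷ τ) f → ∀ a → Θ₁ headMass a ≈ ν (value s) * headMass a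
    headMass-eigen {s} {τ} σ-full ef a = sym (begin
      ν (value s) * headMass a
        ≈⟨ ∑-*ˡ (strings all m) _ _ ⟩
      ∑ (strings all m) (λ t → ν (value s) * ([unique] (a ∷ t) * f (a ∷ t)))
        ≈⟨ ∑-cong (strings all m) (λ t t∈ → trans
             (solve 3 (λ n u f → n :* (u :* f) := u :* (n :* f)) refl (ν (value s)) ([unique] (a ∷ t)) (f (a ∷ t)))
             (trans ([assume] (unique? Finₚ._≟_ (a ∷ t)) (λ u → trans (sym (ef [] s τ [] a t ≡.refl ≡.refl
                (ℕₚ.suc-injective (≡.trans (full-length (full-head t∈ u)) (≡.sym (full-length σ-full)))) (full-head t∈ u)))
                (begin
                  ν 1 * f (a ∷ t) + (∑pick t (λ b q₁ q₂ → weight a b * (f (a ∷ t) - f (b ∷ q₁ ++ a ∷ q₂))) + 0#)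
                    ≈⟨ +-cong (trans (*-congʳ ν-1) (*-identityˡ _)) (trans (+-identityʳ _)
                         (trans (pick-cong t (λ b q₁ q₂ _ → solve 3 (λ w f g → w :* (f :- g) := w :* f :+ con (ℚ.- 1ℚ) :* (w :* g)) refl
                            (weight a b) (f (a ∷ t)) (f (b ∷ q₁ ++ a ∷ q₂)))) (trans (pick-+ t _ _)
                            (+-cong (weight-sum a t t∈ u) (sym (pick-*ˡ t _ _)))))) ⟩
                  f (a ∷ t) + (∑ all (λ b → weight a b * f (a ∷ t)) + ι (ℚ.- 1ℚ) * ∑pick t (λ b q₁ q₂ → weight a b * f (b ∷ q₁ ++ a ∷ q₂)))
                    ≈⟨ +-congˡ (+-congʳ (trans (sym (∑-*ʳ all (f (a ∷ t)) (weight a))) (*-comm _ _))) ⟩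
                  f (a ∷ t) + (f (a ∷ t) * W + ι (ℚ.- 1ℚ) * ∑pick t (λ b q₁ q₂ → weight a b * f (b ∷ q₁ ++ a ∷ q₂))) ∎)))
             (solve 5 (λ u f w i p → u :* (f :+ (f :* w :+ i :* p)) := u :* f :+ (w :* (u :* f) :+ i :* (u :* p))) refl
                ([unique] (a ∷ t)) (f (a ∷ t)) W (ι (ℚ.- 1ℚ)) (∑pick t (λ b q₁ q₂ → weight a b * f (b ∷ q₁ ++ a ∷ q₂)))))) ⟩
      ∑ (strings all m) (λ t → [unique] (a ∷ t) * f (a ∷ t) + (W * ([unique] (a ∷ t) * f (a ∷ t))
          + ι (ℚ.- 1ℚ) * ([unique] (a ∷ t) * ∑pick t (λ b q₁ q₂ → weight a b * f (b ∷ q₁ ++ a ∷ q₂)))))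
        ≈⟨ trans (∑-+ (strings all m) _ _) (+-congˡ (trans (∑-+ (strings all m) _ _)
             (+-cong (sym (∑-*ˡ (strings all m) W _)) (trans (sym (∑-*ˡ (strings all m) (ι (ℚ.- 1ℚ)) _)) (*-congˡ (exchange-sum a)))))) ⟩
      headMass a + (W * headMass a + ι (ℚ.- 1ℚ) * ∑ all (λ b → weight a b * headMass b))
        ≈⟨ +-congˡ (trans (+-cong (∑-*ʳ all (headMass a) (weight a)) (∑-*ˡ all _ _)) (trans (sym (∑-+ all _ _))
             (∑-ext all (λ b → solve 3 (λ w f g → w :* f :+ con (ℚ.- 1ℚ) :* (w :* g) := w :* (f :- g)) refl
               (weight a b) (headMass a) (headMass b))))) ⟩
      Θ₁ headMass a ∎)
      where W = ∑ all (weight a)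

    -- The sums over arrangements with given head are k times `E (toℕ s)`. Hence the sum of f is k Σ
    -- E and that of its rotation is k Σ x_a E; both are known multiples of elementary symmetric
    -- functions. The quotient is stated crosswise to avoid division.
    mass-rotate : ∀ {s τ} → Full (s ∷ τ) → Eig (s ∷ τ) f →
      mass f * (ν (value s) * esym (value s) all) ≈ mass (rotate f) * ((ν N - ν (toℕ s)) * esym (toℕ s) all)
    mass-rotate {s} σ-full ef = combine (Θ₁-eigen-unique s headMass (headMass-eigen σ-full ef))
      where
      i = toℕ s
      combine : (∃ λ k → ∀ a → headMass a ≈ k * E i a) →
        mass f * (ν (value s) * esym (value s) all) ≈ mass (rotate f) * ((ν N - ν i) * esym i all)
      combine (k , h) = begin
        mass f * (ν (value s) * esym (value s) all)
          ≈⟨ *-cong mass-f (sym (∑-xE i)) ⟩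
        (k * ∑ all (E i)) * ∑ all (λ a → x a * E i a)
          ≈⟨ solve 3 (λ k s t → (k :* s) :* t := (k :* t) :* s) refl k (∑ all (E i)) (∑ all (λ a → x a * E i a)) ⟩
        (k * ∑ all (λ a → x a * E i a)) * ∑ all (E i)
          ≈⟨ *-cong (sym mass-πf) (begin
               ∑ all (E i)
                 ≈⟨ solve 2 (λ e v → e := (e :+ v) :- v) refl (∑ all (E i)) (ν i * esym i all) ⟩
               (∑ all (E i) + ν i * esym i all) - ν i * esym i all
                 ≈⟨ +-congʳ (∑-E i) ⟩
               ν N * esym i all - ν i * esym i all
                 ≈⟨ solve 3 (λ n i e → n :* e :- i :* e := (n :- i) :* e) refl (ν N) (ν i) (esym i all) ⟩
               (ν N - ν i) * esym i all ∎) ⟩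
        mass (rotate f) * ((ν N - ν i) * esym i all) ∎
        where
        mass-f : mass f ≈ k * ∑ all (E i)
        mass-f = trans mass-heads (trans (∑-ext all h) (sym (∑-*ˡ all k _)))
        mass-πf : mass (rotate f) ≈ k * ∑ all (λ a → x a * E i a)
        mass-πf = trans mass-rotate-heads (trans (∑-ext all (λ a → trans (*-congˡ (h a))
          (solve 3 (λ x k e → x :* (k :* e) := k :* (x :* e)) refl (x a) k (E i a)))) (sym (∑-*ˡ all k _)))

-- Reaching every arrangement by rotations and admissible exchanges

split-cases : {S : Set} (t₁ t₂ u₁ u₂ : List S) (m : S) → t₁ ++ t₂ ≡ u₁ ++ m ∷ u₂ →
  (∃ λ v → t₁ ≡ u₁ ++ m ∷ v × u₂ ≡ v ++ t₂) ⊎ (∃ λ v → u₁ ≡ t₁ ++ v × t₂ ≡ v ++ m ∷ u₂)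
split-cases []       t₂ u₁       u₂ m e = inj₂ (u₁ , ≡.refl , e)
split-cases (s ∷ t₁) t₂ []       u₂ m ≡.refl = inj₁ (t₁ , ≡.refl , ≡.refl)
split-cases (s ∷ t₁) t₂ (r ∷ u₁) u₂ m e with Listₚ.∷-injective e
... | ≡.refl , e′ with split-cases t₁ t₂ u₁ u₂ m e′
...   | inj₁ (v , ≡.refl , e₂) = inj₁ (v , ≡.refl , e₂)
...   | inj₂ (v , ≡.refl , e₂) = inj₂ (v , ≡.refl , e₂)

-- A label may be moved to the right past any label other than its successor, and the word may be
-- read cyclically. A label that is stopped by its successor has to go round the circle the other
-- way.
module CircularSorting {N : ℕ} (Good : List (Fin N) → Set)
  (good-id : Good (allFin N))
  (good-rotate : ∀ {s τ} → Full (s ∷ τ) → Good (s ∷ τ) → Good (τ ++ s ∷ []))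
  (good-swap : ∀ {s t τ} → Full (s ∷ t ∷ τ) → value t ≢ suc (value s) → Good (s ∷ t ∷ τ) → Good (t ∷ s ∷ τ))
  where

  Good′ : List (Fin N) → Set
  Good′ σ = Full σ × Good σ

  private
    cast : ∀ {σ τ} → σ ≡ τ → Good′ σ → Good′ τ
    cast ≡.refl g = g

  rotate-by : ∀ p q → Good′ (p ++ q) → Good′ (q ++ p)
  rotate-by []      q g = cast (≡.sym (Listₚ.++-identityʳ q)) g
  rotate-by (s ∷ p) q (full , g) = cast (Listₚ.++-assoc q (s ∷ []) p)
    (rotate-by p (q ++ s ∷ []) (cast (Listₚ.++-assoc p q (s ∷ []))
      (↭-trans (snoc-↭ (p ++ q) s) full , good-rotate full g)))

  -- Exchanges are given at the head only; rotation brings the pair there and back.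
  swap-adjacent : ∀ p s t q → value t ≢ suc (value s) → Good′ (p ++ s ∷ t ∷ q) → Good′ (p ++ t ∷ s ∷ q)
  swap-adjacent p s t q ne g with rotate-by p (s ∷ t ∷ q) g
  ... | full , g′ = rotate-by (t ∷ s ∷ q) p (↭-trans (swap t s ↭-refl) full , good-swap full ne g′)

  move : ∀ p b q r → (∀ {e} → e ∈ q → value e ≢ suc (value b)) →
    Good′ (p ++ b ∷ q ++ r) → Good′ (p ++ q ++ b ∷ r)
  move p b []      r ok g = g
  move p b (e ∷ q) r ok g = cast (Listₚ.++-assoc p (e ∷ []) _)
    (move (p ++ e ∷ []) b q r (λ e∈ → ok (there e∈))
      (cast (≡.sym (Listₚ.++-assoc p (e ∷ []) _)) (swap-adjacent p b e (q ++ r) (ok (here ≡.refl)) g)))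

  move-block : ∀ p B q r → (∀ {b e} → b ∈ B → e ∈ q → value e ≢ suc (value b)) →
    Good′ (p ++ B ++ q ++ r) → Good′ (p ++ q ++ B ++ r)
  move-block p []      q r ok g = g
  move-block p (b ∷ B) q r ok g = move p b q (B ++ r) (ok (here ≡.refl))
    (cast (Listₚ.++-assoc p (b ∷ []) _) (move-block (p ++ b ∷ []) B q r (λ b∈ → ok (there b∈))
      (cast (≡.sym (Listₚ.++-assoc p (b ∷ []) _)) g)))

  private
    _>ᶠ_ : Fin N → Fin N → Set
    s >ᶠ t = t Fin.< s

    Decreasing : List (Fin N) → Set
    Decreasing = AllPairs _>ᶠ_

    above : ∀ {b e : Fin N} → b >ᶠ e → value e ≢ suc (value b)
    above e<b eq = ℕₚ.<-irrefl (ℕₚ.suc-injective eq) (ℕₚ.<-trans e<b (ℕₚ.n<1+n _))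

    far : ∀ {b m e : Fin N} → m >ᶠ b → e >ᶠ m → value e ≢ suc (value b)
    far b<m m<e eq = ℕₚ.<-irrefl (≡.sym (ℕₚ.suc-injective eq)) (ℕₚ.≤-<-trans b<m m<e)

  -- Turns the increasing word into the decreasing one. The block B of labels already reversed
  -- exceeds everything left, so it may pass it; after a rotation B moves right past the smaller
  -- labels and the largest remaining label u comes to stand directly behind it.
  reverse-blocks : ∀ R B → Decreasing R → (∀ {b e} → b ∈ B → e ∈ R → b >ᶠ e) →
    Good′ (Data.List.reverse R ++ B) → Good′ (B ++ R)
  reverse-blocks []      B _          _  g = cast (≡.sym (Listₚ.++-identityʳ B)) g
  reverse-blocks (u ∷ R) B (u> ∷ dec) ok g = cast (Listₚ.++-assoc B (u ∷ []) R)
    (reverse-blocks R (B ++ u ∷ []) dec ok′ moved)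
    where
    U = Data.List.reverse R
    U⊆R : ∀ {e} → e ∈ U → e ∈ R
    U⊆R = ↭ₚ.∈-resp-↭ (↭ₚ.↭-reverse R)
    turned : Good′ (B ++ U ++ u ∷ [])
    turned = rotate-by (U ++ u ∷ []) B (cast (cong (_++ B) (Listₚ.unfold-reverse u R)) g)
    moved : Good′ (U ++ B ++ u ∷ [])
    moved = move-block [] B U (u ∷ []) (λ b∈ e∈ → above (ok b∈ (there (U⊆R e∈)))) turned
    ok′ : ∀ {b e} → b ∈ B ++ u ∷ [] → e ∈ R → b >ᶠ e
    ok′ b∈ e∈ with ∈ₚ.∈-++⁻ B b∈
    ... | inj₁ b∈B         = ok b∈B (there e∈)
    ... | inj₂ (here ≡.refl) = All.lookup u> e∈

  -- The block R stands directly after m and travels only to the right. A cut after m is reached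
  -- directly; a cut before m is reached over the end of the word and round to the front. In neither
  -- case does R have to pass m, the only label outside R that may be the successor of one in R.
  relocate : ∀ t₁ t₂ u₁ u₂ m R → t₁ ++ t₂ ≡ u₁ ++ m ∷ u₂ →
    (∀ {b e} → b ∈ R → e ∈ u₁ ++ u₂ → value e ≢ suc (value b)) →
    Good′ (u₁ ++ m ∷ R ++ u₂) → Good′ (t₁ ++ R ++ t₂)
  relocate t₁ t₂ u₁ u₂ m R eq ok g with split-cases t₁ t₂ u₁ u₂ m eq
  ... | inj₁ (v , ≡.refl , ≡.refl) = cast (regroup (R ++ t₂))
      (move-block (u₁ ++ m ∷ []) R v t₂ (λ b∈ e∈ → ok b∈ (∈ₚ.∈-++⁺ʳ u₁ (∈ₚ.∈-++⁺ˡ e∈)))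
        (cast (≡.sym (Listₚ.++-assoc u₁ (m ∷ []) _)) g))
    where
    regroup : ∀ z → (u₁ ++ m ∷ []) ++ v ++ z ≡ (u₁ ++ m ∷ v) ++ z
    regroup z = ≡.trans (Listₚ.++-assoc u₁ (m ∷ []) (v ++ z)) (≡.sym (Listₚ.++-assoc u₁ (m ∷ v) z))
  ... | inj₂ (v , ≡.refl , ≡.refl) = move-block [] R t₁ (v ++ m ∷ u₂)
      (λ b∈ e∈ → ok b∈ (∈ₚ.∈-++⁺ˡ {ys = u₂} (∈ₚ.∈-++⁺ˡ {ys = v} e∈)))
      (cast (cong (R ++_) (Listₚ.++-assoc t₁ v (m ∷ u₂)))
        (rotate-by ((t₁ ++ v) ++ m ∷ u₂) R (cast (≡.sym (Listₚ.++-assoc (t₁ ++ v) (m ∷ u₂) R))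
          (cast (≡.trans (Listₚ.++-assoc (t₁ ++ v) (m ∷ []) _) (cong (λ l → (t₁ ++ v) ++ m ∷ u₂ ++ l) (Listₚ.++-identityʳ R)))
            (move-block ((t₁ ++ v) ++ m ∷ []) R u₂ [] (λ b∈ e∈ → ok b∈ (∈ₚ.∈-++⁺ʳ (t₁ ++ v) e∈))
              (cast (≡.sym (≡.trans (Listₚ.++-assoc (t₁ ++ v) (m ∷ []) _) (cong (λ l → (t₁ ++ v) ++ m ∷ R ++ l) (Listₚ.++-identityʳ u₂)))) g))))))

  -- The smaller labels Q are inserted one at a time, each starting right after its successor m.
  insert-below : ∀ P m Q → (∀ {e} → e ∈ P → e >ᶠ m) → Decreasing (m ∷ Q) →
    (∀ t₁ t₂ → t₁ ++ m ∷ t₂ ↭ m ∷ P → Good′ (t₁ ++ m ∷ Q ++ t₂)) →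
    ∀ σ → σ ↭ m ∷ P ++ Q → Good′ σ
  insert-below P m [] P> dec good σ σ↭ with ∈ₚ.∈-∃++ (↭ₚ.∈-resp-↭ (↭-sym σ↭) (here ≡.refl))
  ... | t₁ , t₂ , ≡.refl = good t₁ t₂ (↭-trans σ↭ (Perm.↭-reflexive (cong (m ∷_) (Listₚ.++-identityʳ P))))
  insert-below P m (r ∷ Q) P> ((r<m ∷ Q<m) ∷ dec@(Q<r ∷ _)) good σ σ↭ =
    insert-below (m ∷ P) r Q P>′ dec good′ σ
      (↭-trans σ↭ (↭-trans (prep m (↭ₚ.shift r P Q)) (swap m r ↭-refl)))
    where
    P>′ : ∀ {e} → e ∈ m ∷ P → e >ᶠ r
    P>′ (here ≡.refl) = r<m
    P>′ (there e∈)    = ℕₚ.<-trans r<m (P> e∈)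
    good′ : ∀ t₁ t₂ → t₁ ++ r ∷ t₂ ↭ r ∷ m ∷ P → Good′ (t₁ ++ r ∷ Q ++ t₂)
    good′ t₁ t₂ t↭ = relocate′ (∈ₚ.∈-∃++ (↭ₚ.∈-resp-↭ (↭-sym t↭′) (here ≡.refl)))
      where
      t↭′ : t₁ ++ t₂ ↭ m ∷ P
      t↭′ = ↭ₚ.drop-∷ (↭-trans (↭-sym (↭ₚ.shift r t₁ t₂)) t↭)
      relocate′ : (∃₂ λ u₁ u₂ → t₁ ++ t₂ ≡ u₁ ++ m ∷ u₂) → Good′ (t₁ ++ r ∷ Q ++ t₂)
      relocate′ (u₁ , u₂ , eq) = relocate t₁ t₂ u₁ u₂ m (r ∷ Q) eq apart (good u₁ u₂ u↭)
        where
        u↭ : u₁ ++ m ∷ u₂ ↭ m ∷ P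
        u↭ = ↭-trans (Perm.↭-reflexive (≡.sym eq)) t↭′
        apart : ∀ {b e} → b ∈ r ∷ Q → e ∈ u₁ ++ u₂ → value e ≢ suc (value b)
        apart b∈ e∈ = far (All.lookup (r<m ∷ Q<m) b∈)
          (P> (↭ₚ.∈-resp-↭ (↭ₚ.drop-∷ (↭-trans (↭-sym (↭ₚ.shift m u₁ u₂)) u↭)) e∈))

  all-good : ∀ σ → Full σ → Good′ σ
  all-good σ full = start (Data.List.reverse (allFin N)) ≡.refl
    where
    increasing : ∀ {n} (g : Fin n → Fin N) → (∀ {i j} → i Fin.< j → g i Fin.< g j) → AllPairs Fin._<_ (Data.List.tabulate g)
    increasing {zero}  g mono = []
    increasing {suc n} g mono = Allₚ.tabulate⁺ (λ i → mono (s≤s z≤n)) ∷ increasing (g ∘ Fin.suc) (λ lt → mono (s≤s lt))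
    snoc-decreasing : ∀ {L u} → Decreasing L → All (_>ᶠ u) L → Decreasing (L ++ u ∷ [])
    snoc-decreasing []         []         = [] ∷ []
    snoc-decreasing (s> ∷ dec) (s>u ∷ L>u) = Allₚ.++⁺ s> (s>u ∷ []) ∷ snoc-decreasing dec L>u
    reverse-decreasing : ∀ {L} → AllPairs Fin._<_ L → Decreasing (Data.List.reverse L)
    reverse-decreasing []                = []
    reverse-decreasing {u ∷ L} (u< ∷ inc) = subst Decreasing (≡.sym (Listₚ.unfold-reverse u L))
      (snoc-decreasing (reverse-decreasing inc) (↭ₚ.All-resp-↭ (↭-sym (↭ₚ.↭-reverse L)) u<))
    start : ∀ R → Data.List.reverse (allFin N) ≡ R → Good′ σ
    start R e = finish R dec (↭-trans full (↭-trans (↭-sym (↭ₚ.↭-reverse (allFin N))) (Perm.↭-reflexive e)))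
        (reverse-blocks R [] dec (λ ()) (cast (≡.trans (≡.sym (≡.trans (cong Data.List.reverse (≡.sym e))
          (Listₚ.reverse-involutive (allFin N)))) (≡.sym (Listₚ.++-identityʳ _))) (↭-refl , good-id)))
      where
      dec : Decreasing R
      dec = subst Decreasing e (reverse-decreasing (increasing id id))
      finish : ∀ R → Decreasing R → σ ↭ R → Good′ R → Good′ σ
      finish []      _   σ↭ g = cast (≡.sym (↭ₚ.↭-empty-inv σ↭)) g
      -- Here m is the largest label. Nothing lies above it, so the hypothesis of `insert-below`
      -- only concerns the decreasing word, which is at hand.
      finish (m ∷ Q) dec σ↭ g = insert-below [] m Q (λ ()) dec alone σ σ↭
        where
        alone : ∀ t₁ t₂ → t₁ ++ m ∷ t₂ ↭ m ∷ [] → Good′ (t₁ ++ m ∷ Q ++ t₂)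
        alone [] []       _ = cast (cong (m ∷_) (≡.sym (Listₚ.++-identityʳ Q))) g
        alone [] (_ ∷ _)  p = contradiction (↭ₚ.↭-length p) (λ ())
        alone (_ ∷ t₁) t₂ p = contradiction (≡.trans (≡.sym (cong suc (↭ₚ.↭-length (↭ₚ.shift m t₁ t₂)))) (↭ₚ.↭-length p)) (λ ())

-- The basis of normalized eigenfunctions

at : {S K : Set} → K → ℕ → List S → (List S → S → List S → K) → K
at k n       []      G = k
at k zero    (a ∷ c) G = G [] a c
at k (suc n) (a ∷ c) G = at k n c (λ p → G (a ∷ p))

at-split : ∀ {S K : Set} (k : K) (p : List S) a q G → at k (length p) (p ++ a ∷ q) G ≡ G p a q
at-split k []      a q G = ≡.refl
at-split k (b ∷ p) a q G = at-split k p a q (λ r → G (b ∷ r))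

data AtView {S : Set} : ℕ → List S → Set where
  inside  : ∀ p a q → AtView (length p) (p ++ a ∷ q)
  outside : ∀ {n c} → length c ≤ n → AtView n c

at-view : ∀ {S : Set} n (c : List S) → AtView n c
at-view n       []      = outside z≤n
at-view zero    (a ∷ c) = inside [] a c
at-view (suc n) (a ∷ c) with at-view n c
... | inside p b q = inside (a ∷ p) b q
... | outside le   = outside (s≤s le)

at-outside : ∀ {S K : Set} (k : K) n (c : List S) G → length c ≤ n → at k n c G ≡ k
at-outside k n       []      G le       = ≡.refl
at-outside k (suc n) (a ∷ c) G (s≤s le) = at-outside k n c _ le

suffix-lengths : ∀ {S T : Set} (p : List S) {a q} (p′ : List T) {s q′} →
  length (p ++ a ∷ q) ≡ length (p′ ++ s ∷ q′) → length p ≡ length p′ → length q ≡ length q′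
suffix-lengths []      []       e _  = ℕₚ.suc-injective e
suffix-lengths (_ ∷ p) (_ ∷ p′) e le = suffix-lengths p p′ (ℕₚ.suc-injective e) (ℕₚ.suc-injective le)

module LabelBasis (F : Field) (N : ℕ) (x : Fin N → Field.Carrier F)
  (x-distinct : ∀ {a b} → a ≢ b → ¬ (Field._≈_ F (x a) (x b)))
  (x-nonzero : ∀ a → ¬ (Field._≈_ F (x a) (Field.0# F)))
  (esym-nonzero : ∀ i → i ≤ N →
    ¬ (Field._≈_ F (ElementarySymmetric.esym (Field.algebra F) x i (allFin N)) (Field.0# F))) where

  open Field F
  open Sums algebra
  open LinearAlgebra F
  open FieldNumbers F
  open PickSums algebra
  open StringSums algebra
  open ElementarySymmetric algebra x
  open ColorFunctions F N x x-distinct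
  open LabelSwaps F N x x-distinct
  open RotationMass F N x x-distinct esym-nonzero
  open ≈-Reasoning
  open Solver using (solve; _:+_; _:*_; _:-_; _:=_; con; :-_)

  private
    all = allFin N
    L   = arrangements {N} N

  value-inj : ∀ {s t : Fin N} → value s ≡ value t → s ≡ t
  value-inj e = Finₚ.toℕ-injective (ℕₚ.suc-injective e)

  -- Positions are natural numbers, with 0 beyond the end for operators and labels alike, so that
  -- all operators form one family indexed by ℕ.
  position : ℕ → Fun → List (Fin N) → Carrier
  position r f c = at 0# r c (Θ f)

  label : List (Fin N) → ℕ → Carrier
  label σ r = at 0# r σ (λ _ s _ → ν (value s))

  private
    position-cong : ∀ r f g → (∀ c → c ∈ L → f c ≈ g c) → ∀ c → c ∈ L → position r f c ≈ position r g c
    position-cong r f g h c c∈ with at-view r c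
    ... | inside p a q = begin
      position (length p) f (p ++ a ∷ q)  ≡⟨ at-split 0# p a q _ ⟩
      Θ f p a q                           ≈⟨ Θ-cong p a q (∈⇒full c∈) (λ d full → h d (full⇒∈ full)) ⟩
      Θ g p a q                           ≡⟨ at-split 0# p a q _ ⟨
      position (length p) g (p ++ a ∷ q)  ∎
    ... | outside le = reflexive (≡.trans (at-outside 0# r c _ le) (≡.sym (at-outside 0# r c _ le)))

    position-linear : ∀ r k f g c → c ∈ L →
      position r (λ d → k * f d + g d) c ≈ k * position r f c + position r g c
    position-linear r k f g c c∈ with at-view r c
    ... | inside p a q = begin
      position (length p) (λ d → k * f d + g d) (p ++ a ∷ q)   ≡⟨ at-split 0# p a q _ ⟩
      Θ (λ d → k * f d + g d) p a q                            ≈⟨ Θ-linear k f g p a q ⟩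
      k * Θ f p a q + Θ g p a q
        ≡⟨ cong₂ (λ u v → k * u + v) (at-split 0# p a q _) (at-split 0# p a q _) ⟨
      k * position (length p) f (p ++ a ∷ q) + position (length p) g (p ++ a ∷ q) ∎
    ... | outside le = begin
      position r (λ d → k * f d + g d) c       ≡⟨ at-outside 0# r c _ le ⟩
      0#                                       ≈⟨ trans (+-identityʳ _) (zeroʳ k) ⟨
      k * 0# + 0#                              ≡⟨ cong₂ (λ u v → k * u + v) (at-outside 0# r c _ le) (at-outside 0# r c _ le) ⟨
      k * position r f c + position r g c      ∎

    labels-separate : ∀ {σ τ} → length σ ≡ length τ → σ ≢ τ → ∃ λ r → ¬ (label σ r ≈ label τ r)
    labels-separate {[]}    {[]}    _  ne = contradiction ≡.refl ne
    labels-separate {s ∷ σ} {t ∷ τ} le ne with s Finₚ.≟ t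
    ... | no s≢t = 0 , λ e → s≢t (value-inj (ν-injective e))
    ... | yes ≡.refl with labels-separate {σ} {τ} (ℕₚ.suc-injective le) (λ e → ne (cong (s ∷_) e))
    ...   | r , sep = suc r , sep

    module B = Eigenbasis F _≟ᶜ_ (arrangements-unique N) position position-cong position-linear label
      (λ y∈ z∈ ne → labels-separate (≡.trans (full-length (∈⇒full y∈)) (≡.sym (full-length (∈⇒full z∈)))) ne)

    Eig⇒Eigenvector : ∀ {σ f} → Full σ → Eig σ f → B.Eigenvector σ f
    Eig⇒Eigenvector {σ} {f} σ-full ef r c c∈ with at-view r c
    ... | outside le = begin
      position r f c     ≡⟨ at-outside 0# r c _ le ⟩
      0#                 ≈⟨ zeroˡ _ ⟨
      0# * f c           ≡⟨ cong (_* f c) (at-outside 0# r σ _ (subst (_≤ r) (≡.trans (full-length (∈⇒full c∈)) (≡.sym (full-length σ-full))) le)) ⟨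
      label σ r * f c    ∎
    ... | inside p a q = inner (at-view (length p) σ) ≡.refl ≡.refl
      where
      inner : ∀ {r σ′} → AtView r σ′ → σ′ ≡ σ → r ≡ length p → position (length p) f (p ++ a ∷ q) ≈ label σ (length p) * f (p ++ a ∷ q)
      inner (inside p′ s q′) ≡.refl e = begin
        position (length p) f (p ++ a ∷ q)  ≡⟨ at-split 0# p a q _ ⟩
        Θ f p a q                           ≈⟨ ef p′ s q′ p a q ≡.refl (≡.sym e) (suffix-lengths p p′ (≡.trans (full-length (∈⇒full c∈)) (≡.sym (full-length σ-full))) (≡.sym e)) (∈⇒full c∈) ⟩
        ν (value s) * f (p ++ a ∷ q)        ≡⟨ cong (_* f (p ++ a ∷ q)) (≡.trans (cong (label (p′ ++ s ∷ q′)) (≡.sym e)) (at-split 0# p′ s q′ _)) ⟨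
        label (p′ ++ s ∷ q′) (length p) * f (p ++ a ∷ q) ∎
      inner (outside le) ≡.refl e = contradiction (subst (_≤ length p) (≡.trans (full-length σ-full)
              (≡.trans (≡.sym (full-length (∈⇒full c∈))) (Listₚ.length-++ p))) (subst (length σ ≤_) e le))
              (ℕₚ.<⇒≱ (ℕₚ.m<m+n (length p) (s≤s z≤n)))

  mass-scale : ∀ k f → mass (λ c → k * f c) ≈ k * mass f
  mass-scale k f = sym (∑-*ˡ L k f)

  Normalized : List (Fin N) → Set
  Normalized σ = ∃ λ f → Eig σ f × mass f ≈ 1#

  normalize : ∀ {σ f} → Eig σ f → ¬ (mass f ≈ 0#) → Normalized σ
  normalize {σ} {f} ef nz = (λ c → recip (mass f) * f c) , Eig-scale {σ} (recip (mass f)) {f} ef ,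
    trans (mass-scale (recip (mass f)) f) (trans (*-comm _ _) (recip-* nz))

  -- Denominator and numerator of s e_s / ((N - s + 1) e_{s-1}), by which rotating the head label s
  -- to the end multiplies the sum.
  rotationFactors : Fin N → Carrier × Carrier
  rotationFactors s = (ν N - ν (toℕ s)) * esym (toℕ s) all , ν (value s) * esym (value s) all

  ν-gap : ∀ s → ¬ (ν N - ν (toℕ s) ≈ 0#)
  ν-gap s e = ℕₚ.<-irrefl (≡.sym (ν-injective {N} {toℕ s} (-≈0 e))) (Finₚ.toℕ<n s)

  rotationFactors-nonzero : ∀ s → ¬ (proj₁ (rotationFactors s) ≈ 0#) × ¬ (proj₂ (rotationFactors s) ≈ 0#)
  rotationFactors-nonzero s =
    ≉0-* (ν-gap s) (esym-nonzero (toℕ s) (ℕₚ.<⇒≤ (Finₚ.toℕ<n s))) ,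
    ≉0-* (ν-suc≉0 (toℕ s)) (esym-nonzero (value s) (Finₚ.toℕ<n s))

  mass-rotated : ∀ {s τ f} → Full (s ∷ τ) → Eig (s ∷ τ) f → mass f ≈ 1# →
    mass (rotate f) * proj₁ (rotationFactors s) ≈ proj₂ (rotationFactors s)
  mass-rotated {s} {τ} {f} full ef m1 = begin
    mass (rotate f) * proj₁ (rotationFactors s)
      ≈⟨ mass-rotate (length τ) (full-length full) f full ef ⟨
    mass f * proj₂ (rotationFactors s)  ≈⟨ *-congʳ m1 ⟩
    1# * proj₂ (rotationFactors s)      ≈⟨ *-identityˡ _ ⟩
    proj₂ (rotationFactors s)           ∎

  δ : Fin N → Fin N → Carrier
  δ s t = ν (value t) - ν (value s)

  swapped : Fin N → Fin N → Fun → Fun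
  swapped s t f c = δ s t * f (swapHead c) + - f c

  mass-swapped : ∀ s t f → mass f ≈ 1# → mass (swapped s t f) ≈ δ s t - 1#
  mass-swapped s t f m1 = begin
    mass (swapped s t f)
      ≈⟨ ∑-+ L _ _ ⟩
    mass (λ c → δ s t * f (swapHead c)) + ∑ L (λ c → - f c)
      ≈⟨ +-cong (mass-scale (δ s t) (f ∘ swapHead)) (sym (∑-neg L f)) ⟩
    δ s t * mass (f ∘ swapHead) - mass f
      ≈⟨ +-cong (trans (*-congˡ (trans (arrangements-swap N f) m1)) (*-identityʳ _)) (-‿cong m1) ⟩
    δ s t - 1# ∎

  δ-1≉0 : ∀ {s t} → value t ≢ suc (value s) → ¬ (δ s t - 1# ≈ 0#)
  δ-1≉0 {s} {t} ne e = ne (ν-injective (begin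
    ν (value t)                     ≈⟨ solve 2 (λ t s → t := (t :- s) :+ s) refl (ν (value t)) (ν (value s)) ⟩
    δ s t + ν (value s)             ≈⟨ +-congʳ (-≈0 e) ⟩
    1# + ν (value s)                ≈⟨ ν-suc (value s) ⟨
    ν (suc (value s))               ∎))

  abstract
    -- Rotations and admissible exchanges multiply the sum by nonzero factors, so a normalized
    -- eigenfunction is carried from the constants to every σ.
    normalized : ∀ σ → Full σ → Normalized σ
    normalized σ full = proj₂ (CircularSorting.all-good Normalized good-id
      (λ { {s} {τ} full (f , ef , m1) → normalize (Eig-rotate {s} {τ} {f} ef) (λ e →
             proj₂ (rotationFactors-nonzero s) (trans (sym (mass-rotated full ef m1)) (trans (*-congʳ e) (zeroˡ _)))) })
      (λ { {s} {t} {τ} full ne (f , ef , m1) → normalize (Eig-swap {s} {t} {τ} {f} ef) (λ e →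
             δ-1≉0 ne (trans (sym (mass-swapped s t f m1)) e)) }) σ full)
      where
      count : ∀ M → all ∈ M → ∃ λ n → ∑ M (λ _ → 1#) ≈ ν (suc n)
      count (c ∷ M) _ = length M , trans (sym (pick-∑ (c ∷ M) (λ _ → 1#))) (trans (pick-const (c ∷ M) 1#) (*-identityʳ _))
      good-id : Normalized all
      good-id = normalize (Eig-const 1#) (λ e → let n , eq = count L (full⇒∈ ↭-refl) in
        ν-suc≉0 n (trans (sym eq) e))

  -- Extended by 0 to all words, so that sums over words can mention it without a proof of fullness.
  basisFun : List (Fin N) → Fun
  basisFun σ c with unique? Finₚ._≟_ σ | length σ ℕ.≟ N
  ... | yes u | yes len = proj₁ (normalized σ (unique-full u len)) c
  ... | _     | _       = 0#

  basisFun-spec : ∀ {σ} → Full σ → Eig σ (basisFun σ) × mass (basisFun σ) ≈ 1#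
  basisFun-spec {σ} full with unique? Finₚ._≟_ σ | length σ ℕ.≟ N
  ... | yes u | yes len = proj₂ (normalized σ (unique-full u len))
  ... | yes u | no ¬len = contradiction (full-length full) ¬len
  ... | no ¬u | _       = contradiction (full-unique full) ¬u

  private
    basis-eigen : ∀ σ → σ ∈ L → B.Eigenvector σ (basisFun σ)
    basis-eigen σ σ∈ = Eig⇒Eigenvector (∈⇒full σ∈) (proj₁ (basisFun-spec (∈⇒full σ∈)))

    basis-nonzero : ∀ σ → σ ∈ L → ∃ λ c → c ∈ L × ¬ (basisFun σ c ≈ 0#)
    basis-nonzero σ σ∈ with any? (λ c → ¬? (basisFun σ c ≟0)) L
    ... | yes some = find some
    ... | no none  = contradiction (trans (sym (proj₂ (basisFun-spec (∈⇒full σ∈)))) (∑-zero L vanish)) 1≉0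
      where
      vanish : ∀ c → c ∈ L → basisFun σ c ≈ 0#
      vanish c c∈ with basisFun σ c ≟0
      ... | yes e = e
      ... | no ne = contradiction (lose c∈ ne) none

  basis-independent : Independent L L basisFun
  basis-independent = B.eigenvectors-independent basisFun basis-eigen basis-nonzero

  -- The eigenspace is a line, and the multiple is read off from the sum because the basis function
  -- has sum 1.
  eigenfunction-unique : ∀ {σ f} → Full σ → Eig σ f → ∀ c → Full c → f c ≈ mass f * basisFun σ c
  eigenfunction-unique {σ} {f} full ef = compare
      (B.eigenvector-unique basisFun basis-eigen basis-nonzero (full⇒∈ full) (Eig⇒Eigenvector full ef))
    where
    compare : (∃ λ k → ∀ c → c ∈ L → f c ≈ k * basisFun σ c) → ∀ c → Full c → f c ≈ mass f * basisFun σ c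
    compare (k , h) c c-full = trans (h c (full⇒∈ c-full)) (*-congʳ (sym (begin
      mass f                           ≈⟨ ∑-cong L h ⟩
      mass (λ c → k * basisFun σ c)    ≈⟨ mass-scale k (basisFun σ) ⟩
      k * mass (basisFun σ)            ≈⟨ *-congˡ (proj₂ (basisFun-spec full)) ⟩
      k * 1#                           ≈⟨ *-identityʳ k ⟩
      k                                ∎)))

  basis-rotate : ∀ {s τ z p} → Full (s ∷ τ) → Full (z ∷ p) →
    proj₁ (rotationFactors s) * (x z * basisFun (s ∷ τ) (z ∷ p))
    ≈ proj₂ (rotationFactors s) * basisFun (τ ++ s ∷ []) (p ++ z ∷ [])
  basis-rotate {s} {τ} {z} {p} full full′ = begin
    k * (x z * basisFun (s ∷ τ) (z ∷ p))
      ≈⟨ *-congˡ (sym (rotate-≡ (basisFun (s ∷ τ)) p z ≡.refl)) ⟩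
    k * rotate (basisFun (s ∷ τ)) (p ++ z ∷ [])
      ≈⟨ *-congˡ (eigenfunction-unique (↭-trans (snoc-↭ τ s) full) (Eig-rotate {s} {τ} {basisFun (s ∷ τ)} (proj₁ (basisFun-spec full)))
           (p ++ z ∷ []) (↭-trans (snoc-↭ p z) full′)) ⟩
    k * (mass (rotate (basisFun (s ∷ τ))) * basisFun (τ ++ s ∷ []) (p ++ z ∷ []))
      ≈⟨ solve 3 (λ k m b → k :* (m :* b) := (m :* k) :* b) refl k _ _ ⟩
    (mass (rotate (basisFun (s ∷ τ))) * k) * basisFun (τ ++ s ∷ []) (p ++ z ∷ [])
      ≈⟨ *-congʳ (mass-rotated full (proj₁ (basisFun-spec full)) (proj₂ (basisFun-spec full))) ⟩
    proj₂ (rotationFactors s) * basisFun (τ ++ s ∷ []) (p ++ z ∷ []) ∎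
    where k = proj₁ (rotationFactors s)

  -- `swapped s t` of the basis function is an eigenfunction for t ∷ s ∷ τ with sum δ - 1, hence δ -
  -- 1 times the basis function there. For t = s + 1 the second term drops out.
  basis-swap-head : ∀ {s t τ a b q} → Full (s ∷ t ∷ τ) → Full (a ∷ b ∷ q) →
    δ s t * basisFun (s ∷ t ∷ τ) (b ∷ a ∷ q)
    ≈ basisFun (s ∷ t ∷ τ) (a ∷ b ∷ q) + (δ s t - 1#) * basisFun (t ∷ s ∷ τ) (a ∷ b ∷ q)
  basis-swap-head {s} {t} {τ} {a} {b} {q} full full′ = begin
    δ s t * g (b ∷ a ∷ q)
      ≈⟨ solve 2 (λ u v → u := v :+ (u :+ :- v)) refl (δ s t * g (b ∷ a ∷ q)) (g (a ∷ b ∷ q)) ⟩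
    g (a ∷ b ∷ q) + swapped s t g (a ∷ b ∷ q)
      ≈⟨ +-congˡ (eigenfunction-unique (↭-trans (swap t s ↭-refl) full) (Eig-swap {s} {t} {τ} {g} (proj₁ (basisFun-spec full))) (a ∷ b ∷ q) full′) ⟩
    g (a ∷ b ∷ q) + mass (swapped s t g) * basisFun (t ∷ s ∷ τ) (a ∷ b ∷ q)
      ≈⟨ +-congˡ (*-congʳ (mass-swapped s t g (proj₂ (basisFun-spec full)))) ⟩
    g (a ∷ b ∷ q) + (δ s t - 1#) * basisFun (t ∷ s ∷ τ) (a ∷ b ∷ q) ∎
    where g = basisFun (s ∷ t ∷ τ)

  -- Rotating labels and colors together carries the pair to the head. All terms acquire the same
  -- rotation factors, which cancel.
  basis-swap : ∀ p′ s t q′ p a b q → length p ≡ length p′ → Full (p′ ++ s ∷ t ∷ q′) → Full (p ++ a ∷ b ∷ q) →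
    δ s t * basisFun (p′ ++ s ∷ t ∷ q′) (p ++ b ∷ a ∷ q)
    ≈ basisFun (p′ ++ s ∷ t ∷ q′) (p ++ a ∷ b ∷ q) + (δ s t - 1#) * basisFun (p′ ++ t ∷ s ∷ q′) (p ++ a ∷ b ∷ q)
  basis-swap []       s t q′ []      a b q _ full full′ = basis-swap-head full full′
  basis-swap (r ∷ p′) s t q′ (z ∷ p) a b q e full full′ = cancelˡ K≉0 (begin
    K * (δ s t * basisFun (r ∷ p′ ++ s ∷ t ∷ q′) (z ∷ p ++ b ∷ a ∷ q))
      ≈⟨ solve 4 (λ k x d b → (k :* x) :* (d :* b) := d :* (k :* (x :* b))) refl k (x z) (δ s t) _ ⟩
    δ s t * (k * (x z * basisFun (r ∷ p′ ++ s ∷ t ∷ q′) (z ∷ p ++ b ∷ a ∷ q)))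
      ≈⟨ *-congˡ (turn (p′ ++ s ∷ t ∷ q′) (p ++ b ∷ a ∷ q) full (↭-trans (swap-↭ (z ∷ p) b a q) full′) (Listₚ.++-assoc p′ _ _) (Listₚ.++-assoc p _ _)) ⟩
    δ s t * (l * basisFun (p′ ++ s ∷ t ∷ q′ ++ r ∷ []) (p ++ b ∷ a ∷ q ++ z ∷ []))
      ≈⟨ solve 3 (λ d l b → d :* (l :* b) := l :* (d :* b)) refl (δ s t) l _ ⟩
    l * (δ s t * basisFun (p′ ++ s ∷ t ∷ q′ ++ r ∷ []) (p ++ b ∷ a ∷ q ++ z ∷ []))
      ≈⟨ *-congˡ (basis-swap p′ s t (q′ ++ r ∷ []) p a b (q ++ z ∷ []) (ℕₚ.suc-injective e)
           (end full (Listₚ.++-assoc p′ _ _)) (end full′ (Listₚ.++-assoc p _ _))) ⟩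
    l * (basisFun (p′ ++ s ∷ t ∷ q′ ++ r ∷ []) (p ++ a ∷ b ∷ q ++ z ∷ [])
          + (δ s t - 1#) * basisFun (p′ ++ t ∷ s ∷ q′ ++ r ∷ []) (p ++ a ∷ b ∷ q ++ z ∷ []))
      ≈⟨ solve 4 (λ l u d v → l :* (u :+ d :* v) := l :* u :+ d :* (l :* v)) refl l _ (δ s t - 1#) _ ⟩
    l * basisFun (p′ ++ s ∷ t ∷ q′ ++ r ∷ []) (p ++ a ∷ b ∷ q ++ z ∷ [])
      + (δ s t - 1#) * (l * basisFun (p′ ++ t ∷ s ∷ q′ ++ r ∷ []) (p ++ a ∷ b ∷ q ++ z ∷ []))
      ≈⟨ +-cong (sym (turn (p′ ++ s ∷ t ∷ q′) (p ++ a ∷ b ∷ q) full full′ (Listₚ.++-assoc p′ _ _) (Listₚ.++-assoc p _ _)))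
           (*-congˡ (sym (turn (p′ ++ t ∷ s ∷ q′) (p ++ a ∷ b ∷ q) (↭-trans (swap-↭ (r ∷ p′) t s q′) full) full′ (Listₚ.++-assoc p′ _ _) (Listₚ.++-assoc p _ _)))) ⟩
    k * (x z * basisFun (r ∷ p′ ++ s ∷ t ∷ q′) (z ∷ p ++ a ∷ b ∷ q))
      + (δ s t - 1#) * (k * (x z * basisFun (r ∷ p′ ++ t ∷ s ∷ q′) (z ∷ p ++ a ∷ b ∷ q)))
      ≈⟨ solve 5 (λ k x u d v → k :* (x :* u) :+ d :* (k :* (x :* v)) := (k :* x) :* (u :+ d :* v)) refl k (x z) _ (δ s t - 1#) _ ⟩
    K * (basisFun (r ∷ p′ ++ s ∷ t ∷ q′) (z ∷ p ++ a ∷ b ∷ q)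
          + (δ s t - 1#) * basisFun (r ∷ p′ ++ t ∷ s ∷ q′) (z ∷ p ++ a ∷ b ∷ q)) ∎)
    where
    k = proj₁ (rotationFactors r)
    l = proj₂ (rotationFactors r)
    K = k * x z
    K≉0 : ¬ (K ≈ 0#)
    K≉0 = ≉0-* (proj₁ (rotationFactors-nonzero r)) (x-nonzero z)
    turn : ∀ σ c {σ′ c′} → Full (r ∷ σ) → Full (z ∷ c) → σ ++ r ∷ [] ≡ σ′ → c ++ z ∷ [] ≡ c′ →
      k * (x z * basisFun (r ∷ σ) (z ∷ c)) ≈ l * basisFun σ′ c′
    turn σ c f₁ f₂ ≡.refl ≡.refl = basis-rotate f₁ f₂
    end : ∀ {u c c′} → Full {N} (u ∷ c) → c ++ u ∷ [] ≡ c′ → Full {N} c′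
    end {u} {c} f₁ ≡.refl = ↭-trans (snoc-↭ c u) f₁

-- The weights A and relations between two consecutive ones

module Transitions (F : Field) (N : ℕ) where
  open Field F
  open Sums algebra
  open LinearAlgebra F
  open FieldNumbers F
  open ≈-Reasoning
  open Solver using (solve; _:+_; _:*_; _:-_; _:=_; con; :-_)

  -- 1/(m − n), with 1/0 = 0.
  inv : ℕ → ℕ → Carrier
  inv m n = recip (ν m - ν n)

  ratio : ℕ → ℕ → Carrier
  ratio m n = 1# + inv m n

  inv-* : ∀ {m n} → m ≢ n → (ν m - ν n) * inv m n ≈ 1#
  inv-* {m} {n} m≢n = recip-* (λ e → m≢n (ν-injective {m} {n} (-≈0 e)))

  inv-unique : ∀ {m n w} → m ≢ n → (ν m - ν n) * w ≈ 1# → inv m n ≈ w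
  inv-unique {m} {n} m≢n e = cancelˡ (λ z → m≢n (ν-injective {m} {n} (-≈0 z))) (trans (inv-* m≢n) (sym e))

  inv-self : ∀ n → inv n n ≈ 0#
  inv-self n with (ν n - ν n) ≟0
  ... | yes _ = refl
  ... | no nz = contradiction (-‿inverseʳ (ν n)) nz

  ratio-self : ∀ n → ratio n n ≈ 1#
  ratio-self n = trans (+-congˡ (inv-self n)) (+-identityʳ 1#)

  inv-suc : ∀ m n → inv (suc m) (suc n) ≈ inv m n
  inv-suc m n with m ℕ.≟ n
  ... | yes ≡.refl = trans (inv-self (suc m)) (sym (inv-self m))
  ... | no m≢n = inv-unique {suc m} {suc n} (m≢n ∘ ℕₚ.suc-injective) (trans (*-congʳ (begin
      ν (suc m) - ν (suc n)        ≈⟨ +-cong (ν-suc m) (-‿cong (ν-suc n)) ⟩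
      (1# + ν m) - (1# + ν n)      ≈⟨ solve 3 (λ o m n → (o :+ m) :- (o :+ n) := m :- n) refl 1# (ν m) (ν n) ⟩
      ν m - ν n                    ∎)) (inv-* m≢n))

  inv-up : ∀ n → inv (suc n) n ≈ 1#
  inv-up n = inv-unique {suc n} {n} (ℕₚ.1+n≢n) (trans (*-identityʳ _) (trans (+-congʳ (ν-suc n))
    (trans (+-assoc 1# (ν n) _) (trans (+-congˡ (-‿inverseʳ (ν n))) (+-identityʳ 1#)))))

  inv-antisym : ∀ m n → inv m n ≈ - inv n m
  inv-antisym m n with m ℕ.≟ n
  ... | yes ≡.refl = trans (inv-self m) (trans (sym Rₚ.-0#≈0#) (-‿cong (sym (inv-self m))))
  ... | no m≢n = inv-unique {m} {n} m≢n (trans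
      (solve 3 (λ m n r → (m :- n) :* :- r := (n :- m) :* r) refl (ν m) (ν n) (inv n m)) (inv-* (m≢n ∘ ≡.sym)))

  inv-down : ∀ n → inv n (suc n) ≈ - 1#
  inv-down n = trans (inv-antisym n (suc n)) (-‿cong (inv-up n))

  ratio-down : ∀ n → ratio n (suc n) ≈ 0#
  ratio-down n = trans (+-congˡ (inv-down n)) (-‿inverseʳ 1#)

  values : List (Fin N) → List ℕ
  values = map value

  abstract
    reachable? : ∀ s σ → Dec (s ∈ 0 ∷ values σ)
    reachable? s σ = DecMem._∈?_ ℕ._≟_ s (0 ∷ values σ)

  ∏ratio : ℕ → List (Fin N) → Carrier
  ∏ratio s []      = ratio s 0
  ∏ratio s (t ∷ σ) = ratio s (value t) * ∏ratio s σ

  -- A(y ∣ σ) is the residue at z = y − 1 of ∏ (z − t + 1)/(z − t) over t ∈ {0} ∪ σ.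
  step : Fin N → List (Fin N) → Carrier
  step y σ = [ reachable? (toℕ y) σ ] * ∏ratio (toℕ y) σ

  ∏ratio-↭ : ∀ s {σ τ} → σ ↭ τ → ∏ratio s σ ≈ ∏ratio s τ
  ∏ratio-↭ s Perm.refl        = refl
  ∏ratio-↭ s (prep t p)       = *-congˡ (∏ratio-↭ s p)
  ∏ratio-↭ s (swap t u p)     = trans (*-congˡ (*-congˡ (∏ratio-↭ s p)))
    (solve 3 (λ a b c → a :* (b :* c) := b :* (a :* c)) refl (ratio s (value t)) (ratio s (value u)) _)
  ∏ratio-↭ s (Perm.trans p q) = trans (∏ratio-↭ s p) (∏ratio-↭ s q)

  step-↭ : ∀ y {σ τ} → σ ↭ τ → step y σ ≈ step y τ
  step-↭ y {σ} {τ} p = *-cong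
    ([⇔] (reachable? (toℕ y) σ) (reachable? (toℕ y) τ)
      (↭ₚ.∈-resp-↭ (prep 0 (↭ₚ.map⁺ value p))) (↭ₚ.∈-resp-↭ (prep 0 (↭ₚ.map⁺ value (↭-sym p)))))
    (∏ratio-↭ (toℕ y) p)

  value∈ : ∀ {y σ} → value y ∈ 0 ∷ values σ → y ∈ σ
  value∈ (there v∈) with ∈ₚ.∈-map⁻ value v∈
  ... | t , t∈ , e = subst (_∈ _) (≡.sym (Finₚ.toℕ-injective (ℕₚ.suc-injective e))) t∈

  -- The factor 1 + 1/((y - 1) - y) is 0. Thus a marked label gets weight 0 automatically, and sums
  -- may run over all labels.
  step-∈ : ∀ {y σ} → y ∈ σ → step y σ ≈ 0#
  step-∈ {y} {σ} y∈ = let τ , σ↭ = extract y∈ in trans (step-↭ y σ↭) (begin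
    step y (y ∷ τ)            ≈⟨ *-congˡ (*-congʳ (ratio-down (toℕ y))) ⟩
    _ * (0# * ∏ratio (toℕ y) τ)  ≈⟨ trans (*-congˡ (zeroˡ _)) (zeroʳ _) ⟩
    0#                        ∎)

  χ : ℕ → List (Fin N) → Carrier
  χ s σ = [ reachable? s σ ]

  _≐_ : ℕ → ℕ → Carrier
  m ≐ n = [ m ℕ.≟ n ]

  χ-∷ : ∀ s a σ → a ∉ σ → χ s (a ∷ σ) ≈ χ s σ + (s ≐ value a)
  χ-∷ s a σ a∉ with s ℕ.≟ value a
  ... | yes ≡.refl = trans ([yes] (reachable? (value a) (a ∷ σ)) (there (here ≡.refl)))
          (sym (trans (+-congʳ ([no] (reachable? (value a) σ) (a∉ ∘ value∈))) (+-identityˡ 1#)))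
  ... | no s≢a = trans ([⇔] (reachable? s (a ∷ σ)) (reachable? s σ) drop-a keep) (sym (+-identityʳ _))
    where
    drop-a : s ∈ 0 ∷ value a ∷ values σ → s ∈ 0 ∷ values σ
    drop-a (here e)           = here e
    drop-a (there (here e))   = contradiction e s≢a
    drop-a (there (there s∈)) = there s∈
    keep : s ∈ 0 ∷ values σ → s ∈ 0 ∷ value a ∷ values σ
    keep (here e)   = here e
    keep (there s∈) = there (there s∈)

  step-∷ : ∀ y a σ → a ∉ σ →
    step y (a ∷ σ) ≈ (χ (toℕ y) σ + (toℕ y ≐ value a)) * (ratio (toℕ y) (value a) * ∏ratio (toℕ y) σ)
  step-∷ y a σ a∉ = *-congʳ (χ-∷ (toℕ y) a σ a∉)

  step-snoc : ∀ z σ y → y ∉ σ →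
    step z (σ ++ y ∷ []) ≈ (χ (toℕ z) σ + (toℕ z ≐ value y)) * (ratio (toℕ z) (value y) * ∏ratio (toℕ z) σ)
  step-snoc z σ y y∉ = trans (step-↭ z (snoc-↭ σ y)) (step-∷ z y σ y∉)

  -- The effect on coefficients of expanding the swap of two labels y, z in seminormal form.
  twist : (Fin N → Fin N → Carrier) → Fin N → Fin N → Carrier
  twist c y z = r * c y z + (1# + r) * c z y
    where r = inv (value z) (value y)

  -- s and t are the predecessors of the labels y and z, that is, the poles whose residues are their
  -- weights; Δ = t - s and r = 1/Δ. The factor `ratio t (suc s)` is what appending y contributes to
  -- the weight of z, and `ratio s (suc t)` is the reverse.
  module Differences (y z : Fin N) (y≢z : y ≢ z) where
    s = toℕ y
    t = toℕ z
    Δ = ν t - ν s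
    r = inv (value z) (value y)

    s≢t : s ≢ t
    s≢t e = y≢z (Finₚ.toℕ-injective e)

    r≈ : r ≈ inv t s
    r≈ = inv-suc t s

    Δ*r : Δ * r ≈ 1#
    Δ*r = trans (*-congˡ r≈) (inv-* (s≢t ∘ ≡.sym))

    inv₋ : t ≢ suc s → (Δ - 1#) * inv t (suc s) ≈ 1#
    inv₋ ne = trans (*-congʳ (begin
      (ν t - ν s) - 1#   ≈⟨ solve 3 (λ t s o → (t :- s) :- o := t :- (o :+ s)) refl (ν t) (ν s) 1# ⟩
      ν t - (1# + ν s)   ≈⟨ +-congˡ (-‿cong (sym (ν-suc s))) ⟩
      ν t - ν (suc s)    ∎)) (inv-* ne)

    inv₊ : s ≢ suc t → (- Δ - 1#) * inv s (suc t) ≈ 1#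
    inv₊ ne = trans (*-congʳ (begin
      - (ν t - ν s) - 1#   ≈⟨ solve 3 (λ t s o → :- (t :- s) :- o := s :- (o :+ t)) refl (ν t) (ν s) 1# ⟩
      ν s - (1# + ν t)     ≈⟨ +-congˡ (-‿cong (sym (ν-suc t))) ⟩
      ν s - ν (suc t)      ∎)) (inv-* ne)

    plus-one : ∀ {u w} → (u - 1#) * w ≈ 1# → 1# + w ≈ u * w
    plus-one {u} {w} e = begin
      1# + w                   ≈⟨ +-congʳ e ⟨
      (u - 1#) * w + w         ≈⟨ trans (+-congʳ (distribʳ w u (- 1#))) (+-congʳ (+-congˡ (trans (sym (Rₚ.-‿distribˡ-* 1# w)) (-‿cong (*-identityˡ w))))) ⟩
      (u * w + - w) + w        ≈⟨ solve 2 (λ a w → (a :+ :- w) :+ w := a) refl (u * w) w ⟩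
      u * w                    ∎

    -- (1 − r)(1 + 1/(Δ − 1)) = 1 and (1 + r)(1 − 1/(Δ + 1)) = 1, where r = 1/Δ.
    ratio₋ : t ≢ suc s → (1# - r) * ratio t (suc s) ≈ 1#
    ratio₋ ne = begin
      (1# - r) * (1# + w)      ≈⟨ *-congˡ (plus-one (inv₋ ne)) ⟩
      (1# - r) * (Δ * w)       ≈⟨ solve 4 (λ o r d w → (o :- r) :* (d :* w) := (o :* d :- d :* r) :* w) refl 1# r Δ w ⟩
      (1# * Δ - Δ * r) * w     ≈⟨ *-congʳ (+-cong (*-identityˡ Δ) (-‿cong Δ*r)) ⟩
      (Δ - 1#) * w             ≈⟨ inv₋ ne ⟩
      1#                       ∎
      where w = inv t (suc s)

    ratio₊ : s ≢ suc t → (1# + r) * ratio s (suc t) ≈ 1#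
    ratio₊ ne = begin
      (1# + r) * (1# + w)      ≈⟨ *-congˡ (plus-one (inv₊ ne)) ⟩
      (1# + r) * (- Δ * w)     ≈⟨ solve 4 (λ o r d w → (o :+ r) :* (:- d :* w) := (:- (o :* d) :- d :* r) :* w) refl 1# r Δ w ⟩
      (- (1# * Δ) - Δ * r) * w ≈⟨ *-congʳ (+-cong (-‿cong (*-identityˡ Δ)) (-‿cong Δ*r)) ⟩
      (- Δ - 1#) * w           ≈⟨ inv₊ ne ⟩
      1#                       ∎
      where w = inv s (suc t)

    r-up : t ≡ suc s → r ≈ 1#
    r-up e = trans r≈ (trans (reflexive (cong (λ k → inv k s) e)) (inv-up s))

    r-down : s ≡ suc t → 1# + r ≈ 0#
    r-down e = trans (+-congˡ (trans r≈ (trans (reflexive (cong (inv t) e)) (inv-down t)))) (-‿inverseʳ 1#)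

  -- M M is symmetric in the two new labels.
  steps-symmetric : ∀ σ y z → y ≢ z → y ∉ σ → z ∉ σ →
    let c = λ y z → step y σ * step z (σ ++ y ∷ []) in twist c y z ≈ c y z
  steps-symmetric σ y z y≢z y∉ z∉ = trans (+-cong (*-congˡ cyz) (*-congˡ czy)) (trans identity (sym cyz))
    where
    open Differences y z y≢z
    p  = χ s σ
    p′ = χ t σ
    P  = ∏ratio s σ
    P′ = ∏ratio t σ
    c  = t ≐ suc s
    c′ = s ≐ suc t
    q₋ = ratio t (suc s)
    q₊ = ratio s (suc t)
    cyz : step y σ * step z (σ ++ y ∷ []) ≈ (p * P) * ((p′ + c) * (q₋ * P′))
    cyz = *-congˡ (step-snoc z σ y y∉)
    czy : step z σ * step y (σ ++ z ∷ []) ≈ (p′ * P′) * ((p + c′) * (q₊ * P))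
    czy = *-congˡ (step-snoc y σ z z∉)
    identity : r * ((p * P) * ((p′ + c) * (q₋ * P′))) + (1# + r) * ((p′ * P′) * ((p + c′) * (q₊ * P)))
      ≈ (p * P) * ((p′ + c) * (q₋ * P′))
    identity with t ℕ.≟ suc s | s ℕ.≟ suc t
    -- z = y + 1: it cannot be appended before y, and r = 1.
    ... | yes e | _ = trans (+-cong (trans (*-congʳ (r-up e)) (*-identityˡ _))
            (trans (*-congˡ (trans (*-congʳ (trans (*-congʳ p′≈0) (zeroˡ _))) (zeroˡ _))) (zeroʳ _))) (+-identityʳ _)
      where
      p′≈0 : p′ ≈ 0#
      p′≈0 = [no] (reachable? t σ) (λ t∈ → y∉ (value∈ (subst (_∈ 0 ∷ values σ) e t∈)))
    -- y = z + 1: it cannot be appended before z, so both sides vanish, the left one also because 1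
    -- + r = 0.
    ... | no _ | yes e = trans (+-cong (trans (*-congˡ vanish) (zeroʳ r)) (trans (*-congʳ (r-down e)) (zeroˡ _)))
            (trans (+-identityˡ 0#) (sym vanish))
      where
      p≈0 : p ≈ 0#
      p≈0 = [no] (reachable? s σ) (λ s∈ → z∉ (value∈ (subst (_∈ 0 ∷ values σ) e s∈)))
      vanish : (p * P) * ((p′ + 0#) * (q₋ * P′)) ≈ 0#
      vanish = trans (*-congʳ (trans (*-congʳ p≈0) (zeroˡ _))) (zeroˡ _)
    -- Since (1 + r) q₊ = 1 = (1 - r) q₋, the combination r q₋ + (1 + r) q₊ is q₋.
    ... | no n₁ | no n₂ = begin
      r * ((p * P) * ((p′ + 0#) * (q₋ * P′))) + (1# + r) * ((p′ * P′) * ((p + 0#) * (q₊ * P)))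
        ≈⟨ +-cong (*-congˡ (*-congˡ (*-congʳ (+-identityʳ p′)))) (*-congˡ (*-congˡ (*-congʳ (+-identityʳ p)))) ⟩
      r * ((p * P) * (p′ * (q₋ * P′))) + (1# + r) * ((p′ * P′) * (p * (q₊ * P)))
        ≈⟨ solve 8 (λ r p P p′ P′ q₋ q₊ o → r :* ((p :* P) :* (p′ :* (q₋ :* P′))) :+ (o :+ r) :* ((p′ :* P′) :* (p :* (q₊ :* P)))
             := (r :* q₋ :+ (o :+ r) :* q₊) :* ((p :* P) :* (p′ :* P′))) refl r p P p′ P′ q₋ q₊ 1# ⟩
      (r * q₋ + (1# + r) * q₊) * ((p * P) * (p′ * P′))
        ≈⟨ *-congʳ (trans (+-congˡ (trans (ratio₊ n₂) (sym (ratio₋ n₁))))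
             (trans (solve 3 (λ r q o → r :* q :+ (o :- r) :* q := o :* q) refl r q₋ 1#) (*-identityˡ q₋))) ⟩
      q₋ * ((p * P) * (p′ * P′))
        ≈⟨ solve 5 (λ q p P p′ P′ → q :* ((p :* P) :* (p′ :* P′)) := (p :* P) :* (p′ :* (q :* P′))) refl q₋ p P p′ P′ ⟩
      (p * P) * (p′ * (q₋ * P′))
        ≈⟨ *-congˡ (*-congʳ (+-identityʳ p′)) ⟨
      (p * P) * ((p′ + 0#) * (q₋ * P′)) ∎

module TransitionExchange (F : Field) (N : ℕ) where
  open Field F
  open Sums algebra
  open FieldNumbers F
  open Transitions F N
  open ≈-Reasoning
  open Solver using (solve; _:+_; _:*_; _:-_; _:=_; con; :-_)

  module _ (a : Fin N) (τ : List (Fin N)) (a∉ : a ∉ τ) (y z : Fin N) (y≢z : y ≢ z) (y∉ : y ∉ τ) (z∉ : z ∉ τ) where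
    open Differences y z y≢z

    private
      va = value a
      P  = ∏ratio s τ
      P′ = ∏ratio t τ

      -- The two sides of `steps-exchange` without the common factor P P′. Reachability of s is
      -- split into p from τ, e from a and c′ from z, that of t into p′, e′ and c from y; Qs and Qt
      -- are the factors due to a, q₋ and q₊ those due to the other new label.
      lhs rhs : (r p e p′ e′ c c′ Qs Qt q₋ q₊ : Carrier) → Carrier
      lhs r p e p′ e′ c c′ Qs Qt q₋ q₊ =
        r * ((p - (p + e) * Qs) * ((p′ + c) * q₋)) + (1# + r) * ((p′ - (p′ + e′) * Qt) * ((p + c′) * q₊))
      rhs r p e p′ e′ c c′ Qs Qt q₋ q₊ =
        ((p + e) * Qs) * (((p′ + c) - ((p′ + e′) + c) * Qt) * q₋)

      lhs-cong : ∀ {r p e p′ e′ c c′ Qs Qt q₋ q₊ r₁ p₁ e₁ p₁′ e₁′ c₁ c₁′ Qs₁ Qt₁ q₁ q₁′} →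
        r ≈ r₁ → p ≈ p₁ → e ≈ e₁ → p′ ≈ p₁′ → e′ ≈ e₁′ → c ≈ c₁ → c′ ≈ c₁′ → Qs ≈ Qs₁ → Qt ≈ Qt₁ → q₋ ≈ q₁ → q₊ ≈ q₁′ →
        lhs r p e p′ e′ c c′ Qs Qt q₋ q₊ ≈ lhs r₁ p₁ e₁ p₁′ e₁′ c₁ c₁′ Qs₁ Qt₁ q₁ q₁′
      lhs-cong r p e p′ e′ c c′ S T q q′ = +-cong
        (*-cong r (*-cong (+-cong p (-‿cong (*-cong (+-cong p e) S))) (*-cong (+-cong p′ c) q)))
        (*-cong (+-congˡ r) (*-cong (+-cong p′ (-‿cong (*-cong (+-cong p′ e′) T))) (*-cong (+-cong p c′) q′)))

      rhs-cong : ∀ {r p e p′ e′ c c′ Qs Qt q₋ q₊ r₁ p₁ e₁ p₁′ e₁′ c₁ c₁′ Qs₁ Qt₁ q₁ q₁′} →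
        r ≈ r₁ → p ≈ p₁ → e ≈ e₁ → p′ ≈ p₁′ → e′ ≈ e₁′ → c ≈ c₁ → c′ ≈ c₁′ → Qs ≈ Qs₁ → Qt ≈ Qt₁ → q₋ ≈ q₁ → q₊ ≈ q₁′ →
        rhs r p e p′ e′ c c′ Qs Qt q₋ q₊ ≈ rhs r₁ p₁ e₁ p₁′ e₁′ c₁ c₁′ Qs₁ Qt₁ q₁ q₁′
      rhs-cong r p e p′ e′ c c′ S T q q′ =
        *-cong (*-cong (+-cong p e) S) (*-cong (+-cong (+-cong p′ c) (-‿cong (*-cong (+-cong (+-cong p′ e′) c) T))) q)

      χ-no : ∀ {k} b → b ∉ τ → k ≡ value b → χ k τ ≈ 0#
      χ-no b b∉ ≡.refl = [no] (reachable? (value b) τ) (b∉ ∘ value∈)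

      yes≐ : ∀ {m n} → m ≡ n → (m ≐ n) ≈ 1#
      yes≐ {m} {n} = [yes] (m ℕ.≟ n)

      no≐ : ∀ {m n} → m ≢ n → (m ≐ n) ≈ 0#
      no≐ {m} {n} = [no] (m ℕ.≟ n)

      ratio-≡ : ∀ {m n} → m ≡ n → ratio m n ≈ 1#
      ratio-≡ {m} ≡.refl = ratio-self m

      ratio-pred : ∀ {m n} → n ≡ suc m → ratio m n ≈ 0#
      ratio-pred {m} ≡.refl = ratio-down m

      suc-apart : ∀ {m n} → m ≡ suc n → n ≢ suc m
      suc-apart ≡.refl e = ℕₚ.m≢1+n+m _ e

      -- Relations between reciprocals of differences, with u = 1/(s − a) and v = 1/(t − a).
      inv-gap : s ≢ va → t ≢ va → inv s va * inv t va ≈ r * (inv s va - inv t va)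
      inv-gap s≢ t≢ = begin
        u * v                        ≈⟨ trans (sym (*-identityˡ _)) (*-congʳ (sym Δ*r)) ⟩
        (Δ * r) * (u * v)            ≈⟨ solve 6 (λ t s a r u v → ((t :- s) :* r) :* (u :* v)
                                          := r :* (((t :- a) :* v) :* u :- ((s :- a) :* u) :* v)) refl (ν t) (ν s) (ν va) r u v ⟩
        r * (((ν t - ν va) * v) * u - ((ν s - ν va) * u) * v)
          ≈⟨ *-congˡ (+-cong (trans (*-congʳ (inv-* t≢)) (*-identityˡ u)) (-‿cong (trans (*-congʳ (inv-* s≢)) (*-identityˡ v)))) ⟩
        r * (u - v)                  ∎
        where
        u = inv s va
        v = inv t va

      -- Cases according to which of a, y, z succeed one another. Consecutive labels put the
      -- indicators in special position and make some ratios 0 or 1; when none are consecutive, what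
      -- is left is a partial fraction identity.
      core : lhs r (χ s τ) (s ≐ va) (χ t τ) (t ≐ va) (t ≐ suc s) (s ≐ suc t) (ratio s va) (ratio t va) (ratio t (suc s)) (ratio s (suc t))
           ≈ rhs r (χ s τ) (s ≐ va) (χ t τ) (t ≐ va) (t ≐ suc s) (s ≐ suc t) (ratio s va) (ratio t va) (ratio t (suc s)) (ratio s (suc t))
      core = go (t ℕ.≟ suc s) (s ℕ.≟ suc t) (s ℕ.≟ va) (t ℕ.≟ va)
        where
        p = χ s τ
        p′ = χ t τ
        q₋ = ratio t (suc s)
        q₊ = ratio s (suc t)
        u = inv s va
        v = inv t va
        Goal = lhs r p (s ≐ va) p′ (t ≐ va) (t ≐ suc s) (s ≐ suc t) (ratio s va) (ratio t va) q₋ q₊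
             ≈ rhs r p (s ≐ va) p′ (t ≐ va) (t ≐ suc s) (s ≐ suc t) (ratio s va) (ratio t va) q₋ q₊
        go : Dec (t ≡ suc s) → Dec (s ≡ suc t) → Dec (s ≡ va) → Dec (t ≡ va) → Goal
        -- Here a = y, which is already marked: the right side vanishes through the factor
        -- `ratio s va` = 0.
        go (yes up) _ _ (yes t≡) = trans
            (lhs-cong (r-up up) refl (no≐ s≢) (χ-no y y∉ up) (yes≐ t≡) (yes≐ up) (no≐ (suc-apart up)) (ratio-pred (≡.trans (≡.sym t≡) up)) (ratio-≡ t≡) (ratio-≡ up) refl)
            (trans (solve 4 (λ o z p q → o :* ((p :- (p :+ z) :* z) :* ((z :+ o) :* o)) :+ (o :+ o) :* ((z :- (z :+ o) :* o) :* ((p :+ z) :* q))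
                := (o :* ((p :- (p :+ z) :* z) :* ((z :+ o) :* o)) :+ (z :- (z :+ o) :* o) :* ((p :+ z) :* ((o :+ o) :* q)))) refl 1# 0# p q₊)
            (trans (+-congˡ (*-congˡ (*-congˡ (trans (*-congʳ (+-congˡ (sym (r-up up)))) (ratio₊ (suc-apart up))))))
            (trans evaluate (sym (rhs-cong {r = r} {q₊ = q₊} refl refl (no≐ s≢) (χ-no y y∉ up) (yes≐ t≡) (yes≐ up) (no≐ (suc-apart up)) (ratio-pred (≡.trans (≡.sym t≡) up)) (ratio-≡ t≡) (ratio-≡ up) refl)))))
          where
          s≢ : s ≢ va
          s≢ e = s≢t (≡.trans e (≡.sym t≡))
          evaluate : 1# * ((p - (p + 0#) * 0#) * ((0# + 1#) * 1#)) + (0# - (0# + 1#) * 1#) * ((p + 0#) * 1#)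
            ≈ ((p + 0#) * 0#) * (((0# + 1#) - ((0# + 1#) + 1#) * 1#) * 1#)
          evaluate = begin
            1# * ((p - (p + 0#) * 0#) * ((0# + 1#) * 1#)) + (0# - (0# + 1#) * 1#) * ((p + 0#) * 1#)
              ≈⟨ +-cong (trans (*-identityˡ _) (trans (*-cong (trans (+-congˡ (trans (-‿cong (zeroʳ _)) Rₚ.-0#≈0#)) (+-identityʳ p)) (trans (*-identityʳ _) (+-identityˡ 1#))) (*-identityʳ p)))
                   (*-cong (trans (+-identityˡ _) (-‿cong (trans (*-identityʳ _) (+-identityˡ 1#)))) (trans (*-identityʳ _) (+-identityʳ p))) ⟩
            p + - 1# * p         ≈⟨ +-congˡ (trans (sym (Rₚ.-‿distribˡ-* 1# p)) (-‿cong (*-identityˡ p))) ⟩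
            p - p                ≈⟨ -‿inverseʳ p ⟩
            0#                   ≈⟨ trans (*-congʳ (zeroʳ _)) (zeroˡ _) ⟨
            ((p + 0#) * 0#) * (((0# + 1#) - ((0# + 1#) + 1#) * 1#) * 1#) ∎
        -- The labels are a, y = a + 1 and z = a + 2; both sides are -1.
        go (yes up) _ (yes s≡) (no t≢) = trans
            (lhs-cong (r-up up) (χ-no a a∉ s≡) (yes≐ s≡) (χ-no y y∉ up) (no≐ t≢) (yes≐ up) (no≐ (suc-apart up)) (ratio-≡ s≡) refl (ratio-≡ up) refl)
            (trans (trans (+-cong
                (trans (*-identityˡ _) (trans (*-cong (trans (+-identityˡ _) (-‿cong (trans (*-identityʳ _) (+-identityˡ 1#)))) (trans (*-identityʳ _) (+-identityˡ 1#))) (*-identityʳ _)))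
                (trans (*-congˡ (trans (*-congˡ (trans (*-congʳ (+-identityˡ 0#)) (zeroˡ _))) (zeroʳ _))) (zeroʳ _))) (+-identityʳ _))
              (sym (trans (rhs-cong {r = r} {q₊ = q₊} refl (χ-no a a∉ s≡) (yes≐ s≡) (χ-no y y∉ up) (no≐ t≢) (yes≐ up) (no≐ (suc-apart up)) (ratio-≡ s≡) Qt (ratio-≡ up) refl)
                (trans (*-cong (trans (*-identityʳ _) (+-identityˡ 1#)) (trans (*-identityʳ _)
                  (+-cong (+-identityˡ 1#) (-‿cong (trans (*-congʳ (trans (+-congʳ (+-identityˡ 0#)) (+-identityˡ 1#))) (*-identityˡ _))))))
                  (trans (*-identityˡ _) (solve 1 (λ o → o :- (o :+ o) := :- o) refl 1#))))))
          where
          Qt : ratio t va ≈ 1# + 1#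
          Qt = +-congˡ (trans (reflexive (cong₂ inv up (≡.sym s≡))) (inv-up s))
        go (yes up) _ (no s≢) (no t≢) = trans
            (lhs-cong (r-up up) refl (no≐ s≢) (χ-no y y∉ up) (no≐ t≢) (yes≐ up) (no≐ (suc-apart up)) refl refl (ratio-≡ up) refl)
            (trans (trans (+-cong
                (trans (*-identityˡ _) (trans (*-cong (+-congˡ (-‿cong (*-congʳ (+-identityʳ p)))) (trans (*-identityʳ _) (+-identityˡ 1#))) (*-identityʳ _)))
                (trans (*-congˡ (trans (*-congʳ (trans (+-identityˡ _) (trans (-‿cong (trans (*-congʳ (+-identityˡ 0#)) (zeroˡ _))) Rₚ.-0#≈0#))) (zeroˡ _))) (zeroʳ _))) (+-identityʳ _))
              (sym (trans (rhs-cong {r = r} {q₊ = q₊} refl refl (no≐ s≢) (χ-no y y∉ up) (no≐ t≢) (yes≐ up) (no≐ (suc-apart up)) refl refl (ratio-≡ up) refl)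
                (trans (*-cong (*-congʳ (+-identityʳ p)) (trans (*-identityʳ _)
                  (+-cong (+-identityˡ 1#) (-‿cong (trans (*-congʳ (trans (+-congʳ (+-identityˡ 0#)) (+-identityˡ 1#))) (*-identityˡ _))))))
                  final))))
          where
          final : (p * (1# + u)) * (1# - (1# + v)) ≈ p - p * (1# + u)
          final = begin
            (p * (1# + u)) * (1# - (1# + v))
              ≈⟨ solve 4 (λ p u v o → (p :* (o :+ u)) :* (o :- (o :+ v)) := :- (p :* (o :* v :+ u :* v))) refl p u v 1# ⟩
            - (p * (1# * v + u * v))
              ≈⟨ -‿cong (*-congˡ (+-cong (*-identityˡ v) (trans (inv-gap s≢ t≢) (trans (*-congʳ (r-up up)) (*-identityˡ _))))) ⟩
            - (p * (v + (u - v)))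
              ≈⟨ solve 4 (λ p u v o → :- (p :* (v :+ (u :- v))) := p :* o :- p :* (o :+ u)) refl p u v 1# ⟩
            p * 1# - p * (1# + u)
              ≈⟨ +-congʳ (*-identityʳ p) ⟩
            p - p * (1# + u) ∎
        -- Here a = z and y = z + 1, so r = -1 and `ratio t va` = 0.
        go (no _) (yes down) (yes s≡) t? = trans
            (lhs-cong refl (χ-no z z∉ down) (yes≐ s≡) refl refl (no≐ (suc-apart down)) (yes≐ down) (ratio-≡ s≡) (ratio-pred (≡.trans (≡.sym s≡) down)) refl refl)
            (trans (trans (+-cong
                 (*-cong r≈-1 (*-cong (trans (+-identityˡ _) (-‿cong (trans (*-identityʳ _) (+-identityˡ 1#)))) (*-congʳ (+-identityʳ p′))))
                 (trans (*-congʳ (r-down down)) (zeroˡ _))) (trans (+-identityʳ _)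
               (trans (solve 2 (λ o w → :- o :* (:- o :* w) := o :* (o :* w)) refl 1# (p′ * q₋)) (trans (*-identityˡ _) (*-identityˡ _)))))
              (sym (trans (rhs-cong {r = r} {q₊ = q₊} refl (χ-no z z∉ down) (yes≐ s≡) refl refl (no≐ (suc-apart down)) (yes≐ down) (ratio-≡ s≡) (ratio-pred (≡.trans (≡.sym s≡) down)) refl refl)
                (trans (*-cong (trans (*-identityʳ _) (+-identityˡ 1#)) (*-congʳ (trans (+-cong (+-identityʳ p′) (trans (-‿cong (zeroʳ _)) Rₚ.-0#≈0#)) (+-identityʳ p′)))) (*-identityˡ _)))))
          where
          r≈-1 : r ≈ - 1#
          r≈-1 = trans r≈ (trans (reflexive (cong (inv t) down)) (inv-down t))
        go (no _) (yes down) (no s≢) t? = trans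
            (lhs-cong refl (χ-no z z∉ down) (no≐ s≢) refl refl (no≐ (suc-apart down)) (yes≐ down) refl refl refl refl)
            (trans (trans (+-cong
                 (trans (*-congˡ (trans (*-congʳ (trans (+-identityˡ _) (trans (-‿cong (trans (*-congʳ (+-identityˡ 0#)) (zeroˡ _))) Rₚ.-0#≈0#))) (zeroˡ _))) (zeroʳ _))
                 (trans (*-congʳ (r-down down)) (zeroˡ _))) (+-identityʳ 0#))
              (sym (trans (rhs-cong {r = r} {q₊ = q₊} refl (χ-no z z∉ down) (no≐ s≢) refl refl (no≐ (suc-apart down)) (yes≐ down) refl refl refl refl)
                (trans (*-congʳ (trans (*-congʳ (+-identityˡ 0#)) (zeroˡ _))) (zeroˡ _)))))
        go (no n₁) (no n₂) (yes s≡) t? = trans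
            (lhs-cong refl (χ-no a a∉ s≡) (yes≐ s≡) refl (no≐ t≢) (no≐ n₁) (no≐ n₂) (ratio-≡ s≡) Qt refl refl)
            (trans (trans (+-cong
                 (*-congˡ (*-cong (trans (+-identityˡ _) (-‿cong (trans (*-identityʳ _) (+-identityˡ 1#)))) (*-congʳ (+-identityʳ p′))))
                 (trans (*-congˡ (trans (*-congˡ (trans (*-congʳ (+-identityˡ 0#)) (zeroˡ _))) (zeroʳ _))) (zeroʳ _))) (trans (+-identityʳ _)
                 (solve 4 (λ r o p q → r :* (:- o :* (p :* q)) := o :* (:- (r :* p) :* q)) refl r 1# p′ q₋)))
              (sym (trans (rhs-cong {r = r} {q₊ = q₊} refl (χ-no a a∉ s≡) (yes≐ s≡) refl (no≐ t≢) (no≐ n₁) (no≐ n₂) (ratio-≡ s≡) Qt refl refl)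
                (*-cong (trans (*-identityʳ _) (+-identityˡ 1#)) (*-congʳ (trans
                  (+-cong (trans (+-identityʳ p′) (sym (*-identityʳ p′))) (-‿cong (*-congʳ (trans (+-identityʳ _) (+-identityʳ p′)))))
                  (solve 3 (λ p o r → p :* o :- p :* (o :+ r) := :- (r :* p)) refl p′ 1# r)))))))
          where
          t≢ : t ≢ va
          t≢ e = s≢t (≡.trans s≡ (≡.sym e))
          Qt : ratio t va ≈ 1# + r
          Qt = +-congˡ (trans (reflexive (cong (inv t) (≡.sym s≡))) (sym r≈))
        go (no n₁) (no n₂) (no s≢) (yes t≡) = trans
            (lhs-cong refl refl (no≐ s≢) (χ-no a a∉ t≡) (yes≐ t≡) (no≐ n₁) (no≐ n₂) Qs (ratio-≡ t≡) refl refl)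
            (trans (trans (+-cong
                 (trans (*-congˡ (trans (*-congˡ (trans (*-congʳ (+-identityˡ 0#)) (zeroˡ _))) (zeroʳ _))) (zeroʳ _))
                 (*-congˡ (*-cong (trans (+-identityˡ _) (-‿cong (trans (*-identityʳ _) (+-identityˡ 1#)))) (*-congʳ (+-identityʳ p)))))
               (trans (+-identityˡ _) (trans (solve 4 (λ o r p q → (o :+ r) :* (:- o :* (p :* q)) := :- (o :* p) :* ((o :+ r) :* q)) refl 1# r p q₊) (*-congˡ (ratio₊ n₂)))))
              (sym (trans (rhs-cong {r = r} {q₊ = q₊} refl refl (no≐ s≢) (χ-no a a∉ t≡) (yes≐ t≡) (no≐ n₁) (no≐ n₂) Qs (ratio-≡ t≡) refl refl)
                (trans (*-cong (*-congʳ (+-identityʳ p)) (*-congʳ (trans (+-cong (+-identityˡ 0#) (-‿cong (trans (*-identityʳ _) (trans (+-identityʳ _) (+-identityˡ 1#))))) (+-identityˡ _))))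
                  (trans (solve 4 (λ o r p q → (p :* (o :- r)) :* (:- o :* q) := :- (o :* p) :* ((o :- r) :* q)) refl 1# r p q₋) (*-congˡ (ratio₋ n₁)))))))
          where
          Qs : ratio s va ≈ 1# - r
          Qs = +-congˡ (trans (reflexive (cong (inv s) (≡.sym t≡))) (trans (inv-antisym s t) (-‿cong (sym r≈))))
        -- Neither new label follows a or the other. Eliminating q₊ through (1 + r) q₊ = (1 - r) q₋
        -- reduces the claim to u v = r (u - v), which is `inv-gap`.
        go (no n₁) (no n₂) (no s≢) (no t≢) = trans
            (lhs-cong refl refl (no≐ s≢) refl (no≐ t≢) (no≐ n₁) (no≐ n₂) refl refl refl refl)
            (trans (trans (+-cong
                (*-congˡ (*-cong (+-congˡ (-‿cong (*-congʳ (+-identityʳ p)))) (*-congʳ (+-identityʳ p′))))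
                (*-congˡ (*-cong (+-congˡ (-‿cong (*-congʳ (+-identityʳ p′)))) (*-congʳ (+-identityʳ p))))) final)
              (sym (trans (rhs-cong {r = r} {q₊ = q₊} refl refl (no≐ s≢) refl (no≐ t≢) (no≐ n₁) (no≐ n₂) refl refl refl refl)
                (*-cong (*-congʳ (+-identityʳ p)) (*-congʳ (+-cong (+-identityʳ p′) (-‿cong (*-congʳ (trans (+-identityʳ _) (+-identityʳ p′))))))))))
          where
          one- : ∀ w b → b - b * (1# + w) ≈ - (b * w)
          one- w b = trans (+-congʳ (sym (*-identityʳ b))) (solve 3 (λ b o w → b :* o :- b :* (o :+ w) := :- (b :* w)) refl b 1# w)
          final : r * ((p - p * (1# + u)) * (p′ * q₋)) + (1# + r) * ((p′ - p′ * (1# + v)) * (p * q₊))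
            ≈ (p * (1# + u)) * ((p′ - p′ * (1# + v)) * q₋)
          final = begin
            r * ((p - p * (1# + u)) * (p′ * q₋)) + (1# + r) * ((p′ - p′ * (1# + v)) * (p * q₊))
              ≈⟨ +-cong (*-congˡ (*-congʳ (one- u p))) (*-congˡ (*-congʳ (one- v p′))) ⟩
            r * (- (p * u) * (p′ * q₋)) + (1# + r) * (- (p′ * v) * (p * q₊))
              ≈⟨ solve 8 (λ o r p p′ u v q q′ → r :* (:- (p :* u) :* (p′ :* q)) :+ (o :+ r) :* (:- (p′ :* v) :* (p :* q′))
                   := :- ((p :* p′) :* ((r :* u) :* q :+ v :* ((o :+ r) :* q′)))) refl 1# r p p′ u v q₋ q₊ ⟩
            - ((p * p′) * ((r * u) * q₋ + v * ((1# + r) * q₊)))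
              ≈⟨ -‿cong (*-congˡ (+-congˡ (*-congˡ (trans (ratio₊ n₂) (sym (ratio₋ n₁)))))) ⟩
            - ((p * p′) * ((r * u) * q₋ + v * ((1# - r) * q₋)))
              ≈⟨ solve 7 (λ o r p p′ u v q → :- ((p :* p′) :* ((r :* u) :* q :+ v :* ((o :- r) :* q)))
                   := :- (((p :* p′) :* q) :* (v :* o :+ r :* (u :- v)))) refl 1# r p p′ u v q₋ ⟩
            - (((p * p′) * q₋) * (v * 1# + r * (u - v)))
              ≈⟨ -‿cong (*-congˡ (+-congˡ (sym (inv-gap s≢ t≢)))) ⟩
            - (((p * p′) * q₋) * (v * 1# + u * v))
              ≈⟨ solve 6 (λ o p p′ u v q → :- (((p :* p′) :* q) :* (v :* o :+ u :* v)) := (p :* (o :+ u)) :* (:- (p′ :* v) :* q)) refl 1# p p′ u v q₋ ⟩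
            (p * (1# + u)) * (- (p′ * v) * q₋)
              ≈⟨ *-congˡ (*-congʳ (sym (one- v p′))) ⟩
            (p * (1# + u)) * ((p′ - p′ * (1# + v)) * q₋) ∎

    -- (1 + s) M D M = M M D + D M M, read off at the labels y, z appended to τ.
    steps-exchange :
      let m = λ y z → step y (a ∷ τ) * step z (τ ++ y ∷ [])
          n = λ y z → step y τ * step z (τ ++ y ∷ []) - m y z
      in twist n y z ≈ m y z - step y (a ∷ τ) * step z (a ∷ τ ++ y ∷ [])
    steps-exchange = begin
      r * (step y τ * step z (τ ++ y ∷ []) - step y (a ∷ τ) * step z (τ ++ y ∷ []))
        + (1# + r) * (step z τ * step y (τ ++ z ∷ []) - step z (a ∷ τ) * step y (τ ++ z ∷ []))
        ≈⟨ +-cong (*-congˡ (+-cong (*-congˡ sz) (-‿cong (*-cong (step-∷ y a τ a∉) sz))))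
             (*-congˡ (+-cong (*-congˡ sy) (-‿cong (*-cong (step-∷ z a τ a∉) sy)))) ⟩
      r * ((p * P) * ((p′ + c) * (q₋ * P′)) - ((p + ε) * (Qs * P)) * ((p′ + c) * (q₋ * P′)))
        + (1# + r) * ((p′ * P′) * ((p + c′) * (q₊ * P)) - ((p′ + ε′) * (Qt * P′)) * ((p + c′) * (q₊ * P)))
        ≈⟨ +-cong (*-congˡ (factor p (p + ε) Qs P (p′ + c) q₋ P′)) (*-congˡ (trans (factor p′ (p′ + ε′) Qt P′ (p + c′) q₊ P) (*-congˡ (*-comm P′ P)))) ⟩
      r * (((p - (p + ε) * Qs) * ((p′ + c) * q₋)) * (P * P′))
        + (1# + r) * (((p′ - (p′ + ε′) * Qt) * ((p + c′) * q₊)) * (P * P′))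
        ≈⟨ solve 5 (λ r o u v w → r :* (u :* w) :+ (o :+ r) :* (v :* w) := (r :* u :+ (o :+ r) :* v) :* w) refl r 1# _ _ (P * P′) ⟩
      lhs r p ε p′ ε′ c c′ Qs Qt q₋ q₊ * (P * P′)
        ≈⟨ *-congʳ core ⟩
      rhs r p ε p′ ε′ c c′ Qs Qt q₋ q₊ * (P * P′)
        ≈⟨ solve 7 (λ pe Q k l R q w → ((pe :* Q) :* ((k :- l :* R) :* q)) :* w := ((pe :* Q) :* (k :* q)) :* w :- ((pe :* Q) :* (l :* (R :* q))) :* w)
             refl (p + ε) Qs (p′ + c) ((p′ + ε′) + c) Qt q₋ (P * P′) ⟩
      (((p + ε) * Qs) * ((p′ + c) * q₋)) * (P * P′) - (((p + ε) * Qs) * (((p′ + ε′) + c) * (Qt * q₋))) * (P * P′)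
        ≈⟨ +-cong (solve 6 (λ pe Q k q w w′ → ((pe :* Q) :* (k :* q)) :* (w :* w′) := (pe :* (Q :* w)) :* (k :* (q :* w′))) refl (p + ε) Qs (p′ + c) q₋ P P′)
             (-‿cong (solve 7 (λ pe Q k R q w w′ → ((pe :* Q) :* (k :* (R :* q))) :* (w :* w′) := (pe :* (Q :* w)) :* (k :* (q :* (R :* w′)))) refl (p + ε) Qs ((p′ + ε′) + c) Qt q₋ P P′)) ⟩
      ((p + ε) * (Qs * P)) * ((p′ + c) * (q₋ * P′)) - ((p + ε) * (Qs * P)) * (((p′ + ε′) + c) * (q₋ * (Qt * P′)))
        ≈⟨ +-cong (sym (*-cong (step-∷ y a τ a∉) sz)) (-‿cong (sym double)) ⟩
      step y (a ∷ τ) * step z (τ ++ y ∷ []) - step y (a ∷ τ) * step z (a ∷ τ ++ y ∷ []) ∎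
      where
      p  = χ s τ
      ε  = s ≐ va
      p′ = χ t τ
      ε′ = t ≐ va
      c  = t ≐ suc s
      c′ = s ≐ suc t
      Qs = ratio s va
      Qt = ratio t va
      q₋ = ratio t (suc s)
      q₊ = ratio s (suc t)
      sz : step z (τ ++ y ∷ []) ≈ (p′ + c) * (q₋ * P′)
      sz = step-snoc z τ y y∉
      sy : step y (τ ++ z ∷ []) ≈ (p + c′) * (q₊ * P)
      sy = step-snoc y τ z z∉
      factor : ∀ p pe Q P k q P′ → (p * P) * (k * (q * P′)) - (pe * (Q * P)) * (k * (q * P′)) ≈ ((p - pe * Q) * (k * q)) * (P * P′)
      factor = solve 7 (λ p pe Q P k q P′ → (p :* P) :* (k :* (q :* P′)) :- (pe :* (Q :* P)) :* (k :* (q :* P′)) := ((p :- pe :* Q) :* (k :* q)) :* (P :* P′)) refl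
      double : step y (a ∷ τ) * step z (a ∷ τ ++ y ∷ []) ≈ ((p + ε) * (Qs * P)) * (((p′ + ε′) + c) * (q₋ * (Qt * P′)))
      double = [ same , differ ]′ (decide-a (y Finₚ.≟ a))
        where
        decide-a : Dec (y ≡ a) → y ≡ a ⊎ y ≢ a
        decide-a (yes q) = inj₁ q
        decide-a (no q)  = inj₂ q
        same : y ≡ a → _
        same ≡.refl = trans (*-congʳ (step-∈ (here ≡.refl))) (trans (zeroˡ _)
          (sym (trans (*-congʳ (trans (sym (step-∷ y y τ a∉)) (step-∈ (here ≡.refl)))) (zeroˡ _))))
        differ : y ≢ a → _
        differ y≢a = *-cong (step-∷ y a τ a∉) (trans (step-snoc z (a ∷ τ) y y∉aτ) (*-congʳ (+-congʳ (χ-∷ t a τ a∉))))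
          where
          y∉aτ : y ∉ a ∷ τ
          y∉aτ (here y≡a) = y≢a y≡a
          y∉aτ (there y∈) = y∉ y∈

-- From arrangements of all labels to shorter tuples

module PartialArrangements (F : Field) (N : ℕ) (x : Fin N → Field.Carrier F)
  (x-distinct : ∀ {a b} → a ≢ b → ¬ (Field._≈_ F (x a) (x b)))
  (x-nonzero : ∀ a → ¬ (Field._≈_ F (x a) (Field.0# F)))
  (esym-nonzero : ∀ i → i ≤ N →
    ¬ (Field._≈_ F (ElementarySymmetric.esym (Field.algebra F) x i (allFin N)) (Field.0# F))) where

  open Field F
  open Sums algebra
  open ColorFunctions F N x x-distinct
  open LabelBasis F N x x-distinct x-nonzero esym-nonzero
  open Transitions F N
  open ≈-Reasoning
  open Solver using (solve; _:+_; _:*_; _:-_; _:=_; con; :-_)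

  private
    all = allFin N

  -- This is g_σ, still evaluated at an arrangement c of all colors; m counts the missing labels.
  -- That only the first |σ| colors matter, up to permuting the rest, follows from
  -- `extendBy-tail-swap`.
  extendBy : ℕ → List (Fin N) → Fun
  extendBy zero    σ c = basisFun σ c
  extendBy (suc m) σ c = ∑ all (λ y → step y σ * extendBy m (σ ++ y ∷ []) c)

  Slots : ℕ → List (Fin N) → Set
  Slots m σ = Unique σ × length σ ℕ.+ m ≡ N

  slots-full : ∀ {σ} → Slots 0 σ → Full σ
  slots-full (u , len) = unique-full u (≡.trans (≡.sym (ℕₚ.+-identityʳ _)) len)

  slots-snoc : ∀ {m σ y} → Slots (suc m) σ → y ∉ σ → Slots m (σ ++ y ∷ [])
  slots-snoc {m} {σ} {y} (u , len) y∉ = Unique-resp-↭ (↭-sym (snoc-↭ σ y)) (Unique-∷ y∉ u) ,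
    ≡.trans (cong (ℕ._+ m) (length-snoc σ y)) (≡.trans (≡.sym (ℕₚ.+-suc (length σ) m)) len)

  slots-tail : ∀ {m s τ} → Slots m (s ∷ τ) → Slots (suc m) τ
  slots-tail {m} {s} {τ} (_ ∷ u , len) = u , ≡.trans (ℕₚ.+-suc (length τ) m) len

  step-sum-cong : ∀ σ {f g : Fin N → Carrier} → (∀ y → y ∉ σ → f y ≈ g y) → ∑ all (λ y → step y σ * f y) ≈ ∑ all (λ y → step y σ * g y)
  step-sum-cong σ {f} {g} h = ∑-ext all term
    where
    term : ∀ y → step y σ * f y ≈ step y σ * g y
    term y with y ∈? σ
    ... | yes y∈ = trans (*-congʳ (step-∈ y∈)) (trans (zeroˡ _) (sym (trans (*-congʳ (step-∈ y∈)) (zeroˡ _))))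
    ... | no y∉  = *-congˡ (h y y∉)

  extendBy-≡ : ∀ m {σ τ c d} → σ ≡ τ → c ≡ d → extendBy m σ c ≈ extendBy m τ d
  extendBy-≡ m ≡.refl ≡.refl = refl

  -- The seminormal relation survives the sum over extensions because the weight of a new label does
  -- not depend on the order of the marked ones.
  extendBy-swap : ∀ m p′ s t q′ p a b q → length p ≡ length p′ → Slots m (p′ ++ s ∷ t ∷ q′) → Full (p ++ a ∷ b ∷ q) →
    δ s t * extendBy m (p′ ++ s ∷ t ∷ q′) (p ++ b ∷ a ∷ q)
    ≈ extendBy m (p′ ++ s ∷ t ∷ q′) (p ++ a ∷ b ∷ q) + (δ s t - 1#) * extendBy m (p′ ++ t ∷ s ∷ q′) (p ++ a ∷ b ∷ q)
  extendBy-swap zero    p′ s t q′ p a b q le slots full = basis-swap p′ s t q′ p a b q le (slots-full slots) full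
  extendBy-swap (suc m) p′ s t q′ p a b q le slots full = begin
    δ s t * ∑ all (λ y → step y σ * extendBy m (σ ++ y ∷ []) c′)
      ≈⟨ ∑-*ˡ all _ _ ⟩
    ∑ all (λ y → δ s t * (step y σ * extendBy m (σ ++ y ∷ []) c′))
      ≈⟨ ∑-ext all (λ y → solve 3 (λ d k e → d :* (k :* e) := k :* (d :* e)) refl (δ s t) (step y σ) _) ⟩
    ∑ all (λ y → step y σ * (δ s t * extendBy m (σ ++ y ∷ []) c′))
      ≈⟨ step-sum-cong σ (λ y y∉ → begin
           δ s t * extendBy m (σ ++ y ∷ []) c′
             ≈⟨ *-congˡ (extendBy-≡ m (Listₚ.++-assoc p′ (s ∷ t ∷ q′) _) ≡.refl) ⟩
           δ s t * extendBy m (p′ ++ s ∷ t ∷ q′ ++ y ∷ []) c′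
             ≈⟨ extendBy-swap m p′ s t (q′ ++ y ∷ []) p a b q le
                  (subst (Slots m) (Listₚ.++-assoc p′ (s ∷ t ∷ q′) _) (slots-snoc slots y∉)) full ⟩
           extendBy m (p′ ++ s ∷ t ∷ q′ ++ y ∷ []) c + (δ s t - 1#) * extendBy m (p′ ++ t ∷ s ∷ q′ ++ y ∷ []) c
             ≈⟨ +-cong (extendBy-≡ m (≡.sym (Listₚ.++-assoc p′ (s ∷ t ∷ q′) _)) ≡.refl)
                       (*-congˡ (extendBy-≡ m (≡.sym (Listₚ.++-assoc p′ (t ∷ s ∷ q′) _)) ≡.refl)) ⟩
           extendBy m (σ ++ y ∷ []) c + (δ s t - 1#) * extendBy m (τ ++ y ∷ []) c ∎) ⟩
    ∑ all (λ y → step y σ * (extendBy m (σ ++ y ∷ []) c + (δ s t - 1#) * extendBy m (τ ++ y ∷ []) c))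
      ≈⟨ ∑-ext all (λ y → trans (distribˡ _ _ _) (+-congˡ (trans
           (solve 3 (λ d k e → k :* (d :* e) := d :* (k :* e)) refl (δ s t - 1#) (step y σ) _)
           (*-congˡ (*-congʳ (step-↭ y (swap-↭ p′ s t q′))))))) ⟩
    ∑ all (λ y → step y σ * extendBy m (σ ++ y ∷ []) c + (δ s t - 1#) * (step y τ * extendBy m (τ ++ y ∷ []) c))
      ≈⟨ ∑-+ all _ _ ⟩
    ∑ all (λ y → step y σ * extendBy m (σ ++ y ∷ []) c) + ∑ all (λ y → (δ s t - 1#) * (step y τ * extendBy m (τ ++ y ∷ []) c))
      ≈⟨ +-congˡ (sym (∑-*ˡ all _ _)) ⟩
    extendBy (suc m) σ c + (δ s t - 1#) * extendBy (suc m) τ c ∎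
    where
    σ  = p′ ++ s ∷ t ∷ q′
    τ  = p′ ++ t ∷ s ∷ q′
    c  = p ++ a ∷ b ∷ q
    c′ = p ++ b ∷ a ∷ q

  two : ℕ → List (Fin N) → Fin N → Fin N → Fun
  two m σ y z = extendBy m ((σ ++ y ∷ []) ++ z ∷ [])

  ∑∑ : (Fin N → Fin N → Carrier) → Carrier
  ∑∑ g = ∑ all (λ y → ∑ all (g y))

  Admissible : List (Fin N) → Fin N → Fin N → Set
  Admissible σ y z = y ≢ z × y ∉ σ × z ∉ σ

  admissible? : ∀ σ y z → Admissible σ y z ⊎ (z ∈ σ ++ y ∷ []) ⊎ (y ∈ σ)
  admissible? σ y z with y ∈? σ | z ∈? (σ ++ y ∷ [])
  ... | yes y∈ | _      = inj₂ (inj₂ y∈)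
  ... | no _   | yes z∈ = inj₂ (inj₁ z∈)
  ... | no y∉  | no z∉  = inj₁ ((λ { ≡.refl → z∉ (∈ₚ.∈-++⁺ʳ σ (here ≡.refl)) }) , y∉ , λ z∈ → z∉ (∈ₚ.∈-++⁺ˡ z∈))

  -- The exchange relation is available only when both new labels are distinct and unmarked;
  -- coefficient arrays vanishing elsewhere let double sums run over all pairs.
  Supported : List (Fin N) → (Fin N → Fin N → Carrier) → Set
  Supported σ g = ∀ y z → ¬ Admissible σ y z → g y z ≈ 0#

  inadmissible : ∀ σ y z → ¬ Admissible σ y z → (z ∈ σ ++ y ∷ []) ⊎ (y ∈ σ)
  inadmissible σ y z na with admissible? σ y z
  ... | inj₁ ad = contradiction ad na
  ... | inj₂ r  = r

  admissible-swap : ∀ {σ y z} → Admissible σ y z → Admissible σ z y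
  admissible-swap (ne , y∉ , z∉) = ne ∘ ≡.sym , z∉ , y∉

  slots-two : ∀ {m σ y z} → Slots (suc (suc m)) σ → Admissible σ y z → Slots m (σ ++ y ∷ z ∷ [])
  slots-two {m} {σ} {y} {z} slots (ne , y∉ , z∉) = subst (Slots m) (Listₚ.++-assoc σ (y ∷ []) (z ∷ []))
    (slots-snoc (slots-snoc slots y∉) z∉′)
    where
    z∉′ : z ∉ σ ++ y ∷ []
    z∉′ z∈ with ∈ₚ.∈-++⁻ σ z∈
    ... | inj₁ z∈σ           = z∉ z∈σ
    ... | inj₂ (here ≡.refl) = ne ≡.refl

  ∑∑-cong-admissible : ∀ σ {g h : Fin N → Fin N → Carrier} (B : Fin N → Fin N → Carrier) → Supported σ g → Supported σ h →
    (∀ y z → Admissible σ y z → g y z ≈ h y z) → ∑∑ (λ y z → g y z * B y z) ≈ ∑∑ (λ y z → h y z * B y z)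
  ∑∑-cong-admissible σ {g} {h} B sg sh eq = ∑-ext all (λ y → ∑-ext all (λ z → *-congʳ (pointwise y z)))
    where
    pointwise : ∀ y z → g y z ≈ h y z
    pointwise y z with admissible? σ y z
    ... | inj₁ ad = eq y z ad
    ... | inj₂ bad = trans (sg y z (no-ad bad)) (sym (sh y z (no-ad bad)))
      where
      no-ad : (z ∈ σ ++ y ∷ []) ⊎ (y ∈ σ) → ¬ Admissible σ y z
      no-ad (inj₂ y∈) (_ , y∉ , _) = y∉ y∈
      no-ad (inj₁ z∈) (ne , _ , z∉) with ∈ₚ.∈-++⁻ σ z∈
      ... | inj₁ z∈σ           = z∉ z∈σ
      ... | inj₂ (here ≡.refl) = ne ≡.refl

  twist-supported : ∀ {σ g} → Supported σ g → Supported σ (twist g)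
  twist-supported sg y z na = trans (+-cong (trans (*-congˡ (sg y z na)) (zeroʳ _))
    (trans (*-congˡ (sg z y (na ∘ admissible-swap))) (zeroʳ _))) (+-identityʳ 0#)

  two-swap : ∀ m σ y z p a b q → length p ≡ length σ → Slots (suc (suc m)) σ → Admissible σ y z → Full (p ++ a ∷ b ∷ q) →
    let r = inv (value z) (value y) in
    two m σ y z (p ++ b ∷ a ∷ q) ≈ r * two m σ y z (p ++ a ∷ b ∷ q) + (1# - r) * two m σ z y (p ++ a ∷ b ∷ q)
  two-swap m σ y z p a b q le slots ad@(ne , _ , _) full = begin
    two m σ y z c′
      ≈⟨ trans (*-congʳ δ*r) (*-identityˡ _) ⟨
    (δ y z * r) * two m σ y z c′
      ≈⟨ solve 3 (λ d r b → (d :* r) :* b := r :* (d :* b)) refl (δ y z) r (two m σ y z c′) ⟩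
    r * (δ y z * two m σ y z c′)
      ≈⟨ *-congˡ (trans (*-congˡ (reassoc y z c′)) (trans (extendBy-swap m σ y z [] p a b q le (slots-two slots ad) full)
           (+-cong (sym (reassoc y z c)) (*-congˡ (sym (reassoc z y c)))))) ⟩
    r * (two m σ y z c + (δ y z - 1#) * two m σ z y c)
      ≈⟨ solve 5 (λ r u d o v → r :* (u :+ (d :- o) :* v) := r :* u :+ (d :* r :- o :* r) :* v) refl r (two m σ y z c) (δ y z) 1# (two m σ z y c) ⟩
    r * two m σ y z c + (δ y z * r - 1# * r) * two m σ z y c
      ≈⟨ +-congˡ (*-congʳ (+-cong δ*r (-‿cong (*-identityˡ r)))) ⟩
    r * two m σ y z c + (1# - r) * two m σ z y c ∎
    where
    c  = p ++ a ∷ b ∷ q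
    c′ = p ++ b ∷ a ∷ q
    r  = inv (value z) (value y)
    δ*r : δ y z * r ≈ 1#
    δ*r = inv-* {value z} {value y} (λ e → ne (≡.sym (value-inj e)))
    reassoc : ∀ y z d → two m σ y z d ≈ extendBy m (σ ++ y ∷ z ∷ []) d
    reassoc y z d = extendBy-≡ m (Listₚ.++-assoc σ (y ∷ []) (z ∷ [])) ≡.refl

  -- Exchanging the colors at the places of the two new labels expands each term by the seminormal
  -- form. Renaming y and z in the second part and 1 - 1/(y - z) = 1 + 1/(z - y) collect the
  -- coefficients into `twist g`.
  ∑∑-swap : ∀ m σ g p a b q → length p ≡ length σ → Slots (suc (suc m)) σ → Full (p ++ a ∷ b ∷ q) → Supported σ g →
    ∑∑ (λ y z → g y z * two m σ y z (p ++ b ∷ a ∷ q)) ≈ ∑∑ (λ y z → twist g y z * two m σ y z (p ++ a ∷ b ∷ q))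
  ∑∑-swap m σ g p a b q le slots full sg = begin
    ∑∑ (λ y z → g y z * two m σ y z c′)
      ≈⟨ ∑-ext all (λ y → ∑-ext all (λ z → pointwise y z)) ⟩
    ∑∑ (λ y z → (r y z * g y z) * B y z + (g y z * (1# - r y z)) * B z y)
      ≈⟨ trans (∑-ext all (λ y → ∑-+ all _ _)) (∑-+ all _ _) ⟩
    ∑∑ (λ y z → (r y z * g y z) * B y z) + ∑∑ (λ y z → (g y z * (1# - r y z)) * B z y)
      ≈⟨ +-congˡ (∑-comm all all _) ⟩
    ∑∑ (λ y z → (r y z * g y z) * B y z) + ∑∑ (λ y z → (g z y * (1# - r z y)) * B y z)
      ≈⟨ trans (∑-ext all (λ y → ∑-+ all _ _)) (∑-+ all _ _) ⟨
    ∑∑ (λ y z → (r y z * g y z) * B y z + (g z y * (1# - r z y)) * B y z)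
      ≈⟨ ∑-ext all (λ y → ∑-ext all (λ z → trans (sym (distribʳ _ _ _)) (*-congʳ (+-congˡ (trans (*-comm _ _)
           (*-congʳ (+-congˡ (trans (-‿cong (inv-antisym (value y) (value z))) (Rₚ.-‿involutive _))))))))) ⟩
    ∑∑ (λ y z → twist g y z * B y z) ∎
    where
    c  = p ++ a ∷ b ∷ q
    c′ = p ++ b ∷ a ∷ q
    r : Fin N → Fin N → Carrier
    r y z = inv (value z) (value y)
    B : Fin N → Fin N → Carrier
    B y z = two m σ y z c
    pointwise : ∀ y z → g y z * two m σ y z c′ ≈ (r y z * g y z) * B y z + (g y z * (1# - r y z)) * B z y
    pointwise y z with admissible? σ y z
    ... | inj₁ ad = trans (*-congˡ (two-swap m σ y z p a b q le slots ad full))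
            (solve 5 (λ g r o u v → g :* (r :* u :+ (o :- r) :* v) := (r :* g) :* u :+ (g :* (o :- r)) :* v) refl
              (g y z) (r y z) 1# (B y z) (B z y))
    ... | inj₂ bad = trans (trans (*-congʳ g0) (zeroˡ _)) (sym (trans (+-cong
            (trans (*-congʳ (trans (*-congˡ g0) (zeroʳ _))) (zeroˡ _))
            (trans (*-congʳ (trans (*-congʳ g0) (zeroˡ _))) (zeroˡ _))) (+-identityʳ 0#)))
      where
      g0 : g y z ≈ 0#
      g0 = sg y z (no-ad bad)
        where
        no-ad : (z ∈ σ ++ y ∷ []) ⊎ (y ∈ σ) → ¬ Admissible σ y z
        no-ad (inj₂ y∈) (_ , y∉ , _) = y∉ y∈
        no-ad (inj₁ z∈) (ne , _ , z∉) with ∈ₚ.∈-++⁻ σ z∈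
        ... | inj₁ z∈σ           = z∉ z∈σ
        ... | inj₂ (here ≡.refl) = ne ≡.refl

  extendBy-two : ∀ m σ c (g : Fin N → Carrier) →
    ∑ all (λ y → g y * extendBy (suc m) (σ ++ y ∷ []) c) ≈ ∑∑ (λ y z → (g y * step z (σ ++ y ∷ [])) * two m σ y z c)
  extendBy-two m σ c g = ∑-ext all (λ y → trans (∑-*ˡ all _ _) (∑-ext all (λ z → sym (*-assoc _ _ _))))

  -- If the two colors lie further back, the exchange passes under the outer sum. If they stand at
  -- the places of the next two labels, the coefficients are twisted, and `steps-symmetric` says
  -- that this changes nothing.
  extendBy-tail-swap : ∀ m σ p a b q → length σ ≤ length p → Slots m σ → Full (p ++ a ∷ b ∷ q) →
    extendBy m σ (p ++ b ∷ a ∷ q) ≈ extendBy m σ (p ++ a ∷ b ∷ q)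
  extendBy-tail-swap m σ p a b q le slots full with ℕₚ.m≤n⇒m<n∨m≡n le
  extendBy-tail-swap zero σ p a b q le slots full | inj₁ lt =
    contradiction (≡.trans (≡.sym (ℕₚ.+-identityʳ _)) (proj₂ slots)) (ℕₚ.<⇒≢ (ℕₚ.<-≤-trans lt (subst (length p ≤_)
      (≡.trans (≡.sym (Listₚ.length-++ p)) (full-length full)) (ℕₚ.m≤m+n (length p) _))))
  extendBy-tail-swap (suc m) σ p a b q le slots full | inj₁ lt = step-sum-cong σ (λ y y∉ →
    extendBy-tail-swap m (σ ++ y ∷ []) p a b q (subst (_≤ length p) (≡.sym (length-snoc σ y)) lt) (slots-snoc slots y∉) full)
  extendBy-tail-swap m σ p a b q le slots full | inj₂ eq = swap-here m slots
    where
    N≡ : length p ℕ.+ suc (suc (length q)) ≡ N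
    N≡ = ≡.trans (≡.sym (Listₚ.length-++ p)) (full-length full)
    m≡ : ∀ {m} → Slots m σ → m ≡ suc (suc (length q))
    m≡ slots = ℕₚ.+-cancelˡ-≡ (length σ) _ _ (≡.trans (proj₂ slots) (≡.trans (≡.sym N≡) (cong (ℕ._+ suc (suc (length q))) (≡.sym eq))))
    swap-here : ∀ m → Slots m σ → extendBy m σ (p ++ b ∷ a ∷ q) ≈ extendBy m σ (p ++ a ∷ b ∷ q)
    swap-here zero          slots = contradiction (m≡ slots) (λ ())
    swap-here (suc zero)    slots = contradiction (m≡ slots) (λ ())
    swap-here (suc (suc m)) slots = begin
      extendBy (suc (suc m)) σ (p ++ b ∷ a ∷ q)
        ≈⟨ extendBy-two m σ _ _ ⟩
      ∑∑ (λ y z → g y z * two m σ y z (p ++ b ∷ a ∷ q))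
        ≈⟨ ∑∑-swap m σ g p a b q (≡.sym eq) slots full supported ⟩
      ∑∑ (λ y z → twist g y z * two m σ y z (p ++ a ∷ b ∷ q))
        ≈⟨ ∑∑-cong-admissible σ _ (twist-supported supported) supported (λ { y z (ne , y∉ , z∉) → steps-symmetric σ y z ne y∉ z∉ }) ⟩
      ∑∑ (λ y z → g y z * two m σ y z (p ++ a ∷ b ∷ q))
        ≈⟨ extendBy-two m σ _ _ ⟨
      extendBy (suc (suc m)) σ (p ++ a ∷ b ∷ q) ∎
      where
      g : Fin N → Fin N → Carrier
      g y z = step y σ * step z (σ ++ y ∷ [])
      supported : Supported σ g
      supported y z na with inadmissible σ y z na
      ... | inj₁ z∈ = trans (*-congˡ (step-∈ z∈)) (zeroʳ _)
      ... | inj₂ y∈ = trans (*-congʳ (step-∈ y∈)) (zeroˡ _)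

-- The weight of the last missing label

module FullSteps (F : Field) (N : ℕ) where
  open Field F
  open FieldNumbers F
  open Transitions F N
  open ≈-Reasoning
  open Solver using (solve; _:+_; _:*_; _:-_; _:=_; con; :-_)

  private
    all = allFin N

  module _ (i : ℕ) where
    -- The factor at i + 1, which vanishes, is skipped.
    skip : ℕ → Carrier
    skip v with v ℕ.≟ suc i
    ... | yes _ = 1#
    ... | no _  = ratio i v

    skip-self : skip (suc i) ≈ 1#
    skip-self with suc i ℕ.≟ suc i
    ... | yes _ = refl
    ... | no ne = contradiction ≡.refl ne

    skip-other : ∀ {v} → v ≢ suc i → skip v ≈ ratio i v
    skip-other {v} ne with v ℕ.≟ suc i
    ... | yes e = contradiction e ne
    ... | no _  = refl

    ∏skip : ∀ {n} → List (Fin n) → Carrier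
    ∏skip []      = skip 0
    ∏skip (t ∷ σ) = skip (value t) * ∏skip σ

    ∏skip-↭ : ∀ {n} {σ τ : List (Fin n)} → σ ↭ τ → ∏skip σ ≈ ∏skip τ
    ∏skip-↭ Perm.refl        = refl
    ∏skip-↭ (prep t p)       = *-congˡ (∏skip-↭ p)
    ∏skip-↭ (swap t u p)     = trans (*-congˡ (*-congˡ (∏skip-↭ p)))
      (solve 3 (λ a b c → a :* (b :* c) := b :* (a :* c)) refl (skip (value t)) (skip (value u)) _)
    ∏skip-↭ (Perm.trans p q) = trans (∏skip-↭ p) (∏skip-↭ q)

    prefix : ℕ → (ℕ → Carrier) → Carrier
    prefix zero    f = 1#
    prefix (suc n) f = f 0 * prefix n (f ∘ suc)

    prefix-snoc : ∀ n f → prefix (suc n) f ≈ prefix n f * f n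
    prefix-snoc zero    f = *-comm (f 0) 1#
    prefix-snoc (suc n) f = trans (*-congˡ (prefix-snoc n (f ∘ suc))) (sym (*-assoc _ _ _))

    ∏skip-tabulate : ∀ m {n} (g : Fin m → Fin n) f → (∀ j → skip (value (g j)) ≡ f (toℕ j)) →
      ∏skip (Data.List.tabulate g) ≈ skip 0 * prefix m f
    ∏skip-tabulate zero    g f h = sym (*-identityʳ _)
    ∏skip-tabulate (suc m) g f h = begin
      skip (value (g Fin.zero)) * ∏skip (Data.List.tabulate (g ∘ Fin.suc))
        ≈⟨ *-cong (reflexive (h Fin.zero)) (∏skip-tabulate m (g ∘ Fin.suc) (f ∘ suc) (λ j → h (Fin.suc j))) ⟩
      f 0 * (skip 0 * prefix m (f ∘ suc))
        ≈⟨ solve 3 (λ a b c → a :* (b :* c) := b :* (a :* c)) refl (f 0) (skip 0) (prefix m (f ∘ suc)) ⟩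
      skip 0 * (f 0 * prefix m (f ∘ suc)) ∎

    range : ℕ → Carrier
    range n = skip 0 * prefix n (skip ∘ suc)

    range-suc : ∀ n → range (suc n) ≈ range n * skip (suc n)
    range-suc n = trans (*-congˡ (prefix-snoc n (skip ∘ suc))) (sym (*-assoc _ _ _))

    ratio-* : ∀ {v} → v ≢ i → (ν i - ν v) * ratio i v ≈ (ν i - ν v) + 1#
    ratio-* {v} ne = trans (distribˡ _ 1# _) (+-cong (*-identityʳ _) (inv-* {i} {v} (ne ∘ ≡.sym)))

    ν-step : ∀ u v → (u - ν (suc v)) + 1# ≈ u - ν v
    ν-step u v = trans (+-congʳ (+-congˡ (-‿cong (ν-suc v))))
      (solve 3 (λ u o v → (u :- (o :+ v)) :+ o := u :- v) refl u 1# (ν v))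

    -- The factors (i - v + 1)/(i - v) for v = 0, ..., n telescope to (i + 1)/(i - n).
    range-below : ∀ n → n < i → (ν i - ν n) * range n ≈ ν (suc i)
    range-below zero    lt = begin
      (ν i - ν 0) * (skip 0 * 1#)   ≈⟨ *-congˡ (trans (*-identityʳ _) (skip-other {0} (λ ()))) ⟩
      (ν i - ν 0) * ratio i 0       ≈⟨ ratio-* {0} (ℕₚ.<⇒≢ lt) ⟩
      (ν i - ν 0) + 1#              ≈⟨ +-congʳ (trans (+-congˡ (trans (-‿cong ν-0) Rₚ.-0#≈0#)) (+-identityʳ _)) ⟩
      ν i + 1#                      ≈⟨ trans (+-comm _ _) (sym (ν-suc i)) ⟩
      ν (suc i)                     ∎
    range-below (suc n) lt = begin
      (ν i - ν (suc n)) * range (suc n)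
        ≈⟨ *-congˡ (trans (range-suc n) (*-congˡ (skip-other (ℕₚ.<⇒≢ (ℕₚ.m<n⇒m<1+n lt))))) ⟩
      (ν i - ν (suc n)) * (range n * ratio i (suc n))
        ≈⟨ solve 3 (λ a b c → a :* (b :* c) := (a :* c) :* b) refl (ν i - ν (suc n)) (range n) (ratio i (suc n)) ⟩
      ((ν i - ν (suc n)) * ratio i (suc n)) * range n
        ≈⟨ *-congʳ (trans (ratio-* (ℕₚ.<⇒≢ lt)) (ν-step (ν i) n)) ⟩
      (ν i - ν n) * range n
        ≈⟨ range-below n (ℕₚ.<-trans (ℕₚ.n<1+n n) lt) ⟩
      ν (suc i) ∎

  range-at : ∀ i → range i i ≈ ν (suc i)
  range-at zero    = trans (*-identityʳ _) (trans (skip-other 0 {0} (λ ())) (trans (ratio-self 0) (sym ν-1)))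
  range-at (suc i) = begin
    range (suc i) (suc i)
      ≈⟨ range-suc (suc i) i ⟩
    range (suc i) i * skip (suc i) (suc i)
      ≈⟨ *-congˡ (trans (skip-other (suc i) (ℕₚ.<⇒≢ (ℕₚ.n<1+n (suc i)))) (ratio-self (suc i))) ⟩
    range (suc i) i * 1#
      ≈⟨ trans (*-comm _ _) (*-congʳ (sym (trans (+-congʳ (ν-suc i)) (trans (+-assoc 1# _ _) (trans (+-congˡ (-‿inverseʳ (ν i))) (+-identityʳ 1#)))))) ⟩
    (ν (suc i) - ν i) * range (suc i) i
      ≈⟨ range-below (suc i) i (ℕₚ.n<1+n i) ⟩
    ν (suc (suc i)) ∎

  -- The factor at v = i is 1 by the convention 1/0 = 0, the one at i + 1 is skipped, and the later
  -- ones (v - i - 1)/(v - i) telescope again.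
  range-above : ∀ i n → i < n → (ν n - ν i) * range i n ≈ ν (suc i)
  range-above i (suc n) (s≤s i≤n) with ℕₚ.m≤n⇒m<n∨m≡n i≤n
  ... | inj₂ ≡.refl = begin
    (ν (suc i) - ν i) * range i (suc i)
      ≈⟨ *-cong (trans (+-congʳ (ν-suc i)) (trans (+-assoc 1# _ _) (trans (+-congˡ (-‿inverseʳ (ν i))) (+-identityʳ 1#))))
           (trans (range-suc i i) (trans (*-congˡ (skip-self i)) (*-identityʳ _))) ⟩
    1# * range i i    ≈⟨ trans (*-identityˡ _) (range-at i) ⟩
    ν (suc i)         ∎
  ... | inj₁ i<n = begin
    (ν (suc n) - ν i) * range i (suc n)
      ≈⟨ *-congˡ (trans (range-suc i n) (*-congˡ (skip-other i (λ e → ℕₚ.<⇒≢ i<n (≡.sym (ℕₚ.suc-injective e)))))) ⟩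
    (ν (suc n) - ν i) * (range i n * ratio i (suc n))
      ≈⟨ solve 4 (λ a b r c → (a :- b) :* (r :* c) := :- ((b :- a) :* c) :* r) refl (ν (suc n)) (ν i) (range i n) (ratio i (suc n)) ⟩
    - ((ν i - ν (suc n)) * ratio i (suc n)) * range i n
      ≈⟨ *-congʳ (-‿cong (trans (ratio-* i (λ e → ℕₚ.<⇒≢ (ℕₚ.m<n⇒m<1+n i<n) (≡.sym e))) (ν-step i (ν i) n))) ⟩
    - (ν i - ν n) * range i n
      ≈⟨ *-congʳ (solve 2 (λ a b → :- (a :- b) := b :- a) refl (ν i) (ν n)) ⟩
    (ν n - ν i) * range i n
      ≈⟨ range-above i n i<n ⟩
    ν (suc i) ∎

  -- The poles are 0, ..., N without s, so the telescoped product gives s / (N - s + 1). This is the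
  -- rational part of the rotation factor, which leaves e_s / e_{s-1} as the weight of forgetting s.
  step-full : ∀ {s τ} → Full (s ∷ τ) → (ν N - ν (toℕ s)) * step s τ ≈ ν (value s)
  step-full {s} {τ} full = begin
    (ν N - ν i) * ([ reachable? i τ ] * ∏ratio i τ)
      ≈⟨ *-congˡ (trans (*-cong ([yes] (reachable? i τ) reach) (∏ratio-skip τ (λ t∈ e → s∉ (subst (_∈ τ) (Finₚ.toℕ-injective (ℕₚ.suc-injective e)) t∈)))) (*-identityˡ _)) ⟩
    (ν N - ν i) * ∏skip i τ
      ≈⟨ *-congˡ (trans (sym (*-identityˡ _)) (trans (*-congʳ (sym (skip-self i))) (trans (∏skip-↭ i full)
           (∏skip-tabulate i N id (skip i ∘ suc) (λ _ → ≡.refl))))) ⟩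
    (ν N - ν i) * range i N
      ≈⟨ range-above i N (Finₚ.toℕ<n s) ⟩
    ν (suc i) ∎
    where
    open Sums algebra using ([yes]; [_])
    i = toℕ s
    s∉ : s ∉ τ
    s∉ = ∉-head (full-unique full)
    ∏ratio-skip : ∀ σ → (∀ {t} → t ∈ σ → value t ≢ suc i) → ∏ratio i σ ≈ ∏skip i σ
    ∏ratio-skip []      h = sym (skip-other i {0} (λ ()))
    ∏ratio-skip (t ∷ σ) h = *-cong (sym (skip-other i (h (here ≡.refl)))) (∏ratio-skip σ (λ t∈ → h (there t∈)))
    predecessor : ∀ j → j ≡ i → j ∈ 0 ∷ values τ
    predecessor zero    _ = here ≡.refl
    predecessor (suc j) e = there (subst (_∈ values τ) (cong suc (Finₚ.toℕ-fromℕ< j<N)) (∈ₚ.∈-map⁺ value t∈))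
      where
      j<N : j < N
      j<N = ℕₚ.<-trans (subst (j <_) e (ℕₚ.n<1+n j)) (Finₚ.toℕ<n s)
      t : Fin N
      t = Fin.fromℕ< j<N
      t∈ : t ∈ τ
      t∈ with full-∈ t full
      ... | there t∈ = t∈
      ... | here t≡s = contradiction (≡.trans (≡.sym (Finₚ.toℕ-fromℕ< j<N)) (≡.trans (cong toℕ t≡s) (≡.sym e))) (ℕₚ.<⇒≢ (ℕₚ.n<1+n j))
    reach : i ∈ 0 ∷ values τ
    reach = predecessor i ≡.refl

-- Forgetting the oldest marked vertex

module PartialRelations (F : Field) (N : ℕ) (x : Fin N → Field.Carrier F)
  (x-distinct : ∀ {a b} → a ≢ b → ¬ (Field._≈_ F (x a) (x b)))
  (x-nonzero : ∀ a → ¬ (Field._≈_ F (x a) (Field.0# F)))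
  (esym-nonzero : ∀ i → i ≤ N →
    ¬ (Field._≈_ F (ElementarySymmetric.esym (Field.algebra F) x i (allFin N)) (Field.0# F))) where

  open Field F
  open Sums algebra
  open LinearAlgebra F
  open FieldNumbers F
  open PickSums algebra
  open ElementarySymmetric algebra x
  open LabelBasis F N x x-distinct x-nonzero esym-nonzero
  open Transitions F N
  open TransitionExchange F N
  open FullSteps F N
  open PartialArrangements F N x x-distinct x-nonzero esym-nonzero
  open ≈-Reasoning
  open Solver using (solve; _:+_; _:*_; _:-_; _:=_; con; :-_)

  private
    all = allFin N

  labelWeight : Fin N → Carrier
  labelWeight s = esym (value s) all * recip (esym (toℕ s) all)

  steps-full : ∀ σ → (∀ y → y ∈ σ) → ∀ (f : Fin N → Carrier) → ∑ all (λ y → step y σ * f y) ≈ 0#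
  steps-full σ cover f = ∑-zero all (λ y _ → trans (*-congʳ (step-∈ (cover y))) (zeroˡ _))

  -- The first sum forgets s and then appends y; the second appends y while s is still marked and
  -- forgets s afterwards.
  Z-side : ℕ → Fin N → List (Fin N) → List (Fin N) → Carrier
  Z-side m s τ c = labelWeight s * (∑ all (λ y → step y τ * extendBy m (τ ++ y ∷ []) c)
                                   - ∑ all (λ y → step y (s ∷ τ) * extendBy m (τ ++ y ∷ []) c))

  -- x_a times the rotation of positions acts on labels as M D − D M.
  rotate-relation : ∀ m s τ a p q → length p ≡ length τ → Slots m (s ∷ τ) → Full (a ∷ p ++ q) →
    x a * extendBy m (s ∷ τ) (a ∷ p ++ q) ≈ Z-side m s τ (p ++ a ∷ q)
  rotate-relation zero s τ a p q le slots full = go q (Listₚ.length-++ p) full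
    where
    full-σ : Full (s ∷ τ)
    full-σ = slots-full slots
    i = toℕ s
    go : ∀ q → length (p ++ q) ≡ length p ℕ.+ length q → Full (a ∷ p ++ q) → x a * basisFun (s ∷ τ) (a ∷ p ++ q) ≈ Z-side 0 s τ (p ++ a ∷ q)
    go (b ∷ q) len full = contradiction (≡.trans (≡.sym (full-length full)) (≡.trans (cong suc len) (cong (λ k → suc (k ℕ.+ suc (length q))) le)))
      (λ e → ℕₚ.<⇒≢ (ℕₚ.m<m+n (suc (length τ)) (s≤s z≤n)) (≡.trans (full-length full-σ) e))
    -- Only s is missing from τ: the first sum has the single nonzero term y = s, the second is 0,
    -- and the claim is `basis-rotate` with its factor rewritten by `step-full`.
    go [] len full = begin
      x a * basisFun (s ∷ τ) (a ∷ p ++ [])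
        ≈⟨ *-congˡ (extendBy-≡ 0 {s ∷ τ} ≡.refl (cong (a ∷_) (Listₚ.++-identityʳ p))) ⟩
      x a * basisFun (s ∷ τ) (a ∷ p)
        ≈⟨ cancelˡ (proj₁ (rotationFactors-nonzero s)) (trans (basis-rotate full-σ (subst (λ c → Full (a ∷ c)) (Listₚ.++-identityʳ p) full))
             (trans (*-congʳ (sym factor)) (*-assoc _ _ _))) ⟩
      (labelWeight s * step s τ) * B s
        ≈⟨ *-assoc _ _ _ ⟩
      labelWeight s * (step s τ * B s)
        ≈⟨ *-congˡ (begin
             step s τ * B s
               ≈⟨ trans (+-identityʳ _) (+-identityʳ _) ⟨
             (step s τ * B s + 0#) + 0#
               ≈⟨ +-cong (+-congˡ (sym (∑-zero τ (λ y y∈ → trans (*-congʳ (step-∈ y∈)) (zeroˡ _))))) (sym Rₚ.-0#≈0#) ⟩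
             ∑ (s ∷ τ) (λ y → step y τ * B y) - 0#
               ≈⟨ +-cong (∑-↭ _ full-σ) (-‿cong (sym (steps-full (s ∷ τ) (λ y → full-∈ y full-σ) B))) ⟩
             ∑ all (λ y → step y τ * B y) - ∑ all (λ y → step y (s ∷ τ) * B y) ∎) ⟩
      Z-side 0 s τ (p ++ a ∷ []) ∎
      where
      B : Fin N → Carrier
      B y = basisFun (τ ++ y ∷ []) (p ++ a ∷ [])
      factor : proj₁ (rotationFactors s) * (labelWeight s * step s τ) ≈ proj₂ (rotationFactors s)
      factor = begin
        ((ν N - ν i) * esym i all) * ((esym (suc i) all * recip (esym i all)) * step s τ)
          ≈⟨ solve 5 (λ n e e′ r t → (n :* e) :* ((e′ :* r) :* t) := ((n :* t) :* e′) :* (e :* r)) refl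
               (ν N - ν i) (esym i all) (esym (suc i) all) (recip (esym i all)) (step s τ) ⟩
        (((ν N - ν i) * step s τ) * esym (suc i) all) * (esym i all * recip (esym i all))
          ≈⟨ *-cong (*-congʳ (step-full full-σ)) (recip-* (esym-nonzero i (ℕₚ.<⇒≤ (Finₚ.toℕ<n s)))) ⟩
        (ν (suc i) * esym (suc i) all) * 1#
          ≈⟨ *-identityʳ _ ⟩
        ν (suc i) * esym (suc i) all ∎
  rotate-relation (suc m) s τ a p q le slots full = go q full
    where
    go : ∀ q → Full (a ∷ p ++ q) → x a * extendBy (suc m) (s ∷ τ) (a ∷ p ++ q) ≈ Z-side (suc m) s τ (p ++ a ∷ q)
    go [] full = contradiction (≡.trans (≡.sym (full-length full)) (cong suc (≡.trans (cong length (Listₚ.++-identityʳ p)) le)))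
      (λ e → ℕₚ.<⇒≢ (ℕₚ.m<m+n (suc (length τ)) (s≤s z≤n)) (≡.trans (≡.sym e) (≡.sym (proj₂ slots))))
    -- The relation for one more label places a after f, one position too late. `∑∑-swap` exchanges
    -- the two colors, and `steps-exchange` evaluates the twist that this causes.
    go (f ∷ q) full = begin
      x a * ∑ all (λ y → step y (s ∷ τ) * extendBy m (s ∷ τ ++ y ∷ []) c₀)
        ≈⟨ trans (∑-*ˡ all _ _) (∑-ext all (λ y → solve 3 (λ x k e → x :* (k :* e) := k :* (x :* e)) refl (x a) (step y (s ∷ τ)) _)) ⟩
      ∑ all (λ y → step y (s ∷ τ) * (x a * extendBy m (s ∷ τ ++ y ∷ []) c₀))
        ≈⟨ step-sum-cong (s ∷ τ) (λ y y∉ → trans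
             (*-congˡ (extendBy-≡ m {s ∷ τ ++ y ∷ []} ≡.refl (cong (a ∷_) (≡.sym (Listₚ.++-assoc p (f ∷ []) q)))))
             (trans (rotate-relation m s (τ ++ y ∷ []) a (p ++ f ∷ []) q
               (≡.trans (length-snoc p f) (≡.trans (cong suc le) (≡.sym (length-snoc τ y))))
               (slots-snoc slots y∉) (↭-trans (Perm.↭-reflexive (cong (a ∷_) (Listₚ.++-assoc p (f ∷ []) q))) full))
             (*-congˡ (+-cong (inner y (λ z → step z (τ ++ y ∷ []))) (-‿cong (inner y (λ z → step z (s ∷ τ ++ y ∷ [])))))))) ⟩
      ∑ all (λ y → step y (s ∷ τ) * (labelWeight s * (∑ all (λ z → step z (τ ++ y ∷ []) * B y z) - ∑ all (λ z → step z (s ∷ τ ++ y ∷ []) * B y z))))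
        ≈⟨ trans (∑-ext all (λ y → solve 4 (λ k w u v → k :* (w :* (u :- v)) := w :* (k :* u :+ :- (k :* v))) refl (step y (s ∷ τ)) (labelWeight s) _ _)) (sym (∑-*ˡ all _ _)) ⟩
      labelWeight s * ∑ all (λ y → step y (s ∷ τ) * ∑ all (λ z → step z (τ ++ y ∷ []) * B y z) + - (step y (s ∷ τ) * ∑ all (λ z → step z (s ∷ τ ++ y ∷ []) * B y z)))
        ≈⟨ *-congˡ (∑-ext all (λ y → trans (+-cong (∑-*ˡ all _ _) (trans (-‿cong (∑-*ˡ all _ _)) (∑-neg all _))) (trans (sym (∑-+ all _ _))
             (∑-ext all (λ z → solve 4 (λ k u v b → k :* (u :* b) :+ :- (k :* (v :* b)) := (k :* u :- k :* v) :* b) refl (step y (s ∷ τ)) (step z (τ ++ y ∷ [])) (step z (s ∷ τ ++ y ∷ [])) (B y z)))))) ⟩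
      labelWeight s * ∑∑ (λ y z → (md y z - dm y z) * B y z)
        ≈⟨ *-congˡ (∑∑-cong-admissible τ B (twist-supported n-supported) md-dm-supported (λ { y z (ne , y∉ , z∉) → steps-exchange s τ s∉ y z ne y∉ z∉ })) ⟨
      labelWeight s * ∑∑ (λ y z → twist n y z * B y z)
        ≈⟨ *-congˡ (∑∑-swap m τ n p f a q le slots-τ (↭-trans (swap-↭ p f a q) (↭-trans (↭ₚ.shift a p (f ∷ q)) full)) n-supported) ⟨
      labelWeight s * ∑∑ (λ y z → n y z * two m τ y z (p ++ a ∷ f ∷ q))
        ≈⟨ *-congˡ (∑-ext all (λ y → trans (∑-ext all (λ z → solve 4 (λ k l u b → (k :* u :- l :* u) :* b := k :* (u :* b) :+ :- (l :* (u :* b))) refl (step y τ) (step y (s ∷ τ)) (step z (τ ++ y ∷ [])) _))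
             (trans (∑-+ all _ _) (+-cong (sym (∑-*ˡ all _ _)) (trans (sym (∑-neg all _)) (-‿cong (sym (∑-*ˡ all _ _)))))))) ⟩
      labelWeight s * ∑ all (λ y → step y τ * extendBy (suc m) (τ ++ y ∷ []) (p ++ a ∷ f ∷ q) + - (step y (s ∷ τ) * extendBy (suc m) (τ ++ y ∷ []) (p ++ a ∷ f ∷ q)))
        ≈⟨ *-congˡ (trans (∑-+ all _ _) (+-congˡ (sym (∑-neg all _)))) ⟩
      Z-side (suc m) s τ (p ++ a ∷ f ∷ q) ∎
      where
      c₀ = a ∷ p ++ f ∷ q
      s∉ : s ∉ τ
      s∉ = ∉-head (proj₁ slots)
      slots-τ : Slots (suc (suc m)) τ
      slots-τ = slots-tail slots
      B : Fin N → Fin N → Carrier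
      B y z = two m τ y z (p ++ f ∷ a ∷ q)
      md dm n : Fin N → Fin N → Carrier
      md y z = step y (s ∷ τ) * step z (τ ++ y ∷ [])
      dm y z = step y (s ∷ τ) * step z (s ∷ τ ++ y ∷ [])
      n  y z = step y τ * step z (τ ++ y ∷ []) - md y z
      inner : ∀ y (g : Fin N → Carrier) → ∑ all (λ z → g z * extendBy m ((τ ++ y ∷ []) ++ z ∷ []) ((p ++ f ∷ []) ++ a ∷ q)) ≈ ∑ all (λ z → g z * B y z)
      inner y g = ∑-ext all (λ z → *-congˡ (extendBy-≡ m {(τ ++ y ∷ []) ++ z ∷ []} ≡.refl (Listₚ.++-assoc p (f ∷ []) (a ∷ q))))
      zero-* : ∀ {u v} → u ≈ 0# → u * v ≈ 0#
      zero-* h = trans (*-congʳ h) (zeroˡ _)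
      *-zero : ∀ {u v} → v ≈ 0# → u * v ≈ 0#
      *-zero h = trans (*-congˡ h) (zeroʳ _)
      minus : ∀ {u v} → u ≈ 0# → v ≈ 0# → u - v ≈ 0#
      minus h k = trans (+-cong h (-‿cong k)) (-‿inverseʳ 0#)
      n-supported : Supported τ n
      n-supported y z na with inadmissible τ y z na
      ... | inj₁ z∈ = minus (*-zero (step-∈ z∈)) (*-zero (step-∈ z∈))
      ... | inj₂ y∈ = minus (zero-* (step-∈ y∈)) (zero-* (step-∈ (there y∈)))
      md-dm-supported : Supported τ (λ y z → md y z - dm y z)
      md-dm-supported y z na with inadmissible τ y z na
      ... | inj₁ z∈ = minus (*-zero (step-∈ z∈)) (*-zero (step-∈ (there z∈)))
      ... | inj₂ y∈ = minus (zero-* (step-∈ (there y∈))) (zero-* (step-∈ (there y∈)))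

  -- The first unmarked color f contributes a difference by `rotate-relation`. The other unmarked
  -- colors, treated inductively with f joined to p, contribute exactly the term subtracted there.
  forget-relation : ∀ m s τ p ρ → length p ≡ length τ → Slots m (s ∷ τ) → Full (p ++ ρ) →
    ∑pick ρ (λ a ρ₁ ρ₂ → x a * extendBy m (s ∷ τ) (a ∷ p ++ ρ₁ ++ ρ₂)) ≈ labelWeight s * extendBy (suc m) τ (p ++ ρ)
  forget-relation m s τ p [] le slots full =
    contradiction (≡.trans (proj₂ slots) (≡.trans (≡.sym (full-length full)) (≡.trans (cong length (Listₚ.++-identityʳ p)) le)))
      (λ e → ℕₚ.<⇒≢ (s≤s (ℕₚ.m≤m+n (length τ) m)) (≡.sym e))
  forget-relation m s τ p (f ∷ ρ) le slots full = begin
    x f * extendBy m (s ∷ τ) (f ∷ p ++ ρ) + ∑pick ρ (λ a ρ₁ ρ₂ → x a * extendBy m (s ∷ τ) (a ∷ p ++ f ∷ ρ₁ ++ ρ₂))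
      ≈⟨ +-cong (rotate-relation m s τ f p ρ le slots (↭-trans (↭-sym (↭ₚ.shift f p ρ)) full)) (rest m slots) ⟩
    labelWeight s * (extendBy (suc m) τ (p ++ f ∷ ρ) - S m) + labelWeight s * S m
      ≈⟨ solve 3 (λ w e s → w :* (e :- s) :+ w :* s := w :* e) refl (labelWeight s) (extendBy (suc m) τ (p ++ f ∷ ρ)) (S m) ⟩
    labelWeight s * extendBy (suc m) τ (p ++ f ∷ ρ) ∎
    where
    S : ℕ → Carrier
    S m = ∑ all (λ y → step y (s ∷ τ) * extendBy m (τ ++ y ∷ []) (p ++ f ∷ ρ))
    rest : ∀ m → Slots m (s ∷ τ) → ∑pick ρ (λ a ρ₁ ρ₂ → x a * extendBy m (s ∷ τ) (a ∷ p ++ f ∷ ρ₁ ++ ρ₂)) ≈ labelWeight s * S m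
    rest zero slots = trans (empty ρ lengths)
        (sym (trans (*-congˡ (steps-full (s ∷ τ) (λ y → full-∈ y (slots-full slots)) _)) (zeroʳ _)))
      where
      lengths : length τ ℕ.+ suc (length ρ) ≡ suc (length τ ℕ.+ 0)
      lengths = ≡.trans (cong (ℕ._+ suc (length ρ)) (≡.sym le)) (≡.trans (≡.sym (Listₚ.length-++ p))
        (≡.trans (full-length full) (≡.sym (proj₂ slots))))
      empty : ∀ ρ → length τ ℕ.+ suc (length ρ) ≡ suc (length τ ℕ.+ 0) →
        ∑pick ρ (λ a ρ₁ ρ₂ → x a * basisFun (s ∷ τ) (a ∷ p ++ f ∷ ρ₁ ++ ρ₂)) ≈ 0#
      empty []      _ = refl
      empty (b ∷ ρ) e = contradiction (ℕₚ.+-cancelˡ-≡ (length τ) _ _ (≡.trans e (≡.sym (ℕₚ.+-suc (length τ) 0)))) (λ ())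
    rest (suc m) slots = begin
      ∑pick ρ (λ a ρ₁ ρ₂ → x a * ∑ all (λ y → step y (s ∷ τ) * extendBy m (s ∷ τ ++ y ∷ []) (a ∷ p ++ f ∷ ρ₁ ++ ρ₂)))
        ≈⟨ pick-cong ρ (λ a ρ₁ ρ₂ _ → trans (∑-*ˡ all _ _) (∑-ext all (λ y → trans
             (solve 3 (λ x k e → x :* (k :* e) := k :* (x :* e)) refl (x a) (step y (s ∷ τ)) _)
             (*-congˡ (*-congˡ (extendBy-≡ m {s ∷ τ ++ y ∷ []} ≡.refl (cong (a ∷_) (≡.sym (Listₚ.++-assoc p (f ∷ []) (ρ₁ ++ ρ₂))))))))) ) ⟩
      ∑pick ρ (λ a ρ₁ ρ₂ → ∑ all (λ y → step y (s ∷ τ) * (x a * extendBy m (s ∷ τ ++ y ∷ []) (a ∷ (p ++ f ∷ []) ++ ρ₁ ++ ρ₂))))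
        ≈⟨ pick-∑-comm ρ all (λ y a ρ₁ ρ₂ → step y (s ∷ τ) * (x a * extendBy m (s ∷ τ ++ y ∷ []) (a ∷ (p ++ f ∷ []) ++ ρ₁ ++ ρ₂))) ⟩
      ∑ all (λ y → ∑pick ρ (λ a ρ₁ ρ₂ → step y (s ∷ τ) * (x a * extendBy m (s ∷ τ ++ y ∷ []) (a ∷ (p ++ f ∷ []) ++ ρ₁ ++ ρ₂))))
        ≈⟨ ∑-ext all (λ y → sym (pick-*ˡ ρ _ _)) ⟩
      ∑ all (λ y → step y (s ∷ τ) * ∑pick ρ (λ a ρ₁ ρ₂ → x a * extendBy m (s ∷ τ ++ y ∷ []) (a ∷ (p ++ f ∷ []) ++ ρ₁ ++ ρ₂)))
        ≈⟨ step-sum-cong (s ∷ τ) (λ y y∉ → trans (forget-relation m s (τ ++ y ∷ []) (p ++ f ∷ []) ρ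
             (≡.trans (length-snoc p f) (≡.trans (cong suc le) (≡.sym (length-snoc τ y)))) (slots-snoc slots y∉)
             (↭-trans (Perm.↭-reflexive (Listₚ.++-assoc p (f ∷ []) ρ)) full))
             (*-congˡ (extendBy-≡ (suc m) {τ ++ y ∷ []} ≡.refl (Listₚ.++-assoc p (f ∷ []) ρ)))) ⟩
      ∑ all (λ y → step y (s ∷ τ) * (labelWeight s * extendBy (suc m) (τ ++ y ∷ []) (p ++ f ∷ ρ)))
        ≈⟨ trans (∑-ext all (λ y → solve 3 (λ k w e → k :* (w :* e) := w :* (k :* e)) refl (step y (s ∷ τ)) (labelWeight s) _)) (sym (∑-*ˡ all _ _)) ⟩
      labelWeight s * S (suc m) ∎

-- Operator words acting on functions of tuples

module ArrangementSums (Alg : RationalAlgebra) {N : ℕ} where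
  open RationalAlgebra Alg
  open Sums Alg
  open StringSums Alg
  open ≈-Reasoning

  private
    all = allFin N

  -- The weight of appending on the color side; it takes the place that A has on the label side.
  fresh : Fin N → List (Fin N) → Carrier
  fresh d c = [ ¬? (d ∈? c) ]

  arrangements-front : ∀ j f →
    ∑ (arrangements (suc j)) f ≈ ∑ (arrangements j) (λ c → ∑ all (λ a → fresh a c * f (a ∷ c)))
  arrangements-front j f = begin
    ∑ (arrangements (suc j)) f
      ≈⟨ ∑-arrangements (suc j) f ⟩
    ∑ (strings all (suc j)) (λ c → [unique] c * f c)
      ≈⟨ trans (strings-front all j _) (∑-comm all (strings all j) _) ⟩
    ∑ (strings all j) (λ c → ∑ all (λ a → [unique] (a ∷ c) * f (a ∷ c)))
      ≈⟨ ∑-ext (strings all j) (λ c → trans (∑-ext all (λ a → trans (*-congʳ ([unique]-∷ a c)) (*-assoc _ _ _)))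
           (sym (∑-*ˡ all ([unique] c) _))) ⟩
    ∑ (strings all j) (λ c → [unique] c * ∑ all (λ a → fresh a c * f (a ∷ c)))
      ≈⟨ ∑-arrangements j _ ⟨
    ∑ (arrangements j) (λ c → ∑ all (λ a → fresh a c * f (a ∷ c))) ∎

  arrangements-back : ∀ j f →
    ∑ (arrangements (suc j)) f ≈ ∑ (arrangements j) (λ c → ∑ all (λ d → fresh d c * f (c ++ d ∷ [])))
  arrangements-back j f = begin
    ∑ (arrangements (suc j)) f
      ≈⟨ ∑-arrangements (suc j) f ⟩
    ∑ (strings all (suc j)) (λ c → [unique] c * f c)
      ≈⟨ strings-back all j _ ⟩
    ∑ (strings all j) (λ c → ∑ all (λ d → [unique] (c ++ d ∷ []) * f (c ++ d ∷ [])))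
      ≈⟨ ∑-ext (strings all j) (λ c → trans (∑-ext all (λ d → trans (*-congʳ (trans ([unique]-↭ (snoc-↭ c d)) ([unique]-∷ d c))) (*-assoc _ _ _)))
           (sym (∑-*ˡ all ([unique] c) _))) ⟩
    ∑ (strings all j) (λ c → [unique] c * ∑ all (λ d → fresh d c * f (c ++ d ∷ [])))
      ≈⟨ ∑-arrangements j _ ⟨
    ∑ (arrangements j) (λ c → ∑ all (λ d → fresh d c * f (c ++ d ∷ []))) ∎

-- The transposes of M, D and of the operators built from them, acting on functions of tuples.
module Runs (Alg : RationalAlgebra) {S : Set} (alphabet : List S)
  (a : S → List S → RationalAlgebra.Carrier Alg) (w : S → RationalAlgebra.Carrier Alg) where
  open RationalAlgebra Alg
  open Sums Alg
  open ≈-Reasoning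
  open Solver using (solve; _:+_; _:*_; _:-_; _:=_; con; :-_)

  append : (List S → Carrier) → List S → Carrier
  append φ σ = ∑ alphabet (λ y → a y σ * φ (σ ++ y ∷ []))

  forget : ℕ → (List S → Carrier) → List S → Carrier
  forget r φ σ with length σ ℕ.≟ r
  forget r φ σ       | yes _ = φ σ
  forget r φ []      | no _  = 0#
  forget r φ (s ∷ σ) | no _  = w s * forget r φ σ

  run : ℕ → List ℕ → (List S → Carrier) → List S → Carrier
  run k []       φ = forget k φ
  run k (r ∷ rs) φ = forget r (append (run k rs φ))

  forget-here : ∀ r φ σ → length σ ≡ r → forget r φ σ ≈ φ σ
  forget-here r φ σ e with length σ ℕ.≟ r
  forget-here r φ σ       e | yes _ = refl
  forget-here r φ σ       e | no ¬e = contradiction e ¬e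

  forget-∷ : ∀ r φ s σ → suc (length σ) ≢ r → forget r φ (s ∷ σ) ≈ w s * forget r φ σ
  forget-∷ r φ s σ ne with length (s ∷ σ) ℕ.≟ r
  ... | yes e = contradiction e ne
  ... | no _  = refl

  forget-[] : ∀ r φ → 0 ≢ r → forget r φ [] ≈ 0#
  forget-[] r φ ne with 0 ℕ.≟ r
  ... | yes e = contradiction e ne
  ... | no _  = refl

  forget-linear : ∀ r k f g σ → forget r (λ τ → k * f τ + g τ) σ ≈ k * forget r f σ + forget r g σ
  forget-linear r k f g σ with length σ ℕ.≟ r
  forget-linear r k f g σ       | yes _ = refl
  forget-linear r k f g []      | no _  = sym (trans (+-identityʳ _) (zeroʳ k))
  forget-linear r k f g (s ∷ σ) | no _  = trans (*-congˡ (forget-linear r k f g σ))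
    (solve 4 (λ w k u v → w :* (k :* u :+ v) := k :* (w :* u) :+ w :* v) refl (w s) k _ _)

  forget-ext : ∀ r {f g} σ → (∀ τ → f τ ≈ g τ) → forget r f σ ≈ forget r g σ
  forget-ext r σ h with length σ ℕ.≟ r
  forget-ext r σ       h | yes _ = h σ
  forget-ext r []      h | no _  = refl
  forget-ext r (s ∷ σ) h | no _  = *-congˡ (forget-ext r σ h)

  append-linear : ∀ k f g σ → append (λ τ → k * f τ + g τ) σ ≈ k * append f σ + append g σ
  append-linear k f g σ = trans (∑-ext alphabet (λ y →
      solve 4 (λ a k u v → a :* (k :* u :+ v) := k :* (a :* u) :+ a :* v) refl (a y σ) k _ _))
    (trans (∑-+ alphabet _ _) (+-congʳ (sym (∑-*ˡ alphabet k _))))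

  run-linear : ∀ k rs c f g σ → run k rs (λ τ → c * f τ + g τ) σ ≈ c * run k rs f σ + run k rs g σ
  run-linear k []       c f g σ = forget-linear k c f g σ
  run-linear k (r ∷ rs) c f g σ = trans (forget-ext r σ (λ τ → trans
      (∑-ext alphabet (λ y → *-congˡ (run-linear k rs c f g (τ ++ y ∷ [])))) (append-linear c (run k rs f) (run k rs g) τ)))
    (forget-linear r c (append (run k rs f)) (append (run k rs g)) σ)

  run-0 : ∀ k rs σ → run k rs (λ _ → 0#) σ ≈ 0#
  run-0 k rs σ = begin
    z                    ≈⟨ solve 1 (λ z → z := (con 1ℚ :* z :+ z) :- z) refl z ⟩
    (ι 1ℚ * z + z) - z   ≈⟨ +-congʳ (sym (run-linear k rs (ι 1ℚ) (λ _ → 0#) (λ _ → 0#) σ)) ⟩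
    run k rs (λ _ → ι 1ℚ * 0# + 0#) σ - z ≈⟨ +-congʳ (run-ext k rs σ (λ _ → trans (+-identityʳ _) (zeroʳ _))) ⟩
    z - z                ≈⟨ -‿inverseʳ z ⟩
    0#                   ∎
    where
    z = run k rs (λ _ → 0#) σ
    run-ext : ∀ k rs {f g} σ → (∀ τ → f τ ≈ g τ) → run k rs f σ ≈ run k rs g σ
    run-ext k []       σ h = forget-ext k σ h
    run-ext k (r ∷ rs) σ h = forget-ext r σ (λ τ → ∑-ext alphabet (λ y → *-congˡ (run-ext k rs (τ ++ y ∷ []) h)))

  run-∑ : ∀ {T : Set} k rs (Zs : List T) (c : T → Carrier) (f : T → List S → Carrier) σ →
    run k rs (λ τ → ∑ Zs (λ z → c z * f z τ)) σ ≈ ∑ Zs (λ z → c z * run k rs (f z) σ)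
  run-∑ k rs []       c f σ = run-0 k rs σ
  run-∑ k rs (z ∷ Zs) c f σ = trans (run-linear k rs (c z) (f z) _ σ) (+-congˡ (run-∑ k rs Zs c f σ))

  module _ (a-unique : ∀ y σ → y ∈ σ → a y σ ≈ 0#) (_≟ˢ_ : DecidableEquality S) where
    -- Comparison on lists without repetition is enough, since the weights never leave them.
    Agree : ℕ → (f g : List S → Carrier) → Set
    Agree j f g = ∀ σ → Unique σ → length σ ≡ j → f σ ≈ g σ

    append-agree : ∀ {j f g} → Agree (suc j) f g → Agree j (append f) (append g)
    append-agree {j} {f} {g} h σ u len = ∑-ext alphabet term
      where
      term : ∀ y → a y σ * f (σ ++ y ∷ []) ≈ a y σ * g (σ ++ y ∷ [])
      term y with DecMem._∈?_ _≟ˢ_ y σ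
      ... | yes y∈ = trans (*-congʳ (a-unique y σ y∈)) (trans (zeroˡ _) (sym (trans (*-congʳ (a-unique y σ y∈)) (zeroˡ _))))
      ... | no y∉  = *-congˡ (h _ (Unique-resp-↭ (↭-sym (snoc-↭ σ y)) (Unique-∷ y∉ u)) (≡.trans (length-snoc σ y) (cong suc len)))

    forget-agree : ∀ r {f g} → Agree r f g → ∀ σ → Unique σ → forget r f σ ≈ forget r g σ
    forget-agree r h σ u with length σ ℕ.≟ r
    forget-agree r h σ       u       | yes e = h σ u e
    forget-agree r h []      u       | no _  = refl
    forget-agree r h (s ∷ σ) (_ ∷ u) | no _  = *-congˡ (forget-agree r h σ u)

    run-agree : ∀ k rs {f g} → Agree k f g → ∀ σ → Unique σ → run k rs f σ ≈ run k rs g σ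
    run-agree k []       h σ u = forget-agree k h σ u
    run-agree k (r ∷ rs) {f} {g} h σ u = forget-agree r {append (run k rs f)} {append (run k rs g)}
      (append-agree {r} {run k rs f} {run k rs g} (λ τ u′ _ → run-agree k rs h τ u′)) σ u

-- Conjugacy of the label operators and the color operators

module TraceEquality (F : Field) (N : ℕ) (x : Fin N → Field.Carrier F)
  (x-distinct : ∀ {a b} → a ≢ b → ¬ (Field._≈_ F (x a) (x b)))
  (x-nonzero : ∀ a → ¬ (Field._≈_ F (x a) (Field.0# F)))
  (esym-nonzero : ∀ i → i ≤ N →
    ¬ (Field._≈_ F (ElementarySymmetric.esym (Field.algebra F) x i (allFin N)) (Field.0# F))) where

  open Field F
  open Sums algebra
  open LinearAlgebra F
  open FieldNumbers F
  open PickSums algebra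
  open ArrangementSums algebra {N}
  open ColorFunctions F N x x-distinct using (Fun; lastly; lastly-snoc)
  open LabelBasis F N x x-distinct x-nonzero esym-nonzero using (basis-independent)
  open Transitions F N
  open PartialArrangements F N x x-distinct x-nonzero esym-nonzero
  open PartialRelations F N x x-distinct x-nonzero esym-nonzero
  open ≈-Reasoning
  open Solver using (solve; _:+_; _:*_; _:-_; _:=_; con; :-_)

  private
    all = allFin N
    module V = Runs algebra all step labelWeight
    module W = Runs algebra all fresh x

  rest : List (Fin N) → List (Fin N)
  rest c = filter (λ a → ¬? (a ∈? c)) all

  rest-full : ∀ {c} → Unique c → Full (c ++ rest c)
  rest-full {c} u = unique-cover
      (Uniqueₚ.++⁺ u (Uniqueₚ.filter⁺ _ (Uniqueₚ.allFin⁺ N)) (λ (a∈ , a∈′) → proj₂ (∈ₚ.∈-filter⁻ (λ a → ¬? (a ∈? c)) {xs = all} a∈′) a∈))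
      (Uniqueₚ.allFin⁺ N) (unique-⊆-length (Uniqueₚ.allFin⁺ N) (λ {a} _ → covered a)) (λ {a} _ → ∈ₚ.∈-allFin a)
    where
    covered : ∀ a → a ∈ c ++ rest c
    covered a with a ∈? c
    ... | yes a∈ = ∈ₚ.∈-++⁺ˡ a∈
    ... | no a∉  = ∈ₚ.∈-++⁺ʳ c (∈ₚ.∈-filter⁺ (λ a → ¬? (a ∈? c)) (∈ₚ.∈-allFin a) a∉)

  complement-↭ : ∀ c {t} → Full (c ++ t) → t ↭ rest c
  complement-↭ c {t} full = cancel-prefix c (↭-trans full (↭-sym (rest-full (take-unique c (full-unique full)))))
    where
    cancel-prefix : ∀ (c : List (Fin N)) {t t′} → c ++ t ↭ c ++ t′ → t ↭ t′
    cancel-prefix []      p = p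
    cancel-prefix (a ∷ c) p = cancel-prefix c (↭ₚ.drop-∷ p)
    take-unique : ∀ (c : List (Fin N)) {t} → Unique (c ++ t) → Unique c
    take-unique []      u       = []
    take-unique (a ∷ c) (a∉ ∷ u) = Allₚ.++⁻ˡ c a∉ ∷ take-unique c u

  -- Entries common to both tails are moved into the prefix, which reduces a permutation to
  -- exchanges of neighbours, handled by `extendBy-tail-swap`.
  tail-↭ : ∀ m σ p {t t′} → length σ ≤ length p → Slots m σ → t ↭ t′ → Full (p ++ t) →
    extendBy m σ (p ++ t) ≈ extendBy m σ (p ++ t′)
  tail-↭ m σ p le slots Perm.refl full = refl
  tail-↭ m σ p {a ∷ t} {_ ∷ t′} le slots (prep a q) full = begin
    extendBy m σ (p ++ a ∷ t)          ≈⟨ extendBy-≡ m {σ} ≡.refl (≡.sym (Listₚ.++-assoc p (a ∷ []) t)) ⟩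
    extendBy m σ ((p ++ a ∷ []) ++ t)
      ≈⟨ tail-↭ m σ (p ++ a ∷ []) (subst (length σ ≤_) (≡.sym (length-snoc p a)) (ℕₚ.m≤n⇒m≤1+n le)) slots q
           (↭-trans (Perm.↭-reflexive (Listₚ.++-assoc p (a ∷ []) t)) full) ⟩
    extendBy m σ ((p ++ a ∷ []) ++ t′) ≈⟨ extendBy-≡ m {σ} ≡.refl (Listₚ.++-assoc p (a ∷ []) t′) ⟩
    extendBy m σ (p ++ a ∷ t′)         ∎
  tail-↭ m σ p {a ∷ b ∷ t} {_ ∷ _ ∷ t′} le slots (swap a b q) full = begin
    extendBy m σ (p ++ a ∷ b ∷ t)          ≈⟨ extendBy-tail-swap m σ p b a t le slots (↭-trans (swap-↭ p b a t) full) ⟩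
    extendBy m σ (p ++ b ∷ a ∷ t)          ≈⟨ extendBy-≡ m {σ} ≡.refl (≡.sym (Listₚ.++-assoc p (b ∷ a ∷ []) t)) ⟩
    extendBy m σ ((p ++ b ∷ a ∷ []) ++ t)
      ≈⟨ tail-↭ m σ (p ++ b ∷ a ∷ []) (subst (length σ ≤_) (≡.sym (Listₚ.length-++ p)) (ℕₚ.m≤n⇒m≤n+o 2 le)) slots q
           (↭-trans (Perm.↭-reflexive (Listₚ.++-assoc p (b ∷ a ∷ []) t)) (↭-trans (swap-↭ p b a t) full)) ⟩
    extendBy m σ ((p ++ b ∷ a ∷ []) ++ t′) ≈⟨ extendBy-≡ m {σ} ≡.refl (Listₚ.++-assoc p (b ∷ a ∷ []) t′) ⟩
    extendBy m σ (p ++ b ∷ a ∷ t′)         ∎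
  tail-↭ m σ p le slots (Perm.trans q q′) full =
    trans (tail-↭ m σ p le slots q full) (tail-↭ m σ p le slots q′ (↭-trans (↭ₚ.++⁺ˡ p (↭-sym q)) full))

  coefficient : ℕ → List (Fin N) → Fun
  coefficient j σ c = extendBy (N ℕ.∸ j) σ (c ++ rest c)

  slots-of : ∀ {σ} j → Unique σ → length σ ≡ j → Slots (N ℕ.∸ j) σ
  slots-of j u ≡.refl = u , ℕₚ.m+[n∸m]≡n (unique-length u)

  -- The matrix g as a map from functions of color tuples to functions of label tuples.
  Φ : ℕ → Fun → Fun
  Φ j φ σ = ∑ (arrangements j) (λ c → coefficient j σ c * φ c)

  fresh-cong : ∀ c {f g : Fin N → Carrier} → (∀ d → d ∉ c → f d ≈ g d) → ∑ all (λ d → fresh d c * f d) ≈ ∑ all (λ d → fresh d c * g d)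
  fresh-cong c h = ∑-ext all (λ d → [assume] (¬? (d ∈? c)) (h d))

  -- With N entries marked neither side can append anything. Otherwise the sum over new labels is
  -- the recursion of `extendBy`, while appending a new color merely takes it from the completing
  -- ones.
  Φ-append : ∀ j φ σ → Unique σ → length σ ≡ j → V.append (Φ (suc j) φ) σ ≈ Φ j (W.append φ) σ
  Φ-append j φ σ u len with ℕₚ.m≤n⇒m<n∨m≡n (subst (_≤ N) len (unique-length u))
  ... | inj₂ ≡.refl = trans (steps-full σ (λ y → full-∈ y (unique-full u len)) _)
      (sym (∑-zero (arrangements j) (λ c c∈ → trans (*-congˡ (∑-zero all (λ d _ → trans (*-congʳ ([no] (¬? (d ∈? c))
        (λ d∉ → d∉ (full-∈ d (∈⇒full c∈))))) (zeroˡ _)))) (zeroʳ _))))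
  ... | inj₁ j<N = begin
    ∑ all (λ y → step y σ * ∑ (arrangements (suc j)) (λ c → coefficient (suc j) (σ ++ y ∷ []) c * φ c))
      ≈⟨ trans (∑-ext all (λ y → ∑-*ˡ (arrangements {N} (suc j)) _ _)) (∑-comm all (arrangements {N} (suc j)) _) ⟩
    ∑ (arrangements (suc j)) (λ c → ∑ all (λ y → step y σ * (coefficient (suc j) (σ ++ y ∷ []) c * φ c)))
      ≈⟨ ∑-ext (arrangements (suc j)) (λ c → trans (∑-ext all (λ y → sym (*-assoc _ _ _))) (sym (∑-*ʳ all (φ c) _))) ⟩
    ∑ (arrangements (suc j)) (λ c → extendBy (suc (N ℕ.∸ suc j)) σ (c ++ rest c) * φ c)
      ≈⟨ arrangements-back j _ ⟩
    ∑ (arrangements j) (λ c → ∑ all (λ d → fresh d c * (extendBy (suc (N ℕ.∸ suc j)) σ ((c ++ d ∷ []) ++ rest (c ++ d ∷ [])) * φ (c ++ d ∷ []))))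
      ≈⟨ ∑-cong (arrangements j) (λ c c∈ → let u′ , len′ = ∈-arrangements⁻ j c∈ in trans
           (fresh-cong c (λ d d∉ → *-congʳ (regroup c u′ len′ d d∉)))
           (trans (∑-ext all (λ d → solve 3 (λ a b c → a :* (b :* c) := b :* (a :* c)) refl (fresh d c) _ (φ (c ++ d ∷ []))))
             (sym (∑-*ˡ all _ _)))) ⟩
    ∑ (arrangements j) (λ c → coefficient j σ c * W.append φ c) ∎
    where
    m≡ : suc (N ℕ.∸ suc j) ≡ N ℕ.∸ j
    m≡ = ≡.sym (ℕₚ.+-∸-assoc 1 j<N)
    regroup : ∀ c → Unique c → length c ≡ j → ∀ d → d ∉ c →
      extendBy (suc (N ℕ.∸ suc j)) σ ((c ++ d ∷ []) ++ rest (c ++ d ∷ [])) ≈ coefficient j σ c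
    regroup c u′ len′ d d∉ = begin
      extendBy (suc (N ℕ.∸ suc j)) σ ((c ++ d ∷ []) ++ rest (c ++ d ∷ []))
        ≡⟨ cong₂ (λ m c → extendBy m σ c) m≡ (Listₚ.++-assoc c (d ∷ []) _) ⟩
      extendBy (N ℕ.∸ j) σ (c ++ d ∷ rest (c ++ d ∷ []))
        ≈⟨ tail-↭ (N ℕ.∸ j) σ c (ℕₚ.≤-reflexive (≡.trans len (≡.sym len′))) (slots-of j u len) (complement-↭ c full) full ⟩
      extendBy (N ℕ.∸ j) σ (c ++ rest c) ∎
      where
      full : Full (c ++ d ∷ rest (c ++ d ∷ []))
      full = ↭-trans (Perm.↭-reflexive (≡.sym (Listₚ.++-assoc c (d ∷ []) _)))
        (rest-full (Unique-resp-↭ (↭-sym (snoc-↭ c d)) (Unique-∷ d∉ u′)))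

  Φ-forget-one : ∀ j φ ψ s τ → Unique (s ∷ τ) → length τ ≡ j → (∀ a c → length c ≡ j → ψ (a ∷ c) ≈ x a * φ c) →
    labelWeight s * Φ j φ τ ≈ Φ (suc j) ψ (s ∷ τ)
  Φ-forget-one j φ ψ s τ u@(_ ∷ uτ) len hψ = sym (begin
    ∑ (arrangements (suc j)) (λ c → coefficient (suc j) (s ∷ τ) c * ψ c)
      ≈⟨ arrangements-front j _ ⟩
    ∑ (arrangements j) (λ c → ∑ all (λ a → fresh a c * (coefficient (suc j) (s ∷ τ) (a ∷ c) * ψ (a ∷ c))))
      ≈⟨ ∑-cong (arrangements j) (λ c c∈ → let u′ , len′ = ∈-arrangements⁻ j c∈ in begin
           ∑ all (λ a → fresh a c * (coefficient (suc j) (s ∷ τ) (a ∷ c) * ψ (a ∷ c)))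
             ≈⟨ ∑-ext all (λ a → trans (*-congˡ (*-congˡ (hψ a c len′)))
                  (solve 4 (λ f e x p → f :* (e :* (x :* p)) := p :* (f :* (x :* e))) refl (fresh a c) _ (x a) (φ c))) ⟩
           ∑ all (λ a → φ c * (fresh a c * (x a * coefficient (suc j) (s ∷ τ) (a ∷ c))))
             ≈⟨ trans (sym (∑-*ˡ all (φ c) _)) (*-congˡ (sym (∑-filter (λ a → ¬? (a ∈? c)) all _))) ⟩
           φ c * ∑ (rest c) (λ a → x a * coefficient (suc j) (s ∷ τ) (a ∷ c))
             ≈⟨ *-congˡ (sym (pick-∑ (rest c) _)) ⟩
           φ c * ∑pick (rest c) (λ a _ _ → x a * coefficient (suc j) (s ∷ τ) (a ∷ c))
             ≈⟨ *-congˡ (pick-cong (rest c) (λ a ρ₁ ρ₂ e → *-congˡ (regroup c u′ len′ a ρ₁ ρ₂ e))) ⟩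
           φ c * ∑pick (rest c) (λ a ρ₁ ρ₂ → x a * extendBy (N ℕ.∸ suc j) (s ∷ τ) (a ∷ c ++ ρ₁ ++ ρ₂))
             ≈⟨ *-congˡ (forget-relation (N ℕ.∸ suc j) s τ c (rest c) (≡.trans len′ (≡.sym len)) slots (rest-full u′)) ⟩
           φ c * (labelWeight s * extendBy (suc (N ℕ.∸ suc j)) τ (c ++ rest c))
             ≈⟨ solve 3 (λ p w e → p :* (w :* e) := w :* (e :* p)) refl (φ c) (labelWeight s) _ ⟩
           labelWeight s * (extendBy (suc (N ℕ.∸ suc j)) τ (c ++ rest c) * φ c)
             ≡⟨ cong (λ m → labelWeight s * (extendBy m τ (c ++ rest c) * φ c)) m≡ ⟩
           labelWeight s * (coefficient j τ c * φ c) ∎) ⟩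
    ∑ (arrangements j) (λ c → labelWeight s * (coefficient j τ c * φ c))
      ≈⟨ ∑-*ˡ (arrangements j) _ _ ⟨
    labelWeight s * Φ j φ τ ∎)
    where
    slots : Slots (N ℕ.∸ suc j) (s ∷ τ)
    slots = slots-of (suc j) u (cong suc len)
    m≡ : suc (N ℕ.∸ suc j) ≡ N ℕ.∸ j
    m≡ = ≡.sym (ℕₚ.+-∸-assoc 1 (subst (λ k → suc k ≤ N) len (unique-length u)))
    regroup : ∀ c → Unique c → length c ≡ j → ∀ a ρ₁ ρ₂ → rest c ≡ ρ₁ ++ a ∷ ρ₂ →
      coefficient (suc j) (s ∷ τ) (a ∷ c) ≈ extendBy (N ℕ.∸ suc j) (s ∷ τ) (a ∷ c ++ ρ₁ ++ ρ₂)
    regroup c u′ len′ a ρ₁ ρ₂ e = sym (tail-↭ (N ℕ.∸ suc j) (s ∷ τ) (a ∷ c) (s≤s (ℕₚ.≤-reflexive (≡.trans len (≡.sym len′))))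
        slots (complement-↭ (a ∷ c) full) full)
      where
      full : Full (a ∷ c ++ ρ₁ ++ ρ₂)
      full = ↭-trans (↭-sym (↭ₚ.shift a c (ρ₁ ++ ρ₂))) (↭-trans (↭ₚ.++⁺ˡ c (↭-trans (↭-sym (↭ₚ.shift a ρ₁ ρ₂)) (Perm.↭-reflexive (≡.sym e)))) (rest-full u′))

  Φ-cong : ∀ j {f g} σ → (∀ c → length c ≡ j → f c ≈ g c) → Φ j f σ ≈ Φ j g σ
  Φ-cong j σ h = ∑-cong (arrangements j) (λ c c∈ → *-congˡ (h c (proj₂ (∈-arrangements⁻ j c∈))))

  Φ-forget : ∀ r φ σ → Unique σ → V.forget r (Φ r φ) σ ≈ Φ (length σ) (W.forget r φ) σ
  Φ-forget r φ σ u with length σ ℕ.≟ r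
  Φ-forget r φ σ       u        | yes ≡.refl = Φ-cong r σ (λ c e → sym (W.forget-here r φ c e))
  Φ-forget r φ []      u        | no ne = sym (trans (+-identityʳ _) (trans (*-congˡ (W.forget-[] r φ ne)) (zeroʳ _)))
  Φ-forget r φ (s ∷ σ) u@(_ ∷ uσ) | no ne = trans (*-congˡ (Φ-forget r φ σ uσ))
    (Φ-forget-one (length σ) (W.forget r φ) (W.forget r φ) s σ u ≡.refl
      (λ a c e → W.forget-∷ r φ a c (λ e′ → ne (≡.trans (cong suc (≡.sym e)) e′))))

  step-unique : ∀ y σ → y ∈ σ → step y σ ≈ 0#
  step-unique y σ = step-∈

  Φ-run : ∀ k rs φ σ → Unique σ → V.run k rs (Φ k φ) σ ≈ Φ (length σ) (W.run k rs φ) σ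
  Φ-run k []       φ σ u = Φ-forget k φ σ u
  Φ-run k (r ∷ rs) φ σ u = trans
    (V.forget-agree step-unique Finₚ._≟_ r {V.append (V.run k rs (Φ k φ))} {Φ r (W.append (W.run k rs φ))} agree σ u)
    (Φ-forget r (W.append (W.run k rs φ)) σ u)
    where
    agree : ∀ τ → Unique τ → length τ ≡ r → V.append (V.run k rs (Φ k φ)) τ ≈ Φ r (W.append (W.run k rs φ)) τ
    agree τ uτ len = trans
      (V.append-agree step-unique Finₚ._≟_ {r} {V.run k rs (Φ k φ)} {Φ (suc r) (W.run k rs φ)}
        (λ ρ uρ len′ → trans (Φ-run k rs φ ρ uρ) (reflexive (cong (λ j → Φ j (W.run k rs φ) ρ) len′))) τ uτ len)
      (Φ-append r (W.run k rs φ) τ uτ len)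

  -- Descend from a missing label y until its predecessor is 0 or marked. Then the weight is a
  -- product of factors 1 + 1/((y - 1) - v), each of which vanishes only for v = y.
  step-nonzero : ∀ {σ} → length σ < N → ∃ λ y → y ∉ σ × ¬ (step y σ ≈ 0#)
  step-nonzero {σ} lt = let y , y∉ = missing lt in descend (toℕ y) y ≡.refl y∉
    where
    descend : ∀ n y → toℕ y ≡ n → y ∉ σ → ∃ λ y → y ∉ σ × ¬ (step y σ ≈ 0#)
    nonzero : ∀ y → y ∉ σ → toℕ y ∈ 0 ∷ values σ → ¬ (step y σ ≈ 0#)
    nonzero y y∉ reach e = ∏≉0 σ (λ t∈ eq → y∉ (subst (_∈ σ) (Finₚ.toℕ-injective (ℕₚ.suc-injective eq)) t∈))
        (trans (sym (trans (*-congʳ ([yes] (reachable? (toℕ y) σ) reach)) (*-identityˡ _))) e)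
      where
      ratio≉0 : ∀ v → v ≢ value y → ¬ (ratio (toℕ y) v ≈ 0#)
      ratio≉0 v ne z with toℕ y ℕ.≟ v
      ... | yes ≡.refl = 1≉0 (trans (sym (ratio-self v)) z)
      ... | no y≢v = ne (≡.sym (ν-injective (begin
          ν (value y)                              ≈⟨ trans (ν-suc (toℕ y)) (+-comm _ _) ⟩
          ν (toℕ y) + 1#                           ≈⟨ solve 3 (λ n o v → n :+ o := ((n :- v) :+ o) :+ v) refl (ν (toℕ y)) 1# (ν v) ⟩
          ((ν (toℕ y) - ν v) + 1#) + ν v
            ≈⟨ +-congʳ (trans (+-cong (sym (*-identityʳ _)) (sym (inv-* y≢v))) (sym (distribˡ _ _ _))) ⟩
          (ν (toℕ y) - ν v) * ratio (toℕ y) v + ν v ≈⟨ +-congʳ (trans (*-congˡ z) (zeroʳ _)) ⟩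
          0# + ν v                                 ≈⟨ +-identityˡ _ ⟩
          ν v                                      ∎)))
      ∏≉0 : ∀ τ → (∀ {t} → t ∈ τ → value t ≢ value y) → ¬ (∏ratio (toℕ y) τ ≈ 0#)
      ∏≉0 []      h = ratio≉0 0 (λ ())
      ∏≉0 (t ∷ τ) h = ≉0-* (ratio≉0 (value t) (h (here ≡.refl))) (∏≉0 τ (λ t∈ → h (there t∈)))
    descend zero    y e y∉ = y , y∉ , nonzero y y∉ (here e)
    descend (suc n) y e y∉ = below (t ∈? σ)
      where
      n<N : n < N
      n<N = ℕₚ.<-trans (subst (n <_) (≡.sym e) (ℕₚ.n<1+n n)) (Finₚ.toℕ<n y)
      t : Fin N
      t = Fin.fromℕ< n<N
      below : Dec (t ∈ σ) → ∃ λ y → y ∉ σ × ¬ (step y σ ≈ 0#)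
      below (no t∉)  = descend n t (Finₚ.toℕ-fromℕ< n<N) t∉
      below (yes t∈) = y , y∉ , nonzero y y∉ (there (subst (_∈ values σ)
        (≡.trans (cong suc (Finₚ.toℕ-fromℕ< n<N)) (≡.sym e)) (∈ₚ.∈-map⁺ value t∈)))

  -- Inserting the recursion turns a relation between tuples of length j into one between tuples of
  -- length j + 1 with coefficients μ σ A(y | σ). These vanish by induction, and each σ has some y
  -- of nonzero weight.
  extendBy-independent : ∀ m j → j ℕ.+ m ≡ N → ∀ (μ : Fun) →
    (∀ c → Full c → ∑ (arrangements j) (λ σ → μ σ * extendBy m σ c) ≈ 0#) → ∀ σ → σ ∈ arrangements j → μ σ ≈ 0#
  extendBy-independent zero    j eq μ rel with ≡.trans (≡.sym (ℕₚ.+-identityʳ j)) eq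
  ... | ≡.refl = basis-independent μ (λ c c∈ → rel c (∈⇒full c∈))
  extendBy-independent (suc m) j eq μ rel σ σ∈ = conclude (step-nonzero (subst (_< N) (≡.sym (proj₂ uσ)) j<N))
    where
    uσ = ∈-arrangements⁻ j σ∈
    j<N : j < N
    j<N = subst (j <_) eq (ℕₚ.m<m+n j (s≤s z≤n))
    μ′ : Fun
    μ′ τ = lastly τ (λ σ y → μ σ * step y σ)
    μ′-snoc : ∀ σ y → μ′ (σ ++ y ∷ []) ≈ μ σ * step y σ
    μ′-snoc σ y = reflexive (lastly-snoc σ y _)
    rel′ : ∀ c → Full c → ∑ (arrangements (suc j)) (λ τ → μ′ τ * extendBy m τ c) ≈ 0#
    rel′ c full = begin
      ∑ (arrangements (suc j)) (λ τ → μ′ τ * extendBy m τ c)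
        ≈⟨ arrangements-back j _ ⟩
      ∑ (arrangements j) (λ σ → ∑ all (λ y → fresh y σ * (μ′ (σ ++ y ∷ []) * extendBy m (σ ++ y ∷ []) c)))
        ≈⟨ ∑-ext (arrangements j) (λ σ → trans (∑-ext all (λ y → term σ y)) (sym (∑-*ˡ all (μ σ) _))) ⟩
      ∑ (arrangements j) (λ σ → μ σ * extendBy (suc m) σ c)
        ≈⟨ rel c full ⟩
      0# ∎
      where
      term : ∀ σ y → fresh y σ * (μ′ (σ ++ y ∷ []) * extendBy m (σ ++ y ∷ []) c) ≈ μ σ * (step y σ * extendBy m (σ ++ y ∷ []) c)
      term σ y = trans (*-congˡ (*-congʳ (μ′-snoc σ y))) (trans (drop-fresh (y ∈? σ)) (*-assoc _ _ _))
        where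
        drop-fresh : Dec (y ∈ σ) → fresh y σ * ((μ σ * step y σ) * extendBy m (σ ++ y ∷ []) c) ≈ (μ σ * step y σ) * extendBy m (σ ++ y ∷ []) c
        drop-fresh (no y∉)  = trans (*-congʳ ([yes] (¬? (y ∈? σ)) y∉)) (*-identityˡ _)
        drop-fresh (yes y∈) = trans (*-congˡ vanish) (trans (zeroʳ _) (sym vanish))
          where
          vanish : (μ σ * step y σ) * extendBy m (σ ++ y ∷ []) c ≈ 0#
          vanish = trans (*-congʳ (trans (*-congˡ (step-∈ y∈)) (zeroʳ _))) (zeroˡ _)
    conclude : (∃ λ y → y ∉ σ × ¬ (step y σ ≈ 0#)) → μ σ ≈ 0#
    conclude (y , y∉ , nz) = cancel nz (trans (*-comm _ _) (trans (sym (μ′-snoc σ y))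
      (extendBy-independent m (suc j) (≡.trans (≡.sym (ℕₚ.+-suc j m)) eq) μ′ rel′ (σ ++ y ∷ [])
        (subst (λ k → σ ++ y ∷ [] ∈ arrangements k) (≡.trans (length-snoc σ y) (cong suc (proj₂ uσ)))
          (∈-arrangements⁺ (Unique-resp-↭ (↭-sym (snoc-↭ σ y)) (Unique-∷ y∉ (proj₁ uσ))))))))

  δ-fun : List (Fin N) → Fun
  δ-fun τ σ = [ σ ≟ᶜ τ ]

  coefficient-independent : ∀ k → k ≤ N → Independent (arrangements k) (arrangements k) (coefficient k)
  coefficient-independent k k≤N μ rel = extendBy-independent (N ℕ.∸ k) k (ℕₚ.m+[n∸m]≡n k≤N) μ rel-full
    where
    rel-full : ∀ c → Full c → ∑ (arrangements k) (λ σ → μ σ * extendBy (N ℕ.∸ k) σ c) ≈ 0#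
    rel-full c full = trans (∑-cong (arrangements k) (λ σ σ∈ → *-congˡ (begin
        extendBy (N ℕ.∸ k) σ c
          ≡⟨ cong (extendBy (N ℕ.∸ k) σ) (≡.sym (Listₚ.take++drop≡id k c)) ⟩
        extendBy (N ℕ.∸ k) σ (take k c ++ drop k c)
          ≈⟨ tail-↭ (N ℕ.∸ k) σ (take k c) (ℕₚ.≤-reflexive (≡.trans (proj₂ (∈-arrangements⁻ k σ∈)) (≡.sym take-length)))
               (slots-of k (proj₁ (∈-arrangements⁻ k σ∈)) (proj₂ (∈-arrangements⁻ k σ∈))) (complement-↭ (take k c) full′) full′ ⟩
        coefficient k σ (take k c) ∎)))
      (rel (take k c) (subst (λ j → take k c ∈ arrangements j) take-length (∈-arrangements⁺ (Uniqueₚ.take⁺ k (full-unique full)))))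
      where
      full′ : Full (take k c ++ drop k c)
      full′ = subst Full (≡.sym (Listₚ.take++drop≡id k c)) full
      take-length : length (take k c) ≡ k
      take-length = ≡.trans (Listₚ.length-take k c) (ℕₚ.m≤n⇒m⊓n≡m (subst (k ≤_) (≡.sym (full-length full)) k≤N))

  trace-equality : ∀ k rs →
    ∑ (arrangements k) (λ σ → V.run k rs (δ-fun σ) σ) ≈ ∑ (arrangements k) (λ c → W.run k rs (δ-fun c) c)
  trace-equality k rs with k ℕ.≤? N
  -- For k > N there are no tuples of distinct entries, and both sums are empty.
  ... | no k≰N = trans (empty (λ σ → V.run k rs (δ-fun σ) σ)) (sym (empty (λ c → W.run k rs (δ-fun c) c)))
    where
    empty : ∀ f → ∑ (arrangements k) f ≈ 0#
    empty f = ∑-zero (arrangements k) (λ σ σ∈ → let u , len = ∈-arrangements⁻ k σ∈ in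
      contradiction (subst (_≤ N) len (unique-length u)) k≰N)
  ... | yes k≤N = trace-conjugate _≟ᶜ_ (arrangements-unique k) (coefficient k) (coefficient-independent k k≤N)
    (λ y z → V.run k rs (δ-fun z) y) (λ c d → W.run k rs (δ-fun d) c) commute
    where
    -- `Φ-run` applied to delta functions, whose images under Φ are the columns of g.
    commute : ∀ y d → y ∈ arrangements k → d ∈ arrangements k →
      ∑ (arrangements k) (λ c → coefficient k y c * W.run k rs (δ-fun d) c)
      ≈ ∑ (arrangements k) (λ z → V.run k rs (δ-fun z) y * coefficient k z d)
    commute y d y∈ d∈ = begin
      Φ k (W.run k rs (δ-fun d)) y
        ≡⟨ cong (λ j → Φ j (W.run k rs (δ-fun d)) y) (≡.sym (proj₂ uy)) ⟩
      Φ (length y) (W.run k rs (δ-fun d)) y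
        ≈⟨ Φ-run k rs (δ-fun d) y (proj₁ uy) ⟨
      V.run k rs (Φ k (δ-fun d)) y
        ≈⟨ V.run-agree step-unique Finₚ._≟_ k rs {Φ k (δ-fun d)} {λ τ → ∑ (arrangements k) (λ z → coefficient k z d * δ-fun z τ)} expand y (proj₁ uy) ⟩
      V.run k rs (λ τ → ∑ (arrangements k) (λ z → coefficient k z d * δ-fun z τ)) y
        ≈⟨ V.run-∑ k rs (arrangements k) (λ z → coefficient k z d) δ-fun y ⟩
      ∑ (arrangements k) (λ z → coefficient k z d * V.run k rs (δ-fun z) y)
        ≈⟨ ∑-ext (arrangements k) (λ z → *-comm _ _) ⟩
      ∑ (arrangements k) (λ z → V.run k rs (δ-fun z) y * coefficient k z d) ∎
      where
      uy = ∈-arrangements⁻ k y∈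
      expand : ∀ τ → Unique τ → length τ ≡ k → Φ k (δ-fun d) τ ≈ ∑ (arrangements k) (λ z → coefficient k z d * δ-fun z τ)
      expand τ u len = begin
        ∑ (arrangements k) (λ c → coefficient k τ c * [ c ≟ᶜ d ])
          ≈⟨ trans (∑-ext (arrangements k) (λ c → *-comm _ _)) (∑-δ _≟ᶜ_ (coefficient k τ) (arrangements-unique k) d∈) ⟩
        coefficient k τ d
          ≈⟨ ∑-δ _≟ᶜ_ (λ z → coefficient k z d) (arrangements-unique k) (subst (λ j → τ ∈ arrangements j) len (∈-arrangements⁺ u)) ⟨
        ∑ (arrangements k) (λ z → [ z ≟ᶜ τ ] * coefficient k z d)
          ≈⟨ ∑-ext (arrangements k) (λ z → trans (*-comm _ _) (*-congˡ ([⇔] (z ≟ᶜ τ) (τ ≟ᶜ z) ≡.sym ≡.sym))) ⟩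
        ∑ (arrangements k) (λ z → coefficient k z d * δ-fun z τ) ∎

-- The polynomial ring and its field of fractions

module Polynomials where
  open Domain
  open ≡.≡-Reasoning

  private variable
    m : ℕ

  pair-++ : (p q : Poly m) → ∀ g → pair (p ++ q) g ≡ pair p g ℚ.+ pair q g
  pair-++ []            q g = ≡.sym (ℚₚ.+-identityˡ _)
  pair-++ ((c , μ) ∷ p) q g = ≡.trans (cong (c ℚ.* g μ ℚ.+_) (pair-++ p q g)) (≡.sym (ℚₚ.+-assoc (c ℚ.* g μ) _ _))

  pair-ext : (p : Poly m) → ∀ {g h} → (∀ μ → g μ ≡ h μ) → pair p g ≡ pair p h
  pair-ext []            e = ≡.refl
  pair-ext ((c , μ) ∷ p) e = cong₂ (λ u v → c ℚ.* u ℚ.+ v) (e μ) (pair-ext p e)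

  pair-0 : (p : Poly m) → pair p (λ _ → 0ℚ) ≡ 0ℚ
  pair-0 []            = ≡.refl
  pair-0 ((c , μ) ∷ p) = ≡.trans (cong₂ ℚ._+_ (ℚₚ.*-zeroʳ c) (pair-0 p)) (ℚₚ.+-identityˡ 0ℚ)

  interchange : ∀ a b c d → (a ℚ.+ b) ℚ.+ (c ℚ.+ d) ≡ (a ℚ.+ c) ℚ.+ (b ℚ.+ d)
  interchange a b c d = begin
    (a ℚ.+ b) ℚ.+ (c ℚ.+ d)   ≡⟨ ℚₚ.+-assoc a b _ ⟩
    a ℚ.+ (b ℚ.+ (c ℚ.+ d))   ≡⟨ cong (a ℚ.+_) (≡.trans (≡.sym (ℚₚ.+-assoc b c d)) (≡.trans (cong (ℚ._+ d) (ℚₚ.+-comm b c)) (ℚₚ.+-assoc c b d))) ⟩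
    a ℚ.+ (c ℚ.+ (b ℚ.+ d))   ≡⟨ ℚₚ.+-assoc a c _ ⟨
    (a ℚ.+ c) ℚ.+ (b ℚ.+ d)   ∎

  pair-+ : (p : Poly m) → ∀ g h → pair p (λ μ → g μ ℚ.+ h μ) ≡ pair p g ℚ.+ pair p h
  pair-+ []            g h = ≡.refl
  pair-+ ((c , μ) ∷ p) g h = ≡.trans (cong₂ ℚ._+_ (ℚₚ.*-distribˡ-+ c _ _) (pair-+ p g h))
    (interchange (c ℚ.* g μ) (c ℚ.* h μ) (pair p g) (pair p h))

  pair-*ˡ : (p : Poly m) → ∀ c g → pair p (λ μ → c ℚ.* g μ) ≡ c ℚ.* pair p g
  pair-*ˡ []            c g = ≡.sym (ℚₚ.*-zeroʳ c)
  pair-*ˡ ((d , μ) ∷ p) c g = ≡.trans (cong₂ ℚ._+_ commute (pair-*ˡ p c g)) (≡.sym (ℚₚ.*-distribˡ-+ c _ _))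
    where
    commute : d ℚ.* (c ℚ.* g μ) ≡ c ℚ.* (d ℚ.* g μ)
    commute = ≡.trans (≡.sym (ℚₚ.*-assoc d c _)) (≡.trans (cong (ℚ._* g μ) (ℚₚ.*-comm d c)) (ℚₚ.*-assoc c d _))

  pair-comm : (p q : Poly m) (h : Monomial m → Monomial m → ℚ) →
    pair p (λ μ → pair q (λ ν → h μ ν)) ≡ pair q (λ ν → pair p (λ μ → h μ ν))
  pair-comm []            q h = ≡.sym (pair-0 q)
  pair-comm ((c , μ) ∷ p) q h = ≡.trans (cong₂ ℚ._+_ (≡.sym (pair-*ˡ q c (h μ))) (pair-comm p q h))
    (≡.sym (pair-+ q (λ ν → c ℚ.* h μ ν) _))

  infix 8 -ᴾ_
  -ᴾ_ : Poly m → Poly m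
  -ᴾ_ = map (λ (c , μ) → ℚ.- c , μ)

  pair-neg : (p : Poly m) → ∀ g → pair (-ᴾ p) g ≡ ℚ.- pair p g
  pair-neg []            g = ≡.refl
  pair-neg ((c , μ) ∷ p) g = ≡.trans (cong₂ ℚ._+_ (≡.sym (ℚₚ.neg-distribˡ-* c (g μ))) (pair-neg p g))
    (≡.sym (ℚₚ.neg-distrib-+ (c ℚ.* g μ) (pair p g)))

  pair-*ᴾ : (p q : Poly m) → ∀ g → pair (p *ᴾ q) g ≡ pair p (λ μ → pair q (λ ν → g (μ ⊕ ν)))
  pair-*ᴾ []            q g = ≡.refl
  pair-*ᴾ ((c , μ) ∷ p) q g = ≡.trans (pair-++ (map _ q) (p *ᴾ q) g) (cong₂ ℚ._+_ (shift q) (pair-*ᴾ p q g))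
    where
    shift : ∀ q → pair (map (λ (d , ν) → c ℚ.* d , μ ⊕ ν) q) g ≡ c ℚ.* pair q (λ ν → g (μ ⊕ ν))
    shift []            = ≡.sym (ℚₚ.*-zeroʳ c)
    shift ((d , ν) ∷ q) = ≡.trans (cong₂ ℚ._+_ (ℚₚ.*-assoc c d _) (shift q)) (≡.sym (ℚₚ.*-distribˡ-+ c _ _))

  from-pair : (p q : Poly m) → (∀ g → pair p g ≡ pair q g) → p ≈ᴾ q
  from-pair p q h α = ≡.trans (coeff-pair p α) (≡.trans (h (δ α)) (≡.sym (coeff-pair q α)))

  -- A list of terms with all total coefficients 0 pairs to 0 with every g; apply this to p - q.
  -- Testing against all functions of monomials, rather than comparing coefficients, reduces the
  -- ring laws to rearranging iterated sums.
  to-pair : {p q : Poly m} → p ≈ᴾ q → ∀ g → pair p g ≡ pair q g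
  to-pair {p = p} {q} p≈q g = ℚRing.x∙y⁻¹≈ε⇒x≈y (pair p g) (pair q g) (begin
    pair p g ℚ.- pair q g        ≡⟨ cong (pair p g ℚ.+_) (≡.sym (pair-neg q g)) ⟩
    pair p g ℚ.+ pair (-ᴾ q) g   ≡⟨ pair-++ p (-ᴾ q) g ⟨
    pair (p ++ -ᴾ q) g           ≡⟨ pair-zero _ (p ++ -ᴾ q) g ℕₚ.≤-refl (λ μ nz → contradiction (vanish μ) nz) ⟩
    0ℚ                           ∎)
    where
    vanish : ∀ μ → [x^ μ ] (p ++ -ᴾ q) ≡ 0ℚ
    vanish μ = begin
      [x^ μ ] (p ++ -ᴾ q)                      ≡⟨ coeff-++ p (-ᴾ q) μ ⟩
      [x^ μ ] p ℚ.+ [x^ μ ] (-ᴾ q)             ≡⟨ cong₂ ℚ._+_ (p≈q μ) (≡.trans (coeff-pair (-ᴾ q) μ) (≡.trans (pair-neg q (δ μ)) (cong ℚ.-_ (≡.sym (coeff-pair q μ))))) ⟩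
      [x^ μ ] q ℚ.- [x^ μ ] q                  ≡⟨ ℚₚ.+-inverseʳ ([x^ μ ] q) ⟩
      0ℚ                                       ∎

  ⊕-comm : (μ ν : Monomial m) → μ ⊕ ν ≡ ν ⊕ μ
  ⊕-comm = Vecₚ.zipWith-comm ℕₚ.+-comm

  ⊕-assoc : (λ′ μ ν : Monomial m) → (λ′ ⊕ μ) ⊕ ν ≡ λ′ ⊕ (μ ⊕ ν)
  ⊕-assoc = Vecₚ.zipWith-assoc ℕₚ.+-assoc

  ⊕-identityˡ : (μ : Monomial m) → Vec.replicate m 0 ⊕ μ ≡ μ
  ⊕-identityˡ = Vecₚ.zipWith-identityˡ ℕₚ.+-identityˡ

  *ᴾ-cong : {p p′ q q′ : Poly m} → p ≈ᴾ p′ → q ≈ᴾ q′ → p *ᴾ q ≈ᴾ p′ *ᴾ q′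
  *ᴾ-cong {p = p} {p′} {q} {q′} hp hq = from-pair (p *ᴾ q) (p′ *ᴾ q′) (λ g → begin
    pair (p *ᴾ q) g                               ≡⟨ pair-*ᴾ p q g ⟩
    pair p (λ μ → pair q (λ ν → g (μ ⊕ ν)))       ≡⟨ pair-ext p (λ μ → to-pair {p = q} {q′} hq _) ⟩
    pair p (λ μ → pair q′ (λ ν → g (μ ⊕ ν)))      ≡⟨ to-pair {p = p} {p′} hp _ ⟩
    pair p′ (λ μ → pair q′ (λ ν → g (μ ⊕ ν)))     ≡⟨ pair-*ᴾ p′ q′ g ⟨
    pair (p′ *ᴾ q′) g                             ∎)

  *ᴾ-comm : (p q : Poly m) → p *ᴾ q ≈ᴾ q *ᴾ p
  *ᴾ-comm p q = from-pair (p *ᴾ q) (q *ᴾ p) (λ g → begin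
    pair (p *ᴾ q) g                               ≡⟨ pair-*ᴾ p q g ⟩
    pair p (λ μ → pair q (λ ν → g (μ ⊕ ν)))       ≡⟨ pair-comm p q (λ μ ν → g (μ ⊕ ν)) ⟩
    pair q (λ ν → pair p (λ μ → g (μ ⊕ ν)))       ≡⟨ pair-ext q (λ ν → pair-ext p (λ μ → cong g (⊕-comm μ ν))) ⟩
    pair q (λ ν → pair p (λ μ → g (ν ⊕ μ)))       ≡⟨ pair-*ᴾ q p g ⟨
    pair (q *ᴾ p) g                               ∎)

  *ᴾ-assoc : (p q r : Poly m) → (p *ᴾ q) *ᴾ r ≈ᴾ p *ᴾ (q *ᴾ r)
  *ᴾ-assoc p q r = from-pair ((p *ᴾ q) *ᴾ r) (p *ᴾ (q *ᴾ r)) (λ g → begin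
    pair ((p *ᴾ q) *ᴾ r) g
      ≡⟨ ≡.trans (pair-*ᴾ (p *ᴾ q) r g) (pair-*ᴾ p q _) ⟩
    pair p (λ λ′ → pair q (λ μ → pair r (λ ν → g ((λ′ ⊕ μ) ⊕ ν))))
      ≡⟨ pair-ext p (λ λ′ → pair-ext q (λ μ → pair-ext r (λ ν → cong g (⊕-assoc λ′ μ ν)))) ⟩
    pair p (λ λ′ → pair q (λ μ → pair r (λ ν → g (λ′ ⊕ (μ ⊕ ν)))))
      ≡⟨ pair-ext p (λ λ′ → ≡.sym (pair-*ᴾ q r (λ κ → g (λ′ ⊕ κ)))) ⟩
    pair p (λ λ′ → pair (q *ᴾ r) (λ κ → g (λ′ ⊕ κ)))
      ≡⟨ pair-*ᴾ p (q *ᴾ r) g ⟨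
    pair (p *ᴾ (q *ᴾ r)) g ∎)

  *ᴾ-identityˡ : (p : Poly m) → 1ᴾ *ᴾ p ≈ᴾ p
  *ᴾ-identityˡ p = from-pair (1ᴾ *ᴾ p) p (λ g → ≡.trans (pair-*ᴾ 1ᴾ p g) (≡.trans (ℚₚ.+-identityʳ _) (≡.trans (ℚₚ.*-identityˡ _)
    (pair-ext p (λ μ → cong g (⊕-identityˡ μ))))))

  *ᴾ-distribʳ : (p q r : Poly m) → (q +ᴾ r) *ᴾ p ≈ᴾ q *ᴾ p +ᴾ r *ᴾ p
  *ᴾ-distribʳ p q r = from-pair ((q +ᴾ r) *ᴾ p) (q *ᴾ p +ᴾ r *ᴾ p) (λ g → begin
    pair ((q ++ r) *ᴾ p) g                        ≡⟨ ≡.trans (pair-*ᴾ (q ++ r) p g) (pair-++ q r _) ⟩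
    pair q _ ℚ.+ pair r _                         ≡⟨ cong₂ ℚ._+_ (≡.sym (pair-*ᴾ q p g)) (≡.sym (pair-*ᴾ r p g)) ⟩
    pair (q *ᴾ p) g ℚ.+ pair (r *ᴾ p) g           ≡⟨ pair-++ (q *ᴾ p) (r *ᴾ p) g ⟨
    pair (q *ᴾ p ++ r *ᴾ p) g                     ∎)

  +ᴾ-cong : {p p′ q q′ : Poly m} → p ≈ᴾ p′ → q ≈ᴾ q′ → p +ᴾ q ≈ᴾ p′ +ᴾ q′
  +ᴾ-cong {p = p} {p′} {q} {q′} hp hq α = ≡.trans (coeff-++ p q α) (≡.trans (cong₂ ℚ._+_ (hp α) (hq α)) (≡.sym (coeff-++ p′ q′ α)))

  +ᴾ-comm : (p q : Poly m) → p +ᴾ q ≈ᴾ q +ᴾ p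
  +ᴾ-comm p q α = ≡.trans (coeff-++ p q α) (≡.trans (ℚₚ.+-comm ([x^ α ] p) ([x^ α ] q)) (≡.sym (coeff-++ q p α)))

  -ᴾ-inverseʳ : (p : Poly m) → p +ᴾ -ᴾ p ≈ᴾ 0ᴾ
  -ᴾ-inverseʳ p = from-pair (p +ᴾ -ᴾ p) 0ᴾ (λ g → ≡.trans (pair-++ p (-ᴾ p) g) (≡.trans (cong (pair p g ℚ.+_) (pair-neg p g)) (ℚₚ.+-inverseʳ (pair p g))))

  -ᴾ-cong : {p q : Poly m} → p ≈ᴾ q → -ᴾ p ≈ᴾ -ᴾ q
  -ᴾ-cong {p = p} {q} h = from-pair (-ᴾ p) (-ᴾ q) (λ g → ≡.trans (pair-neg p g) (≡.trans (cong ℚ.-_ (to-pair {p = p} {q} h g)) (≡.sym (pair-neg q g))))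

  ≈ᴾ-trans : {p q r : Poly m} → p ≈ᴾ q → q ≈ᴾ r → p ≈ᴾ r
  ≈ᴾ-trans h k α = ≡.trans (h α) (k α)

  polyRing : ℕ → CommutativeRing 0ℓ 0ℓ
  polyRing m = record
    { Carrier = Poly m ; _≈_ = _≈ᴾ_ ; _+_ = _+ᴾ_ ; _*_ = _*ᴾ_ ; -_ = -ᴾ_ ; 0# = 0ᴾ ; 1# = 1ᴾ
    ; isCommutativeRing = record
      { isRing = record
        { +-isAbelianGroup = record
          { isGroup = record
            { isMonoid = record
              { isSemigroup = record
                { isMagma = record
                  { isEquivalence = record
                    { refl = λ _ → ≡.refl ; sym = λ h α → ≡.sym (h α)
                    ; trans = λ {p} {q} {r} → ≈ᴾ-trans {p = p} {q} {r} }
                  ; ∙-cong = λ {p} {p′} {q} {q′} → +ᴾ-cong {p = p} {p′} {q} {q′} }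
                ; assoc = λ p q r α → cong (λ l → [x^ α ] l) (Listₚ.++-assoc p q r) }
              ; identity = (λ p α → ≡.refl) , (λ p α → cong (λ l → [x^ α ] l) (Listₚ.++-identityʳ p)) }
            ; inverse = (λ p → ≈ᴾ-trans {p = -ᴾ p +ᴾ p} {p +ᴾ -ᴾ p} {0ᴾ} (+ᴾ-comm (-ᴾ p) p) (-ᴾ-inverseʳ p)) , -ᴾ-inverseʳ
            ; ⁻¹-cong = λ {p} {q} → -ᴾ-cong {p = p} {q} }
          ; comm = +ᴾ-comm }
        ; *-cong = λ {p} {p′} {q} {q′} → *ᴾ-cong {p = p} {p′} {q} {q′}
        ; *-assoc = *ᴾ-assoc
        ; *-identity = *ᴾ-identityˡ , λ p → ≈ᴾ-trans {p = p *ᴾ 1ᴾ} {1ᴾ *ᴾ p} {p} (*ᴾ-comm p 1ᴾ) (*ᴾ-identityˡ p)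
        ; distrib = (λ p q r → ≈ᴾ-trans {p = p *ᴾ (q +ᴾ r)} {(q +ᴾ r) *ᴾ p} {p *ᴾ q +ᴾ p *ᴾ r} (*ᴾ-comm p (q +ᴾ r))
            (≈ᴾ-trans {p = (q +ᴾ r) *ᴾ p} {q *ᴾ p +ᴾ r *ᴾ p} {p *ᴾ q +ᴾ p *ᴾ r} (*ᴾ-distribʳ p q r)
              (+ᴾ-cong {p = q *ᴾ p} {p *ᴾ q} {r *ᴾ p} {p *ᴾ r} (*ᴾ-comm q p) (*ᴾ-comm r p))))
          , *ᴾ-distribʳ }
      ; *-comm = *ᴾ-comm } }

  polyAlgebra : ℕ → RationalAlgebra
  polyAlgebra m = record
    { commutativeRing = polyRing m
    ; ι   = constᴾ
    ; ι-+ = λ c d → from-pair (constᴾ (c ℚ.+ d)) (constᴾ c +ᴾ constᴾ d) (λ g → constants c d (g (Vec.replicate m 0)))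
    ; ι-* = λ c d α → cong (λ μ → [x^ α ] ((c ℚ.* d , μ) ∷ [])) (≡.sym (⊕-identityˡ (Vec.replicate m 0)))
    ; ι-1 = λ _ → ≡.refl }
    where
    constants : ∀ c d x → (c ℚ.+ d) ℚ.* x ℚ.+ 0ℚ ≡ c ℚ.* x ℚ.+ (d ℚ.* x ℚ.+ 0ℚ)
    constants c d x = ≡.trans (cong (ℚ._+ 0ℚ) (ℚₚ.*-distribʳ-+ x c d)) (ℚₚ.+-assoc (c ℚ.* x) (d ℚ.* x) 0ℚ)

  -- Only the exponents that occur in the list of terms have to be inspected.
  zero? : (p : Poly m) → Dec (p ≈ᴾ 0ᴾ)
  zero? p with all? (λ μ → [x^ μ ] p ℚₚ.≟ 0ℚ) (map proj₂ p)
  ... | no some = no (λ p≈0 → some (All.universal p≈0 _))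
  ... | yes zs  = yes vanish
    where
    vanish : p ≈ᴾ 0ᴾ
    vanish μ with [x^ μ ] p ℚₚ.≟ 0ℚ
    ... | yes z = z
    ... | no nz = contradiction (All.lookup zs (coeff-support p nz)) nz

-- a/b ≈ c/d means a d ≈ c b.
module FractionLaws (Alg : RationalAlgebra)
  (noZeroDivisors : ∀ p d → ¬ (RationalAlgebra._≈_ Alg d (RationalAlgebra.0# Alg)) →
    RationalAlgebra._≈_ Alg (RationalAlgebra._*_ Alg p d) (RationalAlgebra.0# Alg) →
    RationalAlgebra._≈_ Alg p (RationalAlgebra.0# Alg)) where
  open RationalAlgebra Alg
  open Solver using (solve; _:+_; _:*_; _:-_; _:=_; con; :-_)
  open ≈-Reasoning

  cancel : ∀ p q d → ¬ (d ≈ 0#) → p * d ≈ q * d → p ≈ q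
  cancel p q d d≉0 e = Rₚ.x∙y⁻¹≈ε⇒x≈y p q (noZeroDivisors (p - q) d d≉0 (begin
    (p - q) * d       ≈⟨ solve 3 (λ p q d → (p :- q) :* d := p :* d :- q :* d) refl p q d ⟩
    p * d - q * d     ≈⟨ Rₚ.x≈y⇒x∙y⁻¹≈ε e ⟩
    0#                ∎))

  -- Crosswise equality is transitive only after cancelling the middle denominator d, which is where
  -- the absence of zero divisors enters.
  transᶠ : ∀ a b c d e f → ¬ (d ≈ 0#) → a * d ≈ c * b → c * f ≈ e * d → a * f ≈ e * b
  transᶠ a b c d e f d≉0 h k = cancel (a * f) (e * b) d d≉0 (begin
    (a * f) * d   ≈⟨ solve 3 (λ a f d → (a :* f) :* d := (a :* d) :* f) refl a f d ⟩
    (a * d) * f   ≈⟨ *-congʳ h ⟩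
    (c * b) * f   ≈⟨ solve 3 (λ c b f → (c :* b) :* f := (c :* f) :* b) refl c b f ⟩
    (c * f) * b   ≈⟨ *-congʳ k ⟩
    (e * d) * b   ≈⟨ solve 3 (λ e d b → (e :* d) :* b := (e :* b) :* d) refl e d b ⟩
    (e * b) * d   ∎)

  +-congᶠ : ∀ a b a′ b′ c d c′ d′ → a * b′ ≈ a′ * b → c * d′ ≈ c′ * d →
    (a * d + c * b) * (b′ * d′) ≈ (a′ * d′ + c′ * b′) * (b * d)
  +-congᶠ a b a′ b′ c d c′ d′ h k = begin
    (a * d + c * b) * (b′ * d′)
      ≈⟨ solve 6 (λ a b c d b′ d′ → (a :* d :+ c :* b) :* (b′ :* d′) := (a :* b′) :* (d :* d′) :+ (c :* d′) :* (b :* b′)) refl a b c d b′ d′ ⟩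
    (a * b′) * (d * d′) + (c * d′) * (b * b′)
      ≈⟨ +-cong (*-congʳ h) (*-congʳ k) ⟩
    (a′ * b) * (d * d′) + (c′ * d) * (b * b′)
      ≈⟨ solve 6 (λ a′ b c′ d b′ d′ → (a′ :* b) :* (d :* d′) :+ (c′ :* d) :* (b :* b′) := (a′ :* d′ :+ c′ :* b′) :* (b :* d)) refl a′ b c′ d b′ d′ ⟩
    (a′ * d′ + c′ * b′) * (b * d) ∎

  *-congᶠ : ∀ a b a′ b′ c d c′ d′ → a * b′ ≈ a′ * b → c * d′ ≈ c′ * d →
    (a * c) * (b′ * d′) ≈ (a′ * c′) * (b * d)
  *-congᶠ a b a′ b′ c d c′ d′ h k = begin
    (a * c) * (b′ * d′)   ≈⟨ solve 4 (λ a c b d → (a :* c) :* (b :* d) := (a :* b) :* (c :* d)) refl a c b′ d′ ⟩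
    (a * b′) * (c * d′)   ≈⟨ *-cong h k ⟩
    (a′ * b) * (c′ * d)   ≈⟨ solve 4 (λ a b c d → (a :* b) :* (c :* d) := (a :* c) :* (b :* d)) refl a′ b c′ d ⟩
    (a′ * c′) * (b * d)   ∎

  negᶠ : ∀ a b c d → a * d ≈ c * b → - a * d ≈ - c * b
  negᶠ a b c d h = trans (sym (Rₚ.-‿distribˡ-* a d)) (trans (-‿cong h) (Rₚ.-‿distribˡ-* c b))

  +-assocᶠ : ∀ a b c d e f → ((a * d + c * b) * f + e * (b * d)) * (b * (d * f)) ≈ (a * (d * f) + (c * f + e * d) * b) * ((b * d) * f)
  +-assocᶠ = solve 6 (λ a b c d e f → ((a :* d :+ c :* b) :* f :+ e :* (b :* d)) :* (b :* (d :* f))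
    := (a :* (d :* f) :+ (c :* f :+ e :* d) :* b) :* ((b :* d) :* f)) refl

  +-identityˡᶠ : ∀ a b → (0# * b + a * 1#) * b ≈ a * (1# * b)
  +-identityˡᶠ a b = *-cong (trans (+-cong (zeroˡ b) (*-identityʳ a)) (+-identityˡ a)) (sym (*-identityˡ b))

  +-commᶠ : ∀ a b c d → (a * d + c * b) * (d * b) ≈ (c * b + a * d) * (b * d)
  +-commᶠ = solve 4 (λ a b c d → (a :* d :+ c :* b) :* (d :* b) := (c :* b :+ a :* d) :* (b :* d)) refl

  -‿inverseˡᶠ : ∀ a b → (- a * b + a * b) * 1# ≈ 0# * (b * b)
  -‿inverseˡᶠ a b = trans (*-identityʳ _) (trans (trans (+-congʳ (sym (Rₚ.-‿distribˡ-* a b))) (-‿inverseˡ (a * b))) (sym (zeroˡ _)))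

  *-assocᶠ : ∀ a b c d e f → ((a * c) * e) * (b * (d * f)) ≈ (a * (c * e)) * ((b * d) * f)
  *-assocᶠ = solve 6 (λ a b c d e f → ((a :* c) :* e) :* (b :* (d :* f)) := (a :* (c :* e)) :* ((b :* d) :* f)) refl

  *-commᶠ : ∀ a b c d → (a * c) * (d * b) ≈ (c * a) * (b * d)
  *-commᶠ = solve 4 (λ a b c d → (a :* c) :* (d :* b) := (c :* a) :* (b :* d)) refl

  *-identityˡᶠ : ∀ a b → (1# * a) * b ≈ a * (1# * b)
  *-identityˡᶠ a b = *-cong (*-identityˡ a) (sym (*-identityˡ b))

  distribˡᶠ : ∀ a b c d e f →
    (a * (c * f + e * d)) * ((b * d) * (b * f)) ≈ ((a * c) * (b * f) + (a * e) * (b * d)) * (b * (d * f))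
  distribˡᶠ = solve 6 (λ a b c d e f →
    (a :* (c :* f :+ e :* d)) :* ((b :* d) :* (b :* f)) := ((a :* c) :* (b :* f) :+ (a :* e) :* (b :* d)) :* (b :* (d :* f))) refl

  over-one : ∀ a b → (a + b) * (1# * 1#) ≈ (a * 1# + b * 1#) * 1#
  over-one a b = trans (*-cong (+-cong (sym (*-identityʳ a)) (sym (*-identityʳ b))) (*-identityˡ 1#)) refl

  over-one-* : ∀ a b → (a * b) * (1# * 1#) ≈ (a * b) * 1#
  over-one-* a b = *-congˡ (*-identityˡ 1#)

  numerator-zero : ∀ a b → a * 1# ≈ 0# * b → a ≈ 0#
  numerator-zero a b h = trans (sym (*-identityʳ a)) (trans h (zeroˡ b))

  zero-numerator : ∀ a b → a ≈ 0# → a * 1# ≈ 0# * b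
  zero-numerator a b h = trans (*-identityʳ a) (trans h (sym (zeroˡ b)))

  reciprocalᶠ : ∀ a b → (a * b) * 1# ≈ 1# * (b * a)
  reciprocalᶠ a b = trans (*-identityʳ _) (trans (*-comm a b) (sym (*-identityˡ _)))

module Fractions (m : ℕ) where
  open Polynomials using (polyAlgebra; zero?; -ᴾ_)
  private
    module P = RationalAlgebra (polyAlgebra m)
    noZeroDivisors : ∀ (p d : Poly m) → d ≉ᴾ 0ᴾ → p *ᴾ d ≈ᴾ 0ᴾ → p ≈ᴾ 0ᴾ
    noZeroDivisors p d d≉0 e with zero? p
    ... | yes z = z
    ... | no nz = contradiction e (Domain.*ᴾ-≉0 p d nz d≉0)
    module L = FractionLaws (polyAlgebra m) noZeroDivisors

  -ᶠ_ : Frac m → Frac m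
  -ᶠ frac a b nz = frac (-ᴾ a) b nz

  ≈ᶠ-trans : ∀ {u v w : Frac m} → u ≈ᶠ v → v ≈ᶠ w → u ≈ᶠ w
  ≈ᶠ-trans {frac a b _} {frac c d d≉0} {frac e f _} = L.transᶠ a b c d e f d≉0

  fracRing : CommutativeRing 0ℓ 0ℓ
  fracRing = record
    { Carrier = Frac m ; _≈_ = _≈ᶠ_ ; _+_ = _+ᶠ_ ; _*_ = _*ᶠ_ ; -_ = -ᶠ_ ; 0# = 0ᶠ ; 1# = fromPoly 1ᴾ
    ; isCommutativeRing = record
      { isRing = record
        { +-isAbelianGroup = record
          { isGroup = record
            { isMonoid = record
              { isSemigroup = record
                { isMagma = record
                  { isEquivalence = record
                    { refl = λ _ → ≡.refl ; sym = λ h α → ≡.sym (h α)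
                    ; trans = λ {u} {v} {w} → ≈ᶠ-trans {u} {v} {w} }
                  ; ∙-cong = λ { {frac a b _} {frac a′ b′ _} {frac c d _} {frac c′ d′ _} → L.+-congᶠ a b a′ b′ c d c′ d′ } }
                ; assoc = λ (frac a b _) (frac c d _) (frac e f _) → L.+-assocᶠ a b c d e f }
              ; identity = +ᶠ-identityˡ , λ u → ≈ᶠ-trans {u +ᶠ 0ᶠ} {0ᶠ +ᶠ u} {u} (+ᶠ-comm u 0ᶠ) (+ᶠ-identityˡ u) }
            ; inverse = -ᶠ-inverseˡ , λ u → ≈ᶠ-trans {u +ᶠ (-ᶠ u)} {(-ᶠ u) +ᶠ u} {0ᶠ} (+ᶠ-comm u (-ᶠ u)) (-ᶠ-inverseˡ u)
            ; ⁻¹-cong = λ { {frac a b _} {frac c d _} → L.negᶠ a b c d } }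
          ; comm = +ᶠ-comm }
        ; *-cong = λ { {frac a b _} {frac a′ b′ _} {frac c d _} {frac c′ d′ _} → L.*-congᶠ a b a′ b′ c d c′ d′ }
        ; *-assoc = λ (frac a b _) (frac c d _) (frac e f _) → L.*-assocᶠ a b c d e f
        ; *-identity = *ᶠ-identityˡ , λ u → ≈ᶠ-trans {u *ᶠ fromPoly 1ᴾ} {fromPoly 1ᴾ *ᶠ u} {u} (*ᶠ-comm u (fromPoly 1ᴾ)) (*ᶠ-identityˡ u)
        ; distrib = *ᶠ-distribˡ , λ u v w → ≈ᶠ-trans {(v +ᶠ w) *ᶠ u} {u *ᶠ (v +ᶠ w)} {v *ᶠ u +ᶠ w *ᶠ u} (*ᶠ-comm (v +ᶠ w) u)
            (≈ᶠ-trans {u *ᶠ (v +ᶠ w)} {u *ᶠ v +ᶠ u *ᶠ w} {v *ᶠ u +ᶠ w *ᶠ u} (*ᶠ-distribˡ u v w)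
              (+ᶠ-cong (u *ᶠ v) (v *ᶠ u) (u *ᶠ w) (w *ᶠ u) (*ᶠ-comm u v) (*ᶠ-comm u w))) }
      ; *-comm = *ᶠ-comm } }
    where
    +ᶠ-identityˡ : (u : Frac m) → 0ᶠ +ᶠ u ≈ᶠ u
    +ᶠ-identityˡ (frac a b _) = L.+-identityˡᶠ a b
    +ᶠ-comm : (u v : Frac m) → u +ᶠ v ≈ᶠ v +ᶠ u
    +ᶠ-comm (frac a b _) (frac c d _) = L.+-commᶠ a b c d
    -ᶠ-inverseˡ : (u : Frac m) → (-ᶠ u) +ᶠ u ≈ᶠ 0ᶠ
    -ᶠ-inverseˡ (frac a b _) = L.-‿inverseˡᶠ a b
    *ᶠ-comm : (u v : Frac m) → u *ᶠ v ≈ᶠ v *ᶠ u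
    *ᶠ-comm (frac a b _) (frac c d _) = L.*-commᶠ a b c d
    *ᶠ-identityˡ : (u : Frac m) → fromPoly 1ᴾ *ᶠ u ≈ᶠ u
    *ᶠ-identityˡ (frac a b _) = L.*-identityˡᶠ a b
    *ᶠ-distribˡ : (u v w : Frac m) → u *ᶠ (v +ᶠ w) ≈ᶠ u *ᶠ v +ᶠ u *ᶠ w
    *ᶠ-distribˡ (frac a b _) (frac c d _) (frac e f _) = L.distribˡᶠ a b c d e f
    +ᶠ-cong : (u u′ v v′ : Frac m) → u ≈ᶠ u′ → v ≈ᶠ v′ → u +ᶠ v ≈ᶠ u′ +ᶠ v′
    +ᶠ-cong (frac a b _) (frac a′ b′ _) (frac c d _) (frac c′ d′ _) = L.+-congᶠ a b a′ b′ c d c′ d′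

  fromPoly-cong : ∀ {p q} → p ≈ᴾ q → fromPoly p ≈ᶠ fromPoly q
  fromPoly-cong {p} {q} h = P.*-congʳ {1ᴾ} {p} {q} h

  fromPoly-injective : ∀ {p q} → fromPoly p ≈ᶠ fromPoly q → p ≈ᴾ q
  fromPoly-injective {p} {q} h = P.trans {p} {p *ᴾ 1ᴾ} {q} (P.sym {p *ᴾ 1ᴾ} {p} (P.*-identityʳ p))
    (P.trans {p *ᴾ 1ᴾ} {q *ᴾ 1ᴾ} {q} h (P.*-identityʳ q))

  fromPoly-+ : ∀ p q → fromPoly (p +ᴾ q) ≈ᶠ fromPoly p +ᶠ fromPoly q
  fromPoly-+ p q = L.over-one p q

  fromPoly-* : ∀ p q → fromPoly (p *ᴾ q) ≈ᶠ fromPoly p *ᶠ fromPoly q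
  fromPoly-* p q = L.over-one-* p q

  fracAlgebra : RationalAlgebra
  fracAlgebra = record
    { commutativeRing = fracRing
    ; ι   = fromℚ
    ; ι-+ = λ c d → ≈ᶠ-trans {fromℚ (c ℚ.+ d)} {fromPoly (constᴾ c +ᴾ constᴾ d)} {fromℚ c +ᶠ fromℚ d}
              (fromPoly-cong {constᴾ (c ℚ.+ d)} {constᴾ c +ᴾ constᴾ d} (P.ι-+ c d)) (fromPoly-+ (constᴾ c) (constᴾ d))
    ; ι-* = λ c d → ≈ᶠ-trans {fromℚ (c ℚ.* d)} {fromPoly (constᴾ c *ᴾ constᴾ d)} {fromℚ c *ᶠ fromℚ d}
              (fromPoly-cong {constᴾ (c ℚ.* d)} {constᴾ c *ᴾ constᴾ d} (P.ι-* c d)) (fromPoly-* (constᴾ c) (constᴾ d))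
    ; ι-1 = λ _ → ≡.refl }

  fracField : Field
  fracField = record
    { algebra    = fracAlgebra
    ; _≟0        = decide-zero
    ; 1≉0        = λ h → 1ᴾ≉0 {m} (fromPoly-injective {1ᴾ} {0ᴾ} h)
    ; invertible = λ {u} → inverse {u} }
    where
    decide-zero : (u : Frac m) → Dec (u ≈ᶠ 0ᶠ)
    decide-zero (frac a b _) with zero? a
    ... | yes z = yes (L.zero-numerator a b z)
    ... | no nz = no (λ h → nz (L.numerator-zero a b h))
    inverse : {u : Frac m} → ¬ (u ≈ᶠ 0ᶠ) → ∃ λ v → u *ᶠ v ≈ᶠ fromPoly 1ᴾ
    inverse {frac a b nz} u≉0 = frac b a (λ z → u≉0 (L.zero-numerator a b z)) , L.reciprocalᶠ a b

-- `embed` is the identity in disguise: from here on the field is known only through its operations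
-- and the homomorphism laws listed here.
module RationalFunctions (m : ℕ) where
  open Fractions m
  abstract
    rationalFunctions : Field
    rationalFunctions = fracField

  open Field rationalFunctions

  abstract
    embed : Frac m → Carrier
    embed u = u

    embed-cong : ∀ u v → u ≈ᶠ v → embed u ≈ embed v
    embed-cong u v h = h

    embed-reflects : ∀ u v → embed u ≈ embed v → u ≈ᶠ v
    embed-reflects u v h = h

    embed-+ : ∀ u v → embed (u +ᶠ v) ≈ embed u + embed v
    embed-+ u v = refl {u +ᶠ v}

    embed-* : ∀ u v → embed (u *ᶠ v) ≈ embed u * embed v
    embed-* u v = refl {u *ᶠ v}

    embed-0 : embed 0ᶠ ≈ 0#
    embed-0 = refl {0ᶠ}

    embed-ℚ : ∀ c → embed (fromℚ c) ≈ ι c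
    embed-ℚ c = refl {fromℚ c}

    embed-den : ∀ a b nz → embed (frac a b nz) * embed (fromPoly b) ≈ embed (fromPoly a)
    embed-den a b nz = RationalAlgebra.*-assoc (Polynomials.polyAlgebra m) a b 1ᴾ

  poly : Poly m → Carrier
  poly p = embed (fromPoly p)

  poly-injective : ∀ p q → poly p ≈ poly q → p ≈ᴾ q
  poly-injective p q h = fromPoly-injective {p} {q} (embed-reflects (fromPoly p) (fromPoly q) h)

  poly-+ : ∀ p q → poly (p +ᴾ q) ≈ poly p + poly q
  poly-+ p q = trans (embed-cong (fromPoly (p +ᴾ q)) (fromPoly p +ᶠ fromPoly q) (fromPoly-+ p q)) (embed-+ (fromPoly p) (fromPoly q))

  poly-* : ∀ p q → poly (p *ᴾ q) ≈ poly p * poly q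
  poly-* p q = trans (embed-cong (fromPoly (p *ᴾ q)) (fromPoly p *ᶠ fromPoly q) (fromPoly-* p q)) (embed-* (fromPoly p) (fromPoly q))

  poly-0 : poly 0ᴾ ≈ 0#
  poly-0 = embed-0

  poly-ι : ∀ c → poly (constᴾ c) ≈ ι c
  poly-ι = embed-ℚ

  poly-1 : poly 1ᴾ ≈ 1#
  poly-1 = trans (poly-ι 1ℚ) ι-1

  poly-≉0 : ∀ {p} → p ≉ᴾ 0ᴾ → ¬ (poly p ≈ 0#)
  poly-≉0 {p} nz h = nz (poly-injective p 0ᴾ (trans h (sym poly-0)))

-- Variables, contents of colorings and elementary symmetric polynomials

unit : ∀ {n} → Fin n → Monomial n
unit Fin.zero    = 1 ∷ Vec.replicate _ 0
unit (Fin.suc c) = 0 ∷ unit c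

lookup-unit : ∀ {n} (c d : Fin n) → lookup (unit c) d ≡ (if does (c Finₚ.≟ d) then 1 else 0)
lookup-unit Fin.zero    Fin.zero    = ≡.refl
lookup-unit Fin.zero    (Fin.suc d) = Vecₚ.lookup-replicate d 0
lookup-unit (Fin.suc c) Fin.zero    = ≡.refl
lookup-unit (Fin.suc c) (Fin.suc d) = lookup-unit c d

unit-injective : ∀ {n} {c d : Fin n} → unit c ≡ unit d → c ≡ d
unit-injective {c = Fin.zero}  {Fin.zero}  e = ≡.refl
unit-injective {c = Fin.zero}  {Fin.suc d} e = contradiction (Vecₚ.∷-injectiveˡ e) (λ ())
unit-injective {c = Fin.suc c} {Fin.zero}  e = contradiction (Vecₚ.∷-injectiveˡ e) (λ ())
unit-injective {c = Fin.suc c} {Fin.suc d} e = cong Fin.suc (unit-injective (Vecₚ.∷-injectiveʳ e))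

content-∷ : ∀ {n N} (c : Fin N) (κ : Vec (Fin N) n) → content (c ∷ κ) ≡ unit c ⊕ content κ
content-∷ c κ = ≡.trans (Vecₚ.tabulate-cong pointwise) (Vecₚ.tabulate∘lookup (unit c ⊕ content κ))
  where
  pointwise : ∀ d → Vec.count (Finₚ._≟ d) (c ∷ κ) ≡ lookup (unit c ⊕ content κ) d
  pointwise d = ≡.trans (counting (does (c Finₚ.≟ d)) _) (≡.sym (≡.trans (Vecₚ.lookup-zipWith ℕ._+_ d (unit c) (content κ))
      (cong₂ ℕ._+_ (lookup-unit c d) (Vecₚ.lookup∘tabulate (λ d → Vec.count (Finₚ._≟ d) κ) d))))
    where
    counting : ∀ b k → (if b then suc else id) k ≡ (if b then 1 else 0) ℕ.+ k
    counting true  k = ≡.refl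
    counting false k = ≡.refl

module Variables (N : ℕ) where
  open RationalFunctions N public
  open Field rationalFunctions
  open Sums algebra
  open ≈-Reasoning

  monomial : Monomial N → Carrier
  monomial α = poly ((1ℚ , α) ∷ [])

  x : Fin N → Carrier
  x c = monomial (unit c)

  monomial-⊕ : ∀ α β → monomial (α ⊕ β) ≈ monomial α * monomial β
  monomial-⊕ α β = poly-* ((1ℚ , α) ∷ []) ((1ℚ , β) ∷ [])

  monomial-0 : monomial (Vec.replicate N 0) ≈ 1#
  monomial-0 = poly-1

  monomial-injective : ∀ {α β} → monomial α ≈ monomial β → α ≡ β
  monomial-injective {α} {β} h with α ≟ᴹ β
  ... | yes e = e
  ... | no ne = contradiction (≡.trans (≡.sym one) (≡.trans (poly-injective ((1ℚ , α) ∷ []) ((1ℚ , β) ∷ []) h α) nil)) (λ ())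
    where
    one : [x^ α ] ((1ℚ , α) ∷ []) ≡ 1ℚ
    one with α ≟ᴹ α
    ... | yes _ = ≡.refl
    ... | no ne = contradiction ≡.refl ne
    nil : [x^ α ] ((1ℚ , β) ∷ []) ≡ 0ℚ
    nil with β ≟ᴹ α
    ... | yes e = contradiction (≡.sym e) ne
    ... | no _  = ≡.refl

  x-distinct : ∀ {a b} → a ≢ b → ¬ (x a ≈ x b)
  x-distinct a≢b h = a≢b (unit-injective (monomial-injective h))

  x-nonzero : ∀ a → ¬ (x a ≈ 0#)
  x-nonzero a = poly-≉0 {(1ℚ , unit a) ∷ []} (Domain.ones-≉0 ((1ℚ , unit a) ∷ []) (≡.refl ∷ []) (λ ()))

  poly-map : ∀ {S : Set} (f : S → Monomial N) L → poly (map (λ s → 1ℚ , f s) L) ≈ ∑ L (monomial ∘ f)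
  poly-map f []      = poly-0
  poly-map f (s ∷ L) = trans (poly-+ ((1ℚ , f s) ∷ []) (map _ L)) (+-congˡ (poly-map f L))

  monomial-content : ∀ {n} (κ : Vec (Fin N) n) → monomial (content κ) ≈ Vec.foldr′ (λ c → x c *_) 1# κ
  monomial-content []      = trans (reflexive (cong monomial (zeros N))) monomial-0
    where
    zeros : ∀ n → Vec.tabulate {n = n} (λ _ → 0) ≡ Vec.replicate n 0
    zeros zero    = ≡.refl
    zeros (suc n) = cong (0 ∷_) (zeros n)
  monomial-content (c ∷ κ) = begin
    monomial (content (c ∷ κ))        ≡⟨ cong monomial (content-∷ c κ) ⟩
    monomial (unit c ⊕ content κ)     ≈⟨ monomial-⊕ (unit c) (content κ) ⟩
    x c * monomial (content κ)        ≈⟨ *-congˡ (monomial-content κ) ⟩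
    x c * Vec.foldr′ (λ c → x c *_) 1# κ ∎

  exponents : ∀ {n} → Subset n → Monomial n
  exponents = Vec.map (λ b → if b then 1 else 0)

  squarefree : ∀ {n} → (Fin n → Carrier) → Subset n → Carrier
  squarefree y []          = 1#
  squarefree y (true ∷ S)  = y Fin.zero * squarefree (y ∘ Fin.suc) S
  squarefree y (false ∷ S) = squarefree (y ∘ Fin.suc) S

  -- The additive map g places the exponents of n variables among the N given ones, so that the
  -- induction can run over the variables; in the end g is the identity.
  monomial-squarefree : ∀ {n} (g : Monomial n → Monomial N) → (∀ α β → g (α ⊕ β) ≡ g α ⊕ g β) →
    g (Vec.replicate n 0) ≡ Vec.replicate N 0 → ∀ S →
    monomial (g (exponents S)) ≈ squarefree (λ c → monomial (g (unit c))) S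
  monomial-squarefree g g-⊕ g-0 []         = trans (reflexive (cong monomial g-0)) monomial-0
  monomial-squarefree {suc n} g g-⊕ g-0 (true ∷ S) = begin
    monomial (g (1 ∷ exponents S))
      ≡⟨ cong (λ α → monomial (g (1 ∷ α))) (Polynomials.⊕-identityˡ (exponents S)) ⟨
    monomial (g ((1 ∷ Vec.replicate n 0) ⊕ (0 ∷ exponents S)))
      ≡⟨ cong monomial (g-⊕ _ _) ⟩
    monomial (g (1 ∷ Vec.replicate n 0) ⊕ g (0 ∷ exponents S))
      ≈⟨ monomial-⊕ _ _ ⟩
    monomial (g (1 ∷ Vec.replicate n 0)) * monomial (g (0 ∷ exponents S))
      ≈⟨ *-congˡ (monomial-squarefree (g ∘ (0 ∷_)) (λ α β → g-⊕ (0 ∷ α) (0 ∷ β)) g-0 S) ⟩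
    squarefree (λ c → monomial (g (unit c))) (true ∷ S) ∎
  monomial-squarefree g g-⊕ g-0 (false ∷ S) =
    monomial-squarefree (g ∘ (0 ∷_)) (λ α β → g-⊕ (0 ∷ α) (0 ∷ β)) g-0 S

  module Esym {S : Set} (y : S → Carrier) = ElementarySymmetric algebra y

  esym-map : ∀ {S T : Set} (g : S → T) (y : T → Carrier) i L → Esym.esym y i (map g L) ≈ Esym.esym (y ∘ g) i L
  esym-map g y zero    L       = refl
  esym-map g y (suc i) []      = refl
  esym-map g y (suc i) (s ∷ L) = +-cong (esym-map g y (suc i) L) (*-congˡ (esym-map g y i L))

  ∑-squarefree : ∀ n (y : Fin n → Carrier) i →
    ∑ (words sides n) (λ S → [ ∣ S ∣ ℕ.≟ i ] * squarefree y S) ≈ Esym.esym y i (allFin n)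
  ∑-squarefree zero    y zero    = trans (+-identityʳ _) (*-identityˡ _)
  ∑-squarefree zero    y (suc i) = trans (+-identityʳ _) (zeroˡ _)
  ∑-squarefree (suc n) y i = begin
    ∑ (words sides (suc n)) (λ S → [ ∣ S ∣ ℕ.≟ i ] * squarefree y S)
      ≈⟨ trans (∑-++ (map (true ∷_) W) _ _) (+-cong (∑-map (true ∷_) W _) (trans (∑-++ (map (false ∷_) W) [] _) (trans (+-identityʳ _) (∑-map (false ∷_) W _)))) ⟩
    ∑ W (λ S → [ suc ∣ S ∣ ℕ.≟ i ] * (y Fin.zero * squarefree (y ∘ Fin.suc) S)) + ∑ W (λ S → [ ∣ S ∣ ℕ.≟ i ] * squarefree (y ∘ Fin.suc) S)
      ≈⟨ +-congˡ (∑-squarefree n (y ∘ Fin.suc) i) ⟩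
    ∑ W (λ S → [ suc ∣ S ∣ ℕ.≟ i ] * (y Fin.zero * squarefree (y ∘ Fin.suc) S)) + Esym.esym (y ∘ Fin.suc) i (allFin n)
      ≈⟨ finish i ⟩
    Esym.esym y i (allFin (suc n)) ∎
    where
    W = words sides n
    shift : ∀ i → Esym.esym (y ∘ Fin.suc) i (allFin n) ≈ Esym.esym y i (Data.List.tabulate Fin.suc)
    shift i = trans (sym (esym-map Fin.suc y i (allFin n))) (reflexive (cong (Esym.esym y i) (Listₚ.map-tabulate id Fin.suc)))
    finish : ∀ i → ∑ W (λ S → [ suc ∣ S ∣ ℕ.≟ i ] * (y Fin.zero * squarefree (y ∘ Fin.suc) S)) + Esym.esym (y ∘ Fin.suc) i (allFin n)
      ≈ Esym.esym y i (allFin (suc n))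
    finish zero    = trans (+-congʳ (∑-zero W (λ S _ → trans (*-congʳ ([no] (suc ∣ S ∣ ℕ.≟ 0) (λ ()))) (zeroˡ _)))) (+-identityˡ _)
    finish (suc i) = trans (+-comm _ _) (+-cong (shift (suc i)) (begin
      ∑ W (λ S → [ suc ∣ S ∣ ℕ.≟ suc i ] * (y Fin.zero * squarefree (y ∘ Fin.suc) S))
        ≈⟨ ∑-ext W (λ S → trans (*-congʳ ([⇔] (suc ∣ S ∣ ℕ.≟ suc i) (∣ S ∣ ℕ.≟ i) ℕₚ.suc-injective (cong suc)))
             (trans (sym (*-assoc _ _ _)) (trans (*-congʳ (*-comm _ _)) (*-assoc _ _ _)))) ⟩
      ∑ W (λ S → y Fin.zero * ([ ∣ S ∣ ℕ.≟ i ] * squarefree (y ∘ Fin.suc) S))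
        ≈⟨ ∑-*ˡ W _ _ ⟨
      y Fin.zero * ∑ W (λ S → [ ∣ S ∣ ℕ.≟ i ] * squarefree (y ∘ Fin.suc) S)
        ≈⟨ *-congˡ (trans (∑-squarefree n (y ∘ Fin.suc) i) (shift i)) ⟩
      y Fin.zero * Esym.esym y i (Data.List.tabulate Fin.suc) ∎))

  poly-e : ∀ i → poly (e N i) ≈ Esym.esym x i (allFin N)
  poly-e i = begin
    poly (map indicator (subsets N i))
      ≈⟨ poly-map exponents (subsets N i) ⟩
    ∑ (subsets N i) (monomial ∘ exponents)
      ≈⟨ ∑-filter (λ S → ∣ S ∣ ℕ.≟ i) (words sides N) _ ⟩
    ∑ (words sides N) (λ S → [ ∣ S ∣ ℕ.≟ i ] * monomial (exponents S))
      ≈⟨ ∑-ext (words sides N) (λ S → *-congˡ (monomial-squarefree id (λ _ _ → ≡.refl) ≡.refl S)) ⟩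
    ∑ (words sides N) (λ S → [ ∣ S ∣ ℕ.≟ i ] * squarefree x S)
      ≈⟨ ∑-squarefree N x i ⟩
    Esym.esym x i (allFin N) ∎

  esym-nonzero : ∀ i → i ≤ N → ¬ (Esym.esym x i (allFin N) ≈ 0#)
  esym-nonzero i i≤N h = poly-≉0 {e N i} (e≉0 i≤N) (trans (poly-e i) h)

-- The rational numbers A evaluated in the field

toList-≡ : ∀ {S : Set} {m} (u v : Vec S m) → Vec.toList u ≡ Vec.toList v → u ≡ v
toList-≡ u v e = ≡.trans (≡.sym (Vecₚ.cast-is-id ≡.refl u)) (Vecₚ.toList-injective ≡.refl u v e)

integer : ℤ → ℚ
integer z = z ℚ./ 1

private
  integerᵘ : ∀ z → ℚ.toℚᵘ (integer z) ℚᵘ.≃ ℚᵘ.mkℚᵘ z 0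
  integerᵘ z = ℚₚ.toℚᵘ-fromℚᵘ (ℚᵘ.mkℚᵘ z 0)

  quotientᵘ : ∀ z d → ℚ.toℚᵘ (z ℚ./ suc d) ℚᵘ.≃ ℚᵘ.mkℚᵘ z d
  quotientᵘ z d = ℚₚ.toℚᵘ-fromℚᵘ (ℚᵘ.mkℚᵘ z d)

integer-+ : ∀ y z → integer (y ℤ.+ z) ≡ integer y ℚ.+ integer z
integer-+ y z = ℚₚ.toℚᵘ-injective (begin
  ℚ.toℚᵘ (integer (y ℤ.+ z))                        ≈⟨ integerᵘ (y ℤ.+ z) ⟩
  ℚᵘ.mkℚᵘ (y ℤ.+ z) 0
    ≈⟨ ℚᵘ.*≡* (cong (ℤ._* + 1) (≡.sym (cong₂ ℤ._+_ (ℤₚ.*-identityʳ y) (ℤₚ.*-identityʳ z)))) ⟩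
  ℚᵘ.mkℚᵘ y 0 ℚᵘ.+ ℚᵘ.mkℚᵘ z 0                      ≈⟨ ℚᵘₚ.+-cong (integerᵘ y) (integerᵘ z) ⟨
  ℚ.toℚᵘ (integer y) ℚᵘ.+ ℚ.toℚᵘ (integer z)        ≈⟨ ℚₚ.toℚᵘ-homo-+ (integer y) (integer z) ⟨
  ℚ.toℚᵘ (integer y ℚ.+ integer z)                  ∎)
  where open ℚᵘₚ.≃-Reasoning

integer-neg : ∀ z → integer (ℤ.- z) ≡ ℚ.- integer z
integer-neg z = ℚRing.+-inverseˡ-unique (integer (ℤ.- z)) (integer z)
  (≡.trans (≡.sym (integer-+ (ℤ.- z) z)) (cong integer (ℤₚ.+-inverseˡ z)))

integer-nat : ∀ n → integer (+ n) ≡ nat n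
integer-nat zero    = ≡.refl
integer-nat (suc n) = ≡.trans (integer-+ (+ 1) (+ n)) (cong (1ℚ ℚ.+_) (integer-nat n))

/-* : ∀ a d → (a ℚ./ suc d) ℚ.* integer (+ suc d) ≡ integer a
/-* a d = ℚₚ.toℚᵘ-injective (begin
  ℚ.toℚᵘ ((a ℚ./ suc d) ℚ.* integer (+ suc d))         ≈⟨ ℚₚ.toℚᵘ-homo-* (a ℚ./ suc d) (integer (+ suc d)) ⟩
  ℚ.toℚᵘ (a ℚ./ suc d) ℚᵘ.* ℚ.toℚᵘ (integer (+ suc d)) ≈⟨ ℚᵘₚ.*-cong (quotientᵘ a d) (integerᵘ (+ suc d)) ⟩
  ℚᵘ.mkℚᵘ a d ℚᵘ.* ℚᵘ.mkℚᵘ (+ suc d) 0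
    ≈⟨ ℚᵘ.*≡* (≡.trans (ℤₚ.*-identityʳ (a ℤ.* + suc d)) (cong (λ k → a ℤ.* + k) (≡.sym (ℕₚ.*-identityʳ (suc d))))) ⟩
  ℚᵘ.mkℚᵘ a 0                                           ≈⟨ integerᵘ a ⟨
  ℚ.toℚᵘ (integer a)                                    ∎)
  where open ℚᵘₚ.≃-Reasoning

//-* : ∀ a d → d ≢ + 0 → (a // d) ℚ.* integer d ≡ integer a
//-* a (+ zero)  d≢0 = contradiction ≡.refl d≢0
//-* a (+ suc d) d≢0 = /-* a d
//-* a -[1+ d ]  d≢0 = begin
  ((ℤ.- a) ℚ./ suc d) ℚ.* integer -[1+ d ]             ≡⟨ cong (((ℤ.- a) ℚ./ suc d) ℚ.*_) (integer-neg (+ suc d)) ⟩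
  ((ℤ.- a) ℚ./ suc d) ℚ.* (ℚ.- integer (+ suc d))      ≡⟨ ℚₚ.neg-distribʳ-* ((ℤ.- a) ℚ./ suc d) _ ⟨
  ℚ.- (((ℤ.- a) ℚ./ suc d) ℚ.* integer (+ suc d))      ≡⟨ cong ℚ.-_ (/-* (ℤ.- a) d) ⟩
  ℚ.- integer (ℤ.- a)                                  ≡⟨ integer-neg (ℤ.- a) ⟨
  integer (ℤ.- ℤ.- a)                                  ≡⟨ cong integer (ℤₚ.neg-involutive a) ⟩
  integer a                                            ∎
  where open ≡.≡-Reasoning

module TransitionValues (F : Field) (N : ℕ) where
  open Field F
  open Sums algebra
  open LinearAlgebra F
  open FieldNumbers F
  open Transitions F N
  open ≈-Reasoning
  open Solver using (solve; _:+_; _:*_; _:-_; _:=_; con; :-_)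

  ι-integer : ∀ n → ι (integer (+ n)) ≈ ν n
  ι-integer n = reflexive (cong ι (integer-nat n))

  ι-difference : ∀ m n → ι (integer (+ m ℤ.- + n)) ≈ ν m - ν n
  ι-difference m n = begin
    ι (integer (+ m ℤ.+ ℤ.- + n))           ≡⟨ cong ι (≡.trans (integer-+ (+ m) (ℤ.- + n)) (cong (integer (+ m) ℚ.+_) (integer-neg (+ n)))) ⟩
    ι (integer (+ m) ℚ.+ ℚ.- integer (+ n)) ≈⟨ trans (ι-+ _ _) (+-cong (ι-integer m) (trans (ι-neg _) (-‿cong (ι-integer n)))) ⟩
    ν m - ν n                               ∎

  ι-// : ∀ a d → d ≢ + 0 → ι (a // d) * ι (integer d) ≈ ι (integer a)
  ι-// a d d≢0 = trans (sym (ι-* _ _)) (reflexive (cong ι (//-* a d d≢0)))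

  difference≢0 : ∀ {m n} → m ≢ n → + m ℤ.- + n ≢ + 0
  difference≢0 {m} {n} m≢n e = m≢n (ℤₚ.+-injective (ℤₚ.i-j≡0⇒i≡j (+ m) (+ n) e))

  ratio-value : ∀ m n → m ≢ n → ι ((+ m ℤ.- + n ℤ.+ + 1) // (+ m ℤ.- + n)) ≈ ratio m n
  ratio-value m n m≢n = cancelˡ {ν m - ν n} (λ e → m≢n (ν-injective (-≈0 e))) (begin
    (ν m - ν n) * ι ((+ m ℤ.- + n ℤ.+ + 1) // (+ m ℤ.- + n))
      ≈⟨ trans (*-comm _ _) (*-congˡ (sym (ι-difference m n))) ⟩
    ι ((+ m ℤ.- + n ℤ.+ + 1) // (+ m ℤ.- + n)) * ι (integer (+ m ℤ.- + n))
      ≈⟨ ι-// _ (+ m ℤ.- + n) (difference≢0 m≢n) ⟩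
    ι (integer (+ m ℤ.- + n ℤ.+ + 1))
      ≈⟨ trans (reflexive (cong ι (integer-+ (+ m ℤ.- + n) (+ 1)))) (trans (ι-+ _ _) (+-cong (ι-difference m n) (trans (ι-integer 1) ν-1))) ⟩
    (ν m - ν n) + 1#
      ≈⟨ +-cong (sym (*-identityʳ _)) (sym (inv-* m≢n)) ⟩
    (ν m - ν n) * 1# + (ν m - ν n) * inv m n
      ≈⟨ distribˡ _ _ _ ⟨
    (ν m - ν n) * ratio m n ∎)

  ratio-value-0 : ∀ m → m ≢ 0 → ι ((+ m ℤ.+ + 1) // (+ m)) ≈ ratio m 0
  ratio-value-0 m m≢0 = trans (reflexive (cong (λ z → ι ((z ℤ.+ + 1) // z)) (≡.sym (ℤₚ.+-identityʳ (+ m))))) (ratio-value m 0 m≢0)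

  -- (n - 1)/n is 1 + 1/(0 - n), so A(1 | σ) fits the same product formula, with the pole at 0.
  ratio-value-1 : ∀ n → n ≢ 0 → ι ((+ n ℤ.- + 1) // (+ n)) ≈ ratio 0 n
  ratio-value-1 n n≢0 = cancelˡ {ν n} (λ e → n≢0 (ν-injective (trans e (sym ν-0)))) (begin
    ν n * ι ((+ n ℤ.- + 1) // (+ n))
      ≈⟨ trans (*-comm _ _) (*-congˡ (sym (ι-integer n))) ⟩
    ι ((+ n ℤ.- + 1) // (+ n)) * ι (integer (+ n))
      ≈⟨ ι-// _ (+ n) (λ e → n≢0 (ℤₚ.+-injective e)) ⟩
    ι (integer (+ n ℤ.- + 1))
      ≈⟨ trans (ι-difference n 1) (+-congˡ (-‿cong (trans ν-1 (sym (inv-* {0} {n} (n≢0 ∘ ≡.sym)))))) ⟩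
    ν n - (ν 0 - ν n) * inv 0 n
      ≈⟨ +-congˡ (-‿cong (*-congʳ (trans (+-congʳ ν-0) (+-identityˡ _)))) ⟩
    ν n - (- ν n) * inv 0 n
      ≈⟨ solve 2 (λ n i → n :- (:- n) :* i := n :+ n :* i) refl (ν n) (inv 0 n) ⟩
    ν n + ν n * inv 0 n
      ≈⟨ +-congʳ (sym (*-identityʳ (ν n))) ⟩
    ν n * 1# + ν n * inv 0 n
      ≈⟨ distribˡ _ _ _ ⟨
    ν n * ratio 0 n ∎)

  Π : {S : Set} → List S → (S → Carrier) → Carrier
  Π []      g = 1#
  Π (s ∷ L) g = g s * Π L g

  Π-cong : ∀ {S : Set} (L : List S) {g h} → (∀ s → s ∈ L → g s ≈ h s) → Π L g ≈ Π L h
  Π-cong []      e = refl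
  Π-cong (s ∷ L) e = *-cong (e s (here ≡.refl)) (Π-cong L (λ t t∈ → e t (there t∈)))

  ι-∏ : ∀ {j} (rs : List (Fin j)) f → ι (∏ rs f) ≈ Π rs (ι ∘ f)
  ι-∏ []       f = ι-1
  ι-∏ (r ∷ rs) f = trans (ι-* _ _) (*-congˡ (ι-∏ rs f))

  Π-map : ∀ {S T : Set} (k : S → T) L (g : T → Carrier) → Π (map k L) g ≈ Π L (g ∘ k)
  Π-map k []      g = refl
  Π-map k (s ∷ L) g = *-congˡ (Π-map k L g)

  Π-filter : ∀ {S : Set} {P : S → Set} (P? : ∀ s → Dec (P s)) L g → (∀ s → ¬ P s → g s ≈ 1#) → Π (filter P? L) g ≈ Π L g
  Π-filter P? []      g h = refl
  Π-filter P? (s ∷ L) g h with P? s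
  ... | yes _ = *-congˡ (Π-filter P? L g h)
  ... | no ¬p = trans (Π-filter P? L g h) (sym (trans (*-congʳ (h s ¬p)) (*-identityˡ _)))

  Π-lookup : ∀ {S : Set} {j} (v : Vec S j) (g : S → Carrier) → Π (allFin j) (g ∘ lookup v) ≈ Π (Vec.toList v) g
  Π-lookup []      g = refl
  Π-lookup {j = suc j} (s ∷ v) g = *-congˡ (trans
    (trans (reflexive (cong (λ L → Π L (g ∘ lookup (s ∷ v))) (≡.sym (Listₚ.map-tabulate id Fin.suc)))) (Π-map Fin.suc (allFin j) _))
    (Π-lookup v g))

  ∏ratio-Π : ∀ s σ → ∏ratio s σ ≈ ratio s 0 * Π σ (ratio s ∘ value)
  ∏ratio-Π s []      = sym (*-identityʳ _)
  ∏ratio-Π s (t ∷ σ) = trans (*-congˡ (∏ratio-Π s σ))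
    (solve 3 (λ a b c → a :* (b :* c) := b :* (a :* c)) refl (ratio s (value t)) (ratio s 0) _)

  lookup-∈ : ∀ {S : Set} {j} (v : Vec S j) r → lookup v r ∈ Vec.toList v
  lookup-∈ (s ∷ v) Fin.zero    = here ≡.refl
  lookup-∈ (s ∷ v) (Fin.suc r) = there (lookup-∈ v r)

  ∈-lookup : ∀ {S : Set} {j} (v : Vec S j) {s} → s ∈ Vec.toList v → ∃ λ r → lookup v r ≡ s
  ∈-lookup (s ∷ v) (here ≡.refl) = Fin.zero , ≡.refl
  ∈-lookup (s ∷ v) (there s∈)    = let r , e = ∈-lookup v s∈ in Fin.suc r , e

  lookup-injective : ∀ {S : Set} {j} (v : Vec S j) → Unique (Vec.toList v) → ∀ r r′ → lookup v r ≡ lookup v r′ → r ≡ r′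
  lookup-injective (s ∷ v) u Fin.zero    Fin.zero     e = ≡.refl
  lookup-injective (s ∷ v) u Fin.zero    (Fin.suc r′) e = contradiction (subst (_∈ Vec.toList v) (≡.sym e) (lookup-∈ v r′)) (∉-head u)
  lookup-injective (s ∷ v) u (Fin.suc r) Fin.zero     e = contradiction (subst (_∈ Vec.toList v) e (lookup-∈ v r)) (∉-head u)
  lookup-injective (s ∷ v) (_ ∷ u) (Fin.suc r) (Fin.suc r′) e = cong Fin.suc (lookup-injective v u r r′ e)

  -- The defining products omit the factor of the pole itself: the one at 0 for y = 1, the one at
  -- σ_r for y = σ_r + 1. In `∏ratio` this factor is present but equals 1, by the convention 1/0 =
  -- 0.
  transition-step : ∀ {j} y (v : Vec (Fin N) j) → Unique (Vec.toList v) →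
    ι (A (value y) (Vec.map value v)) ≈ step y (Vec.toList v)
  transition-step {j} y v u with value y ℕ.≟ 1 | Finₚ.any? (λ r → value y ℕ.≟ suc (lookup (Vec.map value v) r))
  ... | yes y≡1 | _ = begin
    ι (∏ (allFin j) (λ r → (+ lookup (Vec.map value v) r ℤ.- + 1) // (+ lookup (Vec.map value v) r)))
      ≈⟨ ι-∏ (allFin j) _ ⟩
    Π (allFin j) (λ r → ι ((+ lookup (Vec.map value v) r ℤ.- + 1) // (+ lookup (Vec.map value v) r)))
      ≈⟨ Π-cong (allFin j) (λ r _ → trans (reflexive (cong (λ n → ι ((+ n ℤ.- + 1) // (+ n))) (Vecₚ.lookup-map r value v)))
           (ratio-value-1 (value (lookup v r)) (λ ()))) ⟩
    Π (allFin j) (λ r → ratio 0 (value (lookup v r)))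
      ≈⟨ Π-lookup v _ ⟩
    Π (Vec.toList v) (ratio 0 ∘ value)
      ≈⟨ trans (sym (*-identityˡ _)) (*-congʳ (sym (ratio-self 0))) ⟩
    ratio 0 0 * Π (Vec.toList v) (ratio 0 ∘ value)
      ≈⟨ ∏ratio-Π 0 (Vec.toList v) ⟨
    ∏ratio 0 (Vec.toList v)
      ≈⟨ trans (sym (*-identityˡ _)) (*-cong (sym ([yes] (reachable? (toℕ y) (Vec.toList v)) (here y≡0))) (reflexive (cong (λ s → ∏ratio s (Vec.toList v)) (≡.sym y≡0)))) ⟩
    step y (Vec.toList v) ∎
    where
    y≡0 : toℕ y ≡ 0
    y≡0 = ℕₚ.suc-injective y≡1
  ... | no y≢1 | no none = trans ι-0 (sym (trans (*-congʳ ([no] (reachable? (toℕ y) (Vec.toList v)) unreachable)) (zeroˡ _)))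
    where
    unreachable : toℕ y ∉ 0 ∷ values (Vec.toList v)
    unreachable (here e) = y≢1 (cong suc e)
    unreachable (there y∈) with ∈ₚ.∈-map⁻ value y∈
    ... | t , t∈ , e with ∈-lookup v t∈
    ...   | r , ≡.refl = none (r , cong suc (≡.trans e (≡.sym (Vecₚ.lookup-map r value v))))
  ... | no y≢1 | yes (r , y≡) = begin
    ι (((+ s₀ ℤ.+ + 1) // (+ s₀)) ℚ.* ∏ (filter (λ r′ → ¬? (r′ Finₚ.≟ r)) (allFin j)) (λ r′ → (+ s₀ ℤ.- + lookup (Vec.map value v) r′ ℤ.+ + 1) // (+ s₀ ℤ.- + lookup (Vec.map value v) r′)))
      ≈⟨ trans (ι-* _ _) (*-cong (trans (reflexive (cong (λ n → ι ((+ n ℤ.+ + 1) // (+ n))) (≡.sym y≡s))) (ratio-value-0 (toℕ y) y≢0)) (ι-∏ (filter (λ r′ → ¬? (r′ Finₚ.≟ r)) (allFin j)) _)) ⟩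
    ratio (toℕ y) 0 * Π (filter (λ r′ → ¬? (r′ Finₚ.≟ r)) (allFin j)) (λ r′ → ι ((+ s₀ ℤ.- + lookup (Vec.map value v) r′ ℤ.+ + 1) // (+ s₀ ℤ.- + lookup (Vec.map value v) r′)))
      ≈⟨ *-congˡ (Π-cong (filter (λ r′ → ¬? (r′ Finₚ.≟ r)) (allFin j)) factor) ⟩
    ratio (toℕ y) 0 * Π (filter (λ r′ → ¬? (r′ Finₚ.≟ r)) (allFin j)) (λ r′ → ratio (toℕ y) (value (lookup v r′)))
      ≈⟨ *-congˡ (trans (Π-filter (λ r′ → ¬? (r′ Finₚ.≟ r)) (allFin j) _ (λ r′ ¬¬e → at-r r′ (dne r′ ¬¬e))) (Π-lookup v _)) ⟩
    ratio (toℕ y) 0 * Π (Vec.toList v) (ratio (toℕ y) ∘ value)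
      ≈⟨ ∏ratio-Π (toℕ y) (Vec.toList v) ⟨
    ∏ratio (toℕ y) (Vec.toList v)
      ≈⟨ trans (sym (*-identityˡ _)) (*-congʳ (sym ([yes] (reachable? (toℕ y) (Vec.toList v))
           (there (subst (_∈ values (Vec.toList v)) (≡.sym y≡v) (∈ₚ.∈-map⁺ value (lookup-∈ v r))))))) ⟩
    step y (Vec.toList v) ∎
    where
    s₀ = lookup (Vec.map value v) r
    y≡s : toℕ y ≡ s₀
    y≡s = ℕₚ.suc-injective y≡
    y≡v : toℕ y ≡ value (lookup v r)
    y≡v = ≡.trans y≡s (Vecₚ.lookup-map r value v)
    y≢0 : toℕ y ≢ 0
    y≢0 e = y≢1 (cong suc e)
    dne : ∀ r′ → ¬ ¬ (r′ ≡ r) → r′ ≡ r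
    dne r′ ¬¬e with r′ Finₚ.≟ r
    ... | yes e = e
    ... | no ne = contradiction ne ¬¬e
    at-r : ∀ r′ → r′ ≡ r → ratio (toℕ y) (value (lookup v r′)) ≈ 1#
    at-r r′ ≡.refl = trans (reflexive (cong (λ n → ratio n (value (lookup v r))) y≡v)) (ratio-self (value (lookup v r)))
    factor : ∀ r′ → r′ ∈ filter (λ r′ → ¬? (r′ Finₚ.≟ r)) (allFin j) →
      ι ((+ s₀ ℤ.- + lookup (Vec.map value v) r′ ℤ.+ + 1) // (+ s₀ ℤ.- + lookup (Vec.map value v) r′)) ≈ ratio (toℕ y) (value (lookup v r′))
    factor r′ r′∈ = trans (reflexive (cong₂ (λ m n → ι ((+ m ℤ.- + n ℤ.+ + 1) // (+ m ℤ.- + n))) (≡.sym y≡s) (Vecₚ.lookup-map r′ value v)))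
      (ratio-value (toℕ y) (value (lookup v r′)) (λ e → proj₂ (∈ₚ.∈-filter⁻ (λ r′ → ¬? (r′ Finₚ.≟ r)) {xs = allFin j} r′∈)
        (lookup-injective v u r′ r (Finₚ.toℕ-injective (ℕₚ.suc-injective (≡.trans (≡.sym e) y≡v))))))

-- The trace of the operators M and D on formal vectors

module OperatorTrace (N : ℕ) where
  open Variables N
  open Field rationalFunctions
  open Sums algebra
  open ArrangementSums algebra {N}
  open LinearAlgebra rationalFunctions
  open Transitions rationalFunctions N using (step; step-∈)
  open TransitionValues rationalFunctions N using (transition-step)
  open PartialRelations rationalFunctions N x x-distinct x-nonzero esym-nonzero using (labelWeight)
  open ≈-Reasoning
  open Solver using (solve; _:+_; _:*_; _:-_; _:=_; con; :-_)

  private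
    all = allFin N
    module R = Runs algebra all step labelWeight

  Fun : Set
  Fun = List (Fin N) → Carrier

  listOf : ∀ {j} → Tuple N j → List (Fin N)
  listOf τ = Vec.toList (Tuple.entries τ)

  toList-unique : ∀ {j} {v : Vec (Fin N) j} → Vᵁ.Unique v → Unique (Vec.toList v)
  toList-unique Vᴾ.[]       = []
  toList-unique (s∉ Vᴾ.∷ u) = All-toList s∉ ∷ toList-unique u
    where
    All-toList : ∀ {j} {P : Fin N → Set} {v : Vec (Fin N) j} → Vᴬ.All P v → All P (Vec.toList v)
    All-toList Vᴬ.[]       = []
    All-toList (p Vᴬ.∷ ps) = p ∷ All-toList ps

  listOf-unique : ∀ {j} (τ : Tuple N j) → Unique (listOf τ)
  listOf-unique (tuple v v!) = recompute (unique? Finₚ._≟_ (Vec.toList v)) (toList-unique v!)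

  listOf-length : ∀ {j} (τ : Tuple N j) → length (listOf τ) ≡ j
  listOf-length (tuple v _) = Vecₚ.length-toList v

  -- Gives a name to the local function in the definition of `extensions`.
  extensionsBy : ∀ {j} (v : Vec (Fin N) j) .(v! : Vᵁ.Unique v) →
    Σ[ f ∈ (Fin N → List (Fin N × Tuple N (suc j))) ] extensions (tuple v v!) ≡ concatMap f all
  extensionsBy v v! = _ , ≡.refl

  ∑-extensions : ∀ {j} (σ : Tuple N j) (h : Fin N → List (Fin N) → Carrier) →
    ∑ (extensions σ) (λ (y , τ) → h y (listOf τ)) ≈ ∑ all (λ y → fresh y (listOf σ) * h y (listOf σ ++ y ∷ []))
  ∑-extensions (tuple v v!) h = trans (∑-concatMap (proj₁ (extensionsBy v v!)) all _) (∑-ext all term)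
    where
    fresh-no : ∀ y → Vᴱ.Any (y ≡_) v → fresh y (Vec.toList v) ≈ 0#
    fresh-no y y∈ = [no] (¬? (y ∈? Vec.toList v)) (λ y∉ → y∉ (∈ᵛₚ.∈-toList⁺ y∈))
    term : ∀ y → ∑ (proj₁ (extensionsBy v v!) y) (λ (y , τ) → h y (listOf τ)) ≈ fresh y (Vec.toList v) * h y (Vec.toList v ++ y ∷ [])
    term y with DecMemᵛ._∈?_ Finₚ._≟_ y v
    ... | yes y∈ = sym (trans (*-congʳ (fresh-no y y∈)) (zeroˡ _))
    ... | no y∉  = trans (+-identityʳ _) (sym (trans (*-congʳ ([yes] (¬? (y ∈? Vec.toList v)) (λ y∈ → y∉ (∈ᵛₚ.∈-toList⁻ y∈))))
        (trans (*-identityˡ _) (reflexive (cong (h y) (≡.sym (Vecₚ.toList-∷ʳ y v)))))))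

  ∑-tuples : ∀ j (h : Fun) → ∑ (tuples N j) (h ∘ listOf) ≈ ∑ (arrangements j) h
  ∑-tuples zero    h = refl
  ∑-tuples (suc j) h = begin
    ∑ (tuples N (suc j)) (h ∘ listOf)
      ≈⟨ ∑-concatMap (map proj₂ ∘ extensions) (tuples N j) _ ⟩
    ∑ (tuples N j) (λ σ → ∑ (map proj₂ (extensions σ)) (h ∘ listOf))
      ≈⟨ ∑-ext (tuples N j) (λ σ → trans (∑-map proj₂ (extensions σ) _) (∑-extensions σ (λ _ → h))) ⟩
    ∑ (tuples N j) (λ σ → ∑ all (λ y → fresh y (listOf σ) * h (listOf σ ++ y ∷ [])))
      ≈⟨ ∑-tuples j (λ c → ∑ all (λ y → fresh y c * h (c ++ y ∷ []))) ⟩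
    ∑ (arrangements j) (λ c → ∑ all (λ y → fresh y c * h (c ++ y ∷ [])))
      ≈⟨ arrangements-back j h ⟨
    ∑ (arrangements (suc j)) h ∎

  -- Vectors are lists of terms, possibly with repeated basis elements; pairing them with functions
  -- of label lists depends only on total coefficients and turns M and D into `append` and `forget`.
  ⟨_∣_⟩ : ∀ {j} → V N j → Fun → Carrier
  ⟨ u ∣ φ ⟩ = ∑ u (λ (a , τ) → embed a * φ (listOf τ))

  pairing-ext : ∀ {j} (u : V N j) {φ ψ} → (∀ τ → φ (listOf τ) ≈ ψ (listOf {j} τ)) → ⟨ u ∣ φ ⟩ ≈ ⟨ u ∣ ψ ⟩
  pairing-ext u h = ∑-ext u (λ (a , τ) → *-congˡ (h τ))

  pairing-linear : ∀ {i j} (f : Tuple N i → V N j) (u : V N i) φ ψ →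
    (∀ σ → ⟨ f σ ∣ φ ⟩ ≈ ψ (listOf σ)) → ⟨ extendLinearly f u ∣ φ ⟩ ≈ ⟨ u ∣ ψ ⟩
  pairing-linear f u φ ψ h = trans (∑-concatMap _ u _) (∑-ext u (λ (a , σ) → begin
    ∑ (map (λ (a′ , τ) → a *ᶠ a′ , τ) (f σ)) (λ (a , τ) → embed a * φ (listOf τ))
      ≈⟨ ∑-map _ (f σ) _ ⟩
    ∑ (f σ) (λ (a′ , τ) → embed (a *ᶠ a′) * φ (listOf τ))
      ≈⟨ trans (∑-ext (f σ) (λ (a′ , τ) → trans (*-congʳ (embed-* a a′)) (*-assoc _ _ _))) (sym (∑-*ˡ (f σ) _ _)) ⟩
    embed a * ⟨ f σ ∣ φ ⟩
      ≈⟨ *-congˡ (h σ) ⟩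
    embed a * ψ (listOf σ) ∎))

  M-adjoint : ∀ j (u : V N j) φ → ⟨ M j u ∣ φ ⟩ ≈ ⟨ u ∣ R.append φ ⟩
  M-adjoint j u φ = pairing-linear _ u φ (R.append φ) (λ σ → begin
    ∑ (map (λ (y , τ) → fromℚ (A (value y) (Vec.map value (Tuple.entries σ))) , τ) (extensions σ)) (λ (a , τ) → embed a * φ (listOf τ))
      ≈⟨ ∑-map _ (extensions σ) _ ⟩
    ∑ (extensions σ) (λ (y , τ) → embed (fromℚ (A (value y) (Vec.map value (Tuple.entries σ)))) * φ (listOf τ))
      ≈⟨ ∑-ext (extensions σ) (λ (y , τ) → *-congʳ (trans (embed-ℚ _) (transition-step y (Tuple.entries σ) (listOf-unique σ)))) ⟩
    ∑ (extensions σ) (λ (y , τ) → step y (listOf σ) * φ (listOf τ))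
      ≈⟨ ∑-extensions σ (λ y c → step y (listOf σ) * φ c) ⟩
    ∑ all (λ y → fresh y (listOf σ) * (step y (listOf σ) * φ (listOf σ ++ y ∷ [])))
      ≈⟨ ∑-ext all (λ y → absorb y (listOf σ) _ (y ∈? listOf σ)) ⟩
    R.append φ (listOf σ) ∎)
    where
    absorb : ∀ y c z → Dec (y ∈ c) → fresh y c * (step y c * z) ≈ step y c * z
    absorb y c z (no y∉)  = trans (*-congʳ ([yes] (¬? (y ∈? c)) y∉)) (*-identityˡ _)
    absorb y c z (yes y∈) = trans (*-congˡ vanish) (trans (zeroʳ _) (sym vanish))
      where
      vanish : step y c * z ≈ 0#
      vanish = trans (*-congʳ (step-∈ y∈)) (zeroˡ z)

  embed-weight : ∀ s nz → embed (frac (e N (value s)) (e N (toℕ s)) nz) ≈ labelWeight s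
  embed-weight s nz = cancelˡ (esym-nonzero (toℕ s) le) (begin
    esym (toℕ s) * embed (frac (e N (value s)) (e N (toℕ s)) nz)
      ≈⟨ trans (*-comm _ _) (*-congˡ (sym (poly-e (toℕ s)))) ⟩
    embed (frac (e N (value s)) (e N (toℕ s)) nz) * poly (e N (toℕ s))
      ≈⟨ embed-den _ _ nz ⟩
    poly (e N (value s))
      ≈⟨ trans (poly-e (value s)) (sym (*-identityʳ _)) ⟩
    esym (value s) * 1#
      ≈⟨ *-congˡ (sym (recip-* (esym-nonzero (toℕ s) le))) ⟩
    esym (value s) * (esym (toℕ s) * recip (esym (toℕ s)))
      ≈⟨ solve 3 (λ a b c → a :* (b :* c) := b :* (a :* c)) refl _ _ _ ⟩
    esym (toℕ s) * labelWeight s ∎)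
    where
    esym : ℕ → Carrier
    esym i = Esym.esym x i all
    le : toℕ s ≤ N
    le = ℕₚ.<⇒≤ (Finₚ.toℕ<n s)

  dropHead : Fun → Fun
  dropHead φ []      = 0#
  dropHead φ (s ∷ σ) = labelWeight s * φ σ

  D-adjoint : ∀ j (u : V N (suc j)) φ → ⟨ D j u ∣ φ ⟩ ≈ ⟨ u ∣ dropHead φ ⟩
  D-adjoint j u φ = pairing-linear _ u φ (dropHead φ) (λ { (tuple (s ∷ v) v!) →
    trans (+-identityʳ _) (*-congʳ (embed-weight s _)) })

  forgetTo-adjoint : ∀ r {s} (u : V N s) φ → ⟨ forgetTo r u ∣ φ ⟩ ≈ ⟨ u ∣ R.forget r φ ⟩
  forgetTo-adjoint r {s} u φ with s ℕ.≟ r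
  forgetTo-adjoint r {s}     u φ | yes ≡.refl = pairing-ext u {φ} {R.forget r φ} (λ τ → sym (R.forget-here r φ (listOf τ) (listOf-length τ)))
  forgetTo-adjoint r {zero}  u φ | no ne = sym (∑-zero u (λ { (a , tuple [] _) _ → trans (*-congˡ (R.forget-[] r φ ne)) (zeroʳ _) }))
  forgetTo-adjoint r {suc s} u φ | no ne = trans (forgetTo-adjoint r (D s u) φ) (trans (D-adjoint s u (R.forget r φ))
    (pairing-ext u {dropHead (R.forget r φ)} {R.forget r φ} (λ { τ@(tuple (t ∷ v) _) → sym (R.forget-∷ r φ t (Vec.toList v) (λ e → ne (≡.trans (≡.sym (listOf-length τ)) e))) })))

  build-adjoint : ∀ k rs {s} (u : V N s) φ → ⟨ build k rs u ∣ φ ⟩ ≈ ⟨ u ∣ R.run k rs φ ⟩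
  build-adjoint k []       u φ = forgetTo-adjoint k u φ
  build-adjoint k (r ∷ rs) u φ = trans (build-adjoint k rs (M r (forgetTo r u)) φ)
    (trans (M-adjoint r (forgetTo r u) (R.run k rs φ)) (forgetTo-adjoint r u (R.append (R.run k rs φ))))

  coeff-pairing : ∀ {j} (u : V N j) (σ : Tuple N j) → embed (coeffⱽ u σ) ≈ ⟨ u ∣ (λ c → [ c ≟ᶜ listOf σ ]) ⟩
  coeff-pairing []                      σ = embed-0
  coeff-pairing ((a , tuple w w!) ∷ u) σ@(tuple v v!) = trans (embed-+ _ _) (+-cong (head (Vecₚ.≡-dec Finₚ._≟_ w v)) (coeff-pairing u σ))
    where
    head : (d : Dec (w ≡ v)) → embed (if does d then a else 0ᶠ) ≈ embed a * [ Vec.toList w ≟ᶜ Vec.toList v ]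
    head (yes ≡.refl) = sym (trans (*-congˡ ([yes] (Vec.toList w ≟ᶜ Vec.toList w) ≡.refl)) (*-identityʳ _))
    head (no ne) = trans embed-0 (sym (trans (*-congˡ ([no] (Vec.toList w ≟ᶜ Vec.toList v) (λ e → ne (toList-≡ w v e)))) (zeroʳ _)))

  embed-sum : ∀ {S : Set} (L : List S) (f : S → Frac N) → embed (sumᶠ (map f L)) ≈ ∑ L (embed ∘ f)
  embed-sum []      f = embed-0
  embed-sum (s ∷ L) f = trans (embed-+ (f s) _) (+-congˡ (embed-sum L f))

  trace-run : ∀ k rs → embed (trace {N} {k} (build k rs)) ≈ ∑ (arrangements k) (λ σ → R.run k rs (λ c → [ c ≟ᶜ σ ]) σ)
  trace-run k rs = begin
    embed (trace {N} {k} (build k rs))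
      ≈⟨ embed-sum (tuples N k) _ ⟩
    ∑ (tuples N k) (λ σ → embed (coeffⱽ (build k rs (basis σ)) σ))
      ≈⟨ ∑-ext (tuples N k) (λ σ → trans (coeff-pairing (build k rs (basis σ)) σ)
           (trans (build-adjoint k rs (basis σ) (λ c → [ c ≟ᶜ listOf σ ]))
             (trans (+-identityʳ _) (trans (*-congʳ (trans (embed-ℚ 1ℚ) ι-1)) (*-identityˡ _))))) ⟩
    ∑ (tuples N k) (λ σ → R.run k rs (λ c → [ c ≟ᶜ listOf σ ]) (listOf σ))
      ≈⟨ ∑-tuples k (λ σ → R.run k rs (λ c → [ c ≟ᶜ σ ]) σ) ⟩
    ∑ (arrangements k) (λ σ → R.run k rs (λ c → [ c ≟ᶜ σ ]) σ) ∎

-- Traces as sums over closed walks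

module _ {S : Set} where
  retain : ℕ → List S → List S
  retain r σ = drop (length σ ℕ.∸ r) σ

  length-retain : ∀ {r σ} → r ≤ length σ → length (retain r σ) ≡ r
  length-retain {r} {σ} le = ≡.trans (Listₚ.length-drop (length σ ℕ.∸ r) σ) (ℕₚ.m∸[m∸n]≡n le)

  take-++ : (σ τ : List S) → take (length σ) (σ ++ τ) ≡ σ
  take-++ []      τ = ≡.refl
  take-++ (s ∷ σ) τ = cong (s ∷_) (take-++ σ τ)

  drop-++ : (σ τ : List S) → drop (length σ) (σ ++ τ) ≡ τ
  drop-++ []      τ = ≡.refl
  drop-++ (s ∷ σ) τ = drop-++ σ τ

  retain-++ : ∀ {r} (σ τ : List S) → r ≤ length τ → retain r (σ ++ τ) ≡ retain r τ
  retain-++ {r} σ τ le = ≡.trans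
    (cong (λ j → drop j (σ ++ τ)) (≡.trans (cong (ℕ._∸ r) (Listₚ.length-++ σ)) (ℕₚ.+-∸-assoc (length σ) le)))
    (≡.trans (≡.sym (Listₚ.drop-drop (length σ) (length τ ℕ.∸ r) (σ ++ τ))) (cong (drop (length τ ℕ.∸ r)) (drop-++ σ τ)))

retain-map : ∀ {S T : Set} (f : S → T) r σ → retain r (map f σ) ≡ map f (retain r σ)
retain-map f r σ = ≡.trans (cong (λ j → drop (j ℕ.∸ r) (map f σ)) (Listₚ.length-map f σ)) (Listₚ.drop-map (length σ ℕ.∸ r) σ)

-- With s vertices marked, no step asks to keep more than are marked; keeping r and adding one
-- leaves r + 1, and in the end at least k remain.
Valid : ℕ → List ℕ → ℕ → Set
Valid k []       s = k ≤ s
Valid k (r ∷ rs) s = r ≤ s × Valid k rs (suc r)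

valid-≤ : ∀ {k s} rs → Valid k rs s → k ≤ s ℕ.+ length rs
valid-≤ {s = s} []       k≤s = ℕₚ.≤-trans k≤s (ℕₚ.m≤m+n s 0)
valid-≤ {k} {s} (r ∷ rs) (r≤s , valid) = ℕₚ.≤-trans (valid-≤ rs valid)
  (subst (suc r ℕ.+ length rs ≤_) (≡.sym (ℕₚ.+-suc s (length rs))) (s≤s (ℕₚ.+-monoˡ-≤ (length rs) r≤s)))

module RunExpansion (Alg : RationalAlgebra) {N : ℕ}
  (a : Fin N → List (Fin N) → RationalAlgebra.Carrier Alg) (w : Fin N → RationalAlgebra.Carrier Alg) where
  open RationalAlgebra Alg
  open Sums Alg
  open StringSums Alg
  open Runs Alg (allFin N) a w
  open ≈-Reasoning
  open Solver using (solve; _:+_; _:*_; _:-_; _:=_; con; :-_)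

  private
    all = allFin N

  weight : List (Fin N) → Carrier
  weight []      = 1#
  weight (s ∷ σ) = w s * weight σ

  -- Only the weights of appending. Those of forgetting are collected separately, as they do not
  -- depend on when an entry is forgotten.
  walk : List ℕ → List (Fin N) → List (Fin N) → Carrier
  walk []       σ ys       = 1#
  walk (r ∷ rs) σ []       = 1#
  walk (r ∷ rs) σ (y ∷ ys) = a y (retain r σ) * walk rs (retain r σ ++ y ∷ []) ys

  forget-++ : ∀ r φ t τ → r ≤ length τ → forget r φ (t ++ τ) ≈ weight t * forget r φ τ
  forget-++ r φ []      τ le = sym (*-identityˡ _)
  forget-++ r φ (s ∷ t) τ le = trans (forget-∷ r φ s (t ++ τ) long)
      (trans (*-congˡ (forget-++ r φ t τ le)) (sym (*-assoc _ _ _)))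
    where
    long : suc (length (t ++ τ)) ≢ r
    long e = ℕₚ.<-irrefl (≡.sym e) (s≤s (ℕₚ.≤-trans le (subst (length τ ≤_) (≡.sym (Listₚ.length-++ t)) (ℕₚ.m≤n+m _ _))))

  -- Entries are forgotten in the order in which they were marked, each once. So all forgetting may
  -- be postponed to the end, when everything but the last k entries of σ ++ ys is dropped.
  run-walk : ∀ k rs φ σ → Valid k rs (length σ) →
    run k rs φ σ ≈ ∑ (strings all (length rs)) (λ ys → walk rs σ ys * forget k φ (σ ++ ys))
  run-walk k []       φ σ _ = sym (trans (+-identityʳ _) (trans (*-identityˡ _) (reflexive (cong (forget k φ) (Listₚ.++-identityʳ σ)))))
  run-walk k (r ∷ rs) φ σ (r≤ , valid) = begin
    forget r (append (run k rs φ)) σ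
      ≡⟨ cong (forget r (append (run k rs φ))) split ⟨
    forget r (append (run k rs φ)) (t ++ σ′)
      ≈⟨ trans (forget-++ r (append (run k rs φ)) t σ′ (ℕₚ.≤-reflexive (≡.sym len))) (*-congˡ (forget-here r (append (run k rs φ)) σ′ len)) ⟩
    weight t * ∑ all (λ y → a y σ′ * run k rs φ (σ′ ++ y ∷ []))
      ≈⟨ trans (∑-*ˡ all _ _) (∑-ext all (λ y → begin
           weight t * (a y σ′ * run k rs φ (σ′ ++ y ∷ []))
             ≈⟨ *-congˡ (*-congˡ (run-walk k rs φ (σ′ ++ y ∷ []) (subst (Valid k rs) (≡.sym (≡.trans (length-snoc σ′ y) (cong suc len))) valid))) ⟩
           weight t * (a y σ′ * ∑ (strings all (length rs)) (λ ys → walk rs (σ′ ++ y ∷ []) ys * forget k φ ((σ′ ++ y ∷ []) ++ ys)))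
             ≈⟨ trans (*-congˡ (∑-*ˡ (strings all (length rs)) _ _)) (∑-*ˡ (strings all (length rs)) _ _) ⟩
           ∑ (strings all (length rs)) (λ ys → weight t * (a y σ′ * (walk rs (σ′ ++ y ∷ []) ys * forget k φ ((σ′ ++ y ∷ []) ++ ys))))
             ≈⟨ ∑-cong (strings all (length rs)) (λ ys ys∈ → term y ys (∈-strings⁻ (length rs) ys∈)) ⟩
           ∑ (strings all (length rs)) (λ ys → walk (r ∷ rs) σ (y ∷ ys) * forget k φ (σ ++ y ∷ ys)) ∎)) ⟩
    ∑ all (λ y → ∑ (strings all (length rs)) (λ ys → walk (r ∷ rs) σ (y ∷ ys) * forget k φ (σ ++ y ∷ ys)))
      ≈⟨ strings-front all (length rs) (λ ys → walk (r ∷ rs) σ ys * forget k φ (σ ++ ys)) ⟨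
    ∑ (strings all (suc (length rs))) (λ ys → walk (r ∷ rs) σ ys * forget k φ (σ ++ ys)) ∎
    where
    t  = take (length σ ℕ.∸ r) σ
    σ′ = retain r σ
    split : t ++ σ′ ≡ σ
    split = Listₚ.take++drop≡id (length σ ℕ.∸ r) σ
    len : length σ′ ≡ r
    len = length-retain r≤
    term : ∀ y ys → length ys ≡ length rs →
      weight t * (a y σ′ * (walk rs (σ′ ++ y ∷ []) ys * forget k φ ((σ′ ++ y ∷ []) ++ ys)))
      ≈ (a y σ′ * walk rs (σ′ ++ y ∷ []) ys) * forget k φ (σ ++ y ∷ ys)
    term y ys e = begin
      weight t * (a y σ′ * (walk rs (σ′ ++ y ∷ []) ys * forget k φ ((σ′ ++ y ∷ []) ++ ys)))
        ≡⟨ cong (λ τ → weight t * (a y σ′ * (walk rs (σ′ ++ y ∷ []) ys * forget k φ τ))) (Listₚ.++-assoc σ′ (y ∷ []) ys) ⟩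
      weight t * (a y σ′ * (walk rs (σ′ ++ y ∷ []) ys * forget k φ (σ′ ++ y ∷ ys)))
        ≈⟨ solve 4 (λ t a w f → t :* (a :* (w :* f)) := (a :* w) :* (t :* f)) refl (weight t) (a y σ′) (walk rs (σ′ ++ y ∷ []) ys) _ ⟩
      (a y σ′ * walk rs (σ′ ++ y ∷ []) ys) * (weight t * forget k φ (σ′ ++ y ∷ ys))
        ≈⟨ *-congˡ (forget-++ k φ t (σ′ ++ y ∷ ys) enough) ⟨
      (a y σ′ * walk rs (σ′ ++ y ∷ []) ys) * forget k φ (t ++ σ′ ++ y ∷ ys)
        ≡⟨ cong (λ τ → (a y σ′ * walk rs (σ′ ++ y ∷ []) ys) * forget k φ τ)
             (≡.trans (≡.sym (Listₚ.++-assoc t σ′ (y ∷ ys))) (cong (_++ y ∷ ys) split)) ⟩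
      (a y σ′ * walk rs (σ′ ++ y ∷ []) ys) * forget k φ (σ ++ y ∷ ys) ∎
      where
      enough : k ≤ length (σ′ ++ y ∷ ys)
      enough = subst (k ≤_) (≡.sym (≡.trans (Listₚ.length-++ σ′) (≡.trans (cong₂ (λ i j → i ℕ.+ suc j) len e) (ℕₚ.+-suc r (length rs)))))
        (valid-≤ rs valid)

  strings-++ : ∀ i j (f : List (Fin N) → Carrier) →
    ∑ (strings all (i ℕ.+ j)) f ≈ ∑ (strings all i) (λ c → ∑ (strings all j) (λ d → f (c ++ d)))
  strings-++ zero    j f = sym (+-identityʳ _)
  strings-++ (suc i) j f = begin
    ∑ (strings all (suc (i ℕ.+ j))) f
      ≈⟨ trans (strings-front all (i ℕ.+ j) f) (∑-ext all (λ s → strings-++ i j (λ c → f (s ∷ c)))) ⟩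
    ∑ all (λ s → ∑ (strings all i) (λ c → ∑ (strings all j) (λ d → f (s ∷ c ++ d))))
      ≈⟨ strings-front all i _ ⟨
    ∑ (strings all (suc i)) (λ c → ∑ (strings all j) (λ d → f (c ++ d))) ∎

  -- κ lists the labels of the n vertices of the glued graph: the walk starts from the first k,
  -- appends the others and then the first k again. Each of the n labels is forgotten once.
  closedWalk : ℕ → List ℕ → List (Fin N) → Carrier
  closedWalk k rs κ = [unique] (take k κ) * (walk rs (take k κ) (drop k κ ++ take k κ) * weight κ)

  -- The delta function at the end forces the last k appended entries to repeat the initial tuple σ.
  run-trace : ∀ k rs → k ≤ length rs → Valid k rs k →
    ∑ (arrangements k) (λ σ → run k rs (λ c → [ c ≟ᶜ σ ]) σ) ≈ ∑ (strings all (length rs)) (closedWalk k rs)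
  run-trace k rs k≤n valid = begin
    ∑ (arrangements k) (λ σ → run k rs (λ c → [ c ≟ᶜ σ ]) σ)
      ≈⟨ ∑-cong (arrangements k) (λ σ σ∈ → let _ , len = ∈-arrangements⁻ k σ∈ in
           trans (run-walk k rs (λ c → [ c ≟ᶜ σ ]) σ (subst (Valid k rs) (≡.sym len) valid)) (close σ len)) ⟩
    ∑ (arrangements k) (λ σ → ∑ (strings all m) (λ zs → walk rs σ (zs ++ σ) * weight (σ ++ zs)))
      ≈⟨ trans (∑-arrangements k _) (∑-cong (strings all k) (λ σ σ∈ → trans (∑-*ˡ (strings all m) _ _)
           (∑-ext (strings all m) (λ zs → reclose σ (∈-strings⁻ k σ∈) zs)))) ⟩
    ∑ (strings all k) (λ σ → ∑ (strings all m) (λ zs → closedWalk k rs (σ ++ zs)))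
      ≈⟨ strings-++ k m (closedWalk k rs) ⟨
    ∑ (strings all (k ℕ.+ m)) (closedWalk k rs)
      ≡⟨ cong (λ j → ∑ (strings all j) (closedWalk k rs)) (ℕₚ.m+[n∸m]≡n k≤n) ⟩
    ∑ (strings all (length rs)) (closedWalk k rs) ∎
    where
    m = length rs ℕ.∸ k
    reclose : ∀ σ → length σ ≡ k → ∀ zs → [unique] σ * (walk rs σ (zs ++ σ) * weight (σ ++ zs)) ≈ closedWalk k rs (σ ++ zs)
    reclose σ ≡.refl zs = reflexive (cong₂ (λ τ υ → [unique] τ * (walk rs τ (υ ++ τ) * weight (σ ++ zs)))
      (≡.sym (take-++ σ zs)) (≡.sym (drop-++ σ zs)))
    close : ∀ σ → length σ ≡ k →
      ∑ (strings all (length rs)) (λ ys → walk rs σ ys * forget k (λ c → [ c ≟ᶜ σ ]) (σ ++ ys))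
      ≈ ∑ (strings all m) (λ zs → walk rs σ (zs ++ σ) * weight (σ ++ zs))
    close σ len = begin
      ∑ (strings all (length rs)) F
        ≡⟨ cong (λ j → ∑ (strings all j) F) (≡.sym (ℕₚ.m∸n+n≡m k≤n)) ⟩
      ∑ (strings all (m ℕ.+ k)) F
        ≈⟨ strings-++ m k F ⟩
      ∑ (strings all m) (λ zs → ∑ (strings all k) (λ τ → F (zs ++ τ)))
        ≈⟨ ∑-ext (strings all m) (λ zs → trans (∑-cong (strings all k) (λ τ τ∈ → final zs τ (∈-strings⁻ k τ∈)))
             (∑-δ _≟ᶜ_ (λ τ → walk rs σ (zs ++ τ) * weight (σ ++ zs)) (strings-unique k (Uniqueₚ.allFin⁺ N))
               (subst (λ j → σ ∈ strings all j) len (∈-strings⁺ (λ {s} _ → ∈ₚ.∈-allFin s))))) ⟩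
      ∑ (strings all m) (λ zs → walk rs σ (zs ++ σ) * weight (σ ++ zs)) ∎
      where
      F : List (Fin N) → Carrier
      F ys = walk rs σ ys * forget k (λ c → [ c ≟ᶜ σ ]) (σ ++ ys)
      final : ∀ zs τ → length τ ≡ k → F (zs ++ τ) ≈ [ τ ≟ᶜ σ ] * (walk rs σ (zs ++ τ) * weight (σ ++ zs))
      final zs τ e = begin
        walk rs σ (zs ++ τ) * forget k (λ c → [ c ≟ᶜ σ ]) (σ ++ zs ++ τ)
          ≡⟨ cong (λ υ → walk rs σ (zs ++ τ) * forget k (λ c → [ c ≟ᶜ σ ]) υ) (≡.sym (Listₚ.++-assoc σ zs τ)) ⟩
        walk rs σ (zs ++ τ) * forget k (λ c → [ c ≟ᶜ σ ]) ((σ ++ zs) ++ τ)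
          ≈⟨ *-congˡ (trans (forget-++ k (λ c → [ c ≟ᶜ σ ]) (σ ++ zs) τ (ℕₚ.≤-reflexive (≡.sym e)))
               (*-congˡ (forget-here k (λ c → [ c ≟ᶜ σ ]) τ e))) ⟩
        walk rs σ (zs ++ τ) * (weight (σ ++ zs) * [ τ ≟ᶜ σ ])
          ≈⟨ solve 3 (λ a b c → a :* (b :* c) := c :* (a :* b)) refl (walk rs σ (zs ++ τ)) (weight (σ ++ zs)) [ τ ≟ᶜ σ ] ⟩
        [ τ ≟ᶜ σ ] * (walk rs σ (zs ++ τ) * weight (σ ++ zs)) ∎

-- Back degrees in natural unit interval graphs

module _ {S : Set} where
  -- A condition inherited by later entries selects a final segment. This will identify the earlier
  -- neighbours of a vertex with the most recently marked vertices.
  filter-retain : ∀ {P : S → Set} (P? : ∀ s → Dec (P s)) {us : List S} →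
    AllPairs (λ u v → P u → P v) us → filter P? us ≡ retain (length (filter P? us)) us
  filter-retain P? {[]}     [] = ≡.refl
  filter-retain P? {u ∷ us} (later ∷ pairs) with P? u
  ... | yes p = ≡.sym (≡.trans
    (cong (λ vs → drop (length us ℕ.∸ length vs) (u ∷ us)) kept)
    (≡.trans (cong (λ j → drop j (u ∷ us)) (ℕₚ.n∸n≡0 (length us))) (cong (u ∷_) (≡.sym kept))))
    where
    kept : filter P? us ≡ us
    kept = Listₚ.filter-all P? (All.map (λ f → f p) later)
  ... | no _ = ≡.trans (filter-retain P? pairs)
    (cong (λ j → drop j (u ∷ us)) (≡.sym (ℕₚ.+-∸-assoc 1 (Listₚ.length-filter P? us))))

  length-filter-mono : ∀ {P Q : S → Set} (P? : ∀ s → Dec (P s)) (Q? : ∀ s → Dec (Q s)) (us : List S) →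
    (∀ {u} → u ∈ us → P u → Q u) → length (filter P? us) ≤ length (filter Q? us)
  length-filter-mono P? Q? []       h = z≤n
  length-filter-mono P? Q? (u ∷ us) h with P? u | Q? u
  ... | yes p | yes _ = s≤s (length-filter-mono P? Q? us (h ∘ there))
  ... | yes p | no ¬q = contradiction (h (here ≡.refl) p) ¬q
  ... | no _  | yes _ = ℕₚ.m≤n⇒m≤1+n (length-filter-mono P? Q? us (h ∘ there))
  ... | no _  | no _  = length-filter-mono P? Q? us (h ∘ there)

  pairs-++ : ∀ {R : S → S → Set} (us : List S) {vs} → AllPairs R (us ++ vs) →
    AllPairs R us × (∀ {u v} → u ∈ us → v ∈ vs → R u v) × AllPairs R vs
  pairs-++ []       pairs          = [] , (λ ()) , pairs
  pairs-++ (u ∷ us) (later ∷ pairs) = let left , cross , right = pairs-++ us pairs in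
    Allₚ.++⁻ˡ us later ∷ left
    , (λ { (here ≡.refl) v∈ → All.lookup (Allₚ.++⁻ʳ us later) v∈ ; (there u∈) v∈ → cross u∈ v∈ })
    , right

  pairs-map : ∀ {R Q : S → S → Set} {us : List S} → (∀ {u v} → u ∈ us → v ∈ us → R u v → Q u v) → AllPairs R us → AllPairs Q us
  pairs-map h []              = []
  pairs-map h (later ∷ pairs) =
    All.tabulate (λ v∈ → h (here ≡.refl) (there v∈) (All.lookup later v∈)) ∷ pairs-map (λ u∈ v∈ → h (there u∈) (there v∈)) pairs

filter-initial : ∀ {m i o} k (f : Fin i → Fin m) → (∀ j → toℕ (f j) ≡ o ℕ.+ toℕ j) →
  filter (λ v → k ℕ.≤? toℕ v) (Data.List.tabulate f) ≡ drop (k ℕ.∸ o) (Data.List.tabulate f)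
filter-initial {i = zero}      {o} k f h = ≡.sym (Listₚ.drop-[] (k ℕ.∸ o))
filter-initial {m} {i = suc i} {o} k f h = go (k ℕ.≤? toℕ (f Fin.zero)) rest
  where
  f0 : toℕ (f Fin.zero) ≡ o
  f0 = ≡.trans (h Fin.zero) (ℕₚ.+-identityʳ o)
  rest : filter (λ v → k ℕ.≤? toℕ v) (Data.List.tabulate (f ∘ Fin.suc)) ≡ drop (k ℕ.∸ suc o) (Data.List.tabulate (f ∘ Fin.suc))
  rest = filter-initial k (f ∘ Fin.suc) (λ j → ≡.trans (h (Fin.suc j)) (ℕₚ.+-suc o (toℕ j)))
  go : ∀ {us} → Dec (k ≤ toℕ (f Fin.zero)) → filter (λ v → k ℕ.≤? toℕ v) us ≡ drop (k ℕ.∸ suc o) us →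
    filter (λ v → k ℕ.≤? toℕ v) (f Fin.zero ∷ us) ≡ drop (k ℕ.∸ o) (f Fin.zero ∷ us)
  go {us} (yes le) e = ≡.trans (Listₚ.filter-accept (λ v → k ℕ.≤? toℕ v) le)
    (≡.trans (cong (f Fin.zero ∷_) (≡.trans e (cong (λ j → drop j us) (ℕₚ.m≤n⇒m∸n≡0 (ℕₚ.m≤n⇒m≤1+n k≤o)))))
      (cong (λ j → drop j (f Fin.zero ∷ us)) (≡.sym (ℕₚ.m≤n⇒m∸n≡0 k≤o))))
    where
    k≤o : k ≤ o
    k≤o = subst (k ≤_) f0 le
  go {us} (no nle) e = ≡.trans (Listₚ.filter-reject (λ v → k ℕ.≤? toℕ v) nle)
    (≡.trans e (cong (λ j → drop j (f Fin.zero ∷ us)) (≡.sym (ℕₚ.+-∸-assoc 1 (subst (_< k) f0 (ℕₚ.≰⇒> nle))))))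

filter-≤-allFin : ∀ m k → filter (λ v → k ℕ.≤? toℕ v) (allFin m) ≡ drop k (allFin m)
filter-≤-allFin m k = filter-initial k id (λ _ → ≡.refl)

module UnitIntervals {n k : ℕ} (k≤n : k ≤ n) (G : Graph (n ℕ.+ k)) (Γ : Graph n)
  (interval : NaturalUnitInterval G) (first : IsClique G (First {n} k)) (last : IsClique G (Last {n} k))
  (glued : ObtainedByGluing k≤n G Γ) where
  open Graph G

  private
    m = n ℕ.+ k
    Vertex = Fin m

  sorted : AllPairs Fin._<_ (allFin m)
  sorted = AllPairsₚ.tabulate⁺-< id

  Back : Vertex → Vertex → Set
  Back v q = q Fin.< v × q ∼ v

  back? : ∀ v q → Dec (Back v q)
  back? v q = (q Finₚ.<? v) ×-dec (q ∼? v)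

  module At {us : List Vertex} {v : Vertex} {vs : List Vertex} (eq : us ++ v ∷ vs ≡ allFin m) where
    private
      parts = pairs-++ us (subst (AllPairs Fin._<_) (≡.sym eq) sorted)

    us-sorted : AllPairs Fin._<_ us
    us-sorted = proj₁ parts

    us<v : ∀ {u} → u ∈ us → u Fin.< v
    us<v u∈ = proj₁ (proj₂ parts) u∈ (here ≡.refl)

    <v⇒us : ∀ {u} → u Fin.< v → u ∈ us
    <v⇒us {u} u<v with ∈ₚ.∈-++⁻ us (subst (u ∈_) (≡.sym eq) (∈ₚ.∈-allFin u)) | proj₂ (proj₂ parts)
    ... | inj₁ u∈           | _          = u∈
    ... | inj₂ (here ≡.refl) | _         = contradiction u<v (ℕₚ.<-irrefl ≡.refl)
    ... | inj₂ (there u∈)   | later ∷ _ = contradiction (ℕₚ.<-trans u<v (All.lookup later u∈)) (ℕₚ.<-irrefl ≡.refl)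

    back-us : filter (back? v) (allFin m) ≡ filter (back? v) us
    back-us = ≡.trans (cong (filter (back? v)) (≡.sym eq)) (≡.trans (Listₚ.filter-++ (back? v) us (v ∷ vs))
      (≡.trans (cong (filter (back? v) us ++_) (Listₚ.filter-none (back? v) (All.tabulate later))) (Listₚ.++-identityʳ _)))
      where
      later : ∀ {u} → u ∈ v ∷ vs → ¬ Back v u
      later {u} u∈ (u<v , _) with u∈ | proj₂ (proj₂ parts)
      ... | here ≡.refl | _         = ℕₚ.<-irrefl ≡.refl u<v
      ... | there u∈′   | later ∷ _ = ℕₚ.<-irrefl ≡.refl (ℕₚ.<-trans u<v (All.lookup later u∈′))

    -- By the interval property a neighbour u < v of v has every vertex between them as a neighbour
    -- of v, so the earlier neighbours form a final segment of the vertices before v.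
    retain-us : retain (backDegree G v) us ≡ filter (back? v) us
    retain-us = ≡.trans (cong (λ L → retain (length L) us) back-us) (≡.sym (filter-retain (back? v)
      (pairs-map (λ _ u′∈ u<u′ (u<v , u∼v) → us<v u′∈ , proj₂ (interval u<v u∼v _ u<u′ (us<v u′∈))) us-sorted)))

    backDegree-≤ : backDegree G v ≤ length us
    backDegree-≤ = subst (_≤ length us) (cong length (≡.sym back-us)) (Listₚ.length-filter (back? v) us)

  -- A neighbour of w before u is also a neighbour of u.
  backDegree-step : ∀ {us u w vs} → us ++ u ∷ w ∷ vs ≡ allFin m → backDegree G w ≤ suc (backDegree G u)
  backDegree-step {us} {u} {w} {vs} eq = begin
    backDegree G w
      ≡⟨ cong length (At.back-us eq′) ⟩
    length (filter (back? w) (us ++ u ∷ []))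
      ≡⟨ ≡.trans (cong length (Listₚ.filter-++ (back? w) us (u ∷ []))) (Listₚ.length-++ (filter (back? w) us)) ⟩
    length (filter (back? w) us) ℕ.+ length (filter (back? w) (u ∷ []))
      ≤⟨ ℕₚ.+-mono-≤ (length-filter-mono (back? w) (back? u) us
           (λ q∈ (q<w , q∼w) → At.us<v eq q∈ , proj₁ (interval q<w q∼w u (At.us<v eq q∈) (At.us<v eq′ (∈ₚ.∈-++⁺ʳ us (here ≡.refl))))))
           (Listₚ.length-filter (back? w) (u ∷ [])) ⟩
    length (filter (back? u) us) ℕ.+ 1
      ≡⟨ ≡.trans (ℕₚ.+-comm _ 1) (cong suc (cong length (≡.sym (At.back-us eq)))) ⟩
    suc (backDegree G u) ∎
    where
    open ℕₚ.≤-Reasoning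
    eq′ : (us ++ u ∷ []) ++ w ∷ vs ≡ allFin m
    eq′ = ≡.trans (Listₚ.++-assoc us (u ∷ []) (w ∷ vs)) eq

  -- The last k vertices form a clique, so the final vertex is adjacent to the other k - 1 of them;
  -- if it is not among them, then k = 0.
  backDegree-last : ∀ {us u} → us ++ u ∷ [] ≡ allFin m → k ≤ suc (backDegree G u)
  backDegree-last {us} {u} eq = begin
    k
      ≡⟨ ≡.sym (≡.trans (Listₚ.length-drop n (allFin m)) (≡.trans (cong (ℕ._∸ n) (Listₚ.length-tabulate {n = m} id)) (ℕₚ.m+n∸m≡n n k))) ⟩
    length (drop n (allFin m))
      ≡⟨ cong length (≡.trans (≡.sym (filter-≤-allFin m n)) (cong (filter late?) (≡.sym eq))) ⟩
    length (filter late? (us ++ u ∷ []))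
      ≡⟨ ≡.trans (cong length (Listₚ.filter-++ late? us (u ∷ []))) (Listₚ.length-++ (filter late? us)) ⟩
    length (filter late? us) ℕ.+ length (filter late? (u ∷ []))
      ≤⟨ bound (late? u) ⟩
    suc (length (filter (back? u) us))
      ≡⟨ cong suc (cong length (≡.sym (At.back-us eq))) ⟩
    suc (backDegree G u) ∎
    where
    open ℕₚ.≤-Reasoning
    late? : ∀ (v : Vertex) → Dec (n ≤ toℕ v)
    late? v = n ℕ.≤? toℕ v
    bound : Dec (n ≤ toℕ u) → length (filter late? us) ℕ.+ length (filter late? (u ∷ [])) ≤ suc (length (filter (back? u) us))
    bound (yes n≤u) = subst (length (filter late? us) ℕ.+ length (filter late? (u ∷ [])) ≤_) (ℕₚ.+-comm (length (filter (back? u) us)) 1) (ℕₚ.+-mono-≤ (length-filter-mono late? (back? u) us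
        (λ q∈ n≤q → At.us<v eq q∈ , last n≤q n≤u (λ { ≡.refl → ℕₚ.<-irrefl ≡.refl (At.us<v eq q∈) })))
      (Listₚ.length-filter late? (u ∷ [])))
    bound (no n≰u) = subst (_≤ suc (length (filter (back? u) us)))
      (≡.sym (cong₂ ℕ._+_ (cong length (Listₚ.filter-none late? {xs = us} (All.tabulate (λ q∈ n≤q → n≰u (ℕₚ.≤-trans n≤q (ℕₚ.<⇒≤ (At.us<v eq q∈)))))))
                          (cong length (Listₚ.filter-none late? (n≰u ∷ [])))))
      z≤n

  vertices : List Vertex
  vertices = filter (λ v → k ℕ.≤? toℕ v) (allFin m)

  backDegrees : List ℕ
  backDegrees = map (backDegree G) vertices

  initial : List Vertex
  initial = take k (allFin m)

  initial++vertices : initial ++ vertices ≡ allFin m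
  initial++vertices = ≡.trans (cong (initial ++_) (filter-≤-allFin m k)) (Listₚ.take++drop≡id k (allFin m))

  initial-length : length initial ≡ k
  initial-length = ≡.trans (Listₚ.length-take k (allFin m))
    (≡.trans (cong (k ℕ.⊓_) (Listₚ.length-tabulate {n = m} id)) (ℕₚ.m≤n⇒m⊓n≡m (ℕₚ.m≤n+m k n)))

  vertices-length : length vertices ≡ n
  vertices-length = ≡.trans (cong length (filter-≤-allFin m k)) (≡.trans (Listₚ.length-drop k (allFin m))
    (≡.trans (cong (ℕ._∸ k) (Listₚ.length-tabulate {n = m} id)) (ℕₚ.m+n∸n≡m n k)))

  valid-from : ∀ us vs s → us ++ vs ≡ allFin m → (vs ≡ [] → k ≤ s) → (∀ {v vs′} → vs ≡ v ∷ vs′ → backDegree G v ≤ s) →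
    Valid k (map (backDegree G) vs) s
  valid-from us []       s eq none some = none ≡.refl
  valid-from us (v ∷ vs) s eq none some = some ≡.refl
    , valid-from (us ++ v ∷ []) vs (suc (backDegree G v)) (≡.trans (Listₚ.++-assoc us (v ∷ []) vs) eq)
        (λ { ≡.refl → backDegree-last eq }) (λ { ≡.refl → backDegree-step eq })

  valid : Valid k backDegrees k
  valid = valid-from initial vertices k initial++vertices (λ _ → ℕₚ.≤-refl)
    (λ {v} {vs} e → subst (backDegree G v ≤_) initial-length (At.backDegree-≤ (≡.trans (cong (initial ++_) (≡.sym e)) initial++vertices)))

-- Closed walks of colors as proper colorings

module ProperColorings {n k : ℕ} (k≤n : k ≤ n) (G : Graph (n ℕ.+ k)) (Γ : Graph n)
  (interval : NaturalUnitInterval G) (first : IsClique G (First {n} k)) (last : IsClique G (Last {n} k))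
  (glued : ObtainedByGluing k≤n G Γ) (Alg : RationalAlgebra) {N : ℕ} (w : Fin N → RationalAlgebra.Carrier Alg) where
  open UnitIntervals k≤n G Γ interval first last glued
  open Graph G
  open RationalAlgebra Alg
  open Sums Alg
  open StringSums Alg
  open ArrangementSums Alg {N}
  open RunExpansion Alg {N} fresh w

  private
    m = n ℕ.+ k

  module Labelled (T : Fin m → Fin N) where
    Distinct : Fin m → Set
    Distinct v = ∀ u → u Fin.< v → u ∼ v → T u ≢ T v

    distinct? : ∀ v → Dec (Distinct v)
    distinct? v = Finₚ.all? λ u → (u Finₚ.<? v) →-dec ((u ∼? v) →-dec ¬? (T u Finₚ.≟ T v))

    fresh-distinct : ∀ {us v vs σ} (eq : us ++ v ∷ vs ≡ allFin m) → σ ≡ filter (back? v) us →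
      fresh (T v) (map T σ) ≈ [ distinct? v ]
    fresh-distinct {us} {v} eq ≡.refl = [⇔] (¬? (T v ∈? map T (filter (back? v) us))) (distinct? v)
      (λ Tv∉ u u<v u∼v e → Tv∉ (subst (_∈ map T (filter (back? v) us)) e (∈ₚ.∈-map⁺ T (∈ₚ.∈-filter⁺ (back? v) (At.<v⇒us eq u<v) (u<v , u∼v)))))
      (λ distinct Tv∈ → let u , u∈ , e = ∈ₚ.∈-map⁻ T Tv∈ ; u<v , u∼v = proj₂ (∈ₚ.∈-filter⁻ (back? v) {xs = us} u∈) in
        distinct u u<v u∼v (≡.sym e))

    -- Before v is added, the vertices kept are its earlier neighbours, so `fresh` tests v against
    -- these. In the induction t ++ σ are the vertices built so far and σ those still marked.
    walk-distinct : ∀ t σ vs → (t ++ σ) ++ vs ≡ allFin m → Valid k (map (backDegree G) vs) (length σ) →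
      walk (map (backDegree G) vs) (map T σ) (map T vs) ≈ [ all? distinct? vs ]
    walk-distinct t σ []       eq _ = refl
    walk-distinct t σ (v ∷ vs) eq (r≤ , valid′) = begin
      fresh (T v) (retain r (map T σ)) * walk (map (backDegree G) vs) (retain r (map T σ) ++ T v ∷ []) (map T vs)
        ≡⟨ cong (λ τ → fresh (T v) τ * walk (map (backDegree G) vs) (τ ++ T v ∷ []) (map T vs)) (retain-map T r σ) ⟩
      fresh (T v) (map T σ′) * walk (map (backDegree G) vs) (map T σ′ ++ T v ∷ []) (map T vs)
        ≈⟨ *-cong (fresh-distinct eq (≡.trans (≡.sym (retain-++ t σ r≤)) (At.retain-us eq)))
             (trans (reflexive (cong (λ τ → walk (map (backDegree G) vs) τ (map T vs)) (≡.sym (Listₚ.map-++ T σ′ (v ∷ [])))))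
               (walk-distinct (t ++ take (length σ ℕ.∸ r) σ) (σ′ ++ v ∷ []) vs eq′
                 (subst (Valid k (map (backDegree G) vs)) (≡.sym (≡.trans (length-snoc σ′ v) (cong suc (length-retain r≤)))) valid′))) ⟩
      [ distinct? v ] * [ all? distinct? vs ]
        ≈⟨ [×] (all? distinct? (v ∷ vs)) (distinct? v) (all? distinct? vs) (λ { (d ∷ ds) → d , ds }) _∷_ ⟨
      [ all? distinct? (v ∷ vs) ] ∎
      where
      open ≈-Reasoning
      r  = backDegree G v
      σ′ = retain r σ
      eq′ : ((t ++ take (length σ ℕ.∸ r) σ) ++ (σ′ ++ v ∷ [])) ++ vs ≡ allFin m
      eq′ = ≡.trans (Listₚ.++-assoc (t ++ take (length σ ℕ.∸ r) σ) (σ′ ++ v ∷ []) vs)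
        (≡.trans (Listₚ.++-assoc t (take (length σ ℕ.∸ r) σ) _)
        (≡.trans (cong (λ τ → t ++ take (length σ ℕ.∸ r) σ ++ τ) (Listₚ.++-assoc σ′ (v ∷ []) vs))
        (≡.trans (cong (t ++_) (≡.sym (Listₚ.++-assoc (take (length σ ℕ.∸ r) σ) σ′ (v ∷ vs))))
        (≡.trans (cong (λ τ → t ++ τ ++ v ∷ vs) (Listₚ.take++drop≡id (length σ ℕ.∸ r) σ))
        (≡.trans (≡.sym (Listₚ.++-assoc t σ (v ∷ vs))) eq)))))

    private
      parts = pairs-++ initial (subst (AllPairs Fin._<_) (≡.sym initial++vertices) sorted)

    initial-early : ∀ {u} → u ∈ initial → toℕ u < k
    initial-early {u} u∈ = ℕₚ.≰⇒> (λ k≤u → ℕₚ.<-irrefl ≡.refl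
      (proj₁ (proj₂ parts) u∈ (∈ₚ.∈-filter⁺ (λ v → k ℕ.≤? toℕ v) (∈ₚ.∈-allFin u) k≤u)))

    initial-closed : ∀ {u v} → v ∈ initial → u Fin.< v → u ∈ initial
    initial-closed {u} v∈ u<v with ∈ₚ.∈-++⁻ initial (subst (u ∈_) (≡.sym initial++vertices) (∈ₚ.∈-allFin u))
    ... | inj₁ u∈ = u∈
    ... | inj₂ u∈ = contradiction (ℕₚ.<-trans u<v (proj₁ (proj₂ parts) v∈ u∈)) (ℕₚ.<-irrefl ≡.refl)

    unique-map⁻ : ∀ {us u v} → Unique (map T us) → u ∈ us → v ∈ us → u ≢ v → T u ≢ T v
    unique-map⁻ (_  ∷ _) (here ≡.refl) (here ≡.refl) u≢v = contradiction ≡.refl u≢v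
    unique-map⁻ (u∉ ∷ _) (here ≡.refl) (there v∈)    _   = All.lookup u∉ (∈ₚ.∈-map⁺ T v∈)
    unique-map⁻ (v∉ ∷ _) (there u∈)    (here ≡.refl) _   = All.lookup v∉ (∈ₚ.∈-map⁺ T u∈) ∘ ≡.sym
    unique-map⁻ (_  ∷ ps) (there u∈)   (there v∈)    u≢v = unique-map⁻ ps u∈ v∈ u≢v

    -- The first k vertices form a clique, so distinct colors on them are the same as a proper
    -- coloring of them.
    initial-distinct : [unique] (map T initial) ≈ [ all? distinct? initial ]
    initial-distinct = [⇔] (unique? Finₚ._≟_ (map T initial)) (all? distinct? initial)
      (λ u! → All.tabulate (λ {v} v∈ u u<v _ → unique-map⁻ u! (initial-closed v∈ u<v) v∈ (λ { ≡.refl → ℕₚ.<-irrefl ≡.refl u<v })))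
      (λ distinct → AllPairsₚ.map⁺ (pairs-map (λ {u} {v} u∈ v∈ u<v → All.lookup distinct v∈ u u<v
        (first (initial-early u∈) (initial-early v∈) (λ { ≡.refl → ℕₚ.<-irrefl ≡.refl u<v }))) (proj₁ parts)))

    walks-distinct : [unique] (map T initial) * walk backDegrees (map T initial) (map T vertices) ≈ [ all? distinct? (allFin m) ]
    walks-distinct = trans
      (*-cong initial-distinct (walk-distinct [] initial vertices initial++vertices (subst (Valid k backDegrees) (≡.sym initial-length) valid)))
      (sym ([×] (all? distinct? (allFin m)) (all? distinct? initial) (all? distinct? vertices)
        (λ ds → let ds′ = subst (All Distinct) (≡.sym initial++vertices) ds in Allₚ.++⁻ˡ initial ds′ , Allₚ.++⁻ʳ initial ds′)
        (λ ds ds′ → subst (All Distinct) initial++vertices (Allₚ.++⁺ ds ds′))))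

  -- The coloring pulled back along the gluing, so that the last k vertices repeat the colors of the
  -- first k.
  unrolled : Vec (Fin N) n → Fin m → Fin N
  unrolled κ v = lookup κ (glue k≤n v)

  -- Every edge of Γ lifts to an edge of G, whose ends are then taken in increasing order.
  distinct-proper : ∀ κ → [ all? (Labelled.distinct? (unrolled κ)) (allFin m) ] ≈ [ proper? Γ κ ]
  distinct-proper κ = [⇔] (all? (Labelled.distinct? (unrolled κ)) (allFin m)) (proper? Γ κ) to from
    where
    open Labelled (unrolled κ) using (Distinct)
    to : All Distinct (allFin m) → Proper Γ κ
    to distinct u v u∼v with Equivalence.to (glued u v) u∼v
    ... | p , q , ≡.refl , ≡.refl , p∼q with ℕₚ.<-cmp (toℕ p) (toℕ q)
    ...   | tri< p<q _ _ = All.lookup distinct (∈ₚ.∈-allFin q) p p<q p∼q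
    ...   | tri≈ _ p≡q _ = contradiction (subst (p ∼_) (≡.sym (Finₚ.toℕ-injective p≡q)) p∼q) irrefl
    ...   | tri> _ _ q<p = All.lookup distinct (∈ₚ.∈-allFin p) q q<p (∼-sym p∼q) ∘ ≡.sym
    from : Proper Γ κ → All Distinct (allFin m)
    from proper = All.tabulate (λ {v} _ u _ u∼v → proper (glue k≤n u) (glue k≤n v) (Equivalence.from (glued _ _) (u , v , ≡.refl , ≡.refl , u∼v)))

  unrolled-list : ∀ κ → map (unrolled κ) (allFin m) ≡ Vec.toList κ ++ take k (Vec.toList κ)
  unrolled-list κ = ≡.trans (Listₚ.map-tabulate id (unrolled κ)) (≡.trans (tabulate-splitAt n _)
      (cong₂ _++_ (≡.trans (Listₚ.tabulate-cong (λ i → cong (λ s → lookup κ ([ id , (λ r → inject≤ r k≤n) ]′ s)) (Finₚ.splitAt-↑ˡ n i k))) (tabulate-lookup κ))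
        (≡.trans (Listₚ.tabulate-cong (λ i → cong (λ s → lookup κ ([ id , (λ r → inject≤ r k≤n) ]′ s)) (Finₚ.splitAt-↑ʳ n k i))) (tabulate-inject κ k≤n))))
    where
    tabulate-splitAt : ∀ {S : Set} i {j} (f : Fin (i ℕ.+ j) → S) →
      Data.List.tabulate f ≡ Data.List.tabulate (f ∘ (Fin._↑ˡ j)) ++ Data.List.tabulate (f ∘ (i Fin.↑ʳ_))
    tabulate-splitAt zero    f = ≡.refl
    tabulate-splitAt (suc i) f = cong (f Fin.zero ∷_) (tabulate-splitAt i (f ∘ Fin.suc))
    tabulate-lookup : ∀ {S : Set} {j} (v : Vec S j) → Data.List.tabulate (lookup v) ≡ Vec.toList v
    tabulate-lookup []      = ≡.refl
    tabulate-lookup (s ∷ v) = cong (s ∷_) (tabulate-lookup v)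
    tabulate-inject : ∀ {S : Set} {i j} (v : Vec S j) (i≤j : i ≤ j) →
      Data.List.tabulate (λ r → lookup v (inject≤ r i≤j)) ≡ take i (Vec.toList v)
    tabulate-inject v       z≤n       = ≡.refl
    tabulate-inject (s ∷ v) (s≤s i≤j) = cong (s ∷_) (tabulate-inject v i≤j)

  module _ (κ : Vec (Fin N) n) where
    private
      c = Vec.toList κ
      a = take k c
      b = drop k c
      a-length : length a ≡ k
      a-length = ≡.trans (Listₚ.length-take k c) (≡.trans (cong (k ℕ.⊓_) (Vecₚ.length-toList κ)) (ℕₚ.m≤n⇒m⊓n≡m k≤n))
      whole : map (unrolled κ) (allFin m) ≡ a ++ (b ++ a)
      whole = ≡.trans (unrolled-list κ) (≡.trans (cong (_++ a) (≡.sym (Listₚ.take++drop≡id k c))) (Listₚ.++-assoc a b a))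

    initial-labels : map (unrolled κ) initial ≡ a
    initial-labels = ≡.trans (≡.sym (Listₚ.take-map k (allFin m))) (≡.trans (cong (take k) whole)
      (≡.trans (cong (λ j → take j (a ++ (b ++ a))) (≡.sym a-length)) (take-++ a (b ++ a))))

    vertex-labels : map (unrolled κ) vertices ≡ b ++ a
    vertex-labels = ≡.trans (cong (map (unrolled κ)) (filter-≤-allFin m k)) (≡.trans (≡.sym (Listₚ.drop-map k (allFin m))) (≡.trans (cong (drop k) whole)
      (≡.trans (cong (λ j → drop j (a ++ (b ++ a))) (≡.sym a-length)) (drop-++ a (b ++ a)))))

    closedWalk-proper : closedWalk k backDegrees c ≈ [ proper? Γ κ ] * weight c
    closedWalk-proper = trans (sym (*-assoc _ _ _)) (*-congʳ (trans
      (reflexive (≡.sym (cong₂ (λ σ τ → [unique] σ * walk backDegrees σ τ) initial-labels vertex-labels)))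
      (trans (Labelled.walks-distinct (unrolled κ)) (distinct-proper κ))))

toList-words : ∀ {S : Set} (L : List S) n → map Vec.toList (words L n) ≡ strings L n
toList-words L zero    = ≡.refl
toList-words L (suc n) = ≡.trans (go L) (cong (cartesianProductWith _∷_ L) (toList-words L n))
  where
  go : ∀ M → map Vec.toList (cartesianProductWith _∷_ M (words L n)) ≡ cartesianProductWith _∷_ M (map Vec.toList (words L n))
  go []      = ≡.refl
  go (s ∷ M) = ≡.trans (Listₚ.map-++ Vec.toList (map (s ∷_) (words L n)) _) (cong₂ _++_ (inner (words L n)) (go M))
    where
    inner : ∀ ws → map Vec.toList (map (s ∷_) ws) ≡ map (s ∷_) (map Vec.toList ws)
    inner []       = ≡.refl
    inner (w ∷ ws) = cong (_ ∷_) (inner ws)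

-- The chromatic symmetric polynomial as a trace

module ChromaticTrace {n k : ℕ} (k≤n : k ≤ n) (G : Graph (n ℕ.+ k)) (Γ : Graph n)
  (interval : NaturalUnitInterval G) (first : IsClique G (First {n} k)) (last : IsClique G (Last {n} k))
  (glued : ObtainedByGluing k≤n G Γ) (N : ℕ) where
  open UnitIntervals k≤n G Γ interval first last glued using (backDegrees; vertices; vertices-length; valid)
  open Variables N
  open Field rationalFunctions
  open Sums algebra
  open ArrangementSums algebra {N} using (fresh)
  open Transitions rationalFunctions N using (step)
  open PartialRelations rationalFunctions N x x-distinct x-nonzero esym-nonzero using (labelWeight)
  open OperatorTrace N using (trace-run)
  open TraceEquality rationalFunctions N x x-distinct x-nonzero esym-nonzero using (trace-equality)
  open ProperColorings k≤n G Γ interval first last glued algebra {N} x using (closedWalk-proper)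
  open ≈-Reasoning

  private
    all = allFin N
    module W = RunExpansion algebra {N} fresh x
    module V = RunExpansion algebra {N} step labelWeight
    lengths : length backDegrees ≡ n
    lengths = ≡.trans (Listₚ.length-map (backDegree G) vertices) vertices-length
    k≤lengths : k ≤ length backDegrees
    k≤lengths = subst (k ≤_) (≡.sym lengths) k≤n

  X-closedWalks : poly (X Γ N) ≈ ∑ (strings all n) (W.closedWalk k backDegrees)
  X-closedWalks = begin
    poly (X Γ N)
      ≈⟨ poly-map content (filter (proper? Γ) (words all n)) ⟩
    ∑ (filter (proper? Γ) (words all n)) (monomial ∘ content)
      ≈⟨ ∑-filter (proper? Γ) (words all n) _ ⟩
    ∑ (words all n) (λ κ → [ proper? Γ κ ] * monomial (content κ))
      ≈⟨ ∑-ext (words all n) (λ κ → trans (*-congˡ (trans (monomial-content κ) (foldr-weight κ))) (sym (closedWalk-proper κ))) ⟩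
    ∑ (words all n) (W.closedWalk k backDegrees ∘ Vec.toList)
      ≈⟨ ∑-map Vec.toList (words all n) _ ⟨
    ∑ (map Vec.toList (words all n)) (W.closedWalk k backDegrees)
      ≡⟨ cong (λ L → ∑ L (W.closedWalk k backDegrees)) (toList-words all n) ⟩
    ∑ (strings all n) (W.closedWalk k backDegrees) ∎
    where
    foldr-weight : ∀ {j} (κ : Vec (Fin N) j) → Vec.foldr′ (λ c → x c *_) 1# κ ≈ W.weight (Vec.toList κ)
    foldr-weight []      = refl
    foldr-weight (c ∷ κ) = *-congˡ (foldr-weight κ)

  labelled-closedWalks : poly (X Γ N) ≈ ∑ (strings all n) (V.closedWalk k backDegrees)
  labelled-closedWalks = begin
    poly (X Γ N)
      ≈⟨ X-closedWalks ⟩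
    ∑ (strings all n) (W.closedWalk k backDegrees)
      ≡⟨ cong (λ j → ∑ (strings all j) (W.closedWalk k backDegrees)) (≡.sym lengths) ⟩
    ∑ (strings all (length backDegrees)) (W.closedWalk k backDegrees)
      ≈⟨ W.run-trace k backDegrees k≤lengths valid ⟨
    ∑ (arrangements k) (λ σ → Runs.run algebra all fresh x k backDegrees (λ c → [ c ≟ᶜ σ ]) σ)
      ≈⟨ trace-equality k backDegrees ⟨
    ∑ (arrangements k) (λ σ → Runs.run algebra all step labelWeight k backDegrees (λ c → [ c ≟ᶜ σ ]) σ)
      ≈⟨ V.run-trace k backDegrees k≤lengths valid ⟩
    ∑ (strings all (length backDegrees)) (V.closedWalk k backDegrees)
      ≡⟨ cong (λ j → ∑ (strings all j) (V.closedWalk k backDegrees)) lengths ⟩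
    ∑ (strings all n) (V.closedWalk k backDegrees) ∎

  X-trace : fromPoly (X Γ N) ≈ᶠ trace (M𝐆 {n} k G N)
  X-trace = embed-reflects (fromPoly (X Γ N)) (trace (M𝐆 {n} k G N)) (begin
    embed (fromPoly (X Γ N))
      ≈⟨ labelled-closedWalks ⟩
    ∑ (strings all n) (V.closedWalk k backDegrees)
      ≡⟨ cong (λ j → ∑ (strings all j) (V.closedWalk k backDegrees)) (≡.sym lengths) ⟩
    ∑ (strings all (length backDegrees)) (V.closedWalk k backDegrees)
      ≈⟨ V.run-trace k backDegrees k≤lengths valid ⟨
    ∑ (arrangements k) (λ σ → Runs.run algebra all step labelWeight k backDegrees (λ c → [ c ≟ᶜ σ ]) σ)
      ≈⟨ trace-run k backDegrees ⟨
    embed (trace (M𝐆 {n} k G N)) ∎)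

-- Nonnegativity and vanishing of the weights A

*-≥0 : ∀ {p q} → 0ℚ ℚ.≤ p → 0ℚ ℚ.≤ q → 0ℚ ℚ.≤ p ℚ.* q
*-≥0 {p} {q} p≥0 q≥0 = subst (ℚ._≤ p ℚ.* q) (ℚₚ.*-zeroʳ p)
  (ℚₚ.*-monoˡ-≤-nonNeg p {{ℚ.nonNegative p≥0}} q≥0)

∏-≥0 : ∀ {j} (rs : List (Fin j)) {f} → (∀ r → 0ℚ ℚ.≤ f r) → 0ℚ ℚ.≤ ∏ rs f
∏-≥0 []       h = ℚₚ.nonNegative⁻¹ 1ℚ
∏-≥0 (r ∷ rs) h = *-≥0 (h r) (∏-≥0 rs h)

∏-zero : ∀ {j} (rs : List (Fin j)) {f r} → r ∈ rs → f r ≡ 0ℚ → ∏ rs f ≡ 0ℚ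
∏-zero (r ∷ rs) {f} (here ≡.refl) z = ≡.trans (cong (ℚ._* ∏ rs f) z) (ℚₚ.*-zeroˡ (∏ rs f))
∏-zero (r ∷ rs) {f} (there r∈)    z = ≡.trans (cong (f r ℚ.*_) (∏-zero rs r∈ z)) (ℚₚ.*-zeroʳ (f r))

/-≥0 : ∀ a d → 0ℚ ℚ.≤ (+ a) ℚ./ suc d
/-≥0 a d = ℚₚ.nonNegative⁻¹ _ {{ℚₚ.normalize-nonNeg a (suc d)}}

zero-// : ∀ d → (+ 0) // d ≡ 0ℚ
zero-// (+ zero)    = ≡.refl
zero-// (+ (suc d)) = ℚₚ.0/n≡0 (suc d)
zero-// (-[1+ d ])  = ℚₚ.0/n≡0 (suc d)

-- No integer lies strictly between -1 and 0, so d and d + 1 never have opposite signs; for d = 0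
-- the total division returns 0.
successor-//-≥0 : ∀ d → 0ℚ ℚ.≤ (d ℤ.+ + 1) // d
successor-//-≥0 (+ zero)         = ℚₚ.≤-refl
successor-//-≥0 (+ (suc d))      = /-≥0 (suc d ℕ.+ 1) d
successor-//-≥0 (-[1+ zero ])    = /-≥0 0 0
successor-//-≥0 (-[1+ suc d ])   = /-≥0 (suc d) (suc d)

predecessor-//-≥0 : ∀ s → 0ℚ ℚ.≤ (+ s ℤ.- + 1) // (+ s)
predecessor-//-≥0 zero    = ℚₚ.≤-refl
predecessor-//-≥0 (suc s) = /-≥0 s s

A-≥0 : ∀ {j} y (σ : Vec ℕ j) → 0ℚ ℚ.≤ A y σ
A-≥0 {j} y σ with y ℕ.≟ 1 | Finₚ.any? (λ r → y ℕ.≟ suc (lookup σ r))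
... | yes _ | _           = ∏-≥0 (allFin j) (λ r → predecessor-//-≥0 (lookup σ r))
... | no _  | no _        = ℚₚ.≤-refl
... | no _  | yes (r , _) = *-≥0 (successor-//-≥0 (+ lookup σ r))
  (∏-≥0 (filter (λ r′ → ¬? (r′ Finₚ.≟ r)) (allFin j)) (λ r′ → successor-//-≥0 (+ lookup σ r ℤ.- + lookup σ r′)))

-- For a marked y the product contains a zero factor: (1 - 1)/1 if y = 1, and the factor with
-- numerator σ_r′ - y + 1 = 0 if y = σ_r′ + 1.
A-entry : ∀ {j} (σ : Vec ℕ j) r → A (lookup σ r) σ ≡ 0ℚ
A-entry {j} σ r with lookup σ r ℕ.≟ 1 | Finₚ.any? (λ r′ → lookup σ r ℕ.≟ suc (lookup σ r′))
... | yes e | _            = ∏-zero (allFin j) (∈ₚ.∈-allFin r) (cong (λ s → (+ s ℤ.- + 1) // (+ s)) e)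
... | no _  | no _         = ≡.refl
... | no _  | yes (r′ , e) = ≡.trans (cong (((+ s ℤ.+ + 1) // (+ s)) ℚ.*_)
    (∏-zero (filter (λ t → ¬? (t Finₚ.≟ r′)) (allFin j)) {f = λ t → (+ s ℤ.- + lookup σ t ℤ.+ + 1) // (+ s ℤ.- + lookup σ t)}
      (∈ₚ.∈-filter⁺ (λ t → ¬? (t Finₚ.≟ r′)) (∈ₚ.∈-allFin r) (λ r≡r′ → ℕₚ.1+n≢n (≡.trans (≡.sym e) (cong (lookup σ) r≡r′))))
      (≡.trans (cong (_// (+ s ℤ.- + lookup σ r)) vanish) (zero-// (+ s ℤ.- + lookup σ r)))))
    (ℚₚ.*-zeroʳ ((+ s ℤ.+ + 1) // (+ s)))
  where
  s = lookup σ r′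
  vanish : + s ℤ.- + lookup σ r ℤ.+ + 1 ≡ + 0
  vanish = ≡.trans (cong (λ t → + s ℤ.- + t ℤ.+ + 1) e) (≡.trans (ℤₚ.+-assoc (+ s) (ℤ.- + suc s) (+ 1))
    (≡.trans (cong (λ z → + s ℤ.+ z) (cancel s)) (ℤₚ.+-inverseʳ (+ s))))
    where
    cancel : ∀ s → ℤ.- + suc s ℤ.+ + 1 ≡ ℤ.- + s
    cancel zero    = ≡.refl
    cancel (suc s) = ≡.refl

A-predecessor : ∀ {j} y (σ : Vec ℕ j) → A (suc (suc y)) σ ≢ 0ℚ → ∃ λ r → suc y ≡ lookup σ r
A-predecessor y σ nz with Finₚ.any? (λ r → suc (suc y) ℕ.≟ suc (lookup σ r))
... | no _        = contradiction ≡.refl nz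
... | yes (r , e) = r , ℕₚ.suc-injective e

Aᴸ : ℕ → List ℕ → ℚ
Aᴸ y σ = A y (Vec.fromList σ)

Aᴸ-predecessor : ∀ y σ → Aᴸ (suc (suc y)) σ ≢ 0ℚ → suc y ∈ σ × suc (suc y) ∉ σ
Aᴸ-predecessor y σ nz = let r , e = A-predecessor y (Vec.fromList σ) nz in
    subst (_∈ σ) (≡.sym e) (entry r) , λ y∈ → let r′ , e′ = index y∈ in
    nz (≡.trans (cong (λ s → A s (Vec.fromList σ)) e′) (A-entry (Vec.fromList σ) r′))
  where
  entry : ∀ {σ : List ℕ} r → lookup (Vec.fromList σ) r ∈ σ
  entry {s ∷ σ} Fin.zero    = here ≡.refl
  entry {s ∷ σ} (Fin.suc r) = there (entry r)
  index : ∀ {σ : List ℕ} {s} → s ∈ σ → ∃ λ r → s ≡ lookup (Vec.fromList σ) r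
  index (here e)   = Fin.zero , e
  index (there s∈) = let r , e = index s∈ in Fin.suc r , e

-- How often labels occur in a closed walk

module _ {P : Set} where
  mark : Dec P → ℕ
  mark (yes _) = 1
  mark (no _)  = 0

  mark-yes : (d : Dec P) → P → mark d ≡ 1
  mark-yes (yes _) p = ≡.refl
  mark-yes (no ¬p) p = contradiction p ¬p

  mark-no : (d : Dec P) → ¬ P → mark d ≡ 0
  mark-no (yes p) ¬p = contradiction p ¬p
  mark-no (no _)  ¬p = ≡.refl

tally : ℕ → ℕ → ℕ
tally y z = mark (z ℕ.≟ y)

occ : ℕ → List ℕ → ℕ
occ y []      = 0
occ y (z ∷ c) = tally y z ℕ.+ occ y c

occ-++ : ∀ y c d → occ y (c ++ d) ≡ occ y c ℕ.+ occ y d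
occ-++ y []      d = ≡.refl
occ-++ y (z ∷ c) d = ≡.trans (cong (tally y z ℕ.+_) (occ-++ y c d)) (≡.sym (ℕₚ.+-assoc (tally y z) (occ y c) (occ y d)))

occ-∉ : ∀ {y} c → y ∉ c → occ y c ≡ 0
occ-∉     []      y∉ = ≡.refl
occ-∉ {y} (z ∷ c) y∉ = cong₂ ℕ._+_ (mark-no (z ℕ.≟ y) (λ e → y∉ (here (≡.sym e)))) (occ-∉ c (y∉ ∘ there))

occ-∈ : ∀ {y} c → y ∈ c → 1 ≤ occ y c
occ-∈ {y} (_ ∷ c) (here ≡.refl) = subst (λ t → 1 ≤ t ℕ.+ occ y c) (≡.sym (mark-yes (y ℕ.≟ y) ≡.refl)) (s≤s z≤n)
occ-∈ {y} (z ∷ c) (there y∈)    = ℕₚ.≤-trans (occ-∈ c y∈) (ℕₚ.m≤n+m (occ y c) (tally y z))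

∈-occ : ∀ {y} c → 1 ≤ occ y c → y ∈ c
∈-occ {y} (z ∷ c) le = go (z ℕ.≟ y) le
  where
  go : (d : Dec (z ≡ y)) → 1 ≤ mark d ℕ.+ occ y c → y ∈ z ∷ c
  go (yes e) _  = here (≡.sym e)
  go (no _)  le = there (∈-occ c le)

-- Labels start at 1, so the first comparison is between 2 and 1.
Balanced : List ℕ → Set
Balanced c = ∀ y → occ (suc (suc y)) c ≤ occ (suc y) c

-- A label y + 1 can only be appended while y is marked and y + 1 is not, that is, when y was
-- used since the last use of y + 1. The 0-1 variable `available` records whether this is so.
module Availability (y : ℕ) where
  choose : ∀ {P Q : Set} → Dec P → Dec Q → ℕ → ℕ
  choose (yes _) _       s = 1
  choose (no _)  (yes _) s = 0
  choose (no _)  (no _)  s = s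

  after : ℕ → ℕ → ℕ
  after s z = choose (z ℕ.≟ suc y) (z ℕ.≟ suc (suc y)) s

  available : ℕ → List ℕ → ℕ
  available = foldl after

  available-++ : ∀ s p q → available s (p ++ q) ≡ available (available s p) q
  available-++ s []      q = ≡.refl
  available-++ s (z ∷ p) q = available-++ (after s z) p q

  choose-mono : ∀ {P Q : Set} {s t} (d : Dec P) (d′ : Dec Q) → s ≤ t → choose d d′ s ≤ choose d d′ t
  choose-mono (yes _) _       le = ℕₚ.≤-refl
  choose-mono (no _)  (yes _) le = z≤n
  choose-mono (no _)  (no _)  le = le

  available-mono : ∀ {s t} p → s ≤ t → available s p ≤ available t p
  available-mono []      le = le
  available-mono (z ∷ p) le = available-mono p (choose-mono (z ℕ.≟ suc y) (z ℕ.≟ suc (suc y)) le)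

  choose-without : ∀ {P Q : Set} {s} (d : Dec P) (d′ : Dec Q) → ¬ Q → 1 ≤ s → 1 ≤ choose d d′ s
  choose-without (yes _) _       ¬q le = ℕₚ.≤-refl
  choose-without (no _)  (yes q) ¬q le = contradiction q ¬q
  choose-without (no _)  (no _)  ¬q le = le

  choose-yes : ∀ {P Q : Set} {s} (d : Dec P) (d′ : Dec Q) → P → 1 ≤ choose d d′ s
  choose-yes (yes _) _ p = ℕₚ.≤-refl
  choose-yes (no ¬p) _ p = contradiction p ¬p

  available-without : ∀ {s} p → suc (suc y) ∉ p → 1 ≤ s → 1 ≤ available s p
  available-without []      y∉ le = le
  available-without {s} (z ∷ p) y∉ le = available-without p (y∉ ∘ there) (choose-without (z ℕ.≟ suc y) (z ℕ.≟ suc (suc y)) (λ e → y∉ (here (≡.sym e))) le)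

  available-last : ∀ {s} p → suc y ∈ p → suc (suc y) ∉ p → 1 ≤ available s p
  available-last {s} (_ ∷ p) (here ≡.refl) y∉ = available-without p (y∉ ∘ there) (choose-yes {s = s} (suc y ℕ.≟ suc y) (suc y ℕ.≟ suc (suc y)) ≡.refl)
  available-last (z ∷ p)     (there y∈)    y∉ = available-last p y∈ (y∉ ∘ there)

  -- Availability acts as a potential: a use of `suc (suc y)` spends it, and a nonzero weight
  -- guarantees that it was there to be spent; a use of `suc y` restores it to 1.
  after-paid : ∀ s z σ → Aᴸ z σ ≢ 0ℚ → (suc y ∈ σ → suc (suc y) ∉ σ → 1 ≤ s) →
    tally (suc (suc y)) z ℕ.+ after s z ≤ tally (suc y) z ℕ.+ s
  after-paid s z σ nz h = go (z ℕ.≟ suc y) (z ℕ.≟ suc (suc y))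
    where
    go : (d : Dec (z ≡ suc y)) (d′ : Dec (z ≡ suc (suc y))) → mark d′ ℕ.+ choose d d′ s ≤ mark d ℕ.+ s
    go (yes ≡.refl) (yes e)      = contradiction (≡.sym e) ℕₚ.1+n≢n
    go (yes _)      (no _)       = s≤s z≤n
    go (no _)       (yes ≡.refl) = let y∈ , y∉ = Aᴸ-predecessor y σ nz in h y∈ y∉
    go (no _)       (no _)       = ℕₚ.≤-refl

walkℚ : List ℕ → List ℕ → List ℕ → ℚ
walkℚ []       σ ys       = 1ℚ
walkℚ (r ∷ rs) σ []       = 1ℚ
walkℚ (r ∷ rs) σ (y ∷ ys) = Aᴸ y (retain r σ) ℚ.* walkℚ rs (retain r σ ++ y ∷ []) ys

walkℚ-≥0 : ∀ rs σ ys → 0ℚ ℚ.≤ walkℚ rs σ ys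
walkℚ-≥0 []       σ ys       = ℚₚ.nonNegative⁻¹ 1ℚ
walkℚ-≥0 (r ∷ rs) σ []       = ℚₚ.nonNegative⁻¹ 1ℚ
walkℚ-≥0 (r ∷ rs) σ (y ∷ ys) = *-≥0 (A-≥0 y (Vec.fromList (retain r σ))) (walkℚ-≥0 rs (retain r σ ++ y ∷ []) ys)

≢0-*ˡ : ∀ {p q} → p ℚ.* q ≢ 0ℚ → p ≢ 0ℚ
≢0-*ˡ {q = q} nz ≡.refl = nz (ℚₚ.*-zeroˡ q)

≢0-*ʳ : ∀ {p q} → p ℚ.* q ≢ 0ℚ → q ≢ 0ℚ
≢0-*ʳ {p} nz ≡.refl = nz (ℚₚ.*-zeroʳ p)

module _ (y : ℕ) where
  open Availability y

  -- `after-paid` added up along the walk. The forgotten entries are collected in q, so that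
  -- availability is always computed from the whole history and not only from the marked labels.
  walk-paid : ∀ rs s q σ ys → length ys ≡ length rs → walkℚ rs σ ys ≢ 0ℚ →
    occ (suc (suc y)) ys ℕ.+ available s (q ++ σ ++ ys) ≤ occ (suc y) ys ℕ.+ available s (q ++ σ)
  walk-paid []       s q σ []       _ _  = ℕₚ.≤-reflexive (cong (λ τ → available s (q ++ τ)) (Listₚ.++-identityʳ σ))
  walk-paid (r ∷ rs) s q σ (z ∷ ys) e nz = begin
    (tally (suc (suc y)) z ℕ.+ occ (suc (suc y)) ys) ℕ.+ available s (q ++ σ ++ z ∷ ys)
      ≡⟨ cong (λ τ → (tally (suc (suc y)) z ℕ.+ occ (suc (suc y)) ys) ℕ.+ available s τ) regroup ⟩
    (tally (suc (suc y)) z ℕ.+ occ (suc (suc y)) ys) ℕ.+ available s (q′ ++ (σ′ ++ z ∷ []) ++ ys)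
      ≡⟨ ℕₚ.+-assoc (tally (suc (suc y)) z) (occ (suc (suc y)) ys) _ ⟩
    tally (suc (suc y)) z ℕ.+ (occ (suc (suc y)) ys ℕ.+ available s (q′ ++ (σ′ ++ z ∷ []) ++ ys))
      ≤⟨ ℕₚ.+-monoʳ-≤ (tally (suc (suc y)) z) (walk-paid rs s q′ (σ′ ++ z ∷ []) ys (ℕₚ.suc-injective e) (≢0-*ʳ {Aᴸ z σ′} nz)) ⟩
    tally (suc (suc y)) z ℕ.+ (occ (suc y) ys ℕ.+ available s (q′ ++ σ′ ++ z ∷ []))
      ≡⟨ ℕ-swap (tally (suc (suc y)) z) (occ (suc y) ys) _ ⟩
    occ (suc y) ys ℕ.+ (tally (suc (suc y)) z ℕ.+ available s (q′ ++ σ′ ++ z ∷ []))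
      ≡⟨ cong (λ t → occ (suc y) ys ℕ.+ (tally (suc (suc y)) z ℕ.+ t))
           (≡.trans (cong (available s) (≡.sym (Listₚ.++-assoc q′ σ′ (z ∷ [])))) (available-++ s (q′ ++ σ′) (z ∷ []))) ⟩
    occ (suc y) ys ℕ.+ (tally (suc (suc y)) z ℕ.+ after (available s (q′ ++ σ′)) z)
      ≤⟨ ℕₚ.+-monoʳ-≤ (occ (suc y) ys) (after-paid (available s (q′ ++ σ′)) z σ′ (≢0-*ˡ {Aᴸ z σ′} nz)
           (λ y∈ y∉ → subst (1 ≤_) (≡.sym (available-++ s q′ σ′)) (available-last σ′ y∈ y∉))) ⟩
    occ (suc y) ys ℕ.+ (tally (suc y) z ℕ.+ available s (q′ ++ σ′))
      ≡⟨ ≡.sym (ℕ-swap (tally (suc y) z) (occ (suc y) ys) _) ⟩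
    tally (suc y) z ℕ.+ (occ (suc y) ys ℕ.+ available s (q′ ++ σ′))
      ≡⟨ ≡.sym (ℕₚ.+-assoc (tally (suc y) z) (occ (suc y) ys) _) ⟩
    (tally (suc y) z ℕ.+ occ (suc y) ys) ℕ.+ available s (q′ ++ σ′)
      ≡⟨ cong (λ τ → (tally (suc y) z ℕ.+ occ (suc y) ys) ℕ.+ available s τ) whole ⟩
    (tally (suc y) z ℕ.+ occ (suc y) ys) ℕ.+ available s (q ++ σ) ∎
    where
    open ℕₚ.≤-Reasoning
    t  = take (length σ ℕ.∸ r) σ
    σ′ = retain r σ
    q′ = q ++ t
    whole : q′ ++ σ′ ≡ q ++ σ
    whole = ≡.trans (Listₚ.++-assoc q t σ′) (cong (q ++_) (Listₚ.take++drop≡id (length σ ℕ.∸ r) σ))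
    regroup : q ++ σ ++ z ∷ ys ≡ q′ ++ (σ′ ++ z ∷ []) ++ ys
    regroup = ≡.trans (≡.sym (Listₚ.++-assoc q σ (z ∷ ys))) (≡.trans (cong (_++ z ∷ ys) (≡.sym whole))
      (≡.trans (Listₚ.++-assoc q′ σ′ (z ∷ ys)) (cong (q′ ++_) (≡.sym (Listₚ.++-assoc σ′ (z ∷ []) ys)))))
    ℕ-swap : ∀ a b c → a ℕ.+ (b ℕ.+ c) ≡ b ℕ.+ (a ℕ.+ c)
    ℕ-swap a b c = ≡.trans (≡.sym (ℕₚ.+-assoc a b c)) (≡.trans (cong (ℕ._+ c) (ℕₚ.+-comm a b)) (ℕₚ.+-assoc b a c))

-- Going once around, availability does not decrease: it is monotone in its value at the start.
closed-walk-balanced : ∀ rs σ zs → length (zs ++ σ) ≡ length rs → walkℚ rs σ (zs ++ σ) ≢ 0ℚ → Balanced (zs ++ σ)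
closed-walk-balanced rs σ zs len nz y = ℕₚ.+-cancelʳ-≤ (available 0 σ) (occ (suc (suc y)) (zs ++ σ)) (occ (suc y) (zs ++ σ))
    (ℕₚ.≤-trans (ℕₚ.+-monoʳ-≤ (occ (suc (suc y)) (zs ++ σ)) around) (walk-paid y rs 0 [] σ (zs ++ σ) len nz))
  where
  open Availability y
  around : available 0 σ ≤ available 0 (σ ++ zs ++ σ)
  around = subst (available 0 σ ≤_)
    (≡.trans (≡.sym (available-++ 0 (σ ++ zs) σ)) (cong (available 0) (Listₚ.++-assoc σ zs σ))) (available-mono σ z≤n)

when : {P : Set} → Dec P → ℚ → ℚ
when (yes _) q = q
when (no _)  q = 0ℚ

-- The rational part of a closed walk. Labels are natural numbers here, so that N does not appear
-- and the same number serves for all N.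
walkCoefficient : ℕ → List ℕ → List ℕ → ℚ
walkCoefficient k rs c = when (unique? ℕ._≟_ (take k c)) (walkℚ rs (take k c) (drop k c ++ take k c))

walkCoefficient-≥0 : ∀ k rs c → 0ℚ ℚ.≤ walkCoefficient k rs c
walkCoefficient-≥0 k rs c with unique? ℕ._≟_ (take k c)
... | yes _ = walkℚ-≥0 rs (take k c) (drop k c ++ take k c)
... | no _  = ℚₚ.≤-refl

walkCoefficient-balanced : ∀ k rs c → length c ≡ length rs → walkCoefficient k rs c ≢ 0ℚ → Balanced c
walkCoefficient-balanced k rs c len nz y = subst₂ _≤_ (turn (suc (suc y))) (turn (suc y))
    (closed-walk-balanced rs (take k c) (drop k c) (≡.trans turn-length len) (nonzero (unique? ℕ._≟_ (take k c)) nz) y)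
  where
  nonzero : {P : Set} (d : Dec P) {q : ℚ} → when d q ≢ 0ℚ → q ≢ 0ℚ
  nonzero (yes _) nz = nz
  nonzero (no _)  nz = contradiction ≡.refl nz
  turn : ∀ z → occ z (drop k c ++ take k c) ≡ occ z c
  turn z = ≡.trans (occ-++ z (drop k c) (take k c)) (≡.trans (ℕₚ.+-comm (occ z (drop k c)) (occ z (take k c)))
    (≡.trans (≡.sym (occ-++ z (take k c) (drop k c))) (cong (occ z) (Listₚ.take++drop≡id k c))))
  turn-length : length (drop k c ++ take k c) ≡ length c
  turn-length = ≡.trans (Listₚ.length-++ (drop k c)) (≡.trans (ℕₚ.+-comm (length (drop k c)) (length (take k c)))
    (≡.trans (≡.sym (Listₚ.length-++ (take k c))) (cong length (Listₚ.take++drop≡id k c))))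

-- Words of labels and the products of their weights

labels : ℕ → List ℕ
labels N = map suc (Data.List.upTo N)

labels-suc : ∀ N → labels (suc N) ≡ labels N ++ suc N ∷ []
labels-suc N = ≡.trans (cong (map suc) (≡.sym (Listₚ.upTo-∷ʳ N))) (Listₚ.map-++ suc (Data.List.upTo N) (N ∷ []))

∈-labels : ∀ {N y} → y ∈ labels N → 1 ≤ y × y ≤ N
∈-labels y∈ with ∈ₚ.∈-map⁻ suc y∈
... | i , i∈ , ≡.refl = s≤s z≤n , ∈ₚ.∈-upTo⁻ i∈

map-value-allFin : ∀ N → map value (allFin N) ≡ labels N
map-value-allFin N = ≡.trans (Listₚ.map-∘ (allFin N)) (cong (map suc) (≡.trans (Listₚ.map-tabulate id toℕ) (tabulate-upTo N id)))
  where
  tabulate-upTo : ∀ {S : Set} N (f : ℕ → S) → Data.List.tabulate {n = N} (f ∘ toℕ) ≡ Data.List.applyUpTo f N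
  tabulate-upTo zero    f = ≡.refl
  tabulate-upTo (suc N) f = cong (f 0 ∷_) (tabulate-upTo N (f ∘ suc))

∈-strings⇒ : ∀ {S : Set} {L : List S} j {c s} → c ∈ strings L j → s ∈ c → s ∈ L
∈-strings⇒ zero (here ≡.refl) ()
∈-strings⇒ {L = L} (suc j) c∈ s∈ with ∈ₚ.∈-cartesianProductWith⁻ _∷_ L (strings L j) c∈
∈-strings⇒ (suc j) c∈ (here ≡.refl) | a , d , a∈ , d∈ , ≡.refl = a∈
∈-strings⇒ (suc j) c∈ (there s∈)    | a , d , a∈ , d∈ , ≡.refl = ∈-strings⇒ j d∈ s∈

-- With y all of 1, ..., y occur, and these are y distinct entries.
balanced-bound : ∀ {c} → Balanced c → ∀ y → y ∈ c → y ≤ length c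
balanced-bound {c} bal zero    _  = z≤n
balanced-bound {c} bal (suc y) y∈ = subst (_≤ length c) (≡.trans (Listₚ.length-map suc (Data.List.upTo (suc y))) (Listₚ.length-upTo (suc y)))
    (unique-⊆-length (Uniqueₚ.map⁺ ℕₚ.suc-injective (Uniqueₚ.upTo⁺ (suc y))) smaller)
  where
  descend : ∀ d i → i ℕ.+ d ≡ y → suc i ∈ c
  descend zero    i e = subst (λ z → suc z ∈ c) (≡.sym (≡.trans (≡.sym (ℕₚ.+-identityʳ i)) e)) y∈
  descend (suc d) i e = ∈-occ c (ℕₚ.≤-trans (occ-∈ c (descend d (suc i) (≡.trans (≡.sym (ℕₚ.+-suc i d)) e))) (bal i))
  smaller : ∀ {z} → z ∈ labels (suc y) → z ∈ c
  smaller z∈ with ∈ₚ.∈-map⁻ suc z∈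
  ... | i , i∈ , ≡.refl = descend (y ℕ.∸ i) i (ℕₚ.m+[n∸m]≡n (ℕₚ.≤-pred (∈ₚ.∈-upTo⁻ i∈)))

-- The exponent of e_i after telescoping. For balanced words and i ≥ 1 the truncated difference is
-- the true one.
multiplicity : List ℕ → ℕ → ℕ
multiplicity c i = occ i c ℕ.∸ occ (suc i) c

module LabelProducts (Alg : RationalAlgebra) (E w : ℕ → RationalAlgebra.Carrier Alg) where
  open RationalAlgebra Alg
  open Algebra.Properties.CommutativeSemiring.Exp commutativeSemiring using (_^_; ^-homo-*; ^-distrib-*; ^-congˡ)
  open ≈-Reasoning
  open Solver using (solve; _:+_; _:*_; _:-_; _:=_; con; :-_)

  powers : ℕ → (ℕ → Carrier) → (ℕ → ℕ) → Carrier
  powers zero    f m = 1#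
  powers (suc B) f m = f (suc B) ^ m (suc B) * powers B f m

  powers-+ : ∀ B f m m′ → powers B f (λ i → m i ℕ.+ m′ i) ≈ powers B f m * powers B f m′
  powers-+ zero    f m m′ = sym (*-identityˡ 1#)
  powers-+ (suc B) f m m′ = trans (*-cong (^-homo-* (f (suc B)) (m (suc B)) (m′ (suc B))) (powers-+ B f m m′))
    (solve 4 (λ a b c d → (a :* b) :* (c :* d) := (a :* c) :* (b :* d)) refl (f (suc B) ^ m (suc B)) (f (suc B) ^ m′ (suc B)) (powers B f m) (powers B f m′))

  powers-none : ∀ B f m → (∀ i → 1 ≤ i → i ≤ B → m i ≡ 0) → powers B f m ≈ 1#
  powers-none zero    f m h = refl
  powers-none (suc B) f m h = trans (*-cong (reflexive (cong (f (suc B) ^_) (h (suc B) (s≤s z≤n) ℕₚ.≤-refl)))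
    (powers-none B f m (λ i 1≤i i≤B → h i 1≤i (ℕₚ.m≤n⇒m≤1+n i≤B)))) (*-identityˡ 1#)

  powers-tally : ∀ B f z → 1 ≤ z → z ≤ B → powers B f (λ i → tally i z) ≈ f z
  powers-tally zero    f (suc z) 1≤z ()
  powers-tally (suc B) f z 1≤z z≤B with ℕₚ.m≤n⇒m<n∨m≡n z≤B
  ... | inj₁ (s≤s z≤B′) = trans (*-cong (reflexive (cong (f (suc B) ^_) (mark-no (z ℕ.≟ suc B) (λ e → ℕₚ.<-irrefl e (s≤s z≤B′)))))
    (powers-tally B f z 1≤z z≤B′)) (*-identityˡ _)
  ... | inj₂ ≡.refl = trans (*-cong (trans (reflexive (cong (f z ^_) (mark-yes (z ℕ.≟ z) ≡.refl))) (*-identityʳ _))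
    (powers-none B f (λ i → tally i z) (λ i _ i≤B → mark-no (z ℕ.≟ i) (λ e → ℕₚ.<-irrefl (≡.sym e) (s≤s i≤B))))) (*-identityʳ _)

  product : (ℕ → Carrier) → List ℕ → Carrier
  product f []      = 1#
  product f (z ∷ c) = f z * product f c

  product-powers : ∀ B f c → (∀ {z} → z ∈ c → 1 ≤ z × z ≤ B) → product f c ≈ powers B f (λ i → occ i c)
  product-powers B f []      h = sym (powers-none B f (λ _ → 0) (λ _ _ _ → ≡.refl))
  product-powers B f (z ∷ c) h = sym (trans (powers-+ B f (λ i → tally i z) (λ i → occ i c))
    (*-cong (let 1≤z , z≤B = h (here ≡.refl) in powers-tally B f z 1≤z z≤B) (sym (product-powers B f c (λ z∈ → h (there z∈))))))

  Π : ℕ → List ℕ → Carrier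
  Π B c = powers B E (multiplicity c)

  -- ∏ (e_i / e_{i−1})^{m_i} telescopes to ∏ e_i^{m_i − m_{i+1}}.
  telescope : ∀ B c → E 0 ≈ 1# → (∀ i → suc i ≤ B → w (suc i) * E i ≈ E (suc i)) → Balanced c →
    powers B w (λ i → occ i c) ≈ E B ^ occ (suc B) c * Π B c
  telescope zero    c E0 _  _   = sym (trans (*-identityʳ _) (one (occ 1 c)))
    where
    one : ∀ m → E 0 ^ m ≈ 1#
    one zero    = refl
    one (suc m) = trans (*-cong E0 (one m)) (*-identityˡ 1#)
  telescope (suc B) c E0 hw bal = begin
    w (suc B) ^ m * powers B w (λ i → occ i c)
      ≈⟨ *-congˡ (telescope B c E0 (λ i le → hw i (ℕₚ.m≤n⇒m≤1+n le)) bal) ⟩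
    w (suc B) ^ m * (E B ^ m * Π B c)
      ≈⟨ trans (sym (*-assoc _ _ _)) (*-congʳ (trans (sym (^-distrib-* (w (suc B)) (E B) m)) (^-congˡ m (hw B ℕₚ.≤-refl)))) ⟩
    E (suc B) ^ m * Π B c
      ≈⟨ *-congʳ (trans (reflexive (cong (E (suc B) ^_) (≡.sym (ℕₚ.m+[n∸m]≡n (bal B))))) (^-homo-* (E (suc B)) m′ (multiplicity c (suc B)))) ⟩
    (E (suc B) ^ m′ * E (suc B) ^ multiplicity c (suc B)) * Π B c
      ≈⟨ *-assoc _ _ _ ⟩
    E (suc B) ^ m′ * Π (suc B) c ∎
    where
    m  = occ (suc B) c
    m′ = occ (suc (suc B)) c

  -- Labels above B do not occur in c, so the additional exponents are 0.
  Π-extend : ∀ B d c → (∀ {z} → z ∈ c → z ≤ B) → Π (d ℕ.+ B) c ≈ Π B c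
  Π-extend B zero    c h = refl
  Π-extend B (suc d) c h = trans (*-congʳ (reflexive (cong (E (suc (d ℕ.+ B)) ^_) none)))
      (trans (*-identityˡ _) (Π-extend B d c h))
    where
    none : multiplicity c (suc (d ℕ.+ B)) ≡ 0
    none = ≡.trans (cong (ℕ._∸ occ (suc (suc (d ℕ.+ B))) c)
        (occ-∉ c (λ z∈ → ℕₚ.<-irrefl ≡.refl (ℕₚ.<-≤-trans (s≤s (ℕₚ.m≤n+m B d)) (h z∈)))))
      (ℕₚ.0∸n≡0 (occ (suc (suc (d ℕ.+ B))) c))

  -- The largest label has positive multiplicity.
  Π-zero : ∀ m → (∀ i → m < i → E i ≈ 0#) → ∀ B c → occ (suc B) c ≡ 0 → ∀ j → m < j → j ≤ B → j ∈ c → Π B c ≈ 0#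
  Π-zero m E≈0 zero    c none j m<j z≤n j∈ = contradiction m<j λ ()
  Π-zero m E≈0 (suc B) c none j m<j j≤B j∈ = go (occ (suc B) c) ≡.refl
    where
    go : ∀ o → occ (suc B) c ≡ o → Π (suc B) c ≈ 0#
    go zero e = trans (*-congˡ (Π-zero m E≈0 B c e j m<j j≤B′ j∈)) (zeroʳ _)
      where
      j≤B′ : j ≤ B
      j≤B′ with ℕₚ.m≤n⇒m<n∨m≡n j≤B
      ... | inj₁ (s≤s le) = le
      ... | inj₂ ≡.refl = contradiction (subst (1 ≤_) e (occ-∈ c j∈)) λ ()
    go (suc o) e = trans (*-congʳ (trans (reflexive (cong (E (suc B) ^_) (≡.trans (cong (occ (suc B) c ℕ.∸_) none) e)))
      (trans (*-congʳ (E≈0 (suc B) (ℕₚ.<-≤-trans m<j j≤B))) (zeroˡ _)))) (zeroˡ _)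

-- The expansion over words of labels

module LabelSums {n k : ℕ} (k≤n : k ≤ n) (G : Graph (n ℕ.+ k)) (Γ : Graph n)
  (interval : NaturalUnitInterval G) (first : IsClique G (First {n} k)) (last : IsClique G (Last {n} k))
  (glued : ObtainedByGluing k≤n G Γ) where
  open UnitIntervals k≤n G Γ interval first last glued using (backDegrees; vertices; vertices-length)

  degrees-length : length backDegrees ≡ n
  degrees-length = ≡.trans (Listₚ.length-map (backDegree G) vertices) vertices-length

  coefficient : List ℕ → ℚ
  coefficient = walkCoefficient k backDegrees

  module InVariables (N : ℕ) where
    open ChromaticTrace k≤n G Γ interval first last glued N using (labelled-closedWalks)
    open Variables N
    open Field rationalFunctions
    open Sums algebra
    open StringSums algebra
    open LinearAlgebra rationalFunctions using (recip; recip-*)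
    open Transitions rationalFunctions N using (step; step-∈)
    open TransitionValues rationalFunctions N using (transition-step)
    open PartialRelations rationalFunctions N x x-distinct x-nonzero esym-nonzero using (labelWeight)
    open RunExpansion algebra {N} step labelWeight
    open ≈-Reasoning

    private
      all = allFin N

    E : ℕ → Carrier
    E i = Esym.esym x i all

    w : ℕ → Carrier
    w zero    = 1#
    w (suc i) = E (suc i) * recip (E i)

    open LabelProducts algebra E w
    open Algebra.Properties.CommutativeSemiring.Exp commutativeSemiring using (_^_)

    esym-long : ∀ i c → length c < i → Esym.esym x i c ≈ 0#
    esym-long (suc i) []      _        = refl
    esym-long (suc i) (s ∷ c) (s≤s lt) = trans (+-cong (esym-long (suc i) c (ℕₚ.m≤n⇒m≤1+n lt)) (trans (*-congˡ (esym-long i c lt)) (zeroʳ _))) (+-identityˡ 0#)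

    E-zero : ∀ i → N < i → E i ≈ 0#
    E-zero i lt = esym-long i all (subst (_< i) (≡.sym (Listₚ.length-tabulate {n = N} id)) lt)

    Aᴸ-step : ∀ y σ → Unique σ → ι (Aᴸ (value y) (map value σ)) ≈ step y σ
    Aᴸ-step y σ u = trans (reflexive (cong ι (A-cong (value y) (Vec.fromList (map value σ)) (Vec.map value (Vec.fromList σ)) (Listₚ.length-map value σ)
        (≡.trans (Vecₚ.toList∘fromList (map value σ)) (≡.sym (≡.trans (Vecₚ.toList-map value (Vec.fromList σ)) (cong (map value) (Vecₚ.toList∘fromList σ))))))))
      (trans (transition-step y (Vec.fromList σ) (subst Unique (≡.sym (Vecₚ.toList∘fromList σ)) u)) (reflexive (cong (step y) (Vecₚ.toList∘fromList σ))))
      where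
      A-cong : ∀ {i j} y (u : Vec ℕ i) (v : Vec ℕ j) → i ≡ j → Vec.toList u ≡ Vec.toList v → A y u ≡ A y v
      A-cong y u v ≡.refl e = cong (A y) (toList-≡ u v e)

    -- A agrees with `step` on lists without repetition. If the walk repeats a marked label, its
    -- weight is 0 and the rest of the walk no longer matters.
    ι-walk : ∀ rs σ ys → Unique σ → ι (walkℚ rs (map value σ) (map value ys)) ≈ walk rs σ ys
    ι-walk []       σ ys       u = ι-1
    ι-walk (r ∷ rs) σ []       u = ι-1
    ι-walk (r ∷ rs) σ (y ∷ ys) u = begin
      ι (Aᴸ (value y) (retain r (map value σ)) ℚ.* walkℚ rs (retain r (map value σ) ++ value y ∷ []) (map value ys))
        ≡⟨ cong (λ τ → ι (Aᴸ (value y) τ ℚ.* walkℚ rs (τ ++ value y ∷ []) (map value ys))) (retain-map value r σ) ⟩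
      ι (Aᴸ (value y) (map value σ′) ℚ.* walkℚ rs (map value σ′ ++ value y ∷ []) (map value ys))
        ≈⟨ trans (ι-* _ _) (*-congʳ (Aᴸ-step y σ′ u′)) ⟩
      step y σ′ * ι (walkℚ rs (map value σ′ ++ value y ∷ []) (map value ys))
        ≡⟨ cong (λ τ → step y σ′ * ι (walkℚ rs τ (map value ys))) (≡.sym (Listₚ.map-++ value σ′ (y ∷ []))) ⟩
      step y σ′ * ι (walkℚ rs (map value (σ′ ++ y ∷ [])) (map value ys))
        ≈⟨ continue (y ∈? σ′) ⟩
      step y σ′ * walk rs (σ′ ++ y ∷ []) ys ∎
      where
      σ′ = retain r σ
      u′ : Unique σ′
      u′ = Uniqueₚ.drop⁺ (length σ ℕ.∸ r) u
      continue : Dec (y ∈ σ′) →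
        step y σ′ * ι (walkℚ rs (map value (σ′ ++ y ∷ [])) (map value ys)) ≈ step y σ′ * walk rs (σ′ ++ y ∷ []) ys
      continue (yes y∈) = trans (*-congʳ (step-∈ y∈)) (trans (zeroˡ _) (sym (trans (*-congʳ (step-∈ y∈)) (zeroˡ _))))
      continue (no y∉)  = *-congˡ (ι-walk rs (σ′ ++ y ∷ []) ys (Unique-resp-↭ (↭-sym (snoc-↭ σ′ y)) (Unique-∷ y∉ u′)))

    closedWalk-coefficient : ∀ κ → closedWalk k backDegrees κ ≈ ι (coefficient (map value κ)) * weight κ
    closedWalk-coefficient κ = trans (sym (*-assoc _ _ _)) (*-congʳ (trans (go (unique? Finₚ._≟_ (take k κ)) (unique? ℕ._≟_ (map value (take k κ))))
        (reflexive (cong₂ (λ σ τ → ι (when (unique? ℕ._≟_ σ) (walkℚ backDegrees σ τ)))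
          (≡.sym (Listₚ.take-map k κ)) (≡.trans (Listₚ.map-++ value (drop k κ) (take k κ)) (≡.sym (cong₂ _++_ (Listₚ.drop-map k κ) (Listₚ.take-map k κ))))))))
      where
      go : (d : Dec (Unique (take k κ))) (d′ : Dec (Unique (map value (take k κ)))) →
        [ d ] * walk backDegrees (take k κ) (drop k κ ++ take k κ)
        ≈ ι (when d′ (walkℚ backDegrees (map value (take k κ)) (map value (drop k κ ++ take k κ))))
      go (yes u) (yes _) = trans (*-identityˡ _) (sym (ι-walk backDegrees (take k κ) (drop k κ ++ take k κ) u))
      go (yes u) (no ¬u) = contradiction (Uniqueₚ.map⁺ (λ e → Finₚ.toℕ-injective (ℕₚ.suc-injective e)) u) ¬u
      go (no ¬u) (yes u) = contradiction (AllPairsₚ.map⁻ u ▸ (λ ne e → ne (cong value e))) ¬u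
        where
        _▸_ : ∀ {R Q : Fin N → Fin N → Set} {us} → AllPairs R us → (∀ {u v} → R u v → Q u v) → AllPairs Q us
        ps ▸ h = pairs-map (λ _ _ → h) ps
      go (no _)  (no _)  = trans (zeroˡ _) (sym ι-0)

    weight-product : ∀ κ → weight κ ≈ product w (map value κ)
    weight-product []      = refl
    weight-product (s ∷ κ) = *-congˡ (weight-product κ)

    w-E : ∀ i → suc i ≤ N → w (suc i) * E i ≈ E (suc i)
    w-E i le = trans (*-assoc _ _ _) (trans (*-congˡ (trans (*-comm _ _) (recip-* (esym-nonzero i (ℕₚ.<⇒≤ le))))) (*-identityʳ _))

    weight-Π : ∀ κ → Balanced (map value κ) → weight κ ≈ Π N (map value κ)
    weight-Π κ bal = begin
      weight κ
        ≈⟨ trans (weight-product κ) (product-powers N w (map value κ) inside-labels) ⟩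
      powers N w (λ i → occ i (map value κ))
        ≈⟨ telescope N (map value κ) refl w-E bal ⟩
      E N ^ occ (suc N) (map value κ) * Π N (map value κ)
        ≈⟨ trans (*-congʳ (reflexive (cong (E N ^_) (occ-∉ (map value κ) (λ z∈ → ℕₚ.<-irrefl ≡.refl (proj₂ (inside-labels z∈))))))) (*-identityˡ _) ⟩
      Π N (map value κ) ∎
      where
      inside-labels : ∀ {z} → z ∈ map value κ → 1 ≤ z × z ≤ N
      inside-labels z∈ with ∈ₚ.∈-map⁻ value z∈
      ... | s , _ , ≡.refl = s≤s z≤n , Finₚ.toℕ<n s

    balanced-term : ∀ c {a b} → length c ≡ n → (Balanced c → a ≈ b) → ι (coefficient c) * a ≈ ι (coefficient c) * b
    balanced-term c len h with coefficient c ℚₚ.≟ 0ℚ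
    ... | yes z = trans (*-congʳ (trans (reflexive (cong ι z)) ι-0)) (trans (zeroˡ _) (sym (trans (*-congʳ (trans (reflexive (cong ι z)) ι-0)) (zeroˡ _))))
    ... | no nz = *-congˡ (h (walkCoefficient-balanced k backDegrees c (≡.trans len (≡.sym degrees-length)) nz))

    X-labels : poly (X Γ N) ≈ ∑ (strings (labels N) n) (λ c → ι (coefficient c) * Π N c)
    X-labels = begin
      poly (X Γ N)
        ≈⟨ labelled-closedWalks ⟩
      ∑ (strings all n) (closedWalk k backDegrees)
        ≈⟨ ∑-cong (strings all n) (λ κ κ∈ → trans (closedWalk-coefficient κ)
             (balanced-term (map value κ) (≡.trans (Listₚ.length-map value κ) (∈-strings⁻ n κ∈)) (weight-Π κ))) ⟩
      ∑ (strings all n) (λ κ → ι (coefficient (map value κ)) * Π N (map value κ))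
        ≈⟨ ∑-map (map value) (strings all n) (λ c → ι (coefficient c) * Π N c) ⟨
      ∑ (map (map value) (strings all n)) (λ c → ι (coefficient c) * Π N c)
        ≡⟨ cong (λ L → ∑ L (λ c → ι (coefficient c) * Π N c)) (≡.trans (≡.sym (strings-map value all n)) (cong (λ L → strings L n) (map-value-allFin N))) ⟩
      ∑ (strings (labels N) n) (λ c → ι (coefficient c) * Π N c) ∎

    -- Each enlargement of the alphabet only adds words containing a new letter, on which f is 0.
    labels-+ : ∀ B d j (f : List ℕ → Carrier) →
      (∀ c {z} → length c ≡ j → (∀ {y} → y ∈ c → y ≤ d ℕ.+ B) → z ∈ c → B < z → f c ≈ 0#) →
      ∑ (strings (labels (d ℕ.+ B)) j) f ≈ ∑ (strings (labels B) j) f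
    labels-+ B zero    j f h = refl
    labels-+ B (suc d) j f h = trans
        (trim j f (λ c len small z∈ → h c len small z∈ (s≤s (ℕₚ.m≤n+m B d))))
        (labels-+ B d j f (λ c len small z∈ lt → h c len (λ y∈ → ℕₚ.m≤n⇒m≤1+n (small y∈)) z∈ lt))
      where
      L = labels (d ℕ.+ B)
      L⁺ = labels (suc d ℕ.+ B)
      z = suc (d ℕ.+ B)
      trim : ∀ j f → (∀ c → length c ≡ j → (∀ {y} → y ∈ c → y ≤ z) → z ∈ c → f c ≈ 0#) → ∑ (strings L⁺ j) f ≈ ∑ (strings L j) f
      trim zero    f h = refl
      trim (suc j) f h = begin
        ∑ (strings L⁺ (suc j)) f
          ≈⟨ strings-front L⁺ j f ⟩
        ∑ L⁺ (λ y → ∑ (strings L⁺ j) (λ c → f (y ∷ c)))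
          ≈⟨ ∑-cong L⁺ (λ y y∈ → trim j (λ c → f (y ∷ c)) (λ c len small z∈ → h (y ∷ c) (cong suc len)
               (λ { (here ≡.refl) → proj₂ (∈-labels y∈) ; (there u∈) → small u∈ }) (there z∈))) ⟩
        ∑ L⁺ (λ y → ∑ (strings L j) (λ c → f (y ∷ c)))
          ≈⟨ trans (reflexive (cong (λ M → ∑ M (λ y → ∑ (strings L j) (λ c → f (y ∷ c)))) (labels-suc (d ℕ.+ B)))) (∑-++ L (z ∷ []) _) ⟩
        ∑ L (λ y → ∑ (strings L j) (λ c → f (y ∷ c))) + (∑ (strings L j) (λ c → f (z ∷ c)) + 0#)
          ≈⟨ +-congˡ (trans (+-identityʳ _) (∑-zero (strings L j) (λ c c∈ → h (z ∷ c) (cong suc (∈-strings⁻ j c∈))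
               (λ { (here ≡.refl) → ℕₚ.≤-refl ; (there u∈) → ℕₚ.m≤n⇒m≤1+n (proj₂ (∈-labels (∈-strings⇒ j c∈ u∈))) }) (here ≡.refl)))) ⟩
        ∑ L (λ y → ∑ (strings L j) (λ c → f (y ∷ c))) + 0#
          ≈⟨ trans (+-identityʳ _) (sym (strings-front L j f)) ⟩
        ∑ (strings L (suc j)) f ∎

    -- Words with a label beyond N contribute e_i = 0 with i > N, those with a label beyond n are not balanced.
    X-labels-fixed : poly (X Γ N) ≈ ∑ (strings (labels n) n) (λ c → ι (coefficient c) * Π n c)
    X-labels-fixed = begin
      poly (X Γ N)
        ≈⟨ X-labels ⟩
      ∑ (strings (labels N) n) (λ c → ι (coefficient c) * Π N c)
        ≈⟨ ∑-cong (strings (labels N) n) (λ c c∈ → *-congˡ (Π-extend N n c (λ z∈ → proj₂ (∈-labels (∈-strings⇒ n c∈ z∈))))) ⟨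
      ∑ (strings (labels N) n) (λ c → ι (coefficient c) * Π (n ℕ.+ N) c)
        ≈⟨ labels-+ N n n (λ c → ι (coefficient c) * Π (n ℕ.+ N) c) (λ c {z} _ small z∈ N<z →
             trans (*-congˡ (Π-zero N E-zero (n ℕ.+ N) c (occ-∉ c (λ y∈ → ℕₚ.<-irrefl ≡.refl (small y∈))) z N<z (small z∈) z∈)) (zeroʳ _)) ⟨
      ∑ (strings (labels (n ℕ.+ N)) n) (λ c → ι (coefficient c) * Π (n ℕ.+ N) c)
        ≡⟨ cong (λ B → ∑ (strings (labels B) n) (λ c → ι (coefficient c) * Π B c)) (ℕₚ.+-comm n N) ⟩
      ∑ (strings (labels (N ℕ.+ n)) n) (λ c → ι (coefficient c) * Π (N ℕ.+ n) c)
        ≈⟨ labels-+ n N n (λ c → ι (coefficient c) * Π (N ℕ.+ n) c) (λ c {z} len _ z∈ n<z → trans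
             (balanced-term c len (λ bal → contradiction (subst (z ≤_) len (balanced-bound bal z z∈)) (ℕₚ.<⇒≱ n<z))) (zeroʳ (ι (coefficient c)))) ⟩
      ∑ (strings (labels n) n) (λ c → ι (coefficient c) * Π (N ℕ.+ n) c)
        ≈⟨ ∑-cong (strings (labels n) n) (λ c c∈ → *-congˡ (Π-extend n N c (λ z∈ → proj₂ (∈-labels (∈-strings⇒ n c∈ z∈))))) ⟩
      ∑ (strings (labels n) n) (λ c → ι (coefficient c) * Π n c) ∎

-- Coefficients of series in infinitely many variables

rationals : RationalAlgebra
rationals = record
  { commutativeRing = ℚₚ.+-*-commutativeRing
  ; ι = id ; ι-+ = λ _ _ → ≡.refl ; ι-* = λ _ _ → ≡.refl ; ι-1 = ≡.refl }

if-[] : {P : Set} (d : Dec P) → (if does d then 1ℚ else 0ℚ) ≡ Sums.[_] rationals d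
if-[] (yes _) = ≡.refl
if-[] (no _)  = ≡.refl

sumℚ-≥0 : ∀ {S : Set} (L : List S) (f : S → ℚ) → (∀ s → 0ℚ ℚ.≤ f s) → 0ℚ ℚ.≤ sumℚ (map f L)
sumℚ-≥0 []      f h = ℚₚ.≤-refl
sumℚ-≥0 (s ∷ L) f h = ℚₚ.+-mono-≤ {0ℚ} {f s} (h s) (sumℚ-≥0 L f h)

coeff-≥0 : ∀ {S B : Set} (_≟ᴮ_ : DecidableEquality B) (L : List S) (q : S → ℚ) (g : S → B) → (∀ s → 0ℚ ℚ.≤ q s) →
  ∀ b → 0ℚ ℚ.≤ coeff _≟ᴮ_ (map (λ s → q s , g s) L) b
coeff-≥0 _≟ᴮ_ L q g h b = subst (λ M → 0ℚ ℚ.≤ sumℚ M) (Listₚ.map-∘ L)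
    (sumℚ-≥0 L (λ s → if does (g s ≟ᴮ b) then q s else 0ℚ) (λ s → if-≥0 (does (g s ≟ᴮ b)) (h s)))
  where
  if-≥0 : ∀ t {q} → 0ℚ ℚ.≤ q → 0ℚ ℚ.≤ (if t then q else 0ℚ)
  if-≥0 true  h = h
  if-≥0 false h = ℚₚ.≤-refl

module SeriesCoefficients where
  open RationalAlgebra rationals
  open Sums rationals
  open Solver using (solve; _:+_; _:*_; _:-_; _:=_; con; :-_)

  ∑-sumℚ : ∀ {S : Set} (L : List S) (f : S → ℚ) → sumℚ (map f L) ≡ ∑ L f
  ∑-sumℚ []      f = ≡.refl
  ∑-sumℚ (s ∷ L) f = cong (f s ℚ.+_) (∑-sumℚ L f)

  ∑-product : ∀ {S T U : Set} (h : S → T → U) (L : List S) (M : List T) f →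
    ∑ (cartesianProductWith h L M) f ≡ ∑ L (λ s → ∑ M (λ t → f (h s t)))
  ∑-product h []      M f = ≡.refl
  ∑-product h (s ∷ L) M f = ≡.trans (∑-++ (map (h s) M) _ f) (cong₂ ℚ._+_ (∑-map (h s) M f) (∑-product h L M f))

  Δ : List ℕ → ∀ {m} → Monomial m → ℚ
  Δ β μ = [ Listₚ.≡-dec ℕ._≟_ (Vec.toList μ) β ]

  Δ-∷ : ∀ b β {m} a (μ : Monomial m) → Δ (b ∷ β) (a ∷ μ) ≡ [ a ℕ.≟ b ] ℚ.* Δ β μ
  Δ-∷ b β a μ = [×] (Listₚ.≡-dec ℕ._≟_ (a ∷ Vec.toList μ) (b ∷ β)) (a ℕ.≟ b) (Listₚ.≡-dec ℕ._≟_ (Vec.toList μ) β)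
    (λ { ≡.refl → ≡.refl , ≡.refl }) (λ { ≡.refl ≡.refl → ≡.refl })

  ∑-complement : ∀ i j a → ∑ (allFin (suc a)) (λ t → [ i ℕ.≟ toℕ t ] ℚ.* [ j ℕ.≟ a ℕ.∸ toℕ t ]) ≡ [ (i ℕ.+ j) ℕ.≟ a ]
  ∑-complement i j a with i ℕ.≤? a
  ... | yes i≤a = ≡.trans (∑-ext (allFin (suc a)) (λ t → cong (ℚ._* [ j ℕ.≟ a ℕ.∸ toℕ t ])
        ([⇔] (i ℕ.≟ toℕ t) (t Finₚ.≟ t₀) (λ e → Finₚ.toℕ-injective (≡.trans (≡.sym e) (≡.sym t₀≡i))) (λ e → ≡.sym (≡.trans (cong toℕ e) t₀≡i)))))
      (≡.trans (∑-δ Finₚ._≟_ (λ t → [ j ℕ.≟ a ℕ.∸ toℕ t ]) (Uniqueₚ.allFin⁺ (suc a)) (∈ₚ.∈-allFin t₀))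
        ([⇔] (j ℕ.≟ a ℕ.∸ toℕ t₀) ((i ℕ.+ j) ℕ.≟ a)
          (λ e → ≡.trans (cong (i ℕ.+_) (≡.trans e (cong (a ℕ.∸_) t₀≡i))) (ℕₚ.m+[n∸m]≡n i≤a))
          (λ e → ≡.trans (≡.sym (ℕₚ.m+n∸m≡n i j)) (cong₂ ℕ._∸_ e (≡.sym t₀≡i)))))
    where
    t₀ = Fin.fromℕ< (s≤s i≤a)
    t₀≡i : toℕ t₀ ≡ i
    t₀≡i = Finₚ.toℕ-fromℕ< (s≤s i≤a)
  ... | no i≰a = ≡.trans (∑-zero (allFin (suc a)) (λ t _ → ≡.trans (cong (ℚ._* [ j ℕ.≟ a ℕ.∸ toℕ t ])
        ([no] (i ℕ.≟ toℕ t) (λ e → i≰a (subst (_≤ a) (≡.sym e) (ℕₚ.≤-pred (Finₚ.toℕ<n t)))))) (ℚₚ.*-zeroˡ [ j ℕ.≟ a ℕ.∸ toℕ t ])))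
      (≡.sym ([no] ((i ℕ.+ j) ℕ.≟ a) (λ e → i≰a (subst (i ≤_) e (ℕₚ.m≤m+n i j)))))

  -- In each coordinate at most one splitting of the exponent matches μ and ν, and one exists
  -- exactly when they add up; the coordinates multiply.
  Δ-splits : ∀ {m} (γ μ ν : Monomial m) →
    ∑ (splits (Vec.toList γ)) (λ (β , β′) → Δ β μ ℚ.* Δ β′ ν) ≡ Δ (Vec.toList γ) (μ ⊕ ν)
  Δ-splits []      []      []      = ≡.refl
  Δ-splits (a ∷ γ) (i ∷ μ) (j ∷ ν) = ≡.trans (∑-product _ (allFin (suc a)) (splits (Vec.toList γ)) _)
    (≡.trans (∑-ext (allFin (suc a)) (λ t → ≡.trans (∑-ext (splits (Vec.toList γ)) (λ (β , β′) →
        ≡.trans (cong₂ ℚ._*_ (Δ-∷ (toℕ t) β i μ) (Δ-∷ (a ℕ.∸ toℕ t) β′ j ν))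
          (solve 4 (λ a b c d → (a :* b) :* (c :* d) := (a :* c) :* (b :* d)) ≡.refl [ i ℕ.≟ toℕ t ] (Δ β μ) [ j ℕ.≟ a ℕ.∸ toℕ t ] (Δ β′ ν))))
        (≡.trans (≡.sym (∑-*ˡ (splits (Vec.toList γ)) ([ i ℕ.≟ toℕ t ] ℚ.* [ j ℕ.≟ a ℕ.∸ toℕ t ]) (λ (β , β′) → Δ β μ ℚ.* Δ β′ ν)))
          (cong (([ i ℕ.≟ toℕ t ] ℚ.* [ j ℕ.≟ a ℕ.∸ toℕ t ]) ℚ.*_) (Δ-splits γ μ ν)))))
    (≡.trans (≡.sym (∑-*ʳ (allFin (suc a)) (Δ (Vec.toList γ) (μ ⊕ ν)) (λ t → [ i ℕ.≟ toℕ t ] ℚ.* [ j ℕ.≟ a ℕ.∸ toℕ t ])))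
    (≡.trans (cong (ℚ._* Δ (Vec.toList γ) (μ ⊕ ν)) (∑-complement i j a)) (≡.sym (Δ-∷ a (Vec.toList γ) (i ℕ.+ j) (μ ⊕ ν))))))

  listCoeff : ∀ {m} → Poly m → List ℕ → ℚ
  listCoeff p β = ∑ p (λ (c , μ) → c ℚ.* Δ β μ)

  δ-Δ : ∀ {m} (v μ : Monomial m) → Domain.δ v μ ≡ Δ (Vec.toList v) μ
  δ-Δ v μ = ≡.trans (if-[] (μ ≟ᴹ v)) ([⇔] (μ ≟ᴹ v) (Listₚ.≡-dec ℕ._≟_ (Vec.toList μ) (Vec.toList v)) (cong Vec.toList) (toList-≡ μ v))

  pair-∑ : ∀ {m} (p : Poly m) g → Domain.pair p g ≡ ∑ p (λ (c , μ) → c ℚ.* g μ)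
  pair-∑ p g = ∑-sumℚ p (λ (c , μ) → c ℚ.* g μ)

  coeff-list : ∀ {m} (p : Poly m) v → [x^ v ] p ≡ listCoeff p (Vec.toList v)
  coeff-list p v = ≡.trans (Domain.coeff-pair p v) (≡.trans (pair-∑ p (Domain.δ v)) (∑-ext p (λ (c , μ) → cong (c ℚ.*_) (δ-Δ v μ))))

  listCoeff-* : ∀ {m} (p q : Poly m) (v : Monomial m) → [x^ v ] (p *ᴾ q) ≡ (listCoeff p ⊛ listCoeff q) (Vec.toList v)
  listCoeff-* p q v = ≡.trans (Domain.coeff-* p q v)
    (≡.trans (≡.trans (pair-∑ p _) (∑-ext p (λ (c , μ) → cong (c ℚ.*_) (≡.trans (pair-∑ q _) (∑-ext q (λ (d , ν) → cong (d ℚ.*_)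
        (≡.trans (δ-Δ v (μ ⊕ ν)) (≡.sym (Δ-splits v μ ν)))))))))
    (≡.trans (∑-ext p (λ (c , μ) → ≡.trans (cong (c ℚ.*_) (≡.trans (∑-ext q (λ (d , ν) → ∑-*ˡ splitsᵥ d _)) (∑-comm q splitsᵥ _)))
        (∑-*ˡ splitsᵥ c _)))
    (≡.trans (∑-comm p splitsᵥ _)
    (≡.trans (∑-ext splitsᵥ (λ (β , β′) → ≡.trans (∑-ext p (λ (c , μ) → ≡.trans (cong (c ℚ.*_) (≡.trans
          (∑-ext q (λ (d , ν) → solve 3 (λ d a b → d :* (a :* b) := a :* (d :* b)) ≡.refl d (Δ β μ) (Δ β′ ν)))
          (≡.sym (∑-*ˡ q (Δ β μ) _))))
        (≡.sym (ℚₚ.*-assoc c (Δ β μ) (listCoeff q β′))))) (≡.sym (∑-*ʳ p (listCoeff q β′) _))))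
      (≡.sym (∑-sumℚ splitsᵥ (λ (β , β′) → listCoeff p β ℚ.* listCoeff q β′)))))))
    where
    splitsᵥ = splits (Vec.toList v)

  -- The polynomial is the series with all variables after the first m set to 0. Series take lists
  -- of any length, so agreement is asked on length m only, which `splits` preserves.
  _represents_ : ∀ {m} → Poly m → Series → Set
  _represents_ {m} p f = ∀ (v : Vec ℕ m) → [x^ v ] p ≡ f (Vec.toList v)

  splits-length : ∀ α {β β′} → (β , β′) ∈ splits α → length β ≡ length α × length β′ ≡ length α
  splits-length []      (here ≡.refl) = ≡.refl , ≡.refl
  splits-length (a ∷ α) s∈ with ∈ₚ.∈-cartesianProductWith⁻ _ (allFin (suc a)) (splits α) s∈
  ... | t , (β , β′) , _ , s∈′ , ≡.refl = let l , l′ = splits-length α s∈′ in cong suc l , cong suc l′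

  represents-list : ∀ {m} {p : Poly m} {f} → p represents f → ∀ β → length β ≡ m → listCoeff p β ≡ f β
  represents-list {p = p} {f} h β ≡.refl = ≡.trans (cong (listCoeff p) (≡.sym (Vecₚ.toList∘fromList β)))
    (≡.trans (≡.sym (coeff-list p (Vec.fromList β))) (≡.trans (h (Vec.fromList β)) (cong f (Vecₚ.toList∘fromList β))))

  represents-* : ∀ {m} {p q : Poly m} {f g} → p represents f → q represents g → (p *ᴾ q) represents (f ⊛ g)
  represents-* {m} {p} {q} {f} {g} hp hq v = ≡.trans (listCoeff-* p q v)
    (≡.trans (∑-sumℚ (splits (Vec.toList v)) _) (≡.trans (∑-cong (splits (Vec.toList v)) (λ (β , β′) s∈ →
      let l , l′ = splits-length (Vec.toList v) s∈ in cong₂ ℚ._*_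
        (represents-list {p = p} {f} hp β (≡.trans l (Vecₚ.length-toList v))) (represents-list {p = q} {g} hq β′ (≡.trans l′ (Vecₚ.length-toList v)))))
      (≡.sym (∑-sumℚ (splits (Vec.toList v)) _))))

  elementary? : ∀ i α → Dec (All (_≤ 1) α × sum α ≡ i)
  elementary? i α = all? (ℕ._≤? 1) α ×-dec (sum α ℕ.≟ i)

  -- Induction on the variables: an exponent 0 or 1 decides whether the first variable belongs to
  -- the subset, and a larger exponent excludes every subset.
  e-represents : ∀ m i → e m i represents e∞ i
  e-represents m i v = ≡.trans (≡.trans (coeff-list (e m i) v) (≡.trans (∑-map indicator (subsets m i) _)
      (≡.trans (∑-filter (λ S → ∣ S ∣ ℕ.≟ i) (words sides m) _) (∑-ext (words sides m) (λ S → cong ([ ∣ S ∣ ℕ.≟ i ] ℚ.*_) (ℚₚ.*-identityˡ _))))))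
    (≡.trans (count m i v) (≡.sym (if-[] (elementary? i (Vec.toList v)))))
    where
    exponent : Bool → ℕ
    exponent b = if b then 1 else 0
    count : ∀ m i (v : Monomial m) →
      ∑ (words sides m) (λ S → [ ∣ S ∣ ℕ.≟ i ] ℚ.* Δ (Vec.toList v) (Vec.map exponent S)) ≡ [ elementary? i (Vec.toList v) ]
    count zero i [] = ≡.trans (ℚₚ.+-identityʳ _) (≡.trans (ℚₚ.*-identityʳ _) ([⇔] (0 ℕ.≟ i) (elementary? i []) (λ e → [] , e) proj₂))
    count (suc m) i (a ∷ v) = ≡.trans (∑-product _∷_ sides (words sides m) _)
        (≡.trans (cong₂ ℚ._+_ (branch inside) (≡.trans (ℚₚ.+-identityʳ _) (branch outside))) (cases a i))
      where
      W = words sides m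
      F : Subset m → ℚ
      F S = Δ (Vec.toList v) (Vec.map exponent S)
      size : Bool → Subset m → ℕ
      size b S = ∣ b ∷ S ∣
      branch : ∀ b → ∑ W (λ S → [ size b S ℕ.≟ i ] ℚ.* Δ (a ∷ Vec.toList v) (exponent b ∷ Vec.map exponent S))
        ≡ [ exponent b ℕ.≟ a ] ℚ.* ∑ W (λ S → [ size b S ℕ.≟ i ] ℚ.* F S)
      branch b = ≡.trans (∑-ext W (λ S → ≡.trans (cong ([ size b S ℕ.≟ i ] ℚ.*_) (Δ-∷ a (Vec.toList v) (exponent b) (Vec.map exponent S)))
          (solve 3 (λ a b c → a :* (b :* c) := b :* (a :* c)) ≡.refl [ size b S ℕ.≟ i ] [ exponent b ℕ.≟ a ] (F S))))
        (≡.sym (∑-*ˡ W [ exponent b ℕ.≟ a ] _))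
      ins outs : ℕ → ℚ
      ins i  = ∑ W (λ S → [ suc ∣ S ∣ ℕ.≟ i ] ℚ.* F S)
      outs i = ∑ W (λ S → [ ∣ S ∣ ℕ.≟ i ] ℚ.* F S)
      cases : ∀ a i → [ 1 ℕ.≟ a ] ℚ.* ins i ℚ.+ [ 0 ℕ.≟ a ] ℚ.* outs i ≡ [ elementary? i (a ∷ Vec.toList v) ]
      cases zero i = ≡.trans (cong₂ ℚ._+_ (ℚₚ.*-zeroˡ (ins i)) (ℚₚ.*-identityˡ (outs i))) (≡.trans (ℚₚ.+-identityˡ (outs i)) (≡.trans (count m i v)
        ([⇔] (elementary? i (Vec.toList v)) (elementary? i (0 ∷ Vec.toList v)) (λ (le , e) → z≤n ∷ le , e) (λ { (_ ∷ le , e) → le , e }))))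
      cases (suc zero) zero = ≡.trans (cong₂ ℚ._+_ (≡.trans (ℚₚ.*-identityˡ (ins 0)) (∑-zero W (λ S _ → ℚₚ.*-zeroˡ (F S)))) (ℚₚ.*-zeroˡ (outs 0)))
        (≡.sym ([no] (elementary? 0 (1 ∷ Vec.toList v)) (λ ())))
      cases (suc zero) (suc i) = ≡.trans (cong₂ ℚ._+_ (≡.trans (ℚₚ.*-identityˡ (ins (suc i))) (∑-ext W (λ S →
          cong (ℚ._* F S) ([⇔] (suc ∣ S ∣ ℕ.≟ suc i) (∣ S ∣ ℕ.≟ i) ℕₚ.suc-injective (cong suc))))) (ℚₚ.*-zeroˡ (outs (suc i))))
        (≡.trans (ℚₚ.+-identityʳ (outs i)) (≡.trans (count m i v)
          ([⇔] (elementary? i (Vec.toList v)) (elementary? (suc i) (1 ∷ Vec.toList v))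
            (λ (le , e) → ℕₚ.≤-refl ∷ le , cong suc e) (λ { (_ ∷ le , e) → le , ℕₚ.suc-injective e }))))
      cases (suc (suc a)) i = ≡.trans (cong₂ ℚ._+_ (ℚₚ.*-zeroˡ (ins i)) (ℚₚ.*-zeroˡ (outs i)))
        (≡.sym ([no] (elementary? i (suc (suc a) ∷ Vec.toList v)) (λ { (s≤s () ∷ _ , _) })))

  e-product-represents : ∀ {m} λs → 1ᴾ {m} ≈ᴾ e m 0 → foldr _*ᴾ_ 1ᴾ (map (e m) λs) represents e-basis λs
  e-product-represents {m} []       one v = ≡.trans (one v) (e-represents m 0 v)
  e-product-represents {m} (l ∷ λs) one   = represents-* {p = e m l} {q = foldr _*ᴾ_ 1ᴾ (map (e m) λs)} {f = e∞ l} {g = e-basis λs}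
    (e-represents m l) (e-product-represents λs one)

  coeff-concatMap : ∀ {S : Set} {m} (g : S → Poly m) (L : List S) v → [x^ v ] (concatMap g L) ≡ sumℚ (map (λ s → [x^ v ] (g s)) L)
  coeff-concatMap g []      v = ≡.refl
  coeff-concatMap g (s ∷ L) v = ≡.trans (Domain.coeff-++ (g s) (concatMap g L) v) (cong ([x^ v ] (g s) ℚ.+_) (coeff-concatMap g L v))

-- The partition whose elementary product is `Π B c`, with the largest parts first.
parts : ℕ → List ℕ → List ℕ
parts zero    c = []
parts (suc B) c = Data.List.replicate (multiplicity c (suc B)) (suc B) ++ parts B c

parts-bounds : ∀ B c → All (λ p → 1 ≤ p × p ≤ B) (parts B c)
parts-bounds zero    c = []
parts-bounds (suc B) c = Allₚ.++⁺ (Allₚ.replicate⁺ (multiplicity c (suc B)) (s≤s z≤n , ℕₚ.≤-refl))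
  (All.map (λ (1≤p , p≤B) → 1≤p , ℕₚ.m≤n⇒m≤1+n p≤B) (parts-bounds B c))

parts-partition : ∀ B c → IsPartition (parts B c)
parts-partition B c = Linkedₚ.AllPairs⇒Linked (descending B) , All.map proj₁ (parts-bounds B c)
  where
  prepend : ∀ j {s L} → All (_≤ s) L → AllPairs ℕ._≥_ L → AllPairs ℕ._≥_ (Data.List.replicate j s ++ L)
  prepend zero    small pairs = pairs
  prepend (suc j) small pairs = Allₚ.++⁺ (Allₚ.replicate⁺ j ℕₚ.≤-refl) small ∷ prepend j small pairs
  descending : ∀ B → AllPairs ℕ._≥_ (parts B c)
  descending zero    = []
  descending (suc B) = prepend (multiplicity c (suc B)) (All.map (ℕₚ.m≤n⇒m≤1+n ∘ proj₂) (parts-bounds B c)) (descending B)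

-- Nonnegative expansions in N and in infinitely many variables

module EPositivity {n k : ℕ} (k≤n : k ≤ n) (G : Graph (n ℕ.+ k)) (Γ : Graph n)
  (interval : NaturalUnitInterval G) (first : IsClique G (First {n} k)) (last : IsClique G (Last {n} k))
  (glued : ObtainedByGluing k≤n G Γ) where
  open LabelSums k≤n G Γ interval first last glued using (coefficient; module InVariables)
  open UnitIntervals k≤n G Γ interval first last glued using (backDegrees)

  private
    coefficient-≥0 : ∀ c → 0ℚ ℚ.≤ coefficient c
    coefficient-≥0 = walkCoefficient-≥0 k backDegrees

  module _ (N : ℕ) where
    open InVariables N
    open Variables N
    open Field rationalFunctions
    open Sums algebra
    open LabelProducts algebra E w
    open Algebra.Properties.CommutativeSemiring.Exp commutativeSemiring using (_^_; ^-congˡ)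
    open ≈-Reasoning

    poly-^ : ∀ p j → poly (p ^ᴾ j) ≈ poly p ^ j
    poly-^ p zero    = poly-1
    poly-^ p (suc j) = trans (poly-* p (p ^ᴾ j)) (*-congˡ (poly-^ p j))

    poly-product : ∀ {S : Set} (g : S → Poly N) (v : S → ℕ) f L → (∀ s → poly (g s) ≈ f (v s)) →
      poly (foldr _*ᴾ_ 1ᴾ (map g L)) ≈ product f (map v L)
    poly-product g v f []      h = poly-1
    poly-product g v f (s ∷ L) h = trans (poly-* (g s) (foldr _*ᴾ_ 1ᴾ (map g L))) (*-cong (h s) (poly-product g v f L h))

    poly-concatMap : ∀ {S : Set} (g : S → Poly N) L → poly (concatMap g L) ≈ ∑ L (λ s → poly (g s))
    poly-concatMap g []      = poly-0
    poly-concatMap g (s ∷ L) = trans (poly-+ (g s) (concatMap g L)) (+-congˡ (poly-concatMap g L))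

    product-++ : ∀ f c d → product f (c ++ d) ≈ product f c * product f d
    product-++ f []      d = sym (*-identityˡ _)
    product-++ f (z ∷ c) d = trans (*-congˡ (product-++ f c d)) (sym (*-assoc _ _ _))

    product-labels : ∀ B m → product (λ i → E i ^ m i) (labels B) ≈ powers B E m
    product-labels zero    m = refl
    product-labels (suc B) m = begin
      product (λ i → E i ^ m i) (labels (suc B))
        ≡⟨ cong (product (λ i → E i ^ m i)) (labels-suc B) ⟩
      product (λ i → E i ^ m i) (labels B ++ suc B ∷ [])
        ≈⟨ product-++ (λ i → E i ^ m i) (labels B) (suc B ∷ []) ⟩
      product (λ i → E i ^ m i) (labels B) * (E (suc B) ^ m (suc B) * 1#)
        ≈⟨ trans (*-cong (product-labels B m) (*-identityʳ _)) (*-comm _ _) ⟩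
      powers (suc B) E m ∎

    product-parts : ∀ B c → product E (parts B c) ≈ Π B c
    product-parts zero    c = refl
    product-parts (suc B) c = trans (product-++ E (Data.List.replicate (multiplicity c (suc B)) (suc B)) (parts B c))
        (*-cong (repeated (multiplicity c (suc B))) (product-parts B c))
      where
      repeated : ∀ j → product E (Data.List.replicate j (suc B)) ≈ E (suc B) ^ j
      repeated zero    = refl
      repeated (suc j) = *-congˡ (repeated j)

    exponentsOf : List ℕ → Monomial N
    exponentsOf c = Vec.tabulate (multiplicity c ∘ value)

    -- Different words may give the same exponents. As total coefficients are sums of the individual
    -- ones, it is enough that each of these is nonnegative.
    expansion : Poly N
    expansion = map (λ c → coefficient c , exponentsOf c) (strings (labels N) n)

    elementary : Fin N → Poly N
    elementary i = e N (value i)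

    -- Gives a name to the local function in the definition of _⟦_⟧.
    termBy : ∀ (P : Poly N) → Σ[ g ∈ (ℚ × Monomial N → Poly N) ] P ⟦ elementary ⟧ ≡ concatMap g P
    termBy P = _ , ≡.refl

    e-positive : EPositive (X Γ N)
    e-positive = expansion , coeff-≥0 _≟ᴹ_ (strings (labels N) n) coefficient exponentsOf coefficient-≥0
        , poly-injective (X Γ N) (expansion ⟦ elementary ⟧) (begin
      poly (X Γ N)
        ≈⟨ X-labels ⟩
      ∑ (strings (labels N) n) (λ c → ι (coefficient c) * Π N c)
        ≈⟨ ∑-ext (strings (labels N) n) (λ c → trans (poly-* (constᴾ (coefficient c)) (foldr _*ᴾ_ 1ᴾ (map (factor c) (allFin N))))
             (*-cong (poly-ι (coefficient c)) (substituted c))) ⟨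
      ∑ (strings (labels N) n) (λ c → poly (proj₁ (termBy expansion) (coefficient c , exponentsOf c)))
        ≈⟨ ∑-map (λ c → coefficient c , exponentsOf c) (strings (labels N) n) (poly ∘ proj₁ (termBy expansion)) ⟨
      ∑ expansion (poly ∘ proj₁ (termBy expansion))
        ≈⟨ poly-concatMap (proj₁ (termBy expansion)) expansion ⟨
      poly (expansion ⟦ elementary ⟧) ∎)
      where
      factor : List ℕ → Fin N → Poly N
      factor c i = elementary i ^ᴾ lookup (exponentsOf c) i
      substituted : ∀ c → poly (foldr _*ᴾ_ 1ᴾ (map (factor c) (allFin N))) ≈ Π N c
      substituted c = begin
        poly (foldr _*ᴾ_ 1ᴾ (map (factor c) (allFin N)))
          ≈⟨ poly-product (factor c) value (λ i → E i ^ multiplicity c i) (allFin N) (λ i →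
               trans (poly-^ (elementary i) (lookup (exponentsOf c) i))
               (trans (reflexive (cong (poly (elementary i) ^_) (Vecₚ.lookup∘tabulate (multiplicity c ∘ value) i)))
                 (^-congˡ (multiplicity c (value i)) (poly-e (value i))))) ⟩
        product (λ i → E i ^ multiplicity c i) (map value (allFin N))
          ≡⟨ cong (product (λ i → E i ^ multiplicity c i)) (map-value-allFin N) ⟩
        product (λ i → E i ^ multiplicity c i) (labels N)
          ≈⟨ product-labels N (multiplicity c) ⟩
        Π N c ∎

    partTerm : List ℕ → Poly N
    partTerm c = constᴾ (coefficient c) *ᴾ foldr _*ᴾ_ 1ᴾ (map (e N) (parts n c))

    -- The words run over 1, ..., n whatever N is, so coefficients and partitions are the same in
    -- every number of variables; the infinite case depends on this.
    X-parts : X Γ N ≈ᴾ concatMap partTerm (strings (labels n) n)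
    X-parts = poly-injective (X Γ N) (concatMap partTerm (strings (labels n) n)) (begin
      poly (X Γ N)
        ≈⟨ X-labels-fixed ⟩
      ∑ (strings (labels n) n) (λ c → ι (coefficient c) * Π n c)
        ≈⟨ ∑-ext (strings (labels n) n) (λ c → trans (poly-* (constᴾ (coefficient c)) (foldr _*ᴾ_ 1ᴾ (map (e N) (parts n c))))
             (*-cong (poly-ι (coefficient c)) (trans (poly-product (e N) id E (parts n c) poly-e)
               (trans (reflexive (cong (product E) (Listₚ.map-id (parts n c)))) (product-parts n c))))) ⟨
      ∑ (strings (labels n) n) (λ c → poly (partTerm c))
        ≈⟨ poly-concatMap partTerm (strings (labels n) n) ⟨
      poly (concatMap partTerm (strings (labels n) n)) ∎)

    -- Products of polynomials start from 1, whereas `e-basis` starts from the series e₀.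
    1≈e₀ : 1ᴾ ≈ᴾ e N 0
    1≈e₀ = poly-injective 1ᴾ (e N 0) (trans poly-1 (sym (poly-e 0)))

  coeff-constant : ∀ {m} q (p : Poly m) v → [x^ v ] (constᴾ q *ᴾ p) ≡ q ℚ.* [x^ v ] p
  coeff-constant {m} q p v = ≡.trans (Domain.coeff-* (constᴾ q) p v) (≡.trans (ℚₚ.+-identityʳ _) (cong (q ℚ.*_) (≡.trans
      (cong sumℚ (Listₚ.map-cong (λ (c , ν) → cong (λ μ → c ℚ.* Domain.δ v μ) (zero-⊕ ν)) p)) (≡.sym (Domain.coeff-pair p v)))))
    where
    zero-⊕ : ∀ {m} (ν : Monomial m) → Vec.replicate m 0 ⊕ ν ≡ ν
    zero-⊕ []      = ≡.refl
    zero-⊕ (a ∷ ν) = cong (a ∷_) (zero-⊕ ν)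

  -- The coefficient at α can be computed with |α| variables, so it is read off from `X-parts` for N
  -- = |α|.
  e-positive∞ : EPositive∞ (X∞ Γ)
  e-positive∞ = map term (strings (labels n) n)
      , Allₚ.map⁺ (All.universal (parts-partition n) (strings (labels n) n))
      , coeff-≥0 (Listₚ.≡-dec ℕ._≟_) (strings (labels n) n) coefficient (parts n) coefficient-≥0
      , λ α → ≡.trans (X-parts (length α) (Vec.fromList α)) (≡.trans (coeff-concatMap (partTerm (length α)) (strings (labels n) n) (Vec.fromList α))
          (≡.trans (cong sumℚ (Listₚ.map-cong (coefficients α) (strings (labels n) n))) (cong sumℚ (Listₚ.map-∘ (strings (labels n) n)))))
    where
    open SeriesCoefficients using (coeff-concatMap; e-product-represents)
    term : List ℕ → ℚ × List ℕ
    term c = coefficient c , parts n c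
    coefficients : ∀ α c → [x^ Vec.fromList α ] (partTerm (length α) c) ≡ coefficient c ℚ.* e-basis (parts n c) α
    coefficients α c = ≡.trans (coeff-constant (coefficient c) (foldr _*ᴾ_ 1ᴾ (map (e (length α)) (parts n c))) (Vec.fromList α))
      (cong (coefficient c ℚ.*_) (≡.trans (e-product-represents (parts n c) (1≈e₀ (length α)) (Vec.fromList α))
        (cong (e-basis (parts n c)) (Vecₚ.toList∘fromList α))))

theorem21 : (n k : ℕ) (k≤n : k ≤ n) (G : Graph (n ℕ.+ k)) (Γ : Graph n) →
    NaturalUnitInterval G →
    IsClique G (First {n} k) →
    IsClique G (Last {n} k) →
    ObtainedByGluing k≤n G Γ →
    ProperCircularArc Γ →
    ((N : ℕ) → (fromPoly (X Γ N) ≈ᶠ trace (M𝐆 {n} k G N)) × EPositive (X Γ N))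
    × EPositive∞ (X∞ Γ)
theorem21 n k k≤n G Γ interval first last glued _ =
  (λ N → ChromaticTrace.X-trace k≤n G Γ interval first last glued N , e-positive N) , e-positive∞
  where open EPositivity k≤n G Γ interval first last glued
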